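{- Let $\mathbb{S}$ be a surface of type $h$, and let $\vec q_{\mathbb{S}}(n)$ be the number of rooted maps on $\mathbb{S}$ with $n$ edges. Let $$Q_{\mathbb{S}}(t)=\sum_{n\geq 0}(n+2-2h)\,\vec q_{\mathbb{S}}(n)\,t^n .$$ Let $T\equiv T(t)$ and $U\equiv U(t)$ be the formal power series in $t$ defined by $T=1+3tT^2$ and $U=tT^2(1+U+U^2)$. Then $Q_{\mathbb{S}}(t)$ is an algebraic function; more precisely, $Q_{\mathbb{S}}(t)$ is a rational function of $U$.
   Context: A surface is a compact connected 2-dimensional manifold up to homeomorphism. For $h\in\mathbb{N}$, $\mathcal{S}_h$ is the orientable surface obtained by adding $h$ handles to the sphere; for $h\in\{\frac12,1,\frac32,\dots\}$, $\mathcal{N}_h$ is the non-orientable surface obtained by adding $2h$ cross-caps to the sphere; every surface is one of these, and its type is the number $h$ (its Euler characteristic is $2-2h$). A map is an embedding of a finite connected graph (loops and multiple edges allowed) into a surface such that each face is simply connected, considered up to homeomorphism; it is rooted if it carries a distinguished half-edge together with a distinguished side of it. The coefficient $(n+2-2h)\vec q_{\mathbb{S}}(n)$ counts rooted maps with $n$ edges on $\mathbb{S}$ with an additional pointed vertex or face (equivalently rooted bipartite quadrangulations with $n$ faces with a pointed vertex). -}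

module Defs where

open import Data.Nat as ℕ using (ℕ; zero; suc; _!)
open import Data.Nat.Properties using (_!≢0)
open import Data.Nat.DivMod as DM using ()
open import Data.Fin as Fin using (Fin; toℕ)
open import Data.Vec as Vec using (Vec; []; _∷_; lookup)
open import Data.Bool using (Bool; true; false; _∧_; _∨_; not; _xor_; if_then_else_)
open import Data.List as List using (List; []; _∷_; allFin; concatMap)
open import Data.List.Relation.Unary.Any using (Any)
open import Data.Bool.ListAction as BL using ()
open import Data.Nat.ListAction as NL using ()
open import Data.Integer as ℤ using (ℤ; +_)
open import Data.Rational as ℚ using (ℚ; 0ℚ; 1ℚ)
open import Data.Product using (Σ; _×_)
open import Relation.Nullary using (¬_)
open import Relation.Nullary.Decidable using (⌊_⌋)
open import Relation.Binary.PropositionalEquality using (_≡_)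

-- Surfaces.  𝒮 g : orientable surface with g handles (type h = g).
-- 𝒩 k : non-orientable surface with (k+1) cross-caps (type h = (k+1)/2).

data Surface : Set where
  𝒮 : ℕ → Surface
  𝒩 : ℕ → Surface

twoh : Surface → ℕ
twoh (𝒮 g) = 2 ℕ.* g
twoh (𝒩 k) = suc k

-- Combinatorial maps via flags (Tutte / Lins encoding).
-- A map with n ≥ 1 edges is a triple of permutations σ₀ σ₁ σ₂ of the
-- set of 4n flags, each a fixed-point-free involution, such that
-- σ₀σ₂ = σ₂σ₀ is a fixed-point-free involution, and ⟨σ₀,σ₁,σ₂⟩ acts
-- transitively.  Vertices = orbits of ⟨σ₁,σ₂⟩, edges = orbits of
-- ⟨σ₀,σ₂⟩ (each of size 4), faces = orbits of ⟨σ₀,σ₁⟩.  Isomorphism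
-- classes of such triples = maps up to homeomorphism; rooted maps
-- (distinguished half-edge + side = distinguished flag) correspond to
-- isomorphism classes of flag-pointed triples.  Since automorphisms of
-- a transitive action act freely, the number of labelled triples on
-- Fin (4n) equals (number of rooted maps) × (4n-1)!.

Fun : ℕ → Set
Fun m = Vec (Fin m) m

_==_ : ∀ {m} → Fin m → Fin m → Bool
x == y = ⌊ x Fin.≟ y ⌋

app : ∀ {m} → Fun m → Fin m → Fin m
app s x = lookup s x

allF : ∀ {m} → (Fin m → Bool) → Bool
allF {m} p = BL.all p (allFin m)

anyF : ∀ {m} → (Fin m → Bool) → Bool
anyF {m} p = BL.any p (allFin m)

countF : ∀ {m} → (Fin m → Bool) → ℕ
countF {m} p = NL.sum (List.map (λ x → if p x then 1 else 0) (allFin m))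

allVecs : ∀ {A : Set} → List A → (k : ℕ) → List (Vec A k)
allVecs as zero = [] ∷ []
allVecs as (suc k) = concatMap (λ v → List.map (_∷ v) as) (allVecs as k)

fpfInvolution : ∀ {m} → Fun m → Bool
fpfInvolution s = allF λ x → (app s (app s x) == x) ∧ not (app s x == x)

-- σ₀σ₂ = σ₂σ₀ and it is fixed-point free (it is then an involution)
commuteFpf : ∀ {m} → Fun m → Fun m → Bool
commuteFpf a b = allF λ x → (app a (app b x) == app b (app a x)) ∧ not (app a (app b x) == x)

step : ∀ {m} → List (Fun m) → (Fin m → Bool) → (Fin m → Bool)
step gens S y = S y ∨ anyF (λ x → S x ∧ BL.any (λ g → app g x == y) gens)

iter : ∀ {A : Set} → ℕ → (A → A) → A → A
iter zero f a = a
iter (suc k) f a = f (iter k f a)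

-- orbit of x under the group generated by gens (involutions / perms):
-- m steps of closure suffice.
orbit : ∀ {m} → List (Fun m) → Fin m → (Fin m → Bool)
orbit {m} gens x = iter m (step gens) (λ y → y == x)

transitive : ∀ {m} → List (Fun m) → Bool
transitive gens = allF λ x → allF λ y → orbit gens x y

numOrbits : ∀ {m} → List (Fun m) → ℕ
numOrbits gens = countF λ x → allF λ y → not (orbit gens x y) ∨ (toℕ x ℕ.≤ᵇ toℕ y)

allColourings : (m : ℕ) → List (Vec Bool m)
allColourings m = allVecs (true ∷ false ∷ []) m

orientable : ∀ {m} → List (Fun m) → Bool
orientable {m} gens = BL.any (λ c → allF λ x → BL.all (λ g → lookup c (app g x) xor lookup c x) gens)
                               (allColourings m)

isMapOn : (S : Surface) (n : ℕ) → Fun (4 ℕ.* n) → Fun (4 ℕ.* n) → Fun (4 ℕ.* n) → Bool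
isMapOn S n s0 s1 s2 =
  fpfInvolution s0 ∧ fpfInvolution s1 ∧ fpfInvolution s2 ∧ commuteFpf s0 s2
  ∧ transitive (s0 ∷ s1 ∷ s2 ∷ []) ∧ surfaceOK S
  where
  V = numOrbits (s1 ∷ s2 ∷ [])
  F = numOrbits (s0 ∷ s1 ∷ [])
  -- Euler characteristic V - n + F = 2 - 2h
  euler : ℕ → Bool
  euler th = (V ℕ.+ F ℕ.+ th) ℕ.≡ᵇ (n ℕ.+ 2)
  surfaceOK : Surface → Bool
  surfaceOK (𝒮 g) = orientable (s0 ∷ s1 ∷ s2 ∷ []) ∧ euler (2 ℕ.* g)
  surfaceOK (𝒩 k) = not (orientable (s0 ∷ s1 ∷ s2 ∷ [])) ∧ euler (suc k)

labelledMaps : Surface → ℕ → ℕ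
labelledMaps S n =
  let fs = allVecs (allFin (4 ℕ.* n)) (4 ℕ.* n) in
  NL.sum (List.map (λ s0 → NL.sum (List.map (λ s1 → NL.sum (List.map
     (λ s2 → if isMapOn S n s0 s1 s2 then 1 else 0) fs)) fs)) fs)

-- q⃗_S(n) : number of rooted maps on S with n edges.
-- n = 0: only the vertex map on the sphere.
rootedMaps : Surface → ℕ → ℕ
rootedMaps (𝒮 zero) zero = 1
rootedMaps (𝒮 (suc g)) zero = 0
rootedMaps (𝒩 k) zero = 0
rootedMaps S (suc k) = DM._/_ (labelledMaps S (suc k)) ((4 ℕ.* suc k ℕ.∸ 1) !) {{(4 ℕ.* suc k ℕ.∸ 1) !≢0}}

FPS : Set
FPS = ℕ → ℚ

_≈_ : FPS → FPS → Set
A ≈ B = ∀ n → A n ≡ B n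

infix 4 _≈_
infixl 6 _⊕_
infixl 7 _⊗_

_⊕_ : FPS → FPS → FPS
(A ⊕ B) n = A n ℚ.+ B n

convo : (ℕ → ℚ) → (ℕ → ℚ) → ℕ → ℕ → ℚ
convo A B n zero = A 0 ℚ.* B n
convo A B n (suc i) = A (suc i) ℚ.* B (n ℕ.∸ suc i) ℚ.+ convo A B n i

_⊗_ : FPS → FPS → FPS
(A ⊗ B) n = convo A B n n

const : ℚ → FPS
const a zero = a
const a (suc n) = 0ℚ

tSer : FPS
tSer zero = 0ℚ
tSer (suc zero) = 1ℚ
tSer (suc (suc n)) = 0ℚ

Poly : Set
Poly = List ℚ

evalP : Poly → FPS → FPS
evalP [] X = const 0ℚ
evalP (a ∷ as) X = const a ⊕ X ⊗ evalP as X

NonZeroSeries : FPS → Set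
NonZeroSeries A = Σ ℕ λ n → ¬ (A n ≡ 0ℚ)

Poly2 : Set
Poly2 = List Poly

evalY : Poly2 → FPS → FPS
evalY [] Y = const 0ℚ
evalY (c ∷ cs) Y = evalP c tSer ⊕ Y ⊗ evalY cs Y

NonZeroPoly2 : Poly2 → Set
NonZeroPoly2 P = Any (Any (λ a → ¬ (a ≡ 0ℚ))) P

IsAlgebraic : FPS → Set
IsAlgebraic A = Σ Poly2 λ P → NonZeroPoly2 P × (evalY P A ≈ const 0ℚ)

IsRationalIn : FPS → FPS → Set
IsRationalIn A X = Σ Poly λ P → Σ Poly λ R → NonZeroSeries (evalP R X) × (evalP R X ⊗ A ≈ evalP P X)

QSer : Surface → FPS
QSer S n = ((+ (n ℕ.+ 2) ℤ.- + twoh S) ℤ.* + rootedMaps S n) ℚ./ 1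

{-# OPTIONS --safe #-}
module Submission where

-- A rooted map is explored by matching one flag after another of the edges found so far: the σ₁-partner of a flag on
-- a boundary loop lies on the same loop (which then splits, or is twisted), on another loop (they merge), or on a
-- new edge. Hence the number of ways to complete given loops to a connected map satisfies a linear recursion in the
-- loop lengths. Its parameter β is 0 for orientable maps, where half of the gluings are forbidden, and 1 for all maps.
--
-- Give each loop a catalytic variable x and subtract from each loop its planar one-loop function W₀. The recursion
-- becomes a system that is triangular in the Euler characteristic and the number of loops, each equation of which is
-- solved by the kernel method. For x = ζ / (T (1+ζ)²) the kernel x - t - 2x²W₀ is (ζ - U)(1 - Uζ)(1 - ζ) times a unit,
-- so that ζ = U is the root to substitute and the solution is a divided difference between ζ and U. By induction all
-- loop functions are rational expressions in U and the ζᵢ that are regular at the origin; setting ζ = 0 gives the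
-- series of rooted maps. The factor n + 2 - 2h is the operator t d/dt + 2 - 2h, under which rationality in U
-- is preserved because t is rational in U.

open import Data.Bool using (Bool)
open import Data.Fin using (Fin)
open import Data.Nat using (ℕ)
open import Data.Rational using (ℚ; 0ℚ)
open import Relation.Binary.PropositionalEquality using (_≡_)

-- Power series

-- Several loops may be open at once, and their completions need not hang together, because the
-- explored part is connected already. The functions that count completions are therefore moments,
-- not connected functions: to leading order they factor into planar discs, and they need not vanish
-- for many loops. Taking a disc away from each loop is what makes the system finite. A loop that is
-- not capped by a disc of its own costs at least one unit of `2 - χ`, since twisting a loop costs
-- one and joining two loops costs two. With a deficiency below `p` the centred `p`-loop function is
-- therefore zero.
--
-- Non-orientable maps are not explored directly. Their number is the difference between all maps
-- and orientable maps, both obtained from the same recursion.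
--
-- Rationality is kept syntactically: the steps of the solution (product, inverse, derivative,
-- restriction to a diagonal, substitution of the kernel root) are operations on expressions, and
-- only coefficients are compared with the combinatorial recursion. Algebraicity then follows by a
-- dimension count, since `t` is rational in `U` as well.

module Series where
  open import Algebra.Bundles using (CommutativeRing)
  open import Level using (0ℓ)
  open import Data.Nat using (ℕ; zero; suc)
  open import Data.Product using (_,_)
  import Algebra.Solver.Ring.NaturalCoefficients.Default as NatSolver

  CRing : Set₁
  CRing = CommutativeRing 0ℓ 0ℓ

  module PowerSeries (R : CRing) where
    open CommutativeRing R hiding (_-_)
    open NatSolver commutativeSemiring using (solve; _:+_; _:*_; _:=_)
    open import Relation.Binary.Reasoning.Setoid setoid

    Ser : Set
    Ser = ℕ → Carrier

    tl : Ser → Ser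
    tl f n = f (suc n)

    κ : Carrier → Ser
    κ a zero = a
    κ a (suc _) = 0#

    infix 4 _≋_
    _≋_ : Ser → Ser → Set
    f ≋ g = ∀ n → f n ≈ g n

    infixl 7 _✶_
    _✶_ : Ser → Ser → Ser
    (f ✶ g) zero = f 0 * g 0
    (f ✶ g) (suc n) = f 0 * g (suc n) + (tl f ✶ g) n

    _⊞_ : Ser → Ser → Ser
    (f ⊞ g) n = f n + g n

    ⊟_ : Ser → Ser
    (⊟ f) n = - f n

    ✶-cong : ∀ {f f′ g g′} → f ≋ f′ → g ≋ g′ → f ✶ g ≋ f′ ✶ g′
    ✶-cong p q zero = *-cong (p 0) (q 0)
    ✶-cong p q (suc n) = +-cong (*-cong (p 0) (q (suc n))) (✶-cong (λ i → p (suc i)) q n)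

    ✶-zeroˡ : ∀ f g → (∀ n → f n ≈ 0#) → ∀ n → (f ✶ g) n ≈ 0#
    ✶-zeroˡ f g z zero = trans (*-congʳ (z 0)) (zeroˡ _)
    ✶-zeroˡ f g z (suc n) = trans (+-cong (trans (*-congʳ (z 0)) (zeroˡ _)) (✶-zeroˡ (tl f) g (λ i → z (suc i)) n)) (+-identityˡ 0#)

    κ-✶ : ∀ a f n → (κ a ✶ f) n ≈ a * f n
    κ-✶ a f zero = refl
    κ-✶ a f (suc n) = trans (+-congˡ (✶-zeroˡ (tl (κ a)) f (λ _ → refl) n)) (+-identityʳ _)

    -- Mirror image of the defining recursion, peeling off the right factor; commutativity compares
    -- the two.
    ✶-tlʳ : ∀ f g n → (f ✶ g) (suc n) ≈ (f ✶ tl g) n + f (suc n) * g 0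
    ✶-tlʳ f g zero = refl
    ✶-tlʳ f g (suc n) = trans (+-congˡ (✶-tlʳ (tl f) g n)) (sym (+-assoc _ _ _))

    ✶-comm : ∀ f g → f ✶ g ≋ g ✶ f
    ✶-comm f g zero = *-comm _ _
    ✶-comm f g (suc n) = begin
      f 0 * g (suc n) + (tl f ✶ g) n ≈⟨ +-cong (*-comm _ _) (✶-comm (tl f) g n) ⟩
      g (suc n) * f 0 + (g ✶ tl f) n ≈⟨ +-comm _ _ ⟩
      (g ✶ tl f) n + g (suc n) * f 0 ≈⟨ ✶-tlʳ g f n ⟨
      (g ✶ f) (suc n) ∎

    ✶-distribʳ : ∀ h f g → (f ⊞ g) ✶ h ≋ (f ✶ h) ⊞ (g ✶ h)
    ✶-distribʳ h f g zero = distribʳ _ _ _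
    ✶-distribʳ h f g (suc n) = begin
      (f 0 + g 0) * h (suc n) + ((tl f ⊞ tl g) ✶ h) n
        ≈⟨ +-congˡ (✶-distribʳ h (tl f) (tl g) n) ⟩
      (f 0 + g 0) * h (suc n) + ((tl f ✶ h) n + (tl g ✶ h) n)
        ≈⟨ solve 5 (λ a b c x y → (a :+ b) :* c :+ (x :+ y) := (a :* c :+ x) :+ (b :* c :+ y)) refl _ _ _ _ _ ⟩
      _ ∎

    ✶-distribˡ : ∀ h f g → h ✶ (f ⊞ g) ≋ (h ✶ f) ⊞ (h ✶ g)
    ✶-distribˡ h f g n = trans (✶-comm h (f ⊞ g) n) (trans (✶-distribʳ h f g n) (+-cong (✶-comm f h n) (✶-comm g h n)))

    ✶-scale : ∀ a f g n → ((λ i → a * f i) ✶ g) n ≈ a * (f ✶ g) n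
    ✶-scale a f g zero = *-assoc _ _ _
    ✶-scale a f g (suc n) = begin
      a * f 0 * g (suc n) + ((λ i → a * f (suc i)) ✶ g) n ≈⟨ +-cong (*-assoc _ _ _) (✶-scale a (tl f) g n) ⟩
      a * (f 0 * g (suc n)) + a * (tl f ✶ g) n ≈⟨ distribˡ _ _ _ ⟨
      a * (f ✶ g) (suc n) ∎

    ✶-assoc : ∀ f g h → (f ✶ g) ✶ h ≋ f ✶ (g ✶ h)
    ✶-assoc f g h zero = *-assoc _ _ _
    ✶-assoc f g h (suc n) = begin
      f 0 * g 0 * h (suc n) + (((λ i → f 0 * g (suc i)) ⊞ (tl f ✶ g)) ✶ h) n
        ≈⟨ +-congˡ (✶-distribʳ h (λ i → f 0 * g (suc i)) (tl f ✶ g) n) ⟩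
      f 0 * g 0 * h (suc n) + (((λ i → f 0 * g (suc i)) ✶ h) n + ((tl f ✶ g) ✶ h) n)
        ≈⟨ +-congˡ (+-cong (✶-scale (f 0) (tl g) h n) (✶-assoc (tl f) g h n)) ⟩
      f 0 * g 0 * h (suc n) + (f 0 * (tl g ✶ h) n + (tl f ✶ (g ✶ h)) n)
        ≈⟨ solve 5 (λ a b c x y → a :* b :* c :+ (a :* x :+ y) := a :* (b :* c :+ x) :+ y) refl _ _ _ _ _ ⟩
      f 0 * (g ✶ h) (suc n) + (tl f ✶ (g ✶ h)) n ∎

    series : CRing
    series = record
      { Carrier = Ser ; _≈_ = _≋_ ; _+_ = _⊞_ ; _*_ = _✶_ ; -_ = ⊟_ ; 0# = κ 0# ; 1# = κ 1#
      ; isCommutativeRing = record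
        { isRing = record
          { +-isAbelianGroup = record
            { isGroup = record
              { isMonoid = record
                { isSemigroup = record
                  { isMagma = record
                    { isEquivalence = record { refl = λ n → refl ; sym = λ p n → sym (p n) ; trans = λ p q n → trans (p n) (q n) }
                    ; ∙-cong = λ p q n → +-cong (p n) (q n) }
                  ; assoc = λ f g h n → +-assoc _ _ _ }
                ; identity = (λ f n → trans (+-congʳ (κ0 n)) (+-identityˡ _)) , (λ f n → trans (+-congˡ (κ0 n)) (+-identityʳ _)) }
              ; inverse = (λ f n → trans (-‿inverseˡ _) (sym (κ0 n))) , (λ f n → trans (-‿inverseʳ _) (sym (κ0 n)))
              ; ⁻¹-cong = λ p n → -‿cong (p n) }
            ; comm = λ f g n → +-comm _ _ }
          ; *-cong = ✶-cong
          ; *-assoc = ✶-assoc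
          ; *-identity = (λ f n → trans (κ-✶ 1# f n) (*-identityˡ _)) , (λ f n → trans (✶-comm f (κ 1#) n) (trans (κ-✶ 1# f n) (*-identityˡ _)))
          ; distrib = ✶-distribˡ , ✶-distribʳ }
        ; *-comm = ✶-comm } }
      where
      κ0 : ∀ n → κ 0# n ≈ 0#
      κ0 zero = refl
      κ0 (suc n) = refl

    κ-+ : ∀ a b → κ (a + b) ≋ κ a ⊞ κ b
    κ-+ a b zero = refl
    κ-+ a b (suc n) = sym (+-identityʳ 0#)

    κ-* : ∀ a b → κ (a * b) ≋ κ a ✶ κ b
    κ-* a b zero = refl
    κ-* a b (suc n) = sym (trans (κ-✶ a (κ b) (suc n)) (zeroʳ a))

    κ-neg : ∀ a → κ (- a) ≋ ⊟ κ a
    κ-neg a zero = refl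
    κ-neg a (suc n) = sym (trans (sym (+-identityˡ _)) (-‿inverseʳ 0#))

    κ-cong : ∀ {a b} → a ≈ b → κ a ≋ κ b
    κ-cong p zero = p
    κ-cong p (suc n) = refl

    X : Ser
    X zero = 0#
    X (suc zero) = 1#
    X (suc (suc n)) = 0#

    X-✶-zero : ∀ f → (X ✶ f) 0 ≈ 0#
    X-✶-zero f = zeroˡ _

    X-✶-suc : ∀ f n → (X ✶ f) (suc n) ≈ f n
    X-✶-suc f n = begin
      0# * f (suc n) + (tl X ✶ f) n ≈⟨ +-cong (zeroˡ _) (✶-cong {g = f} tlX (λ _ → refl) n) ⟩
      0# + (κ 1# ✶ f) n ≈⟨ +-identityˡ _ ⟩
      (κ 1# ✶ f) n ≈⟨ κ-✶ 1# f n ⟩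
      1# * f n ≈⟨ *-identityˡ _ ⟩
      f n ∎
      where
      tlX : tl X ≋ κ 1#
      tlX zero = refl
      tlX (suc n) = refl

  module Swap (R : CRing) where
    open CommutativeRing R hiding (_-_)
    open PowerSeries R
    private module P₂ = PowerSeries series
    open NatSolver commutativeSemiring using (solve; _:+_; _:*_; _:=_)
    open import Relation.Binary.Reasoning.Setoid setoid

    swap : P₂.Ser → P₂.Ser
    swap f m n = f n m

    private
      ∂X ∂Y : P₂.Ser → P₂.Ser
      ∂X f n m = f (suc n) m
      ∂Y f n m = f n (suc m)

      -- The product formed with the two indices exchanged. `swap` is multiplicative once this
      -- product obeys, in the first index, the recursion that defines `_✶_`.
      _∘_ : P₂.Ser → P₂.Ser → P₂.Ser
      f ∘ g = swap (swap f P₂.✶ swap g)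

      ∘-∂X : ∀ f g n m → (f ∘ g) (suc n) m ≈ (f 0 ✶ g (suc n)) m + (∂X f ∘ g) n m
      ∘-∂X f g n zero = refl
      ∘-∂X f g n (suc m) = begin
        (f 0 0 * g (suc n) (suc m) + (tl (swap f 0) ✶ swap g (suc m)) n) + (∂Y f ∘ g) (suc n) m
          ≈⟨ +-congˡ (∘-∂X (∂Y f) g n m) ⟩
        (f 0 0 * g (suc n) (suc m) + (tl (swap f 0) ✶ swap g (suc m)) n) + ((tl (f 0) ✶ g (suc n)) m + (∂X (∂Y f) ∘ g) n m)
          ≈⟨ solve 4 (λ a b c d → (a :+ b) :+ (c :+ d) := (a :+ c) :+ (b :+ d)) refl _ _ _ _ ⟩
        (f 0 ✶ g (suc n)) (suc m) + (∂X f ∘ g) n (suc m) ∎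

    swap-✶ : ∀ f g m n → swap (f P₂.✶ g) m n ≈ (swap f P₂.✶ swap g) m n
    swap-✶ f g m n = go f n
      where
      zer : ∀ f m → (f 0 ✶ g 0) m ≈ (f ∘ g) 0 m
      zer f zero = refl
      zer f (suc m) = +-congˡ (zer (∂Y f) m)
      go : ∀ f n → (f P₂.✶ g) n m ≈ (f ∘ g) n m
      go f zero = zer f m
      go f (suc n) = trans (+-congˡ (go (∂X f) n)) (sym (∘-∂X f g n m))

module Local where
  open import Algebra.Bundles using (CommutativeRing)
  open import Algebra.Solver.Ring.AlmostCommutativeRing using (fromCommutativeRing; _-Raw-AlmostCommutative⟶_)
  import Algebra.Solver.Ring as RingSolver
  open import Data.Maybe using (Maybe; just; nothing)
  open import Data.Nat as ℕ using (ℕ; zero; suc; z≤n; s≤s)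
  import Data.Nat.Properties as ℕₚ
  open import Data.Rational as ℚ using (ℚ; 0ℚ; 1ℚ)
  import Data.Rational.Properties as ℚₚ
  open import Relation.Binary.PropositionalEquality as ≡ using (_≡_)
  open import Relation.Nullary using (yes; no)
  open Series

  -- Augmented ℚ-algebras in which every element of augmentation 1 is invertible.
  record Loc : Set₁ where
    field
      cring : CRing
    open CommutativeRing cring public
    field
      ι : ℚ → Carrier
      ι-+ : ∀ p q → ι (p ℚ.+ q) ≈ ι p + ι q
      ι-* : ∀ p q → ι (p ℚ.* q) ≈ ι p * ι q
      ι-neg : ∀ p → ι (ℚ.- p) ≈ - ι p
      ι-0 : ι 0ℚ ≈ 0#
      ι-1 : ι 1ℚ ≈ 1#
      ε : Carrier → ℚ
      ε-cong : ∀ {a b} → a ≈ b → ε a ≡ ε b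
      ε-+ : ∀ a b → ε (a + b) ≡ ε a ℚ.+ ε b
      ε-* : ∀ a b → ε (a * b) ≡ ε a ℚ.* ε b
      ε-ι : ∀ p → ε (ι p) ≡ p
      geo : Carrier → Carrier
      geo-law : ∀ a → geo a ≈ 1# + (a + ι (ℚ.- ε a)) * geo a

    morphism : CommutativeRing.rawRing ℚₚ.+-*-commutativeRing -Raw-AlmostCommutative⟶ fromCommutativeRing cring
    morphism = record { ⟦_⟧ = ι ; +-homo = ι-+ ; *-homo = ι-* ; -‿homo = ι-neg ; 0-homo = ι-0 ; 1-homo = ι-1 }

    ι≟ : ∀ p q → Maybe (ι p ≈ ι q)
    ι≟ p q with p ℚ.≟ q
    ... | yes ≡.refl = just refl
    ... | no _ = nothing

    module Solver = RingSolver (CommutativeRing.rawRing ℚₚ.+-*-commutativeRing) (fromCommutativeRing cring) morphism ι≟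

    -- With `h = geo a` and `c` the part of augmentation zero, `g = h (1 - c) g = h`. Uniqueness is
    -- what makes every homomorphism commute with `geo`.
    geo-unique : ∀ a g → g ≈ 1# + (a + ι (ℚ.- ε a)) * g → g ≈ geo a
    geo-unique a g p = begin
      g ≈⟨ solve 2 (λ g h → g := h :* g :+ (con 1ℚ :- h) :* g) refl g (geo a) ⟩
      geo a * g + (ι 1ℚ - geo a) * g ≈⟨ +-congˡ (*-congʳ (+-cong ι-1 (-‿cong (geo-law a)))) ⟩
      geo a * g + (1# - (1# + c * geo a)) * g ≈⟨ solve 4 (λ g h c o → h :* g :+ (o :- (o :+ c :* h)) :* g := h :* (g :- c :* g)) refl g (geo a) c 1# ⟩
      geo a * (g - c * g) ≈⟨ *-congˡ (+-congʳ p) ⟩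
      geo a * ((1# + c * g) - c * g) ≈⟨ solve 3 (λ o h x → h :* ((o :+ x) :- x) := h :* o) refl 1# (geo a) (c * g) ⟩
      geo a * 1# ≈⟨ *-identityʳ _ ⟩
      geo a ∎
      where
      open Solver
      open import Relation.Binary.Reasoning.Setoid setoid
      c = a + ι (ℚ.- ε a)

    geo-cong : ∀ {a b} → a ≈ b → geo a ≈ geo b
    geo-cong {a} {b} p = geo-unique b (geo a) (trans (geo-law a)
      (+-congˡ (*-congʳ (+-cong p (reflexive (≡.cong (λ q → ι (ℚ.- q)) (ε-cong p)))))))

  record Hom (A B : Loc) : Set where
    private
      module A = Loc A
      module B = Loc B
    field
      φ : A.Carrier → B.Carrier
      φ-cong : ∀ {a b} → a A.≈ b → φ a B.≈ φ b
      φ-+ : ∀ a b → φ (a A.+ b) B.≈ φ a B.+ φ b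
      φ-* : ∀ a b → φ (a A.* b) B.≈ φ a B.* φ b
      φ-ι : ∀ q → φ (A.ι q) B.≈ B.ι q
      φ-ε : ∀ a → B.ε (φ a) ≡ A.ε a

    φ-geo : ∀ a → φ (A.geo a) B.≈ B.geo (φ a)
    φ-geo a = B.geo-unique (φ a) (φ (A.geo a)) (begin
      φ (A.geo a) ≈⟨ φ-cong (A.geo-law a) ⟩
      φ (A.1# A.+ (a A.+ A.ι (ℚ.- A.ε a)) A.* A.geo a) ≈⟨ φ-+ _ _ ⟩
      φ A.1# B.+ φ ((a A.+ A.ι (ℚ.- A.ε a)) A.* A.geo a)
        ≈⟨ B.+-cong (B.trans (φ-cong (A.sym A.ι-1)) (B.trans (φ-ι 1ℚ) B.ι-1)) (B.trans (φ-* _ _) (B.*-congʳ (φ-+ _ _))) ⟩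
      B.1# B.+ (φ a B.+ φ (A.ι (ℚ.- A.ε a))) B.* φ (A.geo a)
        ≈⟨ B.+-congˡ (B.*-congʳ (B.+-congˡ (B.trans (φ-ι _) (B.reflexive (≡.cong (λ q → B.ι (ℚ.- q)) (≡.sym (φ-ε a))))))) ⟩
      B.1# B.+ (φ a B.+ B.ι (ℚ.- B.ε (φ a))) B.* φ (A.geo a) ∎)
      where
      open import Relation.Binary.Reasoning.Setoid B.setoid

  ℚLoc : Loc
  ℚLoc = record
    { cring = ℚₚ.+-*-commutativeRing ; ι = λ q → q
    ; ι-+ = λ _ _ → ≡.refl ; ι-* = λ _ _ → ≡.refl ; ι-neg = λ _ → ≡.refl ; ι-0 = ≡.refl ; ι-1 = ≡.refl
    ; ε = λ q → q ; ε-cong = λ p → p ; ε-+ = λ _ _ → ≡.refl ; ε-* = λ _ _ → ≡.refl ; ε-ι = λ _ → ≡.refl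
    ; geo = λ _ → 1ℚ
    ; geo-law = λ a → ≡.sym (≡.trans (≡.cong (λ z → 1ℚ ℚ.+ z ℚ.* 1ℚ) (ℚₚ.+-inverseʳ a)) ≡.refl) }

  augmentation : (A : Loc) → Hom A ℚLoc
  augmentation A = record { φ = ε ; φ-cong = ε-cong ; φ-+ = ε-+ ; φ-* = ε-* ; φ-ι = ε-ι ; φ-ε = λ _ → ≡.refl }
    where
    open Loc A

  -- Solves `f = Φ f` when coefficient `n` of `Φ f` depends only on the coefficients of `f` below
  -- `n`: after `n + 1` iterations coefficient `n` no longer changes.
  module FixedPoint (R : CRing) where
    open CommutativeRing R
    open PowerSeries R

    module _ (Φ : Ser → Ser) (local : ∀ {f g} n → (∀ i → i ℕ.< n → f i ≈ g i) → Φ f n ≈ Φ g n) where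
      approx : ℕ → Ser
      approx zero = κ 0#
      approx (suc k) = Φ (approx k)

      fix : Ser
      fix n = approx (suc n) n

      private
        stable : ∀ k l n → n ℕ.< k → n ℕ.< l → approx k n ≈ approx l n
        stable (suc k) (suc l) n (s≤s p) (s≤s q) =
          local n λ i i<n → stable k l i (ℕₚ.<-≤-trans i<n p) (ℕₚ.<-≤-trans i<n q)

      fix-law : fix ≋ Φ fix
      fix-law n = local n λ i i<n → stable n (suc i) i i<n ℕₚ.≤-refl

    ✶-local : ∀ {f f′ g g′} n → (∀ i → i ℕ.≤ n → f i ≈ f′ i) → (∀ i → i ℕ.≤ n → g i ≈ g′ i) → (f ✶ g) n ≈ (f′ ✶ g′) n
    ✶-local zero p q = *-cong (p 0 z≤n) (q 0 z≤n)
    ✶-local (suc n) p q = +-cong (*-cong (p 0 z≤n) (q (suc n) ℕₚ.≤-refl))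
      (✶-local n (λ i i≤n → p (suc i) (s≤s i≤n)) (λ i i≤n → q i (ℕₚ.m≤n⇒m≤1+n i≤n)))

  module PS (A : Loc) where
    open Loc A
    open PowerSeries cring public
    open FixedPoint cring

    private
      -- Comparing coefficients in `g = 1 + (a - ε a) g` leaves the factor `1 - (a₀ - ε a₀)` in
      -- front of the newest coefficient. Multiplying by `geo (a 0)` removes it, and the rest
      -- involves earlier coefficients only.
      Φ : Ser → Ser → Ser
      Φ a g zero = geo (a 0)
      Φ a g (suc n) = geo (a 0) * (tl a ✶ g) n

      Φ-local : ∀ a {f g} n → (∀ i → i ℕ.< n → f i ≈ g i) → Φ a f n ≈ Φ a g n
      Φ-local a zero p = refl
      Φ-local a (suc n) p = *-congˡ (✶-local n (λ _ _ → refl) (λ i i≤n → p i (s≤s i≤n)))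

      geoₛ : Ser → Ser
      geoₛ a = fix (Φ a) (Φ-local a)

      geoₛ-law : ∀ a n → geoₛ a n ≈ (κ 1# ⊞ ((a ⊞ κ (ι (ℚ.- ε (a 0)))) ✶ geoₛ a)) n
      geoₛ-law a zero = geo-law (a 0)
      geoₛ-law a (suc n) = begin
        g (suc n) ≈⟨ law (suc n) ⟩
        geo (a 0) * w ≈⟨ *-congʳ (geo-law (a 0)) ⟩
        (1# + c * geo (a 0)) * w ≈⟨ solve 4 (λ o c h w → (o :+ c :* h) :* w := o :* w :+ c :* (h :* w)) refl 1# c (geo (a 0)) w ⟩
        1# * w + c * (geo (a 0) * w) ≈⟨ +-cong (*-identityˡ w) (*-congˡ (sym (law (suc n)))) ⟩
        w + c * g (suc n) ≈⟨ +-comm _ _ ⟩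
        c * g (suc n) + w ≈⟨ +-congˡ (✶-cong {g = g} (λ i → sym (+-identityʳ _)) (λ _ → refl) n) ⟩
        c * g (suc n) + (tl (a ⊞ κ (ι (ℚ.- ε (a 0)))) ✶ g) n ≈⟨ +-identityˡ _ ⟨
        0# + (c * g (suc n) + (tl (a ⊞ κ (ι (ℚ.- ε (a 0)))) ✶ g) n) ∎
        where
        open Solver
        open import Relation.Binary.Reasoning.Setoid setoid
        g = geoₛ a
        law = fix-law (Φ a) (Φ-local a)
        w = (tl a ✶ g) n
        c = a 0 + ι (ℚ.- ε (a 0))

    loc : Loc
    loc = record
      { cring = series ; ι = λ q → κ (ι q)
      ; ι-+ = λ p q n → trans (κ-cong (ι-+ p q) n) (κ-+ _ _ n)
      ; ι-* = λ p q n → trans (κ-cong (ι-* p q) n) (κ-* _ _ n)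
      ; ι-neg = λ p n → trans (κ-cong (ι-neg p) n) (κ-neg _ n)
      ; ι-0 = κ-cong ι-0 ; ι-1 = κ-cong ι-1
      ; ε = λ f → ε (f 0) ; ε-cong = λ p → ε-cong (p 0)
      ; ε-+ = λ f g → ε-+ _ _ ; ε-* = λ f g → ε-* _ _ ; ε-ι = ε-ι
      ; geo = geoₛ ; geo-law = geoₛ-law }

    constant : Hom A loc
    constant = record { φ = κ ; φ-cong = κ-cong ; φ-+ = κ-+ ; φ-* = κ-* ; φ-ι = λ q n → refl ; φ-ε = λ _ → ≡.refl }

    head : Hom loc A
    head = record { φ = λ f → f 0 ; φ-cong = λ p → p 0 ; φ-+ = λ _ _ → refl ; φ-* = λ _ _ → refl ; φ-ι = λ _ → refl ; φ-ε = λ _ → ≡.refl }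

  mapHom : {A B : Loc} → Hom A B → Hom (PS.loc A) (PS.loc B)
  mapHom {A} {B} h = record
    { φ = λ f n → φ (f n) ; φ-cong = λ p n → φ-cong (p n) ; φ-+ = λ f g n → φ-+ _ _
    ; φ-* = mul
    ; φ-ι = λ { q zero → φ-ι q ; q (suc n) → B.trans (φ-cong (A.sym A.ι-0)) (B.trans (φ-ι 0ℚ) B.ι-0) }
    ; φ-ε = λ f → φ-ε (f 0) }
    where
    open Hom h
    module A = Loc A
    module B = Loc B
    module PA = PowerSeries A.cring
    module PB = PowerSeries B.cring
    mul : ∀ f g n → φ ((f PA.✶ g) n) B.≈ ((λ n → φ (f n)) PB.✶ (λ n → φ (g n))) n
    mul f g zero = φ-* _ _
    mul f g (suc n) = B.trans (φ-+ _ _) (B.+-cong (φ-* _ _) (mul (PA.tl f) g n))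

  swapHom : (A : Loc) → Hom (PS.loc (PS.loc A)) (PS.loc (PS.loc A))
  swapHom A = record
    { φ = swap ; φ-cong = λ p m n → p n m ; φ-+ = λ f g m n → refl ; φ-* = swap-✶
    ; φ-ι = λ { q zero zero → refl ; q zero (suc n) → refl ; q (suc m) zero → refl ; q (suc m) (suc n) → refl }
    ; φ-ε = λ _ → ≡.refl }
    where
    open Loc A
    open Swap cring

  composeHom : {A B C : Loc} → Hom B C → Hom A B → Hom A C
  composeHom {C = C} g f = record
    { φ = λ a → G.φ (F.φ a) ; φ-cong = λ p → G.φ-cong (F.φ-cong p)
    ; φ-+ = λ a b → trans (G.φ-cong (F.φ-+ a b)) (G.φ-+ _ _)
    ; φ-* = λ a b → trans (G.φ-cong (F.φ-* a b)) (G.φ-* _ _)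
    ; φ-ι = λ q → trans (G.φ-cong (F.φ-ι q)) (G.φ-ι q)
    ; φ-ε = λ a → ≡.trans (G.φ-ε _) (F.φ-ε a) }
    where
    module F = Hom f
    module G = Hom g
    open Loc C

open Local using (Loc)

-- Rational expressions and divided differences

module Expr where
  open import Data.Nat as ℕ using (ℕ)
  open import Data.Rational as ℚ using (ℚ; 0ℚ)
  open import Relation.Binary.PropositionalEquality as ≡ using (_≡_)
  open Series
  open Local

  infixl 6 _+ᴱ_
  infixl 7 _*ᴱ_

  -- Rational expressions regular at the origin: geoᴱ e stands for 1 / (1 - e + e(0)).
  data Expr : Set where
    conᴱ : ℚ → Expr
    varᴱ : ℕ → Expr
    _+ᴱ_ _*ᴱ_ : Expr → Expr → Expr
    geoᴱ : Expr → Expr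

  rename : (ℕ → ℕ) → Expr → Expr
  rename s (conᴱ q) = conᴱ q
  rename s (varᴱ v) = varᴱ (s v)
  rename s (e +ᴱ f) = rename s e +ᴱ rename s f
  rename s (e *ᴱ f) = rename s e *ᴱ rename s f
  rename s (geoᴱ e) = geoᴱ (rename s e)

  -- The divided difference of the two substitutions l and r, where d v is the one of var v.
  divDiff : (l r : ℕ → ℕ) (d : ℕ → ℚ) → Expr → Expr
  divDiff l r d (conᴱ q) = conᴱ 0ℚ
  divDiff l r d (varᴱ v) = conᴱ (d v)
  divDiff l r d (e +ᴱ f) = divDiff l r d e +ᴱ divDiff l r d f
  divDiff l r d (e *ᴱ f) = divDiff l r d e *ᴱ rename l f +ᴱ rename r e *ᴱ divDiff l r d f
  divDiff l r d (geoᴱ e) = divDiff l r d e *ᴱ (geoᴱ (rename l e) *ᴱ geoᴱ (rename r e))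

  module Eval (A : Loc) where
    open Loc A

    Env : Set
    Env = ℕ → Carrier

    eval : Env → Expr → Carrier
    eval ρ (conᴱ q) = ι q
    eval ρ (varᴱ v) = ρ v
    eval ρ (e +ᴱ f) = eval ρ e + eval ρ f
    eval ρ (e *ᴱ f) = eval ρ e * eval ρ f
    eval ρ (geoᴱ e) = geo (eval ρ e)

    eval-cong : ∀ {ρ σ} → (∀ v → ρ v ≈ σ v) → ∀ e → eval ρ e ≈ eval σ e
    eval-cong p (conᴱ q) = refl
    eval-cong p (varᴱ v) = p v
    eval-cong p (e +ᴱ f) = +-cong (eval-cong p e) (eval-cong p f)
    eval-cong p (e *ᴱ f) = *-cong (eval-cong p e) (eval-cong p f)
    eval-cong p (geoᴱ e) = geo-cong (eval-cong p e)

    eval-rename : ∀ ρ s e → eval ρ (rename s e) ≡ eval (λ v → ρ (s v)) e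
    eval-rename ρ s (conᴱ q) = ≡.refl
    eval-rename ρ s (varᴱ v) = ≡.refl
    eval-rename ρ s (e +ᴱ f) = ≡.cong₂ _+_ (eval-rename ρ s e) (eval-rename ρ s f)
    eval-rename ρ s (e *ᴱ f) = ≡.cong₂ _*_ (eval-rename ρ s e) (eval-rename ρ s f)
    eval-rename ρ s (geoᴱ e) = ≡.cong geo (eval-rename ρ s e)

  eval-hom : {A B : Loc} (h : Hom A B) → ∀ ρ e →
    Loc._≈_ B (Hom.φ h (Eval.eval A ρ e)) (Eval.eval B (λ v → Hom.φ h (ρ v)) e)
  eval-hom {A} {B} h ρ (conᴱ q) = Hom.φ-ι h q
  eval-hom {A} {B} h ρ (varᴱ v) = Loc.refl B
  eval-hom {A} {B} h ρ (e +ᴱ f) = Loc.trans B (Hom.φ-+ h _ _) (Loc.+-cong B (eval-hom h ρ e) (eval-hom h ρ f))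
  eval-hom {A} {B} h ρ (e *ᴱ f) = Loc.trans B (Hom.φ-* h _ _) (Loc.*-cong B (eval-hom h ρ e) (eval-hom h ρ f))
  eval-hom {A} {B} h ρ (geoᴱ e) = Loc.trans B (Hom.φ-geo h _) (Loc.geo-cong B (eval-hom h ρ e))

  module Vanishing (A : Loc) where
    open Loc A
    open Eval A

    Vanishes : Env → Set
    Vanishes ρ = ∀ v → ε (ρ v) ≡ 0ℚ

    -- The augmentation of a value depends on the expression alone, so the normalisations hidden in
    -- `geo` agree on both sides of a divided difference.
    ε-eval : ∀ ρ → Vanishes ρ → ∀ e → ε (eval ρ e) ≡ Eval.eval ℚLoc (λ _ → 0ℚ) e
    ε-eval ρ z e = ≡.trans (eval-hom (augmentation A) ρ e) (Eval.eval-cong ℚLoc z e)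

    module _ (ρ : Env) (z : Vanishes ρ) (l r : ℕ → ℕ) (d : ℕ → ℚ) (D : Carrier)
             (dvar : ∀ v → ρ (l v) ≈ ρ (r v) + D * ι (d v)) where
      private
        L = λ e → eval ρ (rename l e)
        R = λ e → eval ρ (rename r e)
        E = λ e → eval ρ (divDiff l r d e)

      divDiff-law : ∀ e → L e ≈ R e + D * E e
      divDiff-law (conᴱ q) = sym (trans (+-congˡ (trans (*-congˡ ι-0) (zeroʳ D))) (+-identityʳ _))
      divDiff-law (varᴱ v) = dvar v
      divDiff-law (e +ᴱ f) = begin
        L e + L f ≈⟨ +-cong (divDiff-law e) (divDiff-law f) ⟩
        (R e + D * E e) + (R f + D * E f)
          ≈⟨ solve 5 (λ a b c x y → (a :+ c :* x) :+ (b :+ c :* y) := (a :+ b) :+ c :* (x :+ y)) refl _ _ _ _ _ ⟩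
        (R e + R f) + D * (E e + E f) ∎
        where
        open Solver
        open import Relation.Binary.Reasoning.Setoid setoid
      divDiff-law (e *ᴱ f) = begin
        L e * L f ≈⟨ *-congʳ (divDiff-law e) ⟩
        (R e + D * E e) * L f
          ≈⟨ solve 4 (λ a b c x → (a :+ c :* x) :* b := a :* b :+ c :* (x :* b)) refl _ _ _ _ ⟩
        R e * L f + D * (E e * L f) ≈⟨ +-congʳ (*-congˡ (divDiff-law f)) ⟩
        R e * (R f + D * E f) + D * (E e * L f)
          ≈⟨ solve 6 (λ a b c x y w → a :* (b :+ c :* x) :+ c :* (y :* w) := a :* b :+ c :* (y :* w :+ a :* x)) refl _ _ _ _ _ _ ⟩
        R e * R f + D * (E e * L f + R e * E f) ∎
        where
        open Solver
        open import Relation.Binary.Reasoning.Setoid setoid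
      divDiff-law (geoᴱ e) = begin
        g ≈⟨ *-identityʳ g ⟨
        g * 1# ≈⟨ *-congˡ inv ⟨
        g * (h - (R e + c) * h)
          ≈⟨ solve 6 (λ g h r c d e → g :* (h :- (r :+ c) :* h) := h :* (g :- (r :+ d :* e :+ c) :* g) :+ d :* (e :* (g :* h))) refl g h (R e) c D (E e) ⟩
        h * (g - (R e + D * E e + c) * g) + D * (E e * (g * h))
          ≈⟨ +-congʳ (*-congˡ (trans (+-congˡ (-‿cong (*-congʳ (+-congʳ (sym (divDiff-law e)))))) invL)) ⟩
        h * 1# + D * (E e * (g * h)) ≈⟨ +-congʳ (*-identityʳ h) ⟩
        h + D * (E e * (g * h)) ∎
        where
        open Solver
        open import Relation.Binary.Reasoning.Setoid setoid
        g = geo (L e)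
        h = geo (R e)
        -- One constant serves both sides, as no renaming changes the value at the origin. So `g`
        -- and `h` are inverse to `1 - L e - c` and `1 - R e - c`, and `g - h = (L e - R e) g h`.
        c₀ = ℚ.- Eval.eval ℚLoc (λ _ → 0ℚ) e
        c = ι c₀
        law : ∀ s → geo (eval ρ (rename s e)) - (eval ρ (rename s e) + c) * geo (eval ρ (rename s e)) ≈ 1#
        law s = begin
          x - (y + c) * x ≈⟨ +-congʳ (geo-law y) ⟩
          (1# + (y + ι (ℚ.- ε y)) * x) - (y + c) * x ≈⟨ +-congʳ (+-congˡ (*-congʳ (+-congˡ (reflexive (≡.cong (λ q → ι (ℚ.- q)) eps))))) ⟩
          (1# + (y + c) * x) - (y + c) * x ≈⟨ solve 2 (λ o a → (o :+ a) :- a := o) refl 1# ((y + c) * x) ⟩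
          1# ∎
          where
          y = eval ρ (rename s e)
          x = geo y
          eps : ε y ≡ Eval.eval ℚLoc (λ _ → 0ℚ) e
          eps = ≡.trans (≡.cong ε (eval-rename ρ s e)) (ε-eval (λ v → ρ (s v)) (λ v → z (s v)) e)
        inv = law r
        invL = law l

module Tower where
  open import Data.Nat as ℕ using (ℕ; zero; suc)
  open import Data.Rational as ℚ using (ℚ; 0ℚ; 1ℚ)
  open import Relation.Binary.PropositionalEquality as ≡ using (_≡_)
  open Series
  open Local
  open Expr

  negE : Expr → Expr
  negE e = conᴱ (ℚ.- 1ℚ) *ᴱ e

  oneE : Expr
  oneE = conᴱ 1ℚ

  threeℚ : ℚ
  threeℚ = 1ℚ ℚ.+ (1ℚ ℚ.+ 1ℚ)

  -- With U the variable 0: δᴱ = 1/(1+U+U²), νᴱ = tT², Tᴱ = T = 1+3tT².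
  δᴱ νᴱ Tᴱ T⁻¹ᴱ tᴱ : Expr
  δᴱ = geoᴱ (negE (varᴱ 0 +ᴱ varᴱ 0 *ᴱ varᴱ 0))
  νᴱ = varᴱ 0 *ᴱ δᴱ
  Tᴱ = oneE +ᴱ conᴱ threeℚ *ᴱ νᴱ
  T⁻¹ᴱ = geoᴱ (negE (conᴱ threeℚ *ᴱ νᴱ))
  tᴱ = νᴱ *ᴱ (T⁻¹ᴱ *ᴱ T⁻¹ᴱ)

  -- The catalytic variable x = ζ / (T (1+ζ)²).
  xᴱ : ℕ → Expr
  xᴱ v = varᴱ v *ᴱ (T⁻¹ᴱ *ᴱ (geoᴱ (negE (varᴱ v)) *ᴱ geoᴱ (negE (varᴱ v))))

  -- Variable 0 is `U` and stays; the catalytic variables move up to make room for a new first one.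
  shift : ℕ → ℕ
  shift zero = zero
  shift (suc v) = suc (suc v)

  -- x₁ - x₂ = (ζ₁ - ζ₂) / ratioᴱ
  ratioᴱ : Expr
  ratioᴱ = Tᴱ *ᴱ ((s 1 *ᴱ s 2) *ᴱ geoᴱ (varᴱ 1 *ᴱ varᴱ 2))
    where s = λ v → (oneE +ᴱ varᴱ v) *ᴱ (oneE +ᴱ varᴱ v)

  -- Both make room for one more variable. They send variable 1 to 1 and to 2 respectively, and
  -- agree on all others.
  first second : ℕ → ℕ
  first zero = 0
  first (suc zero) = 1
  first (suc (suc v)) = suc (suc (suc v))
  second = shift

  isOne : ℕ → ℚ
  isOne (suc zero) = 1ℚ
  isOne _ = 0ℚ

  -- f ↦ (f(x₁) - f(x₂)) / (x₁ - x₂)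
  quotient : Expr → Expr
  quotient e = divDiff first second isOne e *ᴱ ratioᴱ

  -- Restriction to the diagonal of the first two catalytic variables.
  merge : ℕ → ℕ
  merge zero = 0
  merge (suc zero) = 1
  merge (suc (suc v)) = suc v

  exchange : ℕ → ℕ
  exchange 0 = 0
  exchange 1 = 2
  exchange 2 = 1
  exchange (suc (suc (suc v))) = suc (suc (suc v))

  under : (ℕ → ℕ) → ℕ → ℕ
  under s 0 = 0
  under s 1 = 1
  under s (suc (suc v)) = shift (s (suc v))

  -- Carries the first catalytic variable past the next `n`, by `n` exchanges of neighbours.
  rotate : ℕ → ℕ → ℕ
  rotate zero v = v
  rotate (suc n) v = under (rotate n) (exchange v)

  nat : ℕ → ℚ
  nat zero = 0ℚ
  nat (suc n) = 1ℚ ℚ.+ nat n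

  module LocFacts (A : Loc) where
    open Loc A

    geo-inverse : ∀ a → ε a ≡ 0ℚ → (1# - a) * geo a ≈ 1#
    geo-inverse a z = begin
      (1# - a) * geo a ≈⟨ solve 3 (λ o a g → (o :- a) :* g := o :* g :- a :* g) refl 1# a (geo a) ⟩
      1# * geo a - a * geo a ≈⟨ +-congʳ (trans (*-identityˡ _) (geo-law a)) ⟩
      (1# + (a + ι (ℚ.- ε a)) * geo a) - a * geo a
        ≈⟨ +-congʳ (+-congˡ (*-congʳ (trans (+-congˡ (trans (reflexive (≡.cong (λ q → ι (ℚ.- q)) z)) ι-0)) (+-identityʳ a)))) ⟩
      (1# + a * geo a) - a * geo a ≈⟨ solve 2 (λ o a → (o :+ a) :- a := o) refl 1# (a * geo a) ⟩
      1# ∎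
      where
      open Solver
      open import Relation.Binary.Reasoning.Setoid setoid

    ε-0 : ε 0# ≡ 0ℚ
    ε-0 = ≡.trans (ε-cong (sym ι-0)) (ε-ι 0ℚ)

    ε-*-zero : ∀ a b → ε a ≡ 0ℚ → ε (a * b) ≡ 0ℚ
    ε-*-zero a b z = ≡.trans (ε-* a b) (≡.trans (≡.cong (ℚ._* ε b) z) (zz (ε b)))
      where
      open import Data.Rational.Properties using (*-zeroˡ)
      zz = *-zeroˡ

    ε-*-zeroʳ : ∀ a b → ε b ≡ 0ℚ → ε (a * b) ≡ 0ℚ
    ε-*-zeroʳ a b z = ≡.trans (ε-cong (*-comm a b)) (ε-*-zero b a z)

    ε-+-zero : ∀ a b → ε a ≡ 0ℚ → ε b ≡ 0ℚ → ε (a + b) ≡ 0ℚ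
    ε-+-zero a b y z = ≡.trans (ε-+ a b) (≡.cong₂ ℚ._+_ y z)

    neg-one : ∀ a → ι (ℚ.- 1ℚ) * a ≈ - a
    neg-one a = solve 1 (λ a → con (ℚ.- 1ℚ) :* a := :- a) refl a where
      open Solver

    geo-neg-inverse : ∀ a → ε a ≡ 0ℚ → (1# + a) * geo (ι (ℚ.- 1ℚ) * a) ≈ 1#
    geo-neg-inverse a z = trans (*-congʳ (solve 2 (λ o a → o :+ a := o :- con (ℚ.- 1ℚ) :* a) refl 1# a))
      (geo-inverse _ (ε-*-zeroʳ _ a z))
      where
      open Solver

  module ParameterFacts (A : Loc) (ρ : ℕ → Loc.Carrier A) (z₀ : Loc.ε A (ρ 0) ≡ 0ℚ) where
    open Loc A
    open LocFacts A
    open Eval A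
    open Solver
    open import Relation.Binary.Reasoning.Setoid setoid

    U δ ν T T⁻¹ t : Carrier
    U = ρ 0
    δ = eval ρ δᴱ
    ν = eval ρ νᴱ
    T = eval ρ Tᴱ
    T⁻¹ = eval ρ T⁻¹ᴱ
    t = eval ρ tᴱ

    δ-inverse : (1# + (U + U * U)) * δ ≈ 1#
    δ-inverse = geo-neg-inverse _ (ε-+-zero _ _ z₀ (ε-*-zero _ _ z₀))

    T-inverse : T * T⁻¹ ≈ 1#
    T-inverse = trans (*-congʳ (+-congʳ ι-1)) (geo-neg-inverse _ (ε-*-zeroʳ _ _ (ε-*-zero _ _ z₀)))

    module _ (v : ℕ) (zᵥ : ε (ρ v) ≡ 0ℚ) where
      private
        c = geo (ι (ℚ.- 1ℚ) * ρ v)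
        c-inverse : (1# + ρ v) * c ≈ 1#
        c-inverse = geo-neg-inverse _ zᵥ

      x-law : eval ρ (xᴱ v) * (T * ((1# + ρ v) * (1# + ρ v))) ≈ ρ v
      x-law = begin
        (ρ v * (T⁻¹ * (c * c))) * (T * ((1# + ρ v) * (1# + ρ v)))
          ≈⟨ solve 5 (λ z i c T o → (z :* (i :* (c :* c))) :* (T :* (o :* o)) := z :* ((T :* i) :* ((o :* c) :* (o :* c)))) refl (ρ v) T⁻¹ c T (1# + ρ v) ⟩
        ρ v * ((T * T⁻¹) * (((1# + ρ v) * c) * ((1# + ρ v) * c)))
          ≈⟨ *-congˡ (*-cong T-inverse (*-cong c-inverse c-inverse)) ⟩
        ρ v * (1# * (1# * 1#)) ≈⟨ trans (*-congˡ (trans (*-identityˡ _) (*-identityˡ _))) (*-identityʳ _) ⟩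
        ρ v ∎

      -- Recognises the series variable as the value of `xᴱ` once `ζ` is defined by the inverse
      -- relation `ζ = x T (1+ζ)²`.
      x-unique : ∀ x → ρ v ≈ x * (T * ((1# + ρ v) * (1# + ρ v))) → eval ρ (xᴱ v) ≈ x
      x-unique x p = begin
        ρ v * (T⁻¹ * (c * c)) ≈⟨ *-congʳ p ⟩
        (x * (T * ((1# + ρ v) * (1# + ρ v)))) * (T⁻¹ * (c * c))
          ≈⟨ solve 5 (λ z i c T o → (z :* (T :* (o :* o))) :* (i :* (c :* c)) := z :* ((T :* i) :* ((o :* c) :* (o :* c)))) refl x T⁻¹ c T (1# + ρ v) ⟩
        x * ((T * T⁻¹) * (((1# + ρ v) * c) * ((1# + ρ v) * c)))
          ≈⟨ *-congˡ (*-cong T-inverse (*-cong c-inverse c-inverse)) ⟩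
        x * (1# * (1# * 1#)) ≈⟨ trans (*-congˡ (trans (*-identityˡ _) (*-identityˡ _))) (*-identityʳ _) ⟩
        x ∎

    -- Rests on `ζ₁ (1+ζ₂)² - ζ₂ (1+ζ₁)² = (ζ₁ - ζ₂)(1 - ζ₁ζ₂)`, whose last factor is invertible at
    -- the origin.
    ratio-law : ε (ρ 1) ≡ 0ℚ → ε (ρ 2) ≡ 0ℚ →
      (eval ρ (xᴱ 1) - eval ρ (xᴱ 2)) * eval ρ ratioᴱ ≈ ρ 1 - ρ 2
    ratio-law z₁ z₂ = begin
      (x - y) * (T * (((ι 1ℚ + a) * (ι 1ℚ + a)) * ((ι 1ℚ + b) * (ι 1ℚ + b)) * h))
        ≈⟨ solve 6 (λ x y a b T h → (x :+ :- y) :* (T :* (((con 1ℚ :+ a) :* (con 1ℚ :+ a)) :* ((con 1ℚ :+ b) :* (con 1ℚ :+ b)) :* h))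
             := (x :* (T :* ((con 1ℚ :+ a) :* (con 1ℚ :+ a))) :* ((con 1ℚ :+ b) :* (con 1ℚ :+ b)) :+ :- (y :* (T :* ((con 1ℚ :+ b) :* (con 1ℚ :+ b))) :* ((con 1ℚ :+ a) :* (con 1ℚ :+ a)))) :* h) refl x y a b T h ⟩
      ((x * (T * ((ι 1ℚ + a) * (ι 1ℚ + a)))) * ((ι 1ℚ + b) * (ι 1ℚ + b)) - (y * (T * ((ι 1ℚ + b) * (ι 1ℚ + b)))) * ((ι 1ℚ + a) * (ι 1ℚ + a))) * h
        ≈⟨ *-congʳ (+-cong (*-congʳ (law 1 z₁)) (-‿cong (*-congʳ (law 2 z₂)))) ⟩
      (a * ((ι 1ℚ + b) * (ι 1ℚ + b)) - b * ((ι 1ℚ + a) * (ι 1ℚ + a))) * h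
        ≈⟨ solve 3 (λ a b h → (a :* ((con 1ℚ :+ b) :* (con 1ℚ :+ b)) :+ :- (b :* ((con 1ℚ :+ a) :* (con 1ℚ :+ a)))) :* h := (a :+ :- b) :* ((con 1ℚ :+ :- (a :* b)) :* h)) refl a b h ⟩
      (a - b) * ((ι 1ℚ - a * b) * h) ≈⟨ *-congˡ (trans (*-congʳ (+-congʳ ι-1)) (geo-inverse _ (ε-*-zero a b z₁))) ⟩
      (a - b) * 1# ≈⟨ *-identityʳ _ ⟩
      a - b ∎
      where
      a = ρ 1
      b = ρ 2
      x = eval ρ (xᴱ 1)
      y = eval ρ (xᴱ 2)
      h = geo (a * b)
      law : ∀ v → ε (ρ v) ≡ 0ℚ → eval ρ (xᴱ v) * (T * ((ι 1ℚ + ρ v) * (ι 1ℚ + ρ v))) ≈ ρ v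
      law v z = trans (*-congˡ (*-congˡ (*-cong (+-congʳ ι-1) (+-congʳ ι-1)))) (x-law v z)

  idHom : (A : Loc) → Hom A A
  idHom A = record { φ = λ a → a ; φ-cong = λ p → p ; φ-+ = λ _ _ → refl ; φ-* = λ _ _ → refl ; φ-ι = λ _ → refl ; φ-ε = λ _ → ≡.refl }
    where
    open Loc A

  map-κ : ∀ {A B} (h : Hom A B) a →
    Loc._≈_ (PS.loc B) (λ n → Hom.φ h (PS.κ A a n)) (PS.κ B (Hom.φ h a))
  map-κ {A} {B} h a zero = Loc.refl B
  map-κ {A} {B} h a (suc n) = Loc.trans B (φ-cong (Loc.sym A (Loc.ι-0 A))) (Loc.trans B (φ-ι 0ℚ) (Loc.ι-0 B))
    where
    open Hom h

  map-X : ∀ {A B} (h : Hom A B) →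
    Loc._≈_ (PS.loc B) (λ n → Hom.φ h (PS.X A n)) (PS.X B)
  map-X {A} {B} h zero = map-κ h (Loc.0# A) 1
  map-X {A} {B} h (suc zero) = Loc.trans B (φ-cong (Loc.sym A (Loc.ι-1 A))) (Loc.trans B (φ-ι 1ℚ) (Loc.ι-1 B))
    where
    open Hom h
  map-X {A} {B} h (suc (suc n)) = map-κ h (Loc.0# A) 1

-- Expressions as iterated power series in the catalytic variables

module Subst (base : Loc) where
  open Local

  open import Data.Nat as ℕ using (ℕ; zero; suc)
  import Data.Nat.Properties as ℕₚ
  open import Data.Rational as ℚ using (ℚ; 0ℚ; 1ℚ)
  open import Relation.Binary.PropositionalEquality as ≡ using (_≡_)
  open Series
  open Expr
  open Tower

  -- The outermost layer belongs to variable 1, so that a loop put in front of the list is a layer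
  -- put outside.
  Tower : ℕ → Loc
  Tower zero = base
  Tower (suc p) = PS.loc (Tower p)

  embed : ∀ p → Hom base (Tower p)
  embed zero = idHom base
  embed (suc p) = composeHom (PS.constant (Tower p)) (embed p)

  module Substitution (U : Loc.Carrier base) (U₀ : Loc.ε base U ≡ 0ℚ) where
    module Base = PS base
    private module B = Loc base

    T₀ : B.Carrier
    T₀ = Eval.eval base (λ _ → U) Tᴱ

    private
      module P₁ = Loc (PS.loc base)

      Φ : Base.Ser → Base.Ser
      Φ f = Base.X P₁.* (Base.κ T₀ P₁.* ((P₁.1# P₁.+ f) P₁.* (P₁.1# P₁.+ f)))

      open FixedPoint B.cring

      Φ-local : ∀ {f g} n → (∀ i → i ℕ.< n → f i B.≈ g i) → Φ f n B.≈ Φ g n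
      Φ-local zero p = B.trans (B.zeroˡ _) (B.sym (B.zeroˡ _))
      Φ-local {f} {g} (suc n) p = B.trans (Base.X-✶-suc _ n) (B.trans
        (✶-local {f = Base.κ T₀} n (λ _ _ → B.refl) λ i i≤n → ✶-local i (near i i≤n) (near i i≤n))
        (B.sym (Base.X-✶-suc _ n)))
        where
        near : ∀ i → i ℕ.≤ n → ∀ j → j ℕ.≤ i → (P₁.1# P₁.+ f) j B.≈ (P₁.1# P₁.+ g) j
        near i i≤n j j≤i = B.+-congˡ {x = P₁.1# j} (p j (ℕ.s≤s (ℕₚ.≤-trans j≤i i≤n)))

    -- Inverts `x = ζ / (T (1+ζ)²)`. Its coefficients lie in the base, so each layer of the tower
    -- uses a copy of this one series.
    ζ₀ : Base.Ser
    ζ₀ = fix Φ Φ-local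

    ζ₀-law : ζ₀ P₁.≈ Base.X P₁.* (Base.κ T₀ P₁.* ((P₁.1# P₁.+ ζ₀) P₁.* (P₁.1# P₁.+ ζ₀)))
    ζ₀-law = fix-law Φ Φ-local

    env : ∀ p → ℕ → Loc.Carrier (Tower p)
    env p zero = Hom.φ (embed p) U
    env zero (suc v) = B.0#
    env (suc p) (suc zero) n = Hom.φ (embed p) (ζ₀ n)
    env (suc p) (suc (suc v)) = PS.κ (Tower p) (env p (suc v))

    env-vanishes : ∀ p v → Loc.ε (Tower p) (env p v) ≡ 0ℚ
    env-vanishes p zero = ≡.trans (Hom.φ-ε (embed p) U) U₀
    env-vanishes zero (suc v) = LocFacts.ε-0 base
    env-vanishes (suc p) (suc zero) = ≡.trans (Hom.φ-ε (embed p) (ζ₀ 0)) (≡.trans (B.ε-cong (ζ₀-law 0)) (LocFacts.ε-*-zero base B.0# ((Base.κ T₀ P₁.* ((P₁.1# P₁.+ ζ₀) P₁.* (P₁.1# P₁.+ ζ₀))) 0) (LocFacts.ε-0 base)))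
    env-vanishes (suc p) (suc (suc v)) = env-vanishes p (suc v)

    module _ (p : ℕ) where
      private
        A = Tower (suc p)
        h = mapHom (embed p)
      open Loc A
      open PS (Tower p) using (κ; X)
      open ParameterFacts A (env (suc p)) (env-vanishes (suc p) 0) hiding (U)
      open Eval A

      head-law : env (suc p) 1 ≈ X * (T * ((1# + env (suc p) 1) * (1# + env (suc p) 1)))
      head-law = trans (φ-cong ζ₀-law) (trans (φ-* _ _) (*-cong (map-X (embed p))
        (trans (φ-* _ _) (*-cong (trans (map-κ (embed p) T₀) (eval-hom (embed (suc p)) (λ _ → U) Tᴱ))
          (trans (φ-* _ _) (*-cong one+ζ one+ζ))))))
        where
        open Hom h
        one+ζ = trans (φ-+ _ _) (+-congʳ (map-κ (embed p) B.1# ⟨≈⟩ λ n → PS.κ-cong (Tower p) (Loc.trans (Tower p) (Hom.φ-cong (embed p) (B.sym B.ι-1)) (Loc.trans (Tower p) (Hom.φ-ι (embed p) 1ℚ) (Loc.ι-1 (Tower p)))) n))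
          where _⟨≈⟩_ = trans

      x-head : eval (env (suc p)) (xᴱ 1) ≈ X
      x-head = x-unique 1 (env-vanishes (suc p) 1) X head-law

      eval-shift : ∀ e → eval (env (suc p)) (rename shift e) ≈ κ (Eval.eval (Tower p) (env p) e)
      eval-shift e = trans (reflexive (Eval.eval-rename A (env (suc p)) shift e))
        (trans (Eval.eval-cong A (λ { zero → refl ; (suc v) → refl }) e) (sym (eval-hom (PS.constant (Tower p)) (env p) e)))

    module _ (p : ℕ) where
      private
        A = Tower (suc (suc p))
      open Loc A
      open PS (Tower (suc p)) using (κ; X)
      open Eval A
      module X₁ = PS (Tower p)

      x-second : eval (env (suc (suc p))) (xᴱ 2) ≈ κ X₁.X
      x-second = trans (sym (eval-hom (PS.constant (Tower (suc p))) (env (suc p)) (xᴱ 1))) (PS.κ-cong (Tower (suc p)) (x-head p))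

      private
        ρ = env (suc (suc p))

        x-difference : (X - κ X₁.X) * eval ρ ratioᴱ ≈ ρ 1 - ρ 2
        x-difference = trans (*-congʳ (+-cong (sym (x-head (suc p))) (-‿cong (sym x-second))))
          (ratio-law (env-vanishes (suc (suc p)) 1) (env-vanishes (suc (suc p)) 2))
          where
          open ParameterFacts A ρ (env-vanishes (suc (suc p)) 0)

      -- Coefficients can only be read from a division by `x₁ - x₂`; the factor `ratioᴱ` converts
      -- the division by `ζ₁ - ζ₂` that `divDiff` performs.
      difference : (l r : ℕ → ℕ) (d : ℕ → ℚ) → (∀ v → ρ (l v) ≈ ρ (r v) + (ρ 1 - ρ 2) * ι (d v)) → ∀ e →
        eval ρ (rename l e) ≈ eval ρ (rename r e) + (X - κ X₁.X) * eval ρ (divDiff l r d e *ᴱ ratioᴱ)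
      difference l r d dvar e = begin
        eval ρ (rename l e) ≈⟨ Vanishing.divDiff-law A ρ (env-vanishes (suc (suc p))) l r d (ρ 1 - ρ 2) dvar e ⟩
        eval ρ (rename r e) + (ρ 1 - ρ 2) * E ≈⟨ +-congˡ (*-congʳ (sym x-difference)) ⟩
        eval ρ (rename r e) + ((X - κ X₁.X) * eval ρ ratioᴱ) * E ≈⟨ +-congˡ (trans (*-assoc _ _ _) (*-congˡ (*-comm _ _))) ⟩
        eval ρ (rename r e) + (X - κ X₁.X) * (E * eval ρ ratioᴱ) ∎
        where
        open import Relation.Binary.Reasoning.Setoid setoid
        E = eval ρ (divDiff l r d e)

      private
        solve-same : ∀ a → a ≈ a + (ρ 1 - ρ 2) * ι 0ℚ
        solve-same a = sym (trans (+-congˡ (trans (*-congˡ ι-0) (zeroʳ _))) (+-identityʳ a))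

        solve-swap : ∀ a b → a ≈ b + (a - b) * ι 1ℚ
        solve-swap = solve 2 (λ a b → a := b :+ (a :- b) :* con 1ℚ) refl
          where
          open Solver


      diagonal-remainder : Expr → Carrier
      diagonal-remainder e = eval ρ (divDiff (λ v → v) (λ v → shift (merge v)) isOne e *ᴱ ratioᴱ)

      -- The first variable is moved onto the second. The value on the diagonal is constant in the
      -- outer variable, and the remainder is divisible by `x₁ - x₂`.
      diagonal-difference : ∀ e → eval ρ e ≈ κ (Eval.eval (Tower (suc p)) (env (suc p)) (rename merge e)) + (X - κ X₁.X) * diagonal-remainder e
      diagonal-difference e = begin
        eval ρ e ≈⟨ reflexive (≡.sym (eval-rename ρ (λ v → v) e)) ⟩
        eval ρ (rename (λ v → v) e) ≈⟨ difference (λ v → v) (λ v → shift (merge v)) isOne dvar e ⟩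
        eval ρ (rename (λ v → shift (merge v)) e) + _ ≈⟨ +-congʳ (reflexive (≡.trans (eval-rename ρ (λ v → shift (merge v)) e) (≡.sym (≡.trans (eval-rename ρ shift (rename merge e)) (eval-rename _ merge e))))) ⟩
        eval ρ (rename shift (rename merge e)) + _ ≈⟨ +-congʳ (eval-shift (suc p) (rename merge e)) ⟩
        _ ∎
        where
        open import Relation.Binary.Reasoning.Setoid setoid
        dvar : ∀ v → ρ v ≈ ρ (shift (merge v)) + (ρ 1 - ρ 2) * ι (isOne v)
        dvar zero = solve-same (ρ 0)
        dvar (suc zero) = solve-swap (ρ 1) (ρ 2)
        dvar (suc (suc zero)) = solve-same (ρ 2)
        dvar (suc (suc (suc v))) = solve-same (ρ (suc (suc (suc v))))

      -- The left side is `f` in the outer variable, `κ f` is `f` in the inner one, so `quotient`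
      -- really divides their difference by `x₁ - x₂`.
      quotient-difference : ∀ e → let f = Eval.eval (Tower (suc p)) (env (suc p)) e in
        (λ n → X₁.κ (f n)) ≈ κ f + (X - κ X₁.X) * eval ρ (quotient e)
      quotient-difference e = begin
        (λ n → X₁.κ (f n)) ≈⟨ eval-hom (mapHom (PS.constant (Tower p))) (env (suc p)) e ⟩
        eval _ e ≈⟨ eval-cong vars e ⟩
        eval (λ v → ρ (first v)) e ≈⟨ reflexive (≡.sym (eval-rename ρ first e)) ⟩
        eval ρ (rename first e) ≈⟨ difference first second isOne dvar e ⟩
        eval ρ (rename second e) + _ ≈⟨ +-congʳ (eval-shift (suc p) e) ⟩
        κ f + (X - κ X₁.X) * eval ρ (quotient e) ∎
        where
        open import Relation.Binary.Reasoning.Setoid setoid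
        f = Eval.eval (Tower (suc p)) (env (suc p)) e
        vars : ∀ v → (λ n → X₁.κ (env (suc p) v n)) ≈ ρ (first v)
        vars zero = map-κ (PS.constant (Tower p)) _
        vars (suc zero) n = Loc.refl (Tower (suc p))
        vars (suc (suc v)) = map-κ (PS.constant (Tower p)) _
        dvar : ∀ v → ρ (first v) ≈ ρ (second v) + (ρ 1 - ρ 2) * ι (isOne v)
        dvar zero = solve-same (ρ 0)
        dvar (suc zero) = solve-swap (ρ 1) (ρ 2)
        dvar (suc (suc v)) = solve-same (ρ (suc (suc (suc v))))

-- Reading off coefficients

module Coeff (base : Loc) where
  open Local

  open import Data.List using (List; []; _∷_; _++_; length)
  open import Data.Nat as ℕ using (ℕ; zero; suc)
  import Data.Nat.Properties as ℕₚ
  open import Data.Rational as ℚ using (ℚ; 0ℚ; 1ℚ)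
  open import Relation.Binary.PropositionalEquality as ≡ using (_≡_)
  open Series
  open Expr
  open Tower
  open Subst base

  module Diagonal (A : Loc) where
    open Loc A
    open import Relation.Binary.Reasoning.Setoid setoid
    open Solver using (solve; _:+_; _:*_; _:=_; _:-_; con)

    dsum : (ℕ → ℕ → Carrier) → ℕ → Carrier
    dsum F zero = F 0 0
    dsum F (suc n) = F 0 (suc n) + dsum (λ i → F (suc i)) n

    dsum-cong : ∀ {F G} → (∀ i j → F i j ≈ G i j) → ∀ n → dsum F n ≈ dsum G n
    dsum-cong p zero = p 0 0
    dsum-cong p (suc n) = +-cong (p 0 (suc n)) (dsum-cong (λ i → p (suc i)) n)

    dsum-+ : ∀ F G n → dsum (λ i j → F i j + G i j) n ≈ dsum F n + dsum G n
    dsum-+ F G zero = refl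
    dsum-+ F G (suc n) = trans (+-congˡ (dsum-+ (λ i → F (suc i)) (λ i → G (suc i)) n))
      (solve 4 (λ a b c d → (a :+ b) :+ (c :+ d) := (a :+ c) :+ (b :+ d)) refl _ _ _ _)

    dsum-scale : ∀ c F n → dsum (λ i j → c * F i j) n ≈ c * dsum F n
    dsum-scale c F zero = refl
    dsum-scale c F (suc n) = trans (+-congˡ (dsum-scale c (λ i → F (suc i)) n)) (sym (distribˡ _ _ _))

    dsum-0 : ∀ {F} → (∀ i j → F i j ≈ 0#) → ∀ n → dsum F n ≈ 0#
    dsum-0 p zero = p 0 0
    dsum-0 p (suc n) = trans (+-cong (p 0 (suc n)) (dsum-0 (λ i → p (suc i)) n)) (+-identityˡ _)

  module DoubleSeries (A : Loc) where
    open Loc A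
    module P = PS A
    module P₂ = PS P.loc
    module L₂ = Loc P₂.loc
    open Diagonal A
    open import Relation.Binary.Reasoning.Setoid setoid
    open Solver using (solve; _:+_; _:*_; _:=_; _:-_; con)

    private
      0*-zero : ∀ (f : P.Ser) j → (P.κ 0# P.✶ f) j ≈ 0#
      0*-zero f j = trans (P.κ-✶ 0# f j) (zeroˡ _)

    -- Multiplication by either variable shifts an antidiagonal onto the next. Hence a multiple of
    -- `x₁ - x₂` has antidiagonal sums zero.
    outer-inner : ∀ H n → dsum (P₂.X P₂.✶ H) n ≈ dsum (P₂.κ P.X P₂.✶ H) n
    outer-inner H zero = trans (0*-zero (H 0) 0) (sym (P.X-✶-zero (H 0)))
    outer-inner H (suc n) = begin
      (P.κ 0# P.✶ H 0) (suc n) + dsum (λ i → (P₂.X P₂.✶ H) (suc i)) n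
        ≈⟨ +-cong (0*-zero (H 0) (suc n)) (dsum-cong (λ i j → P₂.X-✶-suc H i j) n) ⟩
      0# + dsum H n ≈⟨ +-identityˡ _ ⟩
      dsum H n ≈⟨ lower H n ⟨
      dsum (λ i → P.X P.✶ H i) (suc n) ≈⟨ dsum-cong (λ i j → P₂.κ-✶ P.X H i j) (suc n) ⟨
      dsum (P₂.κ P.X P₂.✶ H) (suc n) ∎
      where
      lower : ∀ H n → dsum (λ i → P.X P.✶ H i) (suc n) ≈ dsum H n
      lower H zero = trans (+-cong (P.X-✶-suc (H 0) 0) (P.X-✶-zero (H 1))) (+-identityʳ _)
      lower H (suc n) = +-cong (P.X-✶-suc (H 0) (suc n)) (lower (λ i → H (suc i)) n)

    dsum-κ : ∀ g n → dsum (P₂.κ g) n ≈ g n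
    dsum-κ g zero = refl
    dsum-κ g (suc n) = trans (+-congˡ (dsum-0 zeros n)) (+-identityʳ _)
      where
      zeros : ∀ i j → P.κ 0# j ≈ 0#
      zeros i zero = refl
      zeros i (suc j) = refl

    diagonal : ∀ F g H → F L₂.≈ P₂.κ g L₂.+ (P₂.X L₂.- P₂.κ P.X) L₂.* H → ∀ n → dsum F n ≈ g n
    diagonal F g H p n = begin
      dsum F n ≈⟨ dsum-cong (λ i j → trans (p i j) (+-congˡ (expand i j))) n ⟩
      dsum (λ i j → P₂.κ g i j + ((P₂.X P₂.✶ H) i j + (ι (ℚ.- 1ℚ)) * (P₂.κ P.X P₂.✶ H) i j)) n
        ≈⟨ trans (dsum-+ _ _ n) (+-congˡ (trans (dsum-+ _ _ n) (+-congˡ (dsum-scale _ _ n)))) ⟩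
      dsum (P₂.κ g) n + (dsum (P₂.X P₂.✶ H) n + ι (ℚ.- 1ℚ) * dsum (P₂.κ P.X P₂.✶ H) n)
        ≈⟨ +-cong (dsum-κ g n) (+-congʳ (outer-inner H n)) ⟩
      g n + (dsum (P₂.κ P.X P₂.✶ H) n + ι (ℚ.- 1ℚ) * dsum (P₂.κ P.X P₂.✶ H) n)
        ≈⟨ solve 2 (λ g d → g :+ (d :+ con (ℚ.- 1ℚ) :* d) := g) refl _ _ ⟩
      g n ∎
      where
      expand : ∀ i j → ((P₂.X L₂.- P₂.κ P.X) P₂.✶ H) i j ≈ (P₂.X P₂.✶ H) i j + (ι (ℚ.- 1ℚ)) * (P₂.κ P.X P₂.✶ H) i j
      expand i j = trans (L₂.Solver.solve 3 (λ x y h → (x L₂.Solver.:- y) L₂.Solver.:* h L₂.Solver.:= x L₂.Solver.:* h L₂.Solver.:- y L₂.Solver.:* h) L₂.refl P₂.X (P₂.κ P.X) H i j)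
        (+-congˡ (sym (LocFacts.neg-one A _)))

    -- Coefficientwise the equation says that `H` is constant along antidiagonals and that its row 0
    -- is the tail of `f`.
    quotient-coefficients : ∀ (f : P.Ser) H → (λ n → P.κ (f n)) L₂.≈ P₂.κ f L₂.+ (P₂.X L₂.- P₂.κ P.X) L₂.* H →
      ∀ i j → H i j ≈ f (suc (i ℕ.+ j))
    quotient-coefficients f H p = go
      where
      q : ∀ i j → P.κ (f i) j ≈ P₂.κ f i j + ((P₂.X P₂.✶ H) i j - (P.X P.✶ H i) j)
      q i j = trans (p i j) (+-congˡ (trans (L₂.Solver.solve 3 (λ x y h → (x L₂.Solver.:- y) L₂.Solver.:* h L₂.Solver.:= x L₂.Solver.:* h L₂.Solver.:- y L₂.Solver.:* h) L₂.refl P₂.X (P₂.κ P.X) H i j)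
        (+-congˡ (-‿cong (P₂.κ-✶ P.X H i j)))))
      isolate : ∀ {a b c} → 0# ≈ a + (b - c) → c ≈ a + b
      isolate {a} {b} {c} z = begin
        c ≈⟨ +-identityʳ c ⟨
        c + 0# ≈⟨ +-congˡ z ⟩
        c + (a + (b - c)) ≈⟨ solve 3 (λ a b c → c :+ (a :+ (b :- c)) := a :+ b) refl a b c ⟩
        a + b ∎
      go : ∀ i j → H i j ≈ f (suc (i ℕ.+ j))
      go zero j = trans (sym (P.X-✶-suc (H 0) j)) (trans (isolate (q 0 (suc j))) (trans (+-congˡ (0*-zero (H 0) (suc j))) (+-identityʳ _)))
      go (suc i) j = begin
        H (suc i) j ≈⟨ P.X-✶-suc (H (suc i)) j ⟨
        (P.X P.✶ H (suc i)) (suc j) ≈⟨ isolate (q (suc i) (suc j)) ⟩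
        0# + (P₂.X P₂.✶ H) (suc i) (suc j) ≈⟨ trans (+-identityˡ _) (P₂.X-✶-suc H i (suc j)) ⟩
        H i (suc j) ≈⟨ go i (suc j) ⟩
        f (suc (i ℕ.+ suc j)) ≈⟨ reflexive (≡.cong (λ m → f (suc m)) (ℕₚ.+-suc i j)) ⟩
        f (suc (suc i ℕ.+ j)) ∎

  module B = Loc base

  coeff : (K : List ℕ) → Loc.Carrier (Tower (length K)) → B.Carrier
  coeff [] f = f
  coeff (k ∷ K) f = coeff K (f k)

  coeff-cong : ∀ K {f g} → Loc._≈_ (Tower (length K)) f g → coeff K f B.≈ coeff K g
  coeff-cong [] p = p
  coeff-cong (k ∷ K) p = coeff-cong K (p k)

  coeff-+ : ∀ K f g → coeff K (Loc._+_ (Tower (length K)) f g) B.≈ coeff K f B.+ coeff K g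
  coeff-+ [] f g = B.refl {x = f B.+ g}
  coeff-+ (k ∷ K) f g = coeff-+ K (f k) (g k)

  coeff-embed : ∀ K b f → coeff K (Loc._*_ (Tower (length K)) (Hom.φ (embed (length K)) b) f) B.≈ b B.* coeff K f
  coeff-embed [] b f = B.refl {x = b B.* f}
  coeff-embed (k ∷ K) b f = B.trans (coeff-cong K (PS.κ-✶ (Tower (length K)) _ f k)) (coeff-embed K b (f k))

  coeff-0 : ∀ K → coeff K (Loc.0# (Tower (length K))) B.≈ B.0#
  coeff-0 [] = B.refl {x = B.0#}
  coeff-0 (zero ∷ K) = coeff-0 K
  coeff-0 (suc k ∷ K) = coeff-0 K

  coeff-dsum : ∀ K F n → coeff K (Diagonal.dsum (Tower (length K)) F n) B.≈ Diagonal.dsum base (λ i j → coeff K (F i j)) n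
  coeff-dsum K F zero = B.refl {x = coeff K (F 0 0)}
  coeff-dsum K F (suc n) = B.trans (coeff-+ K _ _) (B.+-congˡ {x = coeff K (F 0 (suc n))} (coeff-dsum K (λ i → F (suc i)) n))

  -- Moves the outermost variable inwards past the variables of `K`, one transposition of
  -- neighbouring layers at a time; on coefficients it only permutes the indices.
  rotateHom : ∀ (K : List ℕ) (k : ℕ) L → Hom (Tower (suc (length (K ++ L)))) (Tower (length (K ++ k ∷ L)))
  rotateHom [] k L = idHom _
  rotateHom (a ∷ K) k L = composeHom {A} {A} {PS.loc (Tower (length (K ++ k ∷ L)))} (mapHom (rotateHom K k L)) (swapHom (Tower (length (K ++ L))))
    where A = PS.loc (PS.loc (Tower (length (K ++ L))))

  rotateHom-coeff : ∀ K k L (f : Loc.Carrier (Tower (suc (length (K ++ L))))) → coeff (K ++ k ∷ L) (Hom.φ (rotateHom K k L) f) ≡ coeff (k ∷ K ++ L) f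
  rotateHom-coeff [] k L f = ≡.refl
  rotateHom-coeff (a ∷ K) k L f = rotateHom-coeff K k L (λ m → f m a)

  module _ (A : Loc) where
    open Loc A
    private
      module P = PS A
      module P₂ = PS P.loc
      module L₂ = Loc P₂.loc
    open Hom (swapHom A)

    swap-κκ : ∀ a → φ (P₂.κ (P.κ a)) L₂.≈ P₂.κ (P.κ a)
    swap-κκ a zero zero = refl
    swap-κκ a zero (suc n) = refl
    swap-κκ a (suc m) zero = refl
    swap-κκ a (suc m) (suc n) = refl

    swap-inner : ∀ (f : P.Ser) → φ (λ n → P.κ (f n)) L₂.≈ P₂.κ f
    swap-inner f zero n = refl
    swap-inner f (suc m) zero = refl
    swap-inner f (suc m) (suc n) = refl

    swap-outer : ∀ (f : P.Ser) → φ (P₂.κ f) L₂.≈ (λ n → P.κ (f n))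
    swap-outer f m zero = refl
    swap-outer f zero (suc n) = refl
    swap-outer f (suc m) (suc n) = refl

  rotateHom-embed : ∀ K k L b → Loc._≈_ (Tower (length (K ++ k ∷ L)))
    (Hom.φ (rotateHom K k L) (Hom.φ (embed (suc (length (K ++ L)))) b)) (Hom.φ (embed (length (K ++ k ∷ L))) b)
  rotateHom-embed [] k L b = Loc.refl (Tower (suc (length L)))
  rotateHom-embed (a ∷ K) k L b = trans (Hom.φ-cong (mapHom r) (swap-κκ (Tower (length (K ++ L))) (Hom.φ (embed (length (K ++ L))) b)))
    (trans (map-κ r (Hom.φ (embed (suc (length (K ++ L)))) b)) (PS.κ-cong (Tower (length (K ++ k ∷ L))) (rotateHom-embed K k L b)))
    where
    r = rotateHom K k L
    open Loc (Tower (suc (length (K ++ k ∷ L)))) using (trans)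

  module Extraction (U : Loc.Carrier base) (U₀ : Loc.ε base U ≡ 0ℚ) where
    open Substitution U U₀ public
    open Diagonal base public

    env-shift : ∀ p v → Loc._≈_ (Tower (suc p)) (PS.κ (Tower p) (env p v)) (env (suc p) (shift v))
    env-shift p zero = Loc.refl (Tower (suc p))
    env-shift p (suc v) = Loc.refl (Tower (suc p))

    rotateHom-env : ∀ K k L v → Loc._≈_ (Tower (length (K ++ k ∷ L)))
      (Hom.φ (rotateHom K k L) (env (suc (length (K ++ L))) v)) (env (length (K ++ k ∷ L)) (rotate (length K) v))
    rotateHom-env [] k L v = Loc.refl (Tower (suc (length L)))
    rotateHom-env (a ∷ K) k L = go
      where
      q = length (K ++ L)
      C = Tower q
      r = rotateHom K k L
      p = length (K ++ k ∷ L)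
      open Loc (Tower (suc p)) using (trans; _≈_)
      fin : ∀ f v → Loc._≈_ (Tower (suc (suc q))) (Hom.φ (swapHom C) f) (PS.κ (Tower (suc q)) (env (suc q) v)) →
        Hom.φ (mapHom r) (Hom.φ (swapHom C) f) ≈ env (suc p) (shift (rotate (length K) v))
      fin f v e = trans (Hom.φ-cong (mapHom r) e) (trans (map-κ r (env (suc q) v))
        (trans (PS.κ-cong (Tower p) (rotateHom-env K k L v)) (env-shift p (rotate (length K) v))))
      go : ∀ v → Hom.φ (rotateHom (a ∷ K) k L) (env (suc (suc q)) v) ≈ env (suc p) (rotate (suc (length K)) v)
      go 0 = rotateHom-embed (a ∷ K) k L U
      go 1 = fin (env (suc (suc q)) 1) 1 (swap-inner C (env (suc q) 1))
      go 2 = trans (Hom.φ-cong (mapHom r) (swap-outer C (env (suc q) 1))) (λ n → rotateHom-embed K k L (ζ₀ n))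
      go (suc (suc (suc v))) = fin (env (suc (suc q)) (suc (suc (suc v)))) (suc (suc v)) (swap-κκ C (env q (suc v)))

    -- The coefficient of the monomial with exponents `K`; the number of catalytic variables is the
    -- length of `K`.
    ⟦_⟧ : Expr → List ℕ → B.Carrier
    ⟦ e ⟧ K = coeff K (Eval.eval (Tower (length K)) (env (length K)) e)

    ⟦rotate⟧ : ∀ e K k L → ⟦ rename (rotate (length K)) e ⟧ (K ++ k ∷ L) B.≈ ⟦ e ⟧ (k ∷ K ++ L)
    ⟦rotate⟧ e K k L = B.trans (coeff-cong (K ++ k ∷ L) {g = Hom.φ (rotateHom K k L) (Eval.eval (Tower q) (env q) e)} (trans (reflexive (Eval.eval-rename A ρ (rotate (length K)) e))
        (trans (Eval.eval-cong A {σ = λ v → Hom.φ (rotateHom K k L) (env q v)} (λ v → sym (rotateHom-env K k L v)) e) (sym (eval-hom (rotateHom K k L) (env q) e)))))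
        (B.reflexive (rotateHom-coeff K k L (Eval.eval (Tower q) (env q) e)))
      where
      q = suc (length (K ++ L))
      A = Tower (length (K ++ k ∷ L))
      ρ = env (length (K ++ k ∷ L))
      open Loc A

    ⟦merge⟧ : ∀ e n K → ⟦ rename merge e ⟧ (n ∷ K) B.≈ dsum (λ i j → ⟦ e ⟧ (i ∷ j ∷ K)) n
    ⟦merge⟧ e n K = B.trans (coeff-cong K (Loc.sym (Tower p) (DoubleSeries.diagonal (Tower p) F g (diagonal-remainder p e) (diagonal-difference p e) n))) (coeff-dsum K F n)
      where
      p = length K
      F = Eval.eval (Tower (suc (suc p))) (env (suc (suc p))) e
      g = Eval.eval (Tower (suc p)) (env (suc p)) (rename merge e)

    ⟦quotient⟧ : ∀ e i j K → ⟦ quotient e ⟧ (i ∷ j ∷ K) B.≈ ⟦ e ⟧ (suc (i ℕ.+ j) ∷ K)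
    ⟦quotient⟧ e i j K = coeff-cong K (DoubleSeries.quotient-coefficients (Tower p) f H (quotient-difference p e) i j)
      where
      p = length K
      f = Eval.eval (Tower (suc p)) (env (suc p)) e
      H = Eval.eval (Tower (suc (suc p))) (env (suc (suc p))) (quotient e)

    ⟦+⟧ : ∀ e f K → ⟦ e +ᴱ f ⟧ K B.≈ ⟦ e ⟧ K B.+ ⟦ f ⟧ K
    ⟦+⟧ e f K = coeff-+ K _ _

    ⟦x⟧-zero : ∀ e K → ⟦ xᴱ 1 *ᴱ e ⟧ (0 ∷ K) B.≈ B.0#
    ⟦x⟧-zero e K = B.trans (coeff-cong K (trans (*-congʳ (x-head (length K) 0)) (zeroˡ _))) (coeff-0 K)
      where
      open Loc (Tower (length K))

    ⟦x⟧-suc : ∀ e k K → ⟦ xᴱ 1 *ᴱ e ⟧ (suc k ∷ K) B.≈ ⟦ e ⟧ (k ∷ K)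
    ⟦x⟧-suc e k K = coeff-cong K (trans (PS.✶-cong (Tower (length K)) {g = v} (x-head (length K)) (λ _ → refl) (suc k)) (PS.X-✶-suc (Tower (length K)) v k))
      where
      open Loc (Tower (length K))
      v = Eval.eval (Tower (suc (length K))) (env (suc (length K))) e

    ⟦con⟧ : ∀ q e K → ⟦ conᴱ q *ᴱ e ⟧ K B.≈ B.ι q B.* ⟦ e ⟧ K
    ⟦con⟧ q e K = B.trans (coeff-cong K (*-congʳ (sym (Hom.φ-ι (embed (length K)) q)))) (coeff-embed K (B.ι q) _)
      where
      open Loc (Tower (length K))

-- The kernel method

module Loop where
  open import Data.Nat as ℕ using (ℕ; zero; suc)
  open import Data.Rational as ℚ using (ℚ; 0ℚ; 1ℚ)
  open import Relation.Binary.PropositionalEquality as ≡ using (_≡_)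
  open Series
  open Local
  open Expr
  open Tower

  1+_ : Expr → Expr
  1+ e = oneE +ᴱ e

  -- The planar one-loop function, `W₀ = (1+ζ)(1 - tT²ζ)`. Since `ζ = T x + ...`, its coefficient of
  -- `x` is `T (1 - tT²) = T (4 - T) / 3`, Tutte's series of planar rooted maps.
  W₀ᴱ : Expr
  W₀ᴱ = 1+ varᴱ 1 *ᴱ 1+ negE (νᴱ *ᴱ varᴱ 1)

  -- (ζ - U) / (x - t - 2x²W₀)
  kernel⁻¹ᴱ : Expr
  kernel⁻¹ᴱ = (Tᴱ *ᴱ Tᴱ) *ᴱ (1+ varᴱ 1 *ᴱ (1+ varᴱ 1 *ᴱ 1+ varᴱ 1)) *ᴱ (1+ (varᴱ 0 +ᴱ varᴱ 0 *ᴱ varᴱ 0) *ᴱ (geoᴱ (varᴱ 0 *ᴱ varᴱ 1) *ᴱ geoᴱ (varᴱ 1)))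

  -- Substitutes the kernel root for `ζ₁` and renumbers the other variables; `pole` below is the
  -- same substitution without the renumbering.
  headToU : ℕ → ℕ
  headToU zero = 0
  headToU (suc zero) = 0
  headToU (suc (suc v)) = suc v

  pole : ℕ → ℕ
  pole v = shift (headToU v)

  -- The solution `g` of `(x - t - 2x²W₀) g = x (e - e(U))`, where `e(U)` is `e` at `ζ₁ = U`. The
  -- right side vanishes at the one root where the kernel fails to be a unit.
  kernelSolve : Expr → Expr
  kernelSolve e = xᴱ 1 *ᴱ (kernel⁻¹ᴱ *ᴱ divDiff (λ v → v) pole isOne e)

  module KernelFacts (A : Loc) (ρ : ℕ → Loc.Carrier A) (z₀ : Loc.ε A (ρ 0) ≡ 0ℚ) (z₁ : Loc.ε A (ρ 1) ≡ 0ℚ) where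
    open Loc A
    open LocFacts A
    open Eval A
    open ParameterFacts A ρ z₀
    open import Relation.Binary.Reasoning.Setoid setoid
    open Solver

    private
      ζ = ρ 1
      x = eval ρ (xᴱ 1)
      W = eval ρ W₀ᴱ
      o = ι 1ℚ
      V = o + ι (ℚ.- 1ℚ) * (ν * ζ)
      a = x * (T * ((o + ζ) * (o + ζ)))
      n = t * (T * T)
      :o : ∀ {n} → Polynomial n
      :o = con 1ℚ

      a≈ζ : a ≈ ζ
      a≈ζ = trans (*-congˡ (*-congˡ (*-cong (+-congʳ ι-1) (+-congʳ ι-1)))) (x-law 1 z₁)

      n≈ν : n ≈ ν
      n≈ν = begin
        (ν * (T⁻¹ * T⁻¹)) * (T * T) ≈⟨ solve 3 (λ v i t → (v :* (i :* i)) :* (t :* t) := v :* ((t :* i) :* (t :* i))) refl ν T⁻¹ T ⟩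
        ν * ((T * T⁻¹) * (T * T⁻¹)) ≈⟨ *-congˡ (*-cong T-inverse T-inverse) ⟩
        ν * (1# * 1#) ≈⟨ trans (*-congˡ (*-identityˡ _)) (*-identityʳ _) ⟩
        ν ∎

    -- Tutte's equation `x W = x + x² W² + t (W - 1 - x w₁)` with `w₁ = T (1 - tT²)`, terms
    -- rearranged. Multiplied by `T² (1+ζ)²` it becomes a polynomial identity in `ζ` and `ν`.
    W₀-equation : x * (x * (W * W)) + t * W + x ≈ x * W + t + (t * (T * (o - ν))) * x
    W₀-equation = begin
      lhs ≈⟨ cancel lhs ⟩
      (lhs * K) * K⁻¹ ≈⟨ *-congʳ scaled ⟩
      (rhs * K) * K⁻¹ ≈⟨ cancel rhs ⟨
      rhs ∎
      where
      lhs = x * (x * (W * W)) + t * W + x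
      rhs = x * W + t + (t * (T * (o - ν))) * x
      K = (T * T) * ((1# + ζ) * (1# + ζ))
      c = geo (ι (ℚ.- 1ℚ) * ζ)
      K⁻¹ = (T⁻¹ * T⁻¹) * (c * c)
      cancel : ∀ y → y ≈ (y * K) * K⁻¹
      cancel y = sym (begin
        (y * K) * K⁻¹ ≈⟨ solve 5 (λ y t i z c → (y :* ((t :* t) :* (z :* z))) :* ((i :* i) :* (c :* c)) := y :* (((t :* i) :* (t :* i)) :* ((z :* c) :* (z :* c)))) refl y T T⁻¹ (1# + ζ) c ⟩
        y * (((T * T⁻¹) * (T * T⁻¹)) * (((1# + ζ) * c) * ((1# + ζ) * c))) ≈⟨ *-congˡ (*-cong (*-cong T-inverse T-inverse) (*-cong ci ci)) ⟩
        y * ((1# * 1#) * (1# * 1#)) ≈⟨ solve 2 (λ y o → y :* ((o :* o) :* (o :* o)) := y :* o :* o :* o :* o) refl y 1# ⟩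
        y * 1# * 1# * 1# * 1# ≈⟨ trans (*-identityʳ _) (trans (*-identityʳ _) (trans (*-identityʳ _) (*-identityʳ _))) ⟩
        y ∎)
        where ci = geo-neg-inverse ζ z₁
      scaled : lhs * K ≈ rhs * K
      scaled = begin
        lhs * K ≈⟨ *-congˡ (*-congˡ (*-cong (+-congʳ (sym ι-1)) (+-congʳ (sym ι-1)))) ⟩
        lhs * ((T * T) * ((o + ζ) * (o + ζ)))
          ≈⟨ solve 5 (λ x ζ T t V → let z = :o :+ ζ ; W = z :* V ; a = x :* (T :* (z :* z)) ; n = t :* (T :* T) in
               (x :* (x :* (W :* W)) :+ t :* W :+ x) :* ((T :* T) :* (z :* z)) := (a :* a) :* (V :* V) :+ n :* (z :* z :* z :* V) :+ T :* a) refl x ζ T t V ⟩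
        (a * a) * (V * V) + n * ((o + ζ) * (o + ζ) * (o + ζ) * V) + T * a ≈⟨ +-cong (+-cong (*-congʳ (*-cong a≈ζ a≈ζ)) (*-congʳ n≈ν)) (*-congˡ a≈ζ) ⟩
        (ζ * ζ) * (V * V) + ν * ((o + ζ) * (o + ζ) * (o + ζ) * V) + T * ζ
          ≈⟨ solve 2 (λ ζ ν → let z = :o :+ ζ ; V = :o :+ con (ℚ.- 1ℚ) :* (ν :* ζ) ; T = :o :+ con threeℚ :* ν in
               (ζ :* ζ) :* (V :* V) :+ ν :* (z :* z :* z :* V) :+ T :* ζ := (T :* ζ) :* (z :* V) :+ ν :* (z :* z) :+ (:o :+ :- ν) :* (ν :* ζ)) refl ζ ν ⟩
        (T * ζ) * ((o + ζ) * V) + ν * ((o + ζ) * (o + ζ)) + (o - ν) * (ν * ζ)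
          ≈⟨ +-cong (+-cong (*-congʳ (*-congˡ a≈ζ)) (*-congʳ n≈ν)) (*-congˡ (*-cong n≈ν a≈ζ)) ⟨
        (T * a) * ((o + ζ) * V) + n * ((o + ζ) * (o + ζ)) + (o - ν) * (n * a)
          ≈⟨ solve 6 (λ x ζ T t V ν → let z = :o :+ ζ ; W = z :* V ; a = x :* (T :* (z :* z)) ; n = t :* (T :* T) in
               (T :* a) :* (z :* V) :+ n :* (z :* z) :+ (:o :+ :- ν) :* (n :* a) := (x :* W :+ t :+ (t :* (T :* (:o :+ :- ν))) :* x) :* ((T :* T) :* (z :* z))) refl x ζ T t V ν ⟩
        rhs * ((T * T) * ((o + ζ) * (o + ζ))) ≈⟨ *-congˡ (*-congˡ (*-cong (+-congʳ ι-1) (+-congʳ ι-1))) ⟩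
        rhs * K ∎

    -- Times `T² (1+ζ)³` the kernel is `ζ - ζ² - ν (1 - ζ³)`. Apart from `ζ = 1` its roots satisfy
    -- `ζ = ν (1+ζ+ζ²)`, which is the equation of `U`; the remaining root is `1/U`.
    kernel-law : (x - (t + (x * x) * (W + W))) * eval ρ kernel⁻¹ᴱ ≈ ζ - U
    kernel-law = begin
      (x - (t + (x * x) * (W + W))) * ((T * T) * ((o + ζ) * ((o + ζ) * (o + ζ))) * ((o + (U + U * U)) * (g * h)))
        ≈⟨ solve 7 (λ x ζ T t V D G → let z = :o :+ ζ ; W = z :* V ; a = x :* (T :* (z :* z)) ; n = t :* (T :* T) in
             (x :- (t :+ (x :* x) :* (W :+ W))) :* ((T :* T) :* (z :* (z :* z)) :* (D :* G)) := ((T :* a) :* z :- (n :* (z :* z :* z) :+ (a :* a) :* (V :+ V))) :* (D :* G)) refl x ζ T t V (o + (U + U * U)) (g * h) ⟩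
      ((T * a) * (o + ζ) - (n * ((o + ζ) * (o + ζ) * (o + ζ)) + (a * a) * (V + V))) * ((o + (U + U * U)) * (g * h))
        ≈⟨ *-congʳ (+-cong (*-congʳ (*-congˡ a≈ζ)) (-‿cong (+-cong (*-congʳ n≈ν) (*-congʳ (*-cong a≈ζ a≈ζ))))) ⟩
      ((T * ζ) * (o + ζ) - (ν * ((o + ζ) * (o + ζ) * (o + ζ)) + (ζ * ζ) * (V + V))) * ((o + (U + U * U)) * (g * h))
        ≈⟨ solve 4 (λ U δ ζ G → let ν = U :* δ ; z = :o :+ ζ ; V = :o :+ con (ℚ.- 1ℚ) :* (ν :* ζ) ; T = :o :+ con threeℚ :* ν ; D = :o :+ (U :+ U :* U) in
             ((T :* ζ) :* z :- (ν :* (z :* z :* z) :+ (ζ :* ζ) :* (V :+ V))) :* (D :* G)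
               := (D :* δ) :* (((:- U) :+ U :* (ζ :* ζ :* ζ)) :* G) :+ (ζ :- ζ :* ζ) :* (D :* G)) refl U δ ζ (g * h) ⟩
      ((o + (U + U * U)) * δ) * (((- U) + U * (ζ * ζ * ζ)) * (g * h)) + (ζ - ζ * ζ) * ((o + (U + U * U)) * (g * h))
        ≈⟨ +-congʳ (trans (*-congʳ (trans (*-congʳ (+-congʳ ι-1)) δ-inverse)) (trans (*-identityˡ _) (sym (trans (*-congʳ ι-1) (*-identityˡ _))))) ⟩
      o * (((- U) + U * (ζ * ζ * ζ)) * (g * h)) + (ζ - ζ * ζ) * ((o + (U + U * U)) * (g * h))
        ≈⟨ solve 4 (λ U ζ g h → :o :* (((:- U) :+ U :* (ζ :* ζ :* ζ)) :* (g :* h)) :+ (ζ :- ζ :* ζ) :* ((:o :+ (U :+ U :* U)) :* (g :* h))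
             := (ζ :- U) :* (((:o :- U :* ζ) :* g) :* ((:o :- ζ) :* h))) refl U ζ g h ⟩
      (ζ - U) * (((o - U * ζ) * g) * ((o - ζ) * h))
        ≈⟨ *-congˡ (*-cong (trans (*-congʳ (+-congʳ ι-1)) (geo-inverse _ (ε-*-zero _ _ z₀))) (trans (*-congʳ (+-congʳ ι-1)) (geo-inverse _ z₁))) ⟩
      (ζ - U) * (1# * 1#) ≈⟨ trans (*-congˡ (*-identityˡ _)) (*-identityʳ _) ⟩
      ζ - U ∎
      where
      g = geo (U * ζ)
      h = geo ζ

-- Loop functions of all Euler characteristics

module Recursion (base : Loc) (U : Loc.Carrier base) (U₀ : Loc.ε base U ≡ 0ℚ) (b : ℚ) where
  open Local
  open import Relation.Binary.PropositionalEquality as ≡ using (_≡_)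
  open import Data.Rational as ℚ using (ℚ; 0ℚ; 1ℚ)

  open import Data.List using (List; []; _∷_; _++_; length)
  open import Data.List.Properties using (++-assoc; length-++)
  open import Data.Nat as ℕ using (ℕ; zero; suc; _∸_)
  import Data.Nat.Properties as ℕₚ
  open import Relation.Binary.PropositionalEquality as ≡ using (_≡_)
  open Series
  open Expr
  open Tower
  open Loop
  open Subst base
  open Coeff base
  open Extraction U U₀

  -- x ∂f/∂x
  θᴱ : Expr → Expr
  θᴱ f = xᴱ 1 *ᴱ rename merge (quotient f)

  -- y ∂/∂y (x f(x) - y f(y)) / (x - y), in the variables (y , x)
  mixᴱ : Expr → Expr
  mixᴱ f = xᴱ 1 *ᴱ rename merge (quotient (quotient (xᴱ 1 *ᴱ f)))

  sumᴱ : ℕ → ℕ → (ℕ → Expr) → Expr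
  sumᴱ i zero f = conᴱ 0ℚ
  sumᴱ i (suc n) f = f i +ᴱ sumᴱ (suc i) n f

  isZero : ℕ → ℚ
  isZero zero = 1ℚ
  isZero (suc n) = 0ℚ

  -- cumulant i d p is the p-point function of deficiency i - 1; it vanishes for p ≥ i, and d = i ∸ p is a termination measure.
  cumulant : (i d p : ℕ) → Expr
  -- One uncentred loop in front of `q` centred ones: either it is capped by a disc, with weight
  -- `W₀`, or it is centred too.
  uncentred : (i q : ℕ) → Expr
  -- The first loop is joined to each of the others in turn. A junction costs two units: `source i`
  -- already stands one below `cumulant (suc i)`, and one more is lost here.
  splice : (i q : ℕ) → Expr
  -- The part of the loop equation that the kernel does not absorb: the loop splits into two centred
  -- loops, is twisted, or is joined to another loop.
  source : (i q : ℕ) → Expr → Expr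

  cumulant zero d p = conᴱ 0ℚ
  -- With no loop left there is one completion if the deficiency is used up, and none otherwise.
  cumulant (suc i) d zero = conᴱ (isZero i)
  cumulant (suc i) zero (suc q) = conᴱ 0ℚ
  -- Splitting a loop keeps the deficiency and adds a loop, so `i` stays and `d` drops; every other
  -- term lowers `i`.
  cumulant (suc i) (suc d) (suc q) = kernelSolve (xᴱ 1 *ᴱ source i q (cumulant (suc i) d (suc (suc q))))

  uncentred i q = W₀ᴱ *ᴱ rename shift (cumulant i (i ∸ q) q) +ᴱ cumulant i (i ∸ suc q) (suc q)

  splice zero q = conᴱ 0ℚ
  splice (suc i) zero = conᴱ 0ℚ
  splice (suc i) (suc q) = sumᴱ 1 (suc q) (λ j → rename (rotate j) (mixᴱ (uncentred i q)))

  source i q e = rename merge e +ᴱ (conᴱ b *ᴱ θᴱ (uncentred i q) +ᴱ conᴱ (1ℚ ℚ.+ b) *ᴱ splice i q)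

  open B hiding (zero) renaming (Carrier to 𝔹)
  open import Relation.Binary.Reasoning.Setoid setoid

  pick : (ℕ → List ℕ → 𝔹) → List ℕ → 𝔹
  pick f [] = 0#
  pick f (k ∷ K) = f k K + pick (λ l L → f l (k ∷ L)) K

  pick-cong : ∀ {f g} → (∀ l L → f l L ≈ g l L) → ∀ K → pick f K ≈ pick g K
  pick-cong p [] = refl
  pick-cong p (k ∷ K) = +-cong (p k K) (pick-cong (λ l L → p l (k ∷ L)) K)

  γ : ℕ → List ℕ → 𝔹
  γ i K = ⟦ cumulant i (i ∸ length K) (length K) ⟧ K

  w : ℕ → 𝔹
  w k = ⟦ W₀ᴱ ⟧ (k ∷ [])

  η : ℕ → ℕ → List ℕ → 𝔹
  η i k K = w k * γ i K + γ i (k ∷ K)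

  τ : 𝔹
  τ = Eval.eval base (λ _ → U) tᴱ

  ⟦0⟧ : ∀ K → ⟦ conᴱ 0ℚ ⟧ K ≈ 0#
  ⟦0⟧ K = trans (coeff-cong K (Loc.ι-0 (Tower (length K)))) (coeff-0 K)

  dsum-const : ∀ c n → dsum (λ _ _ → c) n ≈ ι (nat (suc n)) * c
  dsum-const c zero = sym (trans (*-congʳ (trans (ι-+ 1ℚ 0ℚ) (trans (+-cong ι-1 ι-0) (+-identityʳ _)))) (*-identityˡ c))
  dsum-const c (suc n) = begin
    c + dsum (λ _ _ → c) n ≈⟨ +-cong (sym (*-identityˡ c)) (dsum-const c n) ⟩
    1# * c + ι (nat (suc n)) * c ≈⟨ distribʳ c _ _ ⟨
    (1# + ι (nat (suc n))) * c ≈⟨ *-congʳ (trans (+-congʳ (sym ι-1)) (sym (ι-+ _ _))) ⟩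
    ι (nat (suc (suc n))) * c ∎

  dsum-diagonal : ∀ {F} {f : ℕ → 𝔹} → (∀ i j → F i j ≈ f (i ℕ.+ j)) → ∀ n → dsum F n ≈ ι (nat (suc n)) * f n
  dsum-diagonal {F} {f} p n = trans (go {f = f} p n) (dsum-const (f n) n)
    where
    go : ∀ {F} {f : ℕ → 𝔹} → (∀ i j → F i j ≈ f (i ℕ.+ j)) → ∀ n → dsum F n ≈ dsum (λ _ _ → f n) n
    go p zero = p 0 0
    go {F} {f} p (suc n) = +-cong (p 0 (suc n)) (go {f = λ m → f (suc m)} (λ i → p (suc i)) n)

  ι-0* : ∀ c → ι (nat 0) * c ≈ 0#
  ι-0* c = trans (*-congʳ ι-0) (zeroˡ c)

  -- A derivative is a divided difference restricted to the diagonal: the antidiagonal of the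
  -- quotient consists of equal entries, and their number is the exponent.
  ⟦θ⟧ : ∀ f k K → ⟦ θᴱ f ⟧ (k ∷ K) ≈ ι (nat k) * ⟦ f ⟧ (k ∷ K)
  ⟦θ⟧ f zero K = trans (⟦x⟧-zero (rename merge (quotient f)) K) (sym (ι-0* _))
  ⟦θ⟧ f (suc k) K = begin
    ⟦ θᴱ f ⟧ (suc k ∷ K) ≈⟨ ⟦x⟧-suc (rename merge (quotient f)) k K ⟩
    ⟦ rename merge (quotient f) ⟧ (k ∷ K) ≈⟨ ⟦merge⟧ (quotient f) k K ⟩
    dsum (λ i j → ⟦ quotient f ⟧ (i ∷ j ∷ K)) k ≈⟨ dsum-diagonal {f = λ m → ⟦ f ⟧ (suc m ∷ K)} (λ i j → ⟦quotient⟧ f i j K) k ⟩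
    ι (nat (suc k)) * ⟦ f ⟧ (suc k ∷ K) ∎

  -- The inner quotient separates `y` from `x` at total degree `k + l`; the outer one, restricted to
  -- the diagonal, differentiates in `y`.
  ⟦mix⟧ : ∀ f l k K → ⟦ mixᴱ f ⟧ (l ∷ k ∷ K) ≈ ι (nat l) * ⟦ f ⟧ (k ℕ.+ l ∷ K)
  ⟦mix⟧ f zero k K = trans (⟦x⟧-zero (rename merge (quotient (quotient (xᴱ 1 *ᴱ f)))) (k ∷ K)) (sym (ι-0* _))
  ⟦mix⟧ f (suc l) k K = begin
    ⟦ mixᴱ f ⟧ (suc l ∷ k ∷ K) ≈⟨ ⟦x⟧-suc (rename merge (quotient (quotient h))) l (k ∷ K) ⟩
    ⟦ rename merge (quotient (quotient h)) ⟧ (l ∷ k ∷ K) ≈⟨ ⟦merge⟧ (quotient (quotient h)) l (k ∷ K) ⟩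
    dsum (λ i j → ⟦ quotient (quotient h) ⟧ (i ∷ j ∷ k ∷ K)) l ≈⟨ dsum-diagonal {f = λ m → ⟦ f ⟧ (k ℕ.+ suc m ∷ K)} step l ⟩
    ι (nat (suc l)) * ⟦ f ⟧ (k ℕ.+ suc l ∷ K) ∎
    where
    h = xᴱ 1 *ᴱ f
    step : ∀ i j → ⟦ quotient (quotient h) ⟧ (i ∷ j ∷ k ∷ K) ≈ ⟦ f ⟧ (k ℕ.+ suc (i ℕ.+ j) ∷ K)
    step i j = begin
      ⟦ quotient (quotient h) ⟧ (i ∷ j ∷ k ∷ K) ≈⟨ ⟦quotient⟧ (quotient h) i j (k ∷ K) ⟩
      ⟦ quotient h ⟧ (suc (i ℕ.+ j) ∷ k ∷ K) ≈⟨ ⟦quotient⟧ h (suc (i ℕ.+ j)) k K ⟩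
      ⟦ h ⟧ (suc (suc (i ℕ.+ j) ℕ.+ k) ∷ K) ≈⟨ ⟦x⟧-suc f (suc (i ℕ.+ j) ℕ.+ k) K ⟩
      ⟦ f ⟧ (suc (i ℕ.+ j) ℕ.+ k ∷ K) ≈⟨ reflexive (≡.cong (λ m → ⟦ f ⟧ (m ∷ K)) (ℕₚ.+-comm (suc (i ℕ.+ j)) k)) ⟩
      ⟦ f ⟧ (k ℕ.+ suc (i ℕ.+ j) ∷ K) ∎

  ⟦sum⟧ : ∀ Q k K L → ⟦ sumᴱ (suc (length K)) (length L) (λ j → rename (rotate j) Q) ⟧ (k ∷ K ++ L) ≈ pick (λ l M → ⟦ Q ⟧ (l ∷ k ∷ K ++ M)) L
  ⟦sum⟧ Q k K [] = ⟦0⟧ (k ∷ K ++ [])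
  ⟦sum⟧ Q k K (l ∷ L) = begin
    ⟦ term +ᴱ rest (suc (length K)) ⟧ (k ∷ K ++ l ∷ L) ≈⟨ ⟦+⟧ term (rest (suc (length K))) (k ∷ K ++ l ∷ L) ⟩
    ⟦ term ⟧ (k ∷ K ++ l ∷ L) + ⟦ rest (suc (length K)) ⟧ (k ∷ K ++ l ∷ L)
      ≈⟨ +-cong (⟦rotate⟧ Q (k ∷ K) l L) (reflexive (≡.cong₂ (λ n M → ⟦ rest n ⟧ (k ∷ M)) (≡.sym (≡.trans (length-++ K {l ∷ []}) (ℕₚ.+-comm (length K) 1))) (≡.sym (++-assoc K (l ∷ []) L)))) ⟩
    ⟦ Q ⟧ (l ∷ k ∷ K ++ L) + ⟦ rest (length (K ++ l ∷ [])) ⟧ (k ∷ (K ++ l ∷ []) ++ L)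
      ≈⟨ +-congˡ (⟦sum⟧ Q k (K ++ l ∷ []) L) ⟩
    ⟦ Q ⟧ (l ∷ k ∷ K ++ L) + pick (λ m M → ⟦ Q ⟧ (m ∷ k ∷ (K ++ l ∷ []) ++ M)) L
      ≈⟨ +-congˡ (pick-cong (λ m M → reflexive (≡.cong (λ N → ⟦ Q ⟧ (m ∷ k ∷ N)) (++-assoc K (l ∷ []) M))) L) ⟩
    ⟦ Q ⟧ (l ∷ k ∷ K ++ L) + pick (λ m M → ⟦ Q ⟧ (m ∷ k ∷ K ++ l ∷ M)) L ∎
    where
    term = rename (rotate (suc (length K))) Q
    rest = λ n → sumᴱ (suc n) (length L) (λ j → rename (rotate j) Q)

  module _ (p : ℕ) where
    private
      A = Tower p
      module A = Loc A
      module P = PS A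
      module S = Loc P.loc
      ρ = env (suc p)
      W = Eval.eval P.loc ρ W₀ᴱ
      open KernelFacts P.loc ρ (env-vanishes (suc p) 0) (env-vanishes (suc p) 1)

    private
      -- `W₀ᴱ` mentions only variables 0 and 1, so environments are compared there; all other
      -- variables are sent to 0.
      low : ℕ → ℕ
      low 1 = 1
      low _ = 0

    W₀-coefficients : ∀ n → W n A.≈ Hom.φ (embed p) (w n)
    W₀-coefficients n = A.sym (S.trans (eval-hom (mapHom (embed p)) (env 1) W₀ᴱ)
      (Eval.eval-cong P.loc {ρ = λ v → Hom.φ (mapHom (embed p)) (env 1 (low v))} {σ = λ v → ρ (low v)} vars W₀ᴱ) n)
      where
      vars : ∀ v → Hom.φ (mapHom (embed p)) (env 1 (low v)) S.≈ ρ (low v)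
      vars zero = map-κ (embed p) U
      vars (suc zero) = S.refl
      vars (suc (suc v)) = map-κ (embed p) U

    t-constant : Eval.eval P.loc ρ tᴱ S.≈ P.κ (Hom.φ (embed p) τ)
    t-constant = S.sym (eval-hom (embed (suc p)) (λ _ → U) tᴱ)

    -- The value of `e` at the kernel root stands in for the unknown initial coefficient of the loop
    -- equation. Multiplied by `x`, it affects the exponent of `x` equal to one and no other.
    kernelSolve-law : ∀ e → let v = Eval.eval P.loc ρ in
      P.X S.* v (kernelSolve e) S.+ P.X S.* P.κ (Eval.eval A (env p) (rename headToU e))
        S.≈ (P.κ (Hom.φ (embed p) τ) S.* v (kernelSolve e) S.+ P.X S.* (P.X S.* (W S.* v (kernelSolve e) S.+ W S.* v (kernelSolve e)))) S.+ P.X S.* v e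
    kernelSolve-law e = S.trans (S.+-cong (S.*-congʳ (S.sym (x-head p))) (S.*-congʳ (S.sym (x-head p))))
      (S.trans (solve 6 (λ x t W k E s → x :* (x :* (k :* E)) :+ x :* s :=
              (t :* (x :* (k :* E)) :+ x :* (x :* (W :* (x :* (k :* E)) :+ W :* (x :* (k :* E))))) :+ x :* (s :+ ((x :- (t :+ (x :* x) :* (W :+ W))) :* k) :* E)) S.refl x t W k E s)
      (S.trans (S.+-congˡ (S.*-congˡ (S.trans (S.+-congˡ (S.*-congʳ kernel-law)) (S.sym quotiented))))
        (S.+-cong (S.+-cong (S.*-congʳ t-constant) (S.*-cong (x-head p) (S.*-congʳ (x-head p)))) (S.*-congʳ (x-head p)))))
      where
      open S.Solver
      v = Eval.eval P.loc ρ
      g = v (kernelSolve e)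
      x = v (xᴱ 1)
      t = v tᴱ
      k = v kernel⁻¹ᴱ
      E = v (divDiff (λ u → u) pole isOne e)
      s = P.κ (Eval.eval A (env p) (rename headToU e))
      dvar : ∀ u → ρ u S.≈ ρ (pole u) S.+ (ρ 1 S.- ρ 0) S.* S.ι (isOne u)
      dvar zero = S.sym (S.trans (S.+-congˡ (S.trans (S.*-congˡ S.ι-0) (S.zeroʳ _))) (S.+-identityʳ _))
      dvar (suc zero) = solve 2 (λ a b → a := b :+ (a :- b) :* con 1ℚ) S.refl (ρ 1) (ρ 0)
      dvar (suc (suc u)) = S.sym (S.trans (S.+-congˡ (S.trans (S.*-congˡ S.ι-0) (S.zeroʳ _))) (S.+-identityʳ _))
      quotiented : v e S.≈ s S.+ (ρ 1 S.- ρ 0) S.* E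
      quotiented = S.trans (S.reflexive (≡.sym (Eval.eval-rename P.loc ρ (λ u → u) e)))
        (S.trans (Vanishing.divDiff-law P.loc ρ (env-vanishes (suc p)) (λ u → u) pole isOne (ρ 1 S.- ρ 0) dvar e)
          (S.+-congʳ (S.trans (S.reflexive (≡.trans (Eval.eval-rename P.loc ρ pole e) (≡.sym (≡.trans (Eval.eval-rename P.loc ρ shift (rename headToU e)) (Eval.eval-rename P.loc _ headToU e)))))
                (eval-shift p (rename headToU e)))))

    -- `kernelSolve-law` at exponent `k + 2`, out of reach of the unknown constant.
    kernelSolve-coefficients : ∀ e k → let g = Eval.eval P.loc ρ (kernelSolve e) in
      g (suc k) A.≈ (Hom.φ (embed p) τ A.* g (suc (suc k)) A.+ ((W P.✶ g) k A.+ (W P.✶ g) k)) A.+ Eval.eval P.loc ρ e (suc k)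
    kernelSolve-coefficients e k = A.trans (A.sym (A.trans (A.+-cong (P.X-✶-suc g (suc k)) (P.X-✶-suc s (suc k))) (A.+-identityʳ _)))
      (A.trans (kernelSolve-law e (suc (suc k)))
        (A.+-cong (A.+-cong (P.κ-✶ _ g (suc (suc k))) (A.trans (P.X-✶-suc (P.X S.* h) (suc k)) (P.X-✶-suc h k))) (P.X-✶-suc (Eval.eval P.loc ρ e) (suc k))))
      where
      g = Eval.eval P.loc ρ (kernelSolve e)
      s = P.κ (Eval.eval A (env p) (rename headToU e))
      h = W S.* g S.+ W S.* g

    convolution : ∀ f g n → (f P.✶ g) n A.≈ Diagonal.dsum A (λ i j → f i A.* g j) n
    convolution f g zero = A.refl
    convolution f g (suc n) = A.+-congˡ (convolution (P.tl f) g n)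

    W₀-shift : ∀ e k → Eval.eval P.loc ρ (W₀ᴱ *ᴱ rename shift e) k A.≈ Hom.φ (embed p) (w k) A.* Eval.eval A (env p) e
    W₀-shift e k = A.trans (S.*-congˡ {x = W} (eval-shift p e) k) (A.trans (P.✶-comm W (P.κ f) k) (A.trans (P.κ-✶ f W k)
      (A.trans (A.*-comm _ _) (A.*-congʳ (W₀-coefficients k)))))
      where f = Eval.eval A (env p) e

  ⟦kernelSolve⟧-zero : ∀ e K → ⟦ kernelSolve e ⟧ (0 ∷ K) ≈ 0#
  ⟦kernelSolve⟧-zero e K = ⟦x⟧-zero (kernel⁻¹ᴱ *ᴱ divDiff (λ v → v) pole isOne e) K

  ⟦kernelSolve⟧-suc : ∀ e k K → let G = λ j → ⟦ kernelSolve e ⟧ (j ∷ K) ; D = dsum (λ i j → w i * G j) k in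
    G (suc k) ≈ (τ * G (suc (suc k)) + (D + D)) + ⟦ e ⟧ (suc k ∷ K)
  ⟦kernelSolve⟧-suc e k K = begin
    coeff K (g (suc k)) ≈⟨ coeff-cong K (kernelSolve-coefficients p e k) ⟩
    coeff K ((Hom.φ (embed p) τ A.* g (suc (suc k)) A.+ ((W P.✶ g) k A.+ (W P.✶ g) k)) A.+ E (suc k))
      ≈⟨ trans (coeff-+ K _ _) (+-congʳ (trans (coeff-+ K _ _) (+-cong (coeff-embed K τ (g (suc (suc k)))) (trans (coeff-+ K _ _) (+-cong D D))))) ⟩
    _ ∎
    where
    p = length K
    module A = Loc (Tower p)
    module P = PS (Tower p)
    g = Eval.eval P.loc (env (suc p)) (kernelSolve e)
    E = Eval.eval P.loc (env (suc p)) e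
    W = Eval.eval P.loc (env (suc p)) W₀ᴱ
    D : coeff K ((W P.✶ g) k) ≈ dsum (λ i j → w i * coeff K (g j)) k
    D = trans (coeff-cong K (convolution p W g k)) (trans (coeff-dsum K (λ i j → W i A.* g j) k)
      (dsum-cong (λ i j → trans (coeff-cong K (A.*-congʳ (W₀-coefficients p i))) (coeff-embed K (w i) (g j))) k))

  ⟦uncentred⟧ : ∀ i k K → ⟦ uncentred i (length K) ⟧ (k ∷ K) ≈ η i k K
  ⟦uncentred⟧ i k K = trans (⟦+⟧ (W₀ᴱ *ᴱ rename shift e) (cumulant i (i ∸ suc (length K)) (suc (length K))) (k ∷ K))
    (+-congʳ (trans (coeff-cong K (W₀-shift (length K) e k)) (coeff-embed K (w k) (Eval.eval (Tower (length K)) (env (length K)) e))))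
    where e = cumulant i (i ∸ length K) (length K)

  γ-zero : ∀ K → γ 0 K ≈ 0#
  γ-zero K = ⟦0⟧ K

  -- Built into `cumulant`. That it is compatible with the loop equation is the case of too many
  -- loops in `γ-recursion`.
  γ-vanishes : ∀ i K → i ℕ.≤ length K → γ i K ≈ 0#
  γ-vanishes zero K _ = ⟦0⟧ K
  γ-vanishes (suc i) (k ∷ K) (ℕ.s≤s p) = trans (reflexive (≡.cong (λ d → ⟦ cumulant (suc i) d (suc (length K)) ⟧ (k ∷ K)) (ℕₚ.m≤n⇒m∸n≡0 p))) (⟦0⟧ (k ∷ K))

  γ-empty-loop : ∀ i K → γ i (0 ∷ K) ≈ 0#
  γ-empty-loop zero K = ⟦0⟧ (0 ∷ K)
  γ-empty-loop (suc i) K with i ∸ length K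
  ... | zero = ⟦0⟧ (0 ∷ K)
  ... | suc d = ⟦kernelSolve⟧-zero (xᴱ 1 *ᴱ source i (length K) (cumulant (suc i) d (suc (suc (length K))))) K

  η-zero : ∀ k K → η 0 k K ≈ 0#
  η-zero k K = trans (+-cong (trans (*-congˡ (γ-zero K)) (zeroʳ _)) (γ-zero (k ∷ K))) (+-identityʳ _)

  pick-length : ∀ {f g} q → (∀ l L → length L ≡ q → f l L ≈ g l L) → ∀ K → length K ≡ suc q → pick f K ≈ pick g K
  pick-length q p (k ∷ []) e = +-cong (p k [] (ℕₚ.suc-injective e)) refl
  pick-length (suc q) p (k ∷ l ∷ K) e = +-cong (p k (l ∷ K) (ℕₚ.suc-injective e))
    (pick-length q (λ m M z → p m (k ∷ M) (≡.cong suc z)) (l ∷ K) (ℕₚ.suc-injective e))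

  pick-0 : ∀ {f} → (∀ l L → f l L ≈ 0#) → ∀ K → pick f K ≈ 0#
  pick-0 p [] = refl
  pick-0 p (k ∷ K) = trans (+-cong (p k K) (pick-0 (λ l L → p l (k ∷ L)) K)) (+-identityˡ _)

  merging : ℕ → ℕ → List ℕ → 𝔹
  merging i k = pick (λ l L → ι (nat l) * η i (k ℕ.+ l) L)

  ⟦splice⟧ : ∀ i k K → ⟦ splice i (length K) ⟧ (k ∷ K) ≈ merging (ℕ.pred i) k K
  ⟦splice⟧ zero k K = trans (⟦0⟧ (k ∷ K)) (sym (pick-0 (λ l L → trans (*-congˡ (η-zero (k ℕ.+ l) L)) (zeroʳ _)) K))
  ⟦splice⟧ (suc i) k [] = ⟦0⟧ (k ∷ [])
  ⟦splice⟧ (suc i) k (l ∷ L) = trans (⟦sum⟧ (mixᴱ (uncentred i (length L))) k [] (l ∷ L))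
    (pick-length (length L) (λ m M e → trans (⟦mix⟧ (uncentred i (length L)) m k M)
      (*-congˡ (trans (reflexive (≡.cong (λ q → ⟦ uncentred i q ⟧ (k ℕ.+ m ∷ M)) (≡.sym e))) (⟦uncentred⟧ i (k ℕ.+ m) M)))) (l ∷ L) ≡.refl)

  -- The terms that lower the Euler characteristic: a twist has weight `b`, while a junction may be
  -- straight or crossed and has weight `1 + b`.
  deformation : ℕ → ℕ → List ℕ → 𝔹
  deformation i k K = ι b * (ι (nat k) * η i k K) + ι (1ℚ ℚ.+ b) * merging (ℕ.pred i) k K

  ⟦source⟧ : ∀ i e k K → ⟦ source i (length K) e ⟧ (k ∷ K) ≈ dsum (λ m n → ⟦ e ⟧ (m ∷ n ∷ K)) k + deformation i k K
  ⟦source⟧ i e k K = trans (⟦+⟧ (rename merge e) (b-term +ᴱ s-term) (k ∷ K)) (+-cong (⟦merge⟧ e k K)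
    (trans (⟦+⟧ b-term s-term (k ∷ K)) (+-cong
      (trans (⟦con⟧ b (θᴱ u) (k ∷ K)) (*-congˡ (trans (⟦θ⟧ u k K) (*-congˡ (⟦uncentred⟧ i k K)))))
      (trans (⟦con⟧ (1ℚ ℚ.+ b) (splice i (length K)) (k ∷ K)) (*-congˡ (⟦splice⟧ i k K))))))
    where
    u = uncentred i (length K)
    b-term = conᴱ b *ᴱ θᴱ u
    s-term = conᴱ (1ℚ ℚ.+ b) *ᴱ splice i (length K)

  η-vanishes : ∀ i k K → i ℕ.≤ length K → η i k K ≈ 0#
  η-vanishes i k K p = trans (+-cong (trans (*-congˡ (γ-vanishes i K p)) (zeroʳ _)) (γ-vanishes i (k ∷ K) (ℕₚ.m≤n⇒m≤1+n p))) (+-identityʳ _)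

  deformation-vanishes : ∀ i k K → i ℕ.≤ length K → deformation i k K ≈ 0#
  deformation-vanishes i k K p = trans (+-cong
    (trans (*-congˡ (trans (*-congˡ (η-vanishes i k K p)) (zeroʳ _))) (zeroʳ _))
    (trans (*-congˡ (merged K p)) (zeroʳ _))) (+-identityʳ _)
    where
    merged : ∀ K → i ℕ.≤ length K → merging (ℕ.pred i) k K ≈ 0#
    merged [] p = refl
    merged (l ∷ L) p = trans (pick-length {g = λ _ _ → 0#} (length L) (λ m M e → trans (*-congˡ (η-vanishes (ℕ.pred i) (k ℕ.+ m) M
      (≡.subst (ℕ.pred i ℕ.≤_) (≡.sym e) (ℕₚ.pred-mono-≤ p)))) (zeroʳ _)) (l ∷ L) ≡.refl) (pick-0 (λ _ _ → refl) (l ∷ L))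

  -- Splitting a centred loop leaves a disc on one of the two sides, whence `D` twice, or two
  -- centred loops. With too many loops every term vanishes: a junction removes one loop but also
  -- two units of deficiency.
  γ-recursion : ∀ i k K → let D = dsum (λ m n → w m * γ (suc i) (n ∷ K)) k in
    γ (suc i) (suc k ∷ K) ≈ (τ * γ (suc i) (suc (suc k) ∷ K) + (D + D)) + (dsum (λ m n → γ (suc i) (m ∷ n ∷ K)) k + deformation i k K)
  γ-recursion i k K = cases (i ∸ length K) ≡.refl
    where
    D = dsum (λ m n → w m * γ (suc i) (n ∷ K)) k
    cases : ∀ d → i ∸ length K ≡ d → γ (suc i) (suc k ∷ K) ≈ (τ * γ (suc i) (suc (suc k) ∷ K) + (D + D)) + (dsum (λ m n → γ (suc i) (m ∷ n ∷ K)) k + deformation i k K)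
    cases zero eq = trans (none (suc k)) (sym (begin
      (τ * γ (suc i) (suc (suc k) ∷ K) + (D + D)) + (dsum (λ m n → γ (suc i) (m ∷ n ∷ K)) k + deformation i k K)
        ≈⟨ +-cong (+-cong (trans (*-congˡ (none (suc (suc k)))) (zeroʳ τ)) (+-cong D≈0 D≈0)) (+-cong (dsum-0 (λ m n → γ-vanishes (suc i) (m ∷ n ∷ K) (ℕ.s≤s (ℕₚ.m≤n⇒m≤1+n small))) k) (deformation-vanishes i k K small)) ⟩
      (0# + (0# + 0#)) + (0# + 0#) ≈⟨ trans (+-cong (trans (+-identityˡ _) (+-identityˡ _)) (+-identityˡ _)) (+-identityˡ _) ⟩
      0# ∎))
      where
      small : i ℕ.≤ length K
      small = ℕₚ.m∸n≡0⇒m≤n eq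
      none : ∀ j → γ (suc i) (j ∷ K) ≈ 0#
      none j = γ-vanishes (suc i) (j ∷ K) (ℕ.s≤s small)
      D≈0 : D ≈ 0#
      D≈0 = dsum-0 (λ m n → trans (*-congˡ (none n)) (zeroʳ (w m))) k
    cases (suc d) eq = trans (unfold (suc k)) (trans (⟦kernelSolve⟧-suc (xᴱ 1 *ᴱ S) k K) (+-cong
      (+-cong (*-congˡ (sym (unfold (suc (suc k))))) (+-cong D′ D′))
      (trans (⟦x⟧-suc S k K) (trans (⟦source⟧ i e k K)
        (+-congʳ (dsum-cong (λ m n → reflexive (≡.cong (λ d → ⟦ cumulant (suc i) d (suc (suc (length K))) ⟧ (m ∷ n ∷ K)) (≡.trans (≡.cong ℕ.pred (≡.sym eq)) (ℕₚ.pred[m∸n]≡m∸[1+n] i (length K))))) k))))))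
      where
      e = cumulant (suc i) d (suc (suc (length K)))
      S = source i (length K) e
      unfold : ∀ j → γ (suc i) (j ∷ K) ≈ ⟦ kernelSolve (xᴱ 1 *ᴱ S) ⟧ (j ∷ K)
      unfold j = reflexive (≡.cong (λ d → ⟦ cumulant (suc i) d (suc (length K)) ⟧ (j ∷ K)) eq)
      D′ = dsum-cong (λ m n → *-congˡ (sym (unfold n))) k

-- From centred functions back to counts of completions

module Moments (base : Loc) (U : Loc.Carrier base) (U₀ : Loc.ε base U ≡ 0ℚ) (b : ℚ) where
  open Local
  open import Relation.Binary.PropositionalEquality as ≡ using (_≡_)
  open import Data.Rational as ℚ using (ℚ; 0ℚ; 1ℚ)

  open import Data.List using (List; []; _∷_)
  open import Data.Nat as ℕ using (ℕ; zero; suc)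
  open Series
  open Expr
  open Tower
  open Loop
  open Subst base
  open Coeff base
  open Extraction U U₀
  open Recursion base U U₀ b
  open B hiding (zero) renaming (Carrier to 𝔹)
  open import Relation.Binary.Reasoning.Setoid setoid
  open Solver using (solve; _:+_; _:*_; _:=_; _:-_; con)

  -- (W₀ - 1) / x
  W₁ᴱ : Expr
  W₁ᴱ = (Tᴱ *ᴱ (1+ varᴱ 1 *ᴱ 1+ varᴱ 1)) *ᴱ (1+ negE νᴱ +ᴱ negE (νᴱ *ᴱ varᴱ 1))

  private
    A₁ = Tower 1
    module A₁ = Loc A₁
    module P = PS base
    ρ = env 1
    W = Eval.eval A₁ ρ W₀ᴱ
    W₁ = Eval.eval A₁ ρ W₁ᴱ
    open ParameterFacts A₁ ρ (env-vanishes 1 0) using (x-law)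

    W₀-split : W A₁.≈ P.κ 1# A₁.+ P.X A₁.* W₁
    W₀-split = A₁.trans (S.solve 2 (λ ζ ν → (o S.:+ ζ) S.:* (o S.:+ S.con (ℚ.- 1ℚ) S.:* (ν S.:* ζ)) S.:= o S.:+ ζ S.:* ((o S.:+ S.con (ℚ.- 1ℚ) S.:* ν) S.:+ S.con (ℚ.- 1ℚ) S.:* (ν S.:* ζ))) A₁.refl (ρ 1) ν)
      (A₁.+-cong A₁.ι-1 (A₁.trans (A₁.*-congʳ (A₁.sym (A₁.trans (A₁.*-congˡ (A₁.*-congˡ (A₁.*-cong (A₁.+-congʳ A₁.ι-1) (A₁.+-congʳ A₁.ι-1)))) (x-law 1 (env-vanishes 1 1)))))
        (A₁.trans (A₁.*-assoc _ _ _) (A₁.*-congʳ (x-head 0)))))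
      where
      module S = A₁.Solver
      o : ∀ {n} → S.Polynomial n
      o = S.con 1ℚ
      ν = Eval.eval A₁ ρ νᴱ

  w-zero : w 0 ≈ 1#
  w-zero = trans (W₀-split 0) (trans (+-congˡ (P.X-✶-zero W₁)) (+-identityʳ 1#))

  w-one : w 1 ≈ ⟦ W₁ᴱ ⟧ (0 ∷ [])
  w-one = trans (W₀-split 1) (trans (+-congˡ (P.X-✶-suc W₁ 0)) (+-identityˡ _))

  -- `W₀-equation` at exponent `k + 2`, beyond the terms `x`, `t` and `F x`.
  w-recursion : ∀ k → w (suc k) ≈ dsum (λ m n → w m * w n) k + τ * w (suc (suc k))
  w-recursion k = sym (begin
    dsum (λ m n → w m * w n) k + τ * w (suc (suc k))
      ≈⟨ trans (+-congʳ (sym (convolution 0 W W k))) (sym (+-identityʳ _)) ⟩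
    ((W P.✶ W) k + τ * W (suc (suc k))) + 0#
      ≈⟨ +-congʳ (+-cong (trans (sym (P.X-✶-suc (W P.✶ W) k)) (sym (P.X-✶-suc (P.X P.✶ (W P.✶ W)) (suc k)))) (sym (P.κ-✶ τ W (suc (suc k))))) ⟩
    ((P.X A₁.* (P.X A₁.* (W A₁.* W)) A₁.+ P.κ τ A₁.* W) A₁.+ P.X) (suc (suc k)) ≈⟨ equation (suc (suc k)) ⟩
    ((P.X A₁.* W A₁.+ P.κ τ) A₁.+ P.κ F A₁.* P.X) (suc (suc k))
      ≈⟨ +-cong (trans (+-identityʳ _) (P.X-✶-suc W (suc k))) (trans (P.κ-✶ F P.X (suc (suc k))) (zeroʳ F)) ⟩
    W (suc k) + 0# ≈⟨ +-identityʳ _ ⟩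
    w (suc k) ∎)
    where
    open KernelFacts A₁ ρ (env-vanishes 1 0) (env-vanishes 1 1)
    Fᴱ = tᴱ *ᴱ (Tᴱ *ᴱ (oneE +ᴱ negE νᴱ))
    F = Eval.eval base (λ _ → U) Fᴱ
    module S = A₁.Solver
    equation : (P.X A₁.* (P.X A₁.* (W A₁.* W)) A₁.+ P.κ τ A₁.* W) A₁.+ P.X A₁.≈ (P.X A₁.* W A₁.+ P.κ τ) A₁.+ P.κ F A₁.* P.X
    equation = A₁.trans (A₁.+-cong (A₁.+-cong (A₁.*-cong X≈x (A₁.*-congʳ X≈x)) (A₁.*-congʳ (A₁.sym (t-constant 0)))) X≈x)
      (A₁.trans W₀-equation (A₁.+-cong (A₁.+-cong (A₁.*-congʳ (x-head 0)) (t-constant 0))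
        (A₁.*-cong (A₁.trans (S.solve 3 (λ t T ν → t S.:* (T S.:* (S.con 1ℚ S.:- ν)) S.:= t S.:* (T S.:* (S.con 1ℚ S.:+ S.con (ℚ.- 1ℚ) S.:* ν))) A₁.refl (Eval.eval A₁ ρ tᴱ) (Eval.eval A₁ ρ Tᴱ) (Eval.eval A₁ ρ νᴱ))
          (A₁.sym (eval-hom (P.constant) (λ _ → U) Fᴱ))) (x-head 0))))
      where X≈x = A₁.sym (x-head 0)

  -- ∑_{S ⊆ K} (∏_{k ∉ S} w k) φ S undoes the centring by the planar one-loop function.
  sub : (List ℕ → 𝔹) → List ℕ → 𝔹
  sub φ [] = φ []
  sub φ (k ∷ K) = w k * sub φ K + sub (λ S → φ (k ∷ S)) K

  sub-cong : ∀ {φ ψ} → (∀ S → φ S ≈ ψ S) → ∀ K → sub φ K ≈ sub ψ K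
  sub-cong p [] = p []
  sub-cong p (k ∷ K) = +-cong (*-congˡ (sub-cong p K)) (sub-cong (λ S → p (k ∷ S)) K)

  sub-+ : ∀ φ ψ K → sub (λ S → φ S + ψ S) K ≈ sub φ K + sub ψ K
  sub-+ φ ψ [] = refl
  sub-+ φ ψ (k ∷ K) = trans (+-cong (*-congˡ (sub-+ φ ψ K)) (sub-+ _ _ K))
    (solve 5 (λ w a b c d → w :* (a :+ b) :+ (c :+ d) := (w :* a :+ c) :+ (w :* b :+ d)) refl (w k) _ _ _ _)

  sub-scale : ∀ c φ K → sub (λ S → c * φ S) K ≈ c * sub φ K
  sub-scale c φ [] = refl
  sub-scale c φ (k ∷ K) = trans (+-cong (*-congˡ (sub-scale c φ K)) (sub-scale c _ K))
    (solve 4 (λ w c a b → w :* (c :* a) :+ c :* b := c :* (w :* a :+ b)) refl (w k) c _ _)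

  sub-0 : ∀ {φ} → (∀ S → φ S ≈ 0#) → ∀ K → sub φ K ≈ 0#
  sub-0 p [] = p []
  sub-0 p (k ∷ K) = trans (+-cong (trans (*-congˡ (sub-0 p K)) (zeroʳ _)) (sub-0 (λ S → p (k ∷ S)) K)) (+-identityʳ _)

  sub-dsum : ∀ (F : ℕ → ℕ → List ℕ → 𝔹) n K → sub (λ S → dsum (λ i j → F i j S) n) K ≈ dsum (λ i j → sub (F i j) K) n
  sub-dsum F zero K = refl
  sub-dsum F (suc n) K = trans (sub-+ _ _ K) (+-congˡ (sub-dsum (λ i → F (suc i)) n K))

  pick-+ : ∀ f g K → pick (λ l L → f l L + g l L) K ≈ pick f K + pick g K
  pick-+ f g [] = sym (+-identityʳ 0#)
  pick-+ f g (k ∷ K) = trans (+-congˡ (pick-+ _ _ K)) (solve 4 (λ a b c d → (a :+ b) :+ (c :+ d) := (a :+ c) :+ (b :+ d)) refl _ _ _ _)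

  pick-scale : ∀ c f K → pick (λ l L → c * f l L) K ≈ c * pick f K
  pick-scale c f [] = sym (zeroʳ c)
  pick-scale c f (k ∷ K) = trans (+-congˡ (pick-scale c _ K)) (sym (distribˡ _ _ _))

  sub-pick : ∀ f K → sub (pick f) K ≈ pick (λ l L → sub (f l) L) K
  sub-pick f [] = refl
  sub-pick f (k ∷ K) = begin
    w k * sub (pick f) K + sub (λ S → f k S + pick (λ l L → f l (k ∷ L)) S) K
      ≈⟨ +-cong (*-congˡ (sub-pick f K)) (trans (sub-+ (f k) _ K) (+-congˡ (sub-pick (λ l L → f l (k ∷ L)) K))) ⟩
    w k * pick (λ l L → sub (f l) L) K + (sub (f k) K + pick (λ l L → sub (λ S → f l (k ∷ S)) L) K)
      ≈⟨ solve 3 (λ a b c → a :+ (b :+ c) := b :+ (a :+ c)) refl _ _ _ ⟩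
    sub (f k) K + (w k * pick (λ l L → sub (f l) L) K + pick (λ l L → sub (λ S → f l (k ∷ S)) L) K)
      ≈⟨ +-congˡ (trans (+-congʳ (sym (pick-scale (w k) _ K))) (sym (pick-+ _ _ K))) ⟩
    pick (λ l L → sub (f l) L) (k ∷ K) ∎

  moment′ : ℕ → List ℕ → 𝔹
  moment′ i = sub (γ i)

  moment′-zero : ∀ K → moment′ 0 K ≈ 0#
  moment′-zero = sub-0 γ-zero

  moment′-nil : ∀ i → moment′ (suc i) [] ≈ ι (isZero i)
  moment′-nil i = refl

  moment′-empty-loop : ∀ i K → moment′ i (0 ∷ K) ≈ moment′ i K
  moment′-empty-loop i K = trans (+-cong (trans (*-congʳ w-zero) (*-identityˡ _)) (sub-0 (γ-empty-loop i) K)) (+-identityʳ _)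

  -- The first loop is a disc, which obeys `w-recursion`, or centred, which obeys `γ-recursion`. The
  -- terms disc-disc, twice disc-centred and centred-centred add up to two uncentred loops.
  moment′-recursion : ∀ i k K → moment′ (suc i) (suc k ∷ K) ≈
    (dsum (λ m n → moment′ (suc i) (m ∷ n ∷ K)) k
      + (ι b * (ι (nat k) * moment′ i (k ∷ K)) + ι (1ℚ ℚ.+ b) * pick (λ l L → ι (nat l) * moment′ (ℕ.pred i) (k ℕ.+ l ∷ L)) K))
    + τ * moment′ (suc i) (suc (suc k) ∷ K)
  moment′-recursion i k K = begin
    w (suc k) * G + sub (λ S → g (suc k ∷ S)) K
      ≈⟨ +-cong (*-congʳ (w-recursion k)) (trans (sub-cong (γ-recursion i k) K) expand) ⟩
    (ww + τ * w (suc (suc k))) * G + ((τ * G₂ + (wB + wB)) + (CC + def))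
      ≈⟨ solve 8 (λ ww t w2 G G2 wB CC d → (ww :+ t :* w2) :* G :+ ((t :* G2 :+ (wB :+ wB)) :+ (CC :+ d))
           := ((G :* ww :+ wB :+ (wB :+ CC)) :+ d) :+ t :* (w2 :* G :+ G2)) refl ww τ (w (suc (suc k))) G G₂ wB CC def ⟩
    ((G * ww + wB + (wB + CC)) + def) + τ * moment′ (suc i) (suc (suc k) ∷ K)
      ≈⟨ +-congʳ (+-congʳ (+-cong (+-congʳ (sym (dsum-scale G _ k))) (+-congʳ flipped))) ⟩
    ((dsum (λ m n → G * (w m * w n)) k + wB + (dsum (λ m n → B m * w n) k + CC)) + def) + τ * moment′ (suc i) (suc (suc k) ∷ K)
      ≈⟨ +-congʳ (+-cong (sym (trans (dsum-cong (λ m n → solve 6 (λ a b G x y z → a :* (b :* G :+ x) :+ (b :* y :+ z) := (G :* (a :* b) :+ a :* x) :+ (y :* b :+ z)) refl (w m) (w n) G (B n) (B m) (C m n)) k)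
           (trans (dsum-+ _ _ k) (+-cong (dsum-+ _ _ k) (dsum-+ _ _ k))))) def≈) ⟩
    _ ∎
    where
    g = γ (suc i)
    G = sub g K
    B : ℕ → 𝔹
    B n = sub (λ S → g (n ∷ S)) K
    C : ℕ → ℕ → 𝔹
    C m n = sub (λ S → g (m ∷ n ∷ S)) K
    ww = dsum (λ m n → w m * w n) k
    wB = dsum (λ m n → w m * B n) k
    CC = dsum C k
    G₂ = B (suc (suc k))
    def = sub (deformation i k) K
    flipped : wB ≈ dsum (λ m n → B m * w n) k
    flipped = trans (sym (convolution 0 w B k)) (trans (P.✶-comm w B k) (convolution 0 B w k))
    expand : sub (λ S → let D = dsum (λ m n → w m * g (n ∷ S)) k in (τ * g (suc (suc k) ∷ S) + (D + D)) + (dsum (λ m n → g (m ∷ n ∷ S)) k + deformation i k S)) K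
      ≈ (τ * G₂ + (wB + wB)) + (CC + def)
    expand = trans (sub-+ _ _ K) (+-cong
      (trans (sub-+ _ _ K) (+-cong (sub-scale τ _ K) (trans (sub-+ _ _ K) (+-cong D D))))
      (trans (sub-+ _ _ K) (+-congʳ (sub-dsum (λ m n S → g (m ∷ n ∷ S)) k K))))
      where
      D : sub (λ S → dsum (λ m n → w m * g (n ∷ S)) k) K ≈ wB
      D = trans (sub-dsum (λ m n S → w m * g (n ∷ S)) k K) (dsum-cong (λ m n → sub-scale (w m) _ K) k)
    η-sub : ∀ j l L → sub (η j l) L ≈ moment′ j (l ∷ L)
    η-sub j l L = trans (sub-+ _ _ L) (+-congʳ (sub-scale (w l) (γ j) L))
    def≈ : def ≈ ι b * (ι (nat k) * moment′ i (k ∷ K)) + ι (1ℚ ℚ.+ b) * pick (λ l L → ι (nat l) * moment′ (ℕ.pred i) (k ℕ.+ l ∷ L)) K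
    def≈ = trans (sub-+ _ _ K) (+-cong
      (trans (sub-scale (ι b) _ K) (*-congˡ (trans (sub-scale (ι (nat k)) _ K) (*-congˡ (η-sub i k K)))))
      (trans (sub-scale (ι (1ℚ ℚ.+ b)) _ K) (*-congˡ (trans (sub-pick _ K) (pick-cong (λ l L → trans (sub-scale (ι (nat l)) _ L) (*-congˡ (η-sub (ℕ.pred i) (k ℕ.+ l) L))) K)))))

  evaluate-at-zero : ∀ e → ⟦ e ⟧ (0 ∷ []) ≈ Eval.eval base (env 0) e
  evaluate-at-zero e = trans (eval-hom (PS.head base) (env 1) e) (Eval.eval-cong base vars e)
    where
    vars : ∀ v → env 1 v 0 ≈ env 0 v
    vars zero = refl
    vars (suc zero) = trans (ζ₀-law 0) (zeroˡ _)
    vars (suc (suc v)) = refl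

  -- The coefficient of `x` in the centred one-loop function: `kernelSolve` stripped of its factor
  -- `x`, to be evaluated at `ζ = 0`.
  linear : ℕ → ℕ → Expr
  linear i zero = conᴱ 0ℚ
  linear i (suc d) = kernel⁻¹ᴱ *ᴱ divDiff (λ v → v) pole isOne (xᴱ 1 *ᴱ source i 0 (cumulant (suc i) d 2))

  -- A loop of length one is capped by a disc, which requires that no deficiency remain, or it is
  -- centred. All catalytic variables will be set to zero, so that only `U` survives.
  mapSeries′ : ℕ → Expr
  mapSeries′ zero = conᴱ 0ℚ
  mapSeries′ (suc i) = conᴱ (isZero i) *ᴱ W₁ᴱ +ᴱ linear i i

  mapSeries′-law : ∀ i → moment′ i (1 ∷ []) ≈ Eval.eval base (env 0) (mapSeries′ i)
  mapSeries′-law zero = trans (moment′-zero (1 ∷ [])) (sym ι-0)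
  mapSeries′-law (suc i) = +-cong (trans (*-comm _ _) (*-congˡ (trans w-one (evaluate-at-zero W₁ᴱ)))) (part i)
    where
    part : ∀ d → ⟦ cumulant (suc i) d 1 ⟧ (1 ∷ []) ≈ Eval.eval base (env 0) (linear i d)
    part zero = trans (⟦0⟧ (1 ∷ [])) (sym ι-0)
    part (suc d) = trans (⟦x⟧-suc (linear i (suc d)) 0 []) (evaluate-at-zero (linear i (suc d)))

  abstract
    moment : ℕ → List ℕ → 𝔹
    moment = moment′

    moment-zero : ∀ K → moment 0 K ≈ 0#
    moment-zero = moment′-zero

    moment-nil : ∀ i → moment (suc i) [] ≈ ι (isZero i)
    moment-nil = moment′-nil

    moment-empty-loop : ∀ i K → moment i (0 ∷ K) ≈ moment i K
    moment-empty-loop = moment′-empty-loop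

    moment-recursion : ∀ i k K → moment (suc i) (suc k ∷ K) ≈
      (dsum (λ m n → moment (suc i) (m ∷ n ∷ K)) k
        + (ι b * (ι (nat k) * moment i (k ∷ K)) + ι (1ℚ ℚ.+ b) * pick (λ l L → ι (nat l) * moment (ℕ.pred i) (k ℕ.+ l ∷ L)) K))
      + τ * moment (suc i) (suc (suc k) ∷ K)
    moment-recursion = moment′-recursion

    mapSeries : ℕ → Expr
    mapSeries = mapSeries′

    mapSeries-law : ∀ i → moment i (1 ∷ []) ≈ Eval.eval base (env 0) (mapSeries i)
    mapSeries-law = mapSeries′-law

-- Algebraic dependence

module Algebraic where
  open import Data.List as List using (List; []; _∷_; length)
  open import Data.List.Relation.Unary.Any as Any using (Any; here; there)
  open import Data.List.Relation.Unary.All as All using (All; []; _∷_)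
  import Data.List.Relation.Unary.All.Properties as Allₚ
  import Data.List.Relation.Unary.Any.Properties as Anyₚ
  import Data.List.Properties as Listₚ
  open import Data.Nat as ℕ using (ℕ; zero; suc; z≤n; s≤s)
  import Data.Nat.Properties as ℕₚ
  open import Data.Product using (Σ; _×_; _,_; proj₁; proj₂)
  open import Data.Rational as ℚ using (ℚ; 0ℚ; 1ℚ)
  import Data.Rational.Properties as ℚₚ
  open import Data.Sum using (inj₁; inj₂)
  open import Data.Vec as Vec using (Vec; []; _∷_; toList; concat)
  open import Function using (_∘_)
  open import Relation.Binary.PropositionalEquality as ≡ using (_≡_; _≢_)
  open import Relation.Nullary using (yes; no)
  open import Data.Rational.Solver using (module +-*-Solver)
  open import Defs using (Poly; Poly2; NonZeroPoly2)
  open Series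
  open Local
  open Expr
  open Tower using (module LocFacts)

  module LinearSystems where
    open ≡.≡-Reasoning
    open +-*-Solver

    dot : ∀ {n} → Vec ℚ n → Vec ℚ n → ℚ
    dot [] [] = 0ℚ
    dot (x ∷ xs) (y ∷ ys) = x ℚ.* y ℚ.+ dot xs ys

    NonZero : ∀ {n} → Vec ℚ n → Set
    NonZero v = Any (_≢ 0ℚ) (toList v)

    dot-zeroʳ : ∀ {n} (v : Vec ℚ n) → dot v (Vec.replicate n 0ℚ) ≡ 0ℚ
    dot-zeroʳ [] = ≡.refl
    dot-zeroʳ (x ∷ v) = ≡.cong₂ ℚ._+_ (ℚₚ.*-zeroʳ x) (dot-zeroʳ v)

    eliminate : ∀ {n} → ℚ → Vec ℚ n → Vec ℚ n → Vec ℚ n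
    eliminate s p r = Vec.zipWith (λ x y → y ℚ.- s ℚ.* x) p r

    dot-eliminate : ∀ {n} s (p r c : Vec ℚ n) → dot (eliminate s p r) c ≡ dot r c ℚ.- s ℚ.* dot p c
    dot-eliminate s [] [] [] = ≡.sym (≡.trans (ℚₚ.+-identityˡ _) (≡.cong ℚ.-_ (ℚₚ.*-zeroʳ s)))
    dot-eliminate s (x ∷ p) (y ∷ r) (z ∷ c) = begin
      (y ℚ.- s ℚ.* x) ℚ.* z ℚ.+ dot (eliminate s p r) c ≡⟨ ≡.cong ((y ℚ.- s ℚ.* x) ℚ.* z ℚ.+_) (dot-eliminate s p r c) ⟩
      (y ℚ.- s ℚ.* x) ℚ.* z ℚ.+ (dot r c ℚ.- s ℚ.* dot p c)
        ≡⟨ solve 6 (λ x y z s a b → (y :- s :* x) :* z :+ (a :- s :* b) := (y :* z :+ a) :- s :* (x :* z :+ b)) ≡.refl x y z s (dot r c) (dot p c) ⟩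
      (y ℚ.* z ℚ.+ dot r c) ℚ.- s ℚ.* (x ℚ.* z ℚ.+ dot p c) ∎

    data Pivot {n} (rows : List (Vec ℚ (suc n))) : Set₁ where
      none : All (λ r → Vec.head r ≡ 0ℚ) rows → Pivot rows
      some : ∀ r rest → Vec.head r ≢ 0ℚ → length rows ≡ suc (length rest) →
        (∀ {P : Vec ℚ (suc n) → Set} → P r → All P rest → All P rows) → Pivot rows

    pivot : ∀ {n} (rows : List (Vec ℚ (suc n))) → Pivot rows
    pivot [] = none []
    pivot (r ∷ rows) with Vec.head r ℚ.≟ 0ℚ
    ... | no h = some r rows h ≡.refl (λ p ps → p ∷ ps)
    ... | yes h with pivot rows
    ... | none hs = none (h ∷ hs)
    ... | some p rest q e f = some p (r ∷ rest) q (≡.cong suc e) (λ { x (y ∷ ys) → y ∷ f x ys })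

    -- Gaussian elimination, removing one row and one unknown at a time. If the first column is
    -- zero, the first unit vector is a solution.
    kernel : ∀ n (rows : List (Vec ℚ n)) → length rows ℕ.< n → Σ (Vec ℚ n) λ c → NonZero c × All (λ r → dot r c ≡ 0ℚ) rows
    kernel (suc n) rows lt with pivot rows
    ... | none hs = (1ℚ ∷ Vec.replicate n 0ℚ) , here (λ ()) , All.map (λ { {x ∷ v} ≡.refl → ≡.cong₂ ℚ._+_ (ℚₚ.*-zeroˡ 1ℚ) (dot-zeroʳ v) }) hs
    ... | some (h ∷ p) rest h≢0 e cover with kernel n (List.map reduce rest) (ℕ.s≤s⁻¹ (≡.subst (ℕ._< suc n) (≡.trans e (≡.cong suc (≡.sym (Listₚ.length-map _ rest)))) lt))
      where
      reduce : Vec ℚ (suc n) → Vec ℚ n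
      reduce (x ∷ r) = eliminate (x ℚ.* (ℚ.1/_ h {{ℚ.≢-nonZero h≢0}})) p r
    ... | c , nz , zs = (c₀ ∷ c) , there nz , cover pivot-row (All.map (λ { {x ∷ r} → other x r }) (Allₚ.map⁻ zs))
      where
      instance _ = ℚ.≢-nonZero h≢0
      i = ℚ.1/ h
      -- The pivot row solved for its first unknown.
      c₀ = ℚ.- (i ℚ.* dot p c)
      pivot-row : h ℚ.* c₀ ℚ.+ dot p c ≡ 0ℚ
      pivot-row = begin
        h ℚ.* c₀ ℚ.+ dot p c ≡⟨ solve 3 (λ h i d → h :* (:- (i :* d)) :+ d := (con 1ℚ :- h :* i) :* d) ≡.refl h i (dot p c) ⟩
        (1ℚ ℚ.- h ℚ.* i) ℚ.* dot p c ≡⟨ ≡.cong (λ z → (1ℚ ℚ.- z) ℚ.* dot p c) (ℚₚ.*-inverseʳ h) ⟩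
        0ℚ ℚ.* dot p c ≡⟨ ℚₚ.*-zeroˡ (dot p c) ⟩
        0ℚ ∎
      other : ∀ x r → dot (eliminate (x ℚ.* i) p r) c ≡ 0ℚ → x ℚ.* c₀ ℚ.+ dot r c ≡ 0ℚ
      other x r z = begin
        x ℚ.* c₀ ℚ.+ dot r c ≡⟨ solve 4 (λ x i d e → x :* (:- (i :* d)) :+ e := e :- (x :* i) :* d) ≡.refl x i (dot p c) (dot r c) ⟩
        dot r c ℚ.- (x ℚ.* i) ℚ.* dot p c ≡⟨ dot-eliminate (x ℚ.* i) p r c ⟨
        dot (eliminate (x ℚ.* i) p r) c ≡⟨ z ⟩
        0ℚ ∎

  addP : Poly → Poly → Poly
  addP [] q = q
  addP (a ∷ p) [] = a ∷ p
  addP (a ∷ p) (b ∷ q) = a ℚ.+ b ∷ addP p q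

  scaleP : ℚ → Poly → Poly
  scaleP c = List.map (c ℚ.*_)

  mulP : Poly → Poly → Poly
  mulP [] q = []
  mulP (a ∷ p) q = addP (scaleP a q) (0ℚ ∷ mulP p q)

  powP : Poly → ℕ → Poly
  powP p zero = 1ℚ ∷ []
  powP p (suc n) = mulP p (powP p n)

  coefP : Poly → ℕ → ℚ
  coefP [] l = 0ℚ
  coefP (a ∷ p) zero = a
  coefP (a ∷ p) (suc l) = coefP p l

  -- degree at most n, the zero polynomial included
  Degree : ℕ → Poly → Set
  Degree n p = length p ℕ.≤ suc n

  addP-length : ∀ p q n → length p ℕ.≤ n → length q ℕ.≤ n → length (addP p q) ℕ.≤ n
  addP-length [] q n x y = y
  addP-length (a ∷ p) [] n x y = x
  addP-length (a ∷ p) (b ∷ q) (suc n) (s≤s x) (s≤s y) = s≤s (addP-length p q n x y)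

  mulP-degree : ∀ p q m n → Degree m p → Degree n q → Degree (m ℕ.+ n) (mulP p q)
  mulP-degree [] q m n x y = z≤n
  mulP-degree (a ∷ p) q m n x y = addP-length (scaleP a q) (0ℚ ∷ mulP p q) _
    (ℕₚ.≤-trans (ℕₚ.≤-reflexive (Listₚ.length-map _ q)) (ℕₚ.≤-trans y (s≤s (ℕₚ.m≤n+m n m)))) (s≤s (rest p m x))
    where
    rest : ∀ p m → length (a ∷ p) ℕ.≤ suc m → length (mulP p q) ℕ.≤ m ℕ.+ n
    rest [] m x = z≤n
    rest (b ∷ p) (suc m) (s≤s x) = mulP-degree (b ∷ p) q m n x y

  powP-degree : ∀ p d n → Degree d p → Degree (n ℕ.* d) (powP p n)
  powP-degree p d zero x = s≤s z≤n
  powP-degree p d (suc n) x = mulP-degree p (powP p n) d (n ℕ.* d) x (powP-degree p d n x)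

  coefP-addP : ∀ p q l → coefP (addP p q) l ≡ coefP p l ℚ.+ coefP q l
  coefP-addP [] q l = ≡.sym (ℚₚ.+-identityˡ _)
  coefP-addP (a ∷ p) [] l = ≡.sym (ℚₚ.+-identityʳ _)
  coefP-addP (a ∷ p) (b ∷ q) zero = ≡.refl
  coefP-addP (a ∷ p) (b ∷ q) (suc l) = coefP-addP p q l

  coefP-scaleP : ∀ c p l → coefP (scaleP c p) l ≡ c ℚ.* coefP p l
  coefP-scaleP c [] l = ≡.sym (ℚₚ.*-zeroʳ c)
  coefP-scaleP c (a ∷ p) zero = ≡.refl
  coefP-scaleP c (a ∷ p) (suc l) = coefP-scaleP c p l

  coefP-beyond : ∀ p l → length p ℕ.≤ l → coefP p l ≡ 0ℚ
  coefP-beyond [] l x = ≡.refl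
  coefP-beyond (a ∷ p) (suc l) (s≤s x) = coefP-beyond p l x

  module Combination where
    open LinearSystems

    combine : ∀ {n} → Vec ℚ n → (ℕ → Poly) → Poly
    combine [] f = []
    combine (c ∷ cs) f = addP (scaleP c (f 0)) (combine cs (f ∘ suc))

    combine₂ : ∀ {m n} → Vec (Vec ℚ n) m → (ℕ → ℕ → Poly) → Poly
    combine₂ [] f = []
    combine₂ (c ∷ cs) f = addP (combine c (f 0)) (combine₂ cs (f ∘ suc))

    row : ∀ n → (ℕ → ℚ) → Vec ℚ n
    row zero f = []
    row (suc n) f = f 0 ∷ row n (f ∘ suc)

    row₂ : ∀ m n → (ℕ → ℕ → ℚ) → Vec ℚ (m ℕ.* n)
    row₂ zero n f = []
    row₂ (suc m) n f = row n (f 0) Vec.++ row₂ m n (f ∘ suc)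

    dot-++ : ∀ {m n} (a c : Vec ℚ m) (b d : Vec ℚ n) → dot (a Vec.++ b) (c Vec.++ d) ≡ dot a c ℚ.+ dot b d
    dot-++ [] [] b d = ≡.sym (ℚₚ.+-identityˡ _)
    dot-++ (x ∷ a) (y ∷ c) b d = ≡.trans (≡.cong (x ℚ.* y ℚ.+_) (dot-++ a c b d)) (≡.sym (ℚₚ.+-assoc (x ℚ.* y) (dot a c) (dot b d)))

    coefP-combine : ∀ {n} (c : Vec ℚ n) f l → coefP (combine c f) l ≡ dot (row n (λ i → coefP (f i) l)) c
    coefP-combine [] f l = ≡.refl
    coefP-combine (c ∷ cs) f l = ≡.trans (coefP-addP (scaleP c (f 0)) _ l)
      (≡.cong₂ ℚ._+_ (≡.trans (coefP-scaleP c (f 0) l) (ℚₚ.*-comm c _)) (coefP-combine cs (f ∘ suc) l))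

    coefP-combine₂ : ∀ {m n} (c : Vec (Vec ℚ n) m) f l → coefP (combine₂ c f) l ≡ dot (row₂ m n (λ j i → coefP (f j i) l)) (concat c)
    coefP-combine₂ [] f l = ≡.refl
    coefP-combine₂ {n = n} (c ∷ cs) f l = ≡.trans (coefP-addP (combine c (f 0)) _ l) (≡.trans
      (≡.cong₂ ℚ._+_ (coefP-combine c (f 0) l) (coefP-combine₂ cs (f ∘ suc) l))
      (≡.sym (dot-++ (row n (λ i → coefP (f 0 i) l)) c _ _)))

    combine-length : ∀ {n} (c : Vec ℚ n) f N → (∀ i → i ℕ.< n → length (f i) ℕ.≤ N) → length (combine c f) ℕ.≤ N
    combine-length [] f N h = z≤n
    combine-length (c ∷ cs) f N h = addP-length (scaleP c (f 0)) _ N (ℕₚ.≤-trans (ℕₚ.≤-reflexive (Listₚ.length-map _ (f 0))) (h 0 (s≤s z≤n)))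
      (combine-length cs (f ∘ suc) N (λ i x → h (suc i) (s≤s x)))

    combine₂-length : ∀ {m n} (c : Vec (Vec ℚ n) m) f N → (∀ j i → j ℕ.< m → i ℕ.< n → length (f j i) ℕ.≤ N) → length (combine₂ c f) ℕ.≤ N
    combine₂-length [] f N h = z≤n
    combine₂-length (c ∷ cs) f N h = addP-length (combine c (f 0)) _ N (combine-length c (f 0) N (λ i → h 0 i (s≤s z≤n)))
      (combine₂-length cs (f ∘ suc) N (λ j i x → h (suc j) i (s≤s x)))

    toPoly2 : ∀ {m n} → Vec (Vec ℚ n) m → Poly2
    toPoly2 c = toList (Vec.map toList c)

    nonZero-concat : ∀ {m n} (c : Vec (Vec ℚ n) m) → NonZero (concat c) → NonZeroPoly2 (toPoly2 c)
    nonZero-concat (c ∷ cs) z with Anyₚ.++⁻ (toList c) (≡.subst (Any (_≢ 0ℚ)) (toList-++ c (concat cs)) z)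
      where
      toList-++ : ∀ {A : Set} {m n} (a : Vec A m) (b : Vec A n) → toList (a Vec.++ b) ≡ toList a List.++ toList b
      toList-++ [] b = ≡.refl
      toList-++ (x ∷ a) b = ≡.cong (x ∷_) (toList-++ a b)
    ... | inj₁ y = here y
    ... | inj₂ y = there (nonZero-concat cs y)

    -- Vanishing of the combination is one linear condition for each of `N` coefficients, on more
    -- than `N` unknowns.
    dependent : ∀ m n (f : ℕ → ℕ → Poly) N → (∀ j i → j ℕ.< m → i ℕ.< n → length (f j i) ℕ.≤ N) → N ℕ.< m ℕ.* n →
      Σ (Vec (Vec ℚ n) m) λ c → NonZeroPoly2 (toPoly2 c) × (∀ l → coefP (combine₂ c f) l ≡ 0ℚ)
    dependent m n f N h lt with kernel (m ℕ.* n) rows (≡.subst (ℕ._< m ℕ.* n) (≡.sym (≡.trans (Listₚ.length-map rowOf (List.upTo N)) (Listₚ.length-upTo N))) lt)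
      where
      rowOf = λ l → row₂ m n (λ j i → coefP (f j i) l)
      rows = List.map rowOf (List.upTo N)
    ... | v , nz , zs with Vec.group m n v
    ... | c , ≡.refl = c , nonZero-concat c nz , vanish
      where
      vanish : ∀ l → coefP (combine₂ c f) l ≡ 0ℚ
      vanish l with l ℕ.<? N
      ... | yes l<N = ≡.trans (coefP-combine₂ c f l) (All.lookup (Allₚ.map⁻ zs) (∈-upTo⁺ l<N))
        where
        open import Data.List.Membership.Propositional.Properties using (∈-upTo⁺)
      ... | no l≮N = coefP-beyond (combine₂ c f) l (ℕₚ.≤-trans (combine₂-length c f N h) (ℕₚ.≮⇒≥ l≮N))

  module Evaluation (A : Loc) where
    open Loc A
    open LocFacts A
    open Combination
    open import Relation.Binary.Reasoning.Setoid setoid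
    open Solver using (solve; _:+_; _:*_; _:=_; _:-_; con)

    evalR : Poly → Carrier → Carrier
    evalR [] x = 0#
    evalR (a ∷ p) x = ι a + x * evalR p x

    evalR₂ : Poly2 → Carrier → Carrier → Carrier
    evalR₂ [] t y = 0#
    evalR₂ (c ∷ cs) t y = evalR c t + y * evalR₂ cs t y

    power : Carrier → ℕ → Carrier
    power x zero = 1#
    power x (suc n) = x * power x n

    module _ (x : Carrier) where
      evalR-add : ∀ p q → evalR (addP p q) x ≈ evalR p x + evalR q x
      evalR-add [] q = sym (+-identityˡ _)
      evalR-add (a ∷ p) [] = sym (+-identityʳ _)
      evalR-add (a ∷ p) (b ∷ q) = trans (+-cong (ι-+ a b) (*-congˡ (evalR-add p q)))
        (solve 5 (λ a b x p q → (a :+ b) :+ x :* (p :+ q) := (a :+ x :* p) :+ (b :+ x :* q)) refl (ι a) (ι b) x _ _)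

      evalR-scale : ∀ c p → evalR (scaleP c p) x ≈ ι c * evalR p x
      evalR-scale c [] = sym (zeroʳ _)
      evalR-scale c (a ∷ p) = trans (+-cong (ι-* c a) (*-congˡ (evalR-scale c p)))
        (solve 4 (λ c a x p → c :* a :+ x :* (c :* p) := c :* (a :+ x :* p)) refl (ι c) (ι a) x _)

      evalR-mul : ∀ p q → evalR (mulP p q) x ≈ evalR p x * evalR q x
      evalR-mul [] q = sym (zeroˡ _)
      evalR-mul (a ∷ p) q = trans (evalR-add (scaleP a q) (0ℚ ∷ mulP p q)) (trans (+-cong (evalR-scale a q) (+-cong ι-0 (*-congˡ (evalR-mul p q))))
        (trans (+-congˡ (+-identityˡ _)) (solve 4 (λ a x p q → a :* q :+ x :* (p :* q) := (a :+ x :* p) :* q) refl (ι a) x _ _)))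

      evalR-one : evalR (1ℚ ∷ []) x ≈ 1#
      evalR-one = trans (+-cong ι-1 (zeroʳ x)) (+-identityʳ _)

      evalR-pow : ∀ p n → evalR (powP p n) x ≈ power (evalR p x) n
      evalR-pow p zero = evalR-one
      evalR-pow p (suc n) = trans (evalR-mul p (powP p n)) (*-congˡ (evalR-pow p n))

      evalR-0 : ∀ p → (∀ l → coefP p l ≡ 0ℚ) → evalR p x ≈ 0#
      evalR-0 [] z = refl
      evalR-0 (a ∷ p) z = trans (+-cong (trans (reflexive (≡.cong ι (z 0))) ι-0) (trans (*-congˡ (evalR-0 p (z ∘ suc))) (zeroʳ x))) (+-identityʳ _)

    power-unit : ∀ x n → ε x ≡ 1ℚ → ε (power x n) ≡ 1ℚ
    power-unit x zero z = ≡.trans (ε-cong (sym ι-1)) (ε-ι 1ℚ)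
    power-unit x (suc n) z = ≡.trans (ε-* _ _) (≡.cong₂ ℚ._*_ z (power-unit x n z))

    -- Stands in for the absence of zero divisors: a denominator of augmentation 1 has the inverse
    -- `geo (1 - k)`.
    unit-cancel : ∀ k f → ε k ≡ 1ℚ → k * f ≈ 0# → f ≈ 0#
    unit-cancel k f z p = begin
      f ≈⟨ trans (*-congˡ (geo-inverse c c₀)) (*-identityʳ f) ⟨
      f * ((1# - c) * geo c) ≈⟨ solve 4 (λ o k f g → f :* ((o :- (o :- k)) :* g) := (k :* f) :* g) refl 1# k f (geo c) ⟩
      (k * f) * geo c ≈⟨ trans (*-congʳ p) (zeroˡ _) ⟩
      0# ∎
      where
      c = 1# - k
      c₀ : ε c ≡ 0ℚ
      c₀ = ≡.trans (ε-cong (+-congˡ (sym (neg-one k)))) (≡.trans (ε-+ _ _) (≡.cong₂ ℚ._+_ (≡.trans (ε-cong (sym ι-1)) (ε-ι 1ℚ))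
        (≡.trans (ε-* _ _) (≡.cong₂ ℚ._*_ (ε-ι _) z))))

    -- y = N(u) / D(u) with D(u) invertible
    record Fraction (u y : Carrier) : Set where
      field
        N D : Poly
        equation : evalR D u * y ≈ evalR N u
        unit : ε (evalR D u) ≡ 1ℚ

    open Fraction

    fraction-cong : ∀ {u y z} → y ≈ z → Fraction u y → Fraction u z
    fraction-cong p f = record { N = N f ; D = D f ; equation = trans (*-congˡ (sym p)) (equation f) ; unit = unit f }

    only : Carrier → ℕ → Carrier
    only u zero = u
    only u (suc v) = 0#

    private
      ε-1 : ε 1# ≡ 1ℚ
      ε-1 = ≡.trans (ε-cong (sym ι-1)) (ε-ι 1ℚ)

    polynomial : ∀ {u y} N → y ≈ evalR N u → Fraction u y
    polynomial {u} N p = record { N = N ; D = 1ℚ ∷ [] ; equation = trans (*-cong (evalR-one u) p) (*-identityˡ _)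
      ; unit = ≡.trans (ε-cong (evalR-one u)) ε-1 }

    fraction : ∀ u e → Fraction u (Eval.eval A (only u) e)
    fraction u (conᴱ q) = polynomial (q ∷ []) (sym (trans (+-congˡ (zeroʳ u)) (+-identityʳ _)))
    fraction u (varᴱ zero) = polynomial (0ℚ ∷ 1ℚ ∷ []) (sym (trans (+-cong ι-0 (*-congˡ (evalR-one u))) (trans (+-identityˡ _) (*-identityʳ u))))
    fraction u (varᴱ (suc v)) = polynomial [] refl
    fraction u (e +ᴱ f) = record
      { N = addP (mulP (N F) (D G)) (mulP (D F) (N G)) ; D = mulP (D F) (D G)
      ; equation = begin
          evalR (mulP (D F) (D G)) u * (x + y) ≈⟨ *-congʳ (evalR-mul u (D F) (D G)) ⟩
          (evalR (D F) u * evalR (D G) u) * (x + y) ≈⟨ solve 4 (λ d g x y → (d :* g) :* (x :+ y) := (d :* x) :* g :+ d :* (g :* y)) refl _ _ x y ⟩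
          (evalR (D F) u * x) * evalR (D G) u + evalR (D F) u * (evalR (D G) u * y) ≈⟨ +-cong (*-congʳ (equation F)) (*-congˡ (equation G)) ⟩
          evalR (N F) u * evalR (D G) u + evalR (D F) u * evalR (N G) u ≈⟨ +-cong (evalR-mul u (N F) (D G)) (evalR-mul u (D F) (N G)) ⟨
          evalR (mulP (N F) (D G)) u + evalR (mulP (D F) (N G)) u ≈⟨ evalR-add u (mulP (N F) (D G)) (mulP (D F) (N G)) ⟨
          _ ∎
      ; unit = ≡.trans (ε-cong (evalR-mul u (D F) (D G))) (≡.trans (ε-* _ _) (≡.cong₂ ℚ._*_ (unit F) (unit G))) }
      where
      F = fraction u e
      G = fraction u f
      x = Eval.eval A (only u) e
      y = Eval.eval A (only u) f
    fraction u (e *ᴱ f) = record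
      { N = mulP (N F) (N G) ; D = mulP (D F) (D G)
      ; equation = begin
          evalR (mulP (D F) (D G)) u * (x * y) ≈⟨ *-congʳ (evalR-mul u (D F) (D G)) ⟩
          (evalR (D F) u * evalR (D G) u) * (x * y) ≈⟨ solve 4 (λ d g x y → (d :* g) :* (x :* y) := (d :* x) :* (g :* y)) refl _ _ x y ⟩
          (evalR (D F) u * x) * (evalR (D G) u * y) ≈⟨ *-cong (equation F) (equation G) ⟩
          evalR (N F) u * evalR (N G) u ≈⟨ evalR-mul u (N F) (N G) ⟨
          _ ∎
      ; unit = ≡.trans (ε-cong (evalR-mul u (D F) (D G))) (≡.trans (ε-* _ _) (≡.cong₂ ℚ._*_ (unit F) (unit G))) }
      where
      F = fraction u e
      G = fraction u f
      x = Eval.eval A (only u) e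
      y = Eval.eval A (only u) f
    -- With `x = N/D` and `q = ε x`, `1/(1 - x + q) = D/(D + qD - N)`. As `N` has augmentation `q`,
    -- the new denominator has augmentation `1 + q - q`.
    fraction u (geoᴱ e) = record
      { N = D F ; D = E
      ; equation = begin
          evalR E u * g ≈⟨ *-congʳ E-value ⟩
          (d + (ι q * d + ι (ℚ.- 1ℚ) * n)) * g ≈⟨ *-congʳ (+-congˡ (+-congˡ (*-congˡ (sym (equation F))))) ⟩
          (d + (ι q * d + ι (ℚ.- 1ℚ) * (d * x))) * g ≈⟨ solve 4 (λ d q x g → (d :+ (q :* d :+ con (ℚ.- 1ℚ) :* (d :* x))) :* g := d :* (g :- (x :- q) :* g)) refl d (ι q) x g ⟩
          d * (g - (x - ι q) * g) ≈⟨ *-congˡ (+-cong (geo-law x) (-‿cong (*-congʳ (+-congˡ (sym (ι-neg q)))))) ⟩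
          d * ((1# + (x + ι (ℚ.- q)) * g) - (x + ι (ℚ.- q)) * g) ≈⟨ solve 3 (λ d o a → d :* ((o :+ a) :- a) := d :* o) refl d 1# ((x + ι (ℚ.- q)) * g) ⟩
          d * 1# ≈⟨ *-identityʳ d ⟩
          d ∎
      ; unit = ≡.trans (ε-cong E-value) (≡.trans (ε-+ _ _) (≡.trans (≡.cong₂ ℚ._+_ (unit F) (≡.trans (ε-+ _ _) (≡.cong₂ ℚ._+_
          (≡.trans (ε-* _ _) (≡.cong₂ ℚ._*_ (ε-ι q) (unit F)))
          (≡.trans (ε-* _ _) (≡.cong₂ ℚ._*_ (ε-ι _) n₀))))) cancel)) }
      where
      F = fraction u e
      x = Eval.eval A (only u) e
      g = geo x
      q = ε x
      d = evalR (D F) u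
      n = evalR (N F) u
      E = addP (D F) (addP (scaleP q (D F)) (scaleP (ℚ.- 1ℚ) (N F)))
      E-value : evalR E u ≈ d + (ι q * d + ι (ℚ.- 1ℚ) * n)
      E-value = trans (evalR-add u (D F) _) (+-congˡ (trans (evalR-add u (scaleP q (D F)) _) (+-cong (evalR-scale u q (D F)) (evalR-scale u (ℚ.- 1ℚ) (N F)))))
      n₀ : ε n ≡ q
      n₀ = ≡.trans (ε-cong (sym (equation F))) (≡.trans (ε-* d x) (≡.trans (≡.cong (ℚ._* q) (unit F)) (ℚₚ.*-identityˡ q)))
      cancel : 1ℚ ℚ.+ (q ℚ.* 1ℚ ℚ.+ (ℚ.- 1ℚ) ℚ.* q) ≡ 1ℚ
      cancel = Q.solve 1 (λ q → Q.con 1ℚ Q.:+ (q Q.:* Q.con 1ℚ Q.:+ (Q.con (ℚ.- 1ℚ)) Q.:* q) Q.:= Q.con 1ℚ) ≡.refl q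
        where
        module Q = +-*-Solver

    -- t and a are fractions in u of degree at most d; among the (2d+1)² products tⁱ aʲ, brought to a common
    -- denominator, the numerators have degree at most 2d(2d+1), so that they are linearly dependent.
    algebraic : ∀ {u t a} → Fraction u t → Fraction u a → Σ Poly2 λ P → NonZeroPoly2 P × evalR₂ P t a ≈ 0#
    algebraic {u} {t} {a} F G = toPoly2 c , nz , unit-cancel K _ (K-unit) (trans (*-comm K _) (trans (outer c P K term) (evalR-0 u (combine₂ c P) zs)))
      where
      -- The leading `suc` makes `d` positive, hence `M` at least 2, on which the strict inequality
      -- of `count` rests.
      d = suc (length (N F) ℕ.+ length (D F) ℕ.+ (length (N G) ℕ.+ length (D G)))
      M = suc (d ℕ.+ d)
      fN : Degree d (N F)
      fN = ℕₚ.m≤n⇒m≤1+n (ℕₚ.m≤n⇒m≤1+n (ℕₚ.≤-trans (ℕₚ.m≤m+n _ _) (ℕₚ.m≤m+n _ _)))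
      fD : Degree d (D F)
      fD = ℕₚ.m≤n⇒m≤1+n (ℕₚ.m≤n⇒m≤1+n (ℕₚ.≤-trans (ℕₚ.m≤n+m _ (length (N F))) (ℕₚ.m≤m+n _ _)))
      gN : Degree d (N G)
      gN = ℕₚ.m≤n⇒m≤1+n (ℕₚ.m≤n⇒m≤1+n (ℕₚ.≤-trans (ℕₚ.m≤m+n _ _) (ℕₚ.m≤n+m _ (length (N F) ℕ.+ length (D F)))))
      gD : Degree d (D G)
      gD = ℕₚ.m≤n⇒m≤1+n (ℕₚ.m≤n⇒m≤1+n (ℕₚ.≤-trans (ℕₚ.m≤n+m _ (length (N G))) (ℕₚ.m≤n+m _ (length (N F) ℕ.+ length (D F)))))
      part : {y : Carrier} → Fraction u y → ℕ → Poly
      part H i = mulP (powP (N H) i) (powP (D H) (M ℕ.∸ i))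
      P : ℕ → ℕ → Poly
      P j i = mulP (part F i) (part G j)
      part-degree : ∀ {y} (H : Fraction u y) → Degree d (N H) → Degree d (D H) → ∀ i → i ℕ.≤ M → Degree (M ℕ.* d) (part H i)
      part-degree H n m i i≤M = ≡.subst (λ k → Degree k (part H i))
        (≡.trans (≡.sym (ℕₚ.*-distribʳ-+ d i (M ℕ.∸ i))) (≡.cong (ℕ._* d) (ℕₚ.m+[n∸m]≡n i≤M)))
        (mulP-degree (powP (N H) i) (powP (D H) (M ℕ.∸ i)) (i ℕ.* d) ((M ℕ.∸ i) ℕ.* d) (powP-degree (N H) d i n) (powP-degree (D H) d (M ℕ.∸ i) m))
      P-length : ∀ j i → j ℕ.< M → i ℕ.< M → length (P j i) ℕ.≤ suc (M ℕ.* d ℕ.+ M ℕ.* d)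
      P-length j i x y = mulP-degree (part F i) (part G j) (M ℕ.* d) (M ℕ.* d) (part-degree F fN fD i (ℕₚ.<⇒≤ y)) (part-degree G gN gD j (ℕₚ.<⇒≤ x))
      count : suc (M ℕ.* d ℕ.+ M ℕ.* d) ℕ.< M ℕ.* M
      count = ≡.subst₂ ℕ._≤_ (≡.cong (λ k → suc (suc k)) (ℕₚ.*-distribˡ-+ M d d)) (≡.sym (ℕₚ.*-suc M (d ℕ.+ d)))
        (ℕₚ.+-monoˡ-≤ (M ℕ.* (d ℕ.+ d)) (s≤s (ℕₚ.≤-trans (s≤s z≤n) (ℕₚ.m≤m+n d d))))
      dep = dependent M M P (suc (M ℕ.* d ℕ.+ M ℕ.* d)) P-length count
      c = proj₁ dep
      nz = proj₁ (proj₂ dep)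
      zs = proj₂ (proj₂ dep)
      K = power (evalR (D F) u) M * power (evalR (D G) u) M
      K-unit : ε K ≡ 1ℚ
      K-unit = ≡.trans (ε-* _ _) (≡.cong₂ ℚ._*_ (power-unit _ M (unit F)) (power-unit _ M (unit G)))
      clear : ∀ {y} (H : Fraction u y) m i → i ℕ.≤ m → power (evalR (N H) u) i * power (evalR (D H) u) (m ℕ.∸ i) ≈ power y i * power (evalR (D H) u) m
      clear H m zero le = refl
      clear {y} H (suc m) (suc i) (s≤s le) = begin
        (n * power n i) * power δ (m ℕ.∸ i) ≈⟨ trans (*-assoc _ _ _) (*-cong (sym (equation H)) (clear H m i le)) ⟩
        (δ * y) * (power y i * power δ m) ≈⟨ solve 4 (λ d y p q → (d :* y) :* (p :* q) := (y :* p) :* (d :* q)) refl _ _ _ _ ⟩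
        (y * power y i) * (δ * power δ m) ∎
        where
        n = evalR (N H) u
        δ = evalR (D H) u
      part-value : ∀ {y} (H : Fraction u y) i → i ℕ.≤ M → evalR (part H i) u ≈ power y i * power (evalR (D H) u) M
      part-value H i le = trans (evalR-mul u (powP (N H) i) _) (trans (*-cong (evalR-pow u (N H) i) (evalR-pow u (D H) (M ℕ.∸ i))) (clear H M i le))
      term : ∀ j i → j ℕ.< M → i ℕ.< M → evalR (P j i) u ≈ power t i * (power a j * K)
      term j i x y = trans (evalR-mul u (part F i) (part G j)) (trans (*-cong (part-value F i (ℕₚ.<⇒≤ y)) (part-value G j (ℕₚ.<⇒≤ x)))
        (solve 4 (λ p q r s → (p :* q) :* (r :* s) := p :* (r :* (q :* s))) refl _ _ _ _))
      inner : ∀ {n} (c : Vec ℚ n) f y → (∀ i → i ℕ.< n → evalR (f i) u ≈ power t i * y) → evalR (toList c) t * y ≈ evalR (combine c f) u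
      inner [] f y h = zeroˡ y
      inner (c ∷ cs) f y h = begin
        (ι c + t * evalR (toList cs) t) * y ≈⟨ solve 4 (λ c t e y → (c :+ t :* e) :* y := c :* y :+ e :* (t :* y)) refl _ _ _ _ ⟩
        ι c * y + evalR (toList cs) t * (t * y)
          ≈⟨ +-cong (*-congˡ (sym (trans (h 0 (s≤s z≤n)) (*-identityˡ y)))) (inner cs (f ∘ suc) (t * y) (λ i x → trans (h (suc i) (s≤s x)) (solve 3 (λ t p y → (t :* p) :* y := p :* (t :* y)) refl _ _ _))) ⟩
        ι c * evalR (f 0) u + evalR (combine cs (f ∘ suc)) u ≈⟨ +-congʳ (evalR-scale u c (f 0)) ⟨
        evalR (scaleP c (f 0)) u + evalR (combine cs (f ∘ suc)) u ≈⟨ evalR-add u (scaleP c (f 0)) _ ⟨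
        _ ∎
      outer : ∀ {m n} (c : Vec (Vec ℚ n) m) f y → (∀ j i → j ℕ.< m → i ℕ.< n → evalR (f j i) u ≈ power t i * (power a j * y)) →
        evalR₂ (toPoly2 c) t a * y ≈ evalR (combine₂ c f) u
      outer [] f y h = zeroˡ y
      outer (c ∷ cs) f y h = begin
        (evalR (toList c) t + a * evalR₂ (toPoly2 cs) t a) * y ≈⟨ solve 4 (λ c t e y → (c :+ t :* e) :* y := c :* y :+ e :* (t :* y)) refl _ _ _ _ ⟩
        evalR (toList c) t * y + evalR₂ (toPoly2 cs) t a * (a * y)
          ≈⟨ +-cong (inner c (f 0) y (λ i x → trans (h 0 i (s≤s z≤n) x) (*-congˡ (*-identityˡ y))))
               (outer cs (f ∘ suc) (a * y) (λ j i x z → trans (h (suc j) i (s≤s x) z) (*-congˡ (solve 3 (λ t p y → (t :* p) :* y := p :* (t :* y)) refl _ _ _)))) ⟩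
        evalR (combine c (f 0)) u + evalR (combine₂ cs (f ∘ suc)) u ≈⟨ evalR-add u (combine c (f 0)) _ ⟨
        _ ∎

-- Series that are rational in `U`

module Rational where
  open import Data.Integer using (+_)
  open import Data.List as List using (List; []; _∷_)
  open import Data.Nat as ℕ using (ℕ; zero; suc)
  import Data.Nat.Properties as ℕₚ
  open import Data.Product using (Σ; _×_; _,_; proj₁; proj₂)
  open import Data.Rational as ℚ using (ℚ; 0ℚ; 1ℚ; _/_)
  import Data.Rational.Properties as ℚₚ
  open import Relation.Binary.PropositionalEquality as ≡ using (_≡_; _≢_)
  open import Defs hiding (_≈_)
  open Series
  open Local
  open Expr
  open Tower
  open Algebraic

  ∂ᴱ : Expr → Expr
  ∂ᴱ (conᴱ q) = conᴱ 0ℚ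
  ∂ᴱ (varᴱ zero) = conᴱ 1ℚ
  ∂ᴱ (varᴱ (suc v)) = conᴱ 0ℚ
  ∂ᴱ (e +ᴱ f) = ∂ᴱ e +ᴱ ∂ᴱ f
  ∂ᴱ (e *ᴱ f) = ∂ᴱ e *ᴱ f +ᴱ e *ᴱ ∂ᴱ f
  ∂ᴱ (geoᴱ e) = ∂ᴱ e *ᴱ (geoᴱ e *ᴱ geoᴱ e)

  module ParameterSolution (A : Loc) where
    open Loc A
    open Evaluation A using (only)
    open import Relation.Binary.Reasoning.Setoid setoid
    open Solver using (solve; _:+_; _:*_; _:=_; _:-_; con)

    -- The equation of `U` gives `tT² = U/(1+U+U²)`, that of `T` then gives `T = 1 + 3tT²`, and
    -- dividing gives `t`: both are functions of `U` alone.
    tᴱ-value : ∀ U T t → ε U ≡ 0ℚ → T ≈ 1# + ι threeℚ * t * T * T → U ≈ t * T * T * (1# + U + U * U) →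
      Eval.eval A (only U) tᴱ ≈ t
    tᴱ-value U T t U₀ hT hU = begin
      F.ν * (F.T⁻¹ * F.T⁻¹) ≈⟨ *-congʳ ν≈ ⟩
      (t * T * T) * (F.T⁻¹ * F.T⁻¹) ≈⟨ solve 3 (λ t T i → (t :* T :* T) :* (i :* i) := t :* ((T :* i) :* (T :* i))) refl t T F.T⁻¹ ⟩
      t * ((T * F.T⁻¹) * (T * F.T⁻¹)) ≈⟨ *-congˡ (*-cong inv inv) ⟩
      t * (1# * 1#) ≈⟨ trans (*-congˡ (*-identityˡ _)) (*-identityʳ t) ⟩
      t ∎
      where
      module F = ParameterFacts A (only U) U₀
      ν≈ : F.ν ≈ t * T * T
      ν≈ = begin
        U * F.δ ≈⟨ *-congʳ hU ⟩
        (t * T * T * (1# + U + U * U)) * F.δ ≈⟨ solve 4 (λ n o U d → (n :* (o :+ U :+ U :* U)) :* d := n :* ((o :+ (U :+ U :* U)) :* d)) refl (t * T * T) 1# U F.δ ⟩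
        (t * T * T) * ((1# + (U + U * U)) * F.δ) ≈⟨ trans (*-congˡ F.δ-inverse) (*-identityʳ _) ⟩
        t * T * T ∎
      T≈ : F.T ≈ T
      T≈ = begin
        ι 1ℚ + ι threeℚ * F.ν ≈⟨ +-cong ι-1 (*-congˡ ν≈) ⟩
        1# + ι threeℚ * (t * T * T) ≈⟨ +-congˡ (solve 3 (λ c t T → c :* (t :* T :* T) := c :* t :* T :* T) refl (ι threeℚ) t T) ⟩
        1# + ι threeℚ * t * T * T ≈⟨ hT ⟨
        T ∎
      inv : T * F.T⁻¹ ≈ 1#
      inv = trans (*-congʳ (sym T≈)) F.T-inverse

    module Derivation (θ : Carrier → Carrier) (θ-cong : ∀ {a b} → a ≈ b → θ a ≈ θ b)
      (θ-+ : ∀ a b → θ (a + b) ≈ θ a + θ b) (θ-* : ∀ a b → θ (a * b) ≈ θ a * b + a * θ b) (θ-ι : ∀ q → θ (ι q) ≈ 0#) where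

      -- Differentiating `g = 1 + y g` gives `(1 - y) θg = θx g`, and `g` itself is the inverse of
      -- `1 - y`.
      θ-geo : ∀ x → θ (geo x) ≈ θ x * (geo x * geo x)
      θ-geo x = begin
        θ g ≈⟨ trans (*-congˡ geo-one) (*-identityʳ _) ⟨
        θ g * (g - y * g) ≈⟨ solve 3 (λ d g y → d :* (g :- y :* g) := g :* (d :- y :* d)) refl (θ g) g y ⟩
        g * (θ g - y * θ g) ≈⟨ *-congˡ (+-congʳ θg) ⟩
        g * ((θ x * g + y * θ g) - y * θ g) ≈⟨ solve 4 (λ x g y d → g :* ((x :* g :+ y :* d) :- y :* d) := x :* (g :* g)) refl (θ x) g y (θ g) ⟩
        θ x * (g * g) ∎
        where
        g = geo x
        y = x + ι (ℚ.- ε x)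
        geo-one : g - y * g ≈ 1#
        geo-one = trans (+-congʳ (geo-law x)) (solve 2 (λ o a → (o :+ a) :- a := o) refl 1# (y * g))
        θg : θ g ≈ θ x * g + y * θ g
        θg = begin
          θ g ≈⟨ θ-cong (geo-law x) ⟩
          θ (1# + y * g) ≈⟨ trans (θ-+ _ _) (+-cong (trans (θ-cong (sym ι-1)) (θ-ι 1ℚ)) (θ-* y g)) ⟩
          0# + (θ y * g + y * θ g) ≈⟨ +-identityˡ _ ⟩
          θ y * g + y * θ g ≈⟨ +-congʳ (*-congʳ (trans (θ-+ _ _) (trans (+-congˡ (θ-ι _)) (+-identityʳ _)))) ⟩
          θ x * g + y * θ g ∎

      chain : ∀ u e → θ (Eval.eval A (only u) e) ≈ θ u * Eval.eval A (only u) (∂ᴱ e)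
      chain u (conᴱ q) = trans (θ-ι q) (sym (trans (*-congˡ ι-0) (zeroʳ _)))
      chain u (varᴱ zero) = sym (trans (*-congˡ ι-1) (*-identityʳ _))
      chain u (varᴱ (suc v)) = trans (trans (θ-cong (sym ι-0)) (θ-ι 0ℚ)) (sym (trans (*-congˡ ι-0) (zeroʳ _)))
      chain u (e +ᴱ f) = trans (θ-+ _ _) (trans (+-cong (chain u e) (chain u f)) (sym (distribˡ _ _ _)))
      chain u (e *ᴱ f) = trans (θ-* _ _) (trans (+-cong (*-congʳ (chain u e)) (*-congˡ (chain u f)))
        (solve 5 (λ d x y x′ y′ → (d :* x′) :* y :+ x :* (d :* y′) := d :* (x′ :* y :+ x :* y′)) refl (θ u) _ _ _ _))
      chain u (geoᴱ e) = trans (θ-geo _) (trans (*-congʳ (chain u e)) (*-assoc _ _ _))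

      -- The chain rule turns `θt = t` into `θU t′(U) = t`. The inverse of `t′` is written as
      -- `geo (1 - t′)`, which is legitimate because `t′` is 1 at the origin.
      θUᴱ : Expr
      θUᴱ = tᴱ *ᴱ geoᴱ (oneE +ᴱ negE (∂ᴱ tᴱ))

      θU-value : ∀ U t → ε U ≡ 0ℚ → Eval.eval A (only U) tᴱ ≈ t → θ t ≈ t → θ U ≈ Eval.eval A (only U) θUᴱ
      θU-value U t U₀ ht θt = begin
        θ U ≈⟨ trans (*-congˡ inv) (*-identityʳ _) ⟨
        θ U * (t′ * g) ≈⟨ *-assoc _ _ _ ⟨
        (θ U * t′) * g ≈⟨ *-congʳ (trans (sym (chain U tᴱ)) (trans (θ-cong ht) (trans θt (sym ht)))) ⟩
        v tᴱ * g ∎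
        where
        v = Eval.eval A (only U)
        t′ = v (∂ᴱ tᴱ)
        c = ι 1ℚ + ι (ℚ.- 1ℚ) * t′
        g = geo c
        vanishes : Vanishing.Vanishes A (only U)
        vanishes zero = U₀
        vanishes (suc n) = LocFacts.ε-0 A
        c₀ : ε c ≡ 0ℚ
        -- A computation at the origin: `t = U + O(U²)`, so `1 - t′` vanishes there.
        c₀ = Vanishing.ε-eval A (only U) vanishes (oneE +ᴱ negE (∂ᴱ tᴱ))
        inv : t′ * g ≈ 1#
        inv = trans (*-congʳ (trans (solve 1 (λ t → t := con 1ℚ :- (con 1ℚ :+ con (ℚ.- 1ℚ) :* t)) refl t′) (+-congʳ ι-1))) (LocFacts.geo-inverse A c c₀)

  module Euler (A : Loc) where
    open Loc A
    open PS A
    open import Relation.Binary.Reasoning.Setoid setoid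
    open Solver using (solve; _:+_; _:*_; _:=_; _:-_; con)

    θ : Ser → Ser
    θ f n = ι (nat n) * f n

    θ-* : ∀ f g n → θ (f ✶ g) n ≈ (θ f ✶ g) n + (f ✶ θ g) n
    θ-* f g zero = solve 2 (λ a b → con 0ℚ :* (a :* b) := (con 0ℚ :* a) :* b :+ a :* (con 0ℚ :* b)) refl (f 0) (g 0)
    θ-* f g (suc n) = begin
      ι (1ℚ ℚ.+ nat n) * (f 0 * g (suc n) + (tl f ✶ g) n) ≈⟨ trans (*-congʳ (ι-+ 1ℚ (nat n))) (solve 4 (λ k a b c → (con 1ℚ :+ k) :* (a :* b :+ c) := con 1ℚ :* c :+ (k :* c) :+ a :* ((con 1ℚ :+ k) :* b)) refl (ι (nat n)) (f 0) (g (suc n)) ((tl f ✶ g) n)) ⟩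
      ι 1ℚ * (tl f ✶ g) n + ι (nat n) * (tl f ✶ g) n + f 0 * ((ι 1ℚ + ι (nat n)) * g (suc n))
        ≈⟨ +-cong (+-cong (trans (*-congʳ ι-1) (*-identityˡ _)) (θ-* (tl f) g n)) (*-congˡ (*-congʳ (sym (ι-+ 1ℚ (nat n))))) ⟩
      (tl f ✶ g) n + ((θ (tl f) ✶ g) n + (tl f ✶ θ g) n) + f 0 * θ g (suc n)
        ≈⟨ solve 6 (λ a b c d z g → a :+ (b :+ c) :+ d := ((con 0ℚ :* z) :* g :+ (a :+ b)) :+ (d :+ c)) refl _ _ _ _ (f 0) (g (suc n)) ⟩
      ((ι 0ℚ * f 0) * g (suc n) + ((tl f ✶ g) n + (θ (tl f) ✶ g) n)) + (f 0 * θ g (suc n) + (tl f ✶ θ g) n)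
        ≈⟨ +-congʳ (+-congˡ (trans (sym (✶-distribʳ g (tl f) (θ (tl f)) n)) (✶-cong {g = g} (λ i → sym (trans (*-congʳ (ι-+ 1ℚ (nat i))) (trans (distribʳ _ _ _) (+-congʳ (trans (*-congʳ ι-1) (*-identityˡ _)))))) (λ _ → refl) n))) ⟩
      ((ι 0ℚ * f 0) * g (suc n) + (tl (θ f) ✶ g) n) + (f 0 * θ g (suc n) + (tl f ✶ θ g) n) ∎

    module S = Loc loc

    θ-ι : ∀ q → θ (κ (ι q)) S.≈ S.0#
    θ-ι q zero = trans (*-congʳ ι-0) (zeroˡ _)
    θ-ι q (suc n) = zeroʳ _

    θ-X : θ X S.≈ X
    θ-X zero = zeroʳ _
    θ-X (suc zero) = trans (*-identityʳ _) ι-1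
    θ-X (suc (suc n)) = zeroʳ _

    open ParameterSolution loc
    module D = Derivation θ (λ p n → *-congˡ (p n)) (λ f g n → distribˡ _ _ _) θ-* θ-ι

  𝔽 : Loc
  𝔽 = PS.loc ℚLoc

  private
    module 𝔽 = Loc 𝔽
    module P = PS ℚLoc

  const≈ : ∀ q → const q 𝔽.≈ P.κ q
  const≈ q zero = ≡.refl
  const≈ q (suc n) = ≡.refl

  tSer≈ : tSer 𝔽.≈ P.X
  tSer≈ zero = ≡.refl
  tSer≈ (suc zero) = ≡.refl
  tSer≈ (suc (suc n)) = ≡.refl

  -- The two convolutions list their summands from opposite ends, so the right factor has to be
  -- peeled with `✶-tlʳ`.
  ⊗≈✶ : ∀ A B → A ⊗ B 𝔽.≈ A P.✶ B
  ⊗≈✶ A B zero = ≡.refl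
  ⊗≈✶ A B (suc n) = ≡.trans (≡.cong₂ ℚ._+_ (≡.cong (λ k → A (suc n) ℚ.* B k) (ℕₚ.n∸n≡0 n)) (shifted n ℕₚ.≤-refl))
    (≡.trans (ℚₚ.+-comm (A (suc n) ℚ.* B 0) ((A ⊗ P.tl B) n)) (≡.trans (≡.cong (ℚ._+ A (suc n) ℚ.* B 0) (⊗≈✶ A (P.tl B) n)) (≡.sym (P.✶-tlʳ A B n))))
    where
    shifted : ∀ i → i ℕ.≤ n → convo A B (suc n) i ≡ convo A (P.tl B) n i
    shifted zero _ = ≡.refl
    shifted (suc i) le = ≡.cong₂ ℚ._+_ (≡.cong (λ k → A (suc i) ℚ.* B k) (ℕₚ.+-∸-assoc 1 le)) (shifted i (ℕₚ.≤-trans (ℕₚ.n≤1+n i) le))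

  open Evaluation 𝔽

  ⊗-cong : ∀ {A A′ B B′} → A 𝔽.≈ A′ → B 𝔽.≈ B′ → A ⊗ B 𝔽.≈ A′ 𝔽.* B′
  ⊗-cong {A} {A′} {B} {B′} p q = 𝔽.trans (⊗≈✶ A B) (𝔽.*-cong {A} {A′} {B} {B′} p q)

  evalP≈ : ∀ p X → evalP p X 𝔽.≈ evalR p X
  evalP≈ [] X = const≈ 0ℚ
  evalP≈ (a ∷ p) X n = ≡.cong₂ ℚ._+_ (const≈ a n) (⊗-cong {X} {X} (λ _ → ≡.refl) (evalP≈ p X) n)

  evalY≈ : ∀ P Y → evalY P Y 𝔽.≈ evalR₂ P tSer Y
  evalY≈ [] Y = const≈ 0ℚ
  evalY≈ (c ∷ P) Y n = ≡.cong₂ ℚ._+_ (evalP≈ c tSer n) (⊗-cong {Y} {Y} (λ _ → ≡.refl) (evalY≈ P Y) n)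

  module Parametrization (T U : FPS)
    (hT : T 𝔽.≈ const 1ℚ ⊕ const (+ 3 / 1) ⊗ tSer ⊗ T ⊗ T)
    (hU : U 𝔽.≈ tSer ⊗ T ⊗ T ⊗ (const 1ℚ ⊕ U ⊕ U ⊗ U)) where

    private
      same : ∀ A → A 𝔽.≈ A
      same A n = ≡.refl

      hT′ : T 𝔽.≈ 𝔽.1# 𝔽.+ 𝔽.ι threeℚ 𝔽.* tSer 𝔽.* T 𝔽.* T
      hT′ n = ≡.trans (hT n) (≡.cong₂ ℚ._+_ (const≈ 1ℚ n)
        (⊗-cong {B = T} (⊗-cong {B = T} (⊗-cong {B = tSer} (const≈ (+ 3 / 1)) (same tSer)) (same T)) (same T) n))

      hU′ : U 𝔽.≈ tSer 𝔽.* T 𝔽.* T 𝔽.* (𝔽.1# 𝔽.+ U 𝔽.+ U 𝔽.* U)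
      hU′ n = ≡.trans (hU n) (⊗-cong (⊗-cong {B = T} (⊗≈✶ tSer T) (same T)) (λ m → ≡.cong₂ ℚ._+_ (≡.cong (ℚ._+ U m) (const≈ 1ℚ m)) (⊗≈✶ U U m)) n)

    U₀ : U 0 ≡ 0ℚ
    U₀ = ≡.trans (hU′ 0) (≡.trans (≡.cong (λ z → z ℚ.* T 0 ℚ.* q) (ℚₚ.*-zeroˡ (T 0))) (≡.trans (≡.cong (ℚ._* q) (ℚₚ.*-zeroˡ (T 0))) (ℚₚ.*-zeroˡ q)))
      where q = 1ℚ ℚ.+ U 0 ℚ.+ U 0 ℚ.* U 0

    value : Expr → FPS
    value = Eval.eval 𝔽 (only U)

    t≈ : value tᴱ 𝔽.≈ tSer
    t≈ = ParameterSolution.tᴱ-value 𝔽 U T tSer U₀ hT′ hU′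

    Representable : FPS → Set
    Representable A = Σ Expr λ e → A 𝔽.≈ value e

    θU≈ : Euler.θ ℚLoc U 𝔽.≈ value (Euler.D.θUᴱ ℚLoc)
    θU≈ = Euler.D.θU-value ℚLoc U tSer U₀ t≈ (λ n → ≡.trans (≡.cong (nat n ℚ.*_) (tSer≈ n)) (≡.trans (Euler.θ-X ℚLoc n) (≡.sym (tSer≈ n))))

    -- The factor `n` is the operator `t d/dt`, which acts on an expression in `U` as its derivative
    -- times `θU`. It is applied with `c = 2 - 2h`.
    pointing : ∀ {A} c → Representable A → Representable (λ n → (nat n ℚ.+ c) ℚ.* A n)
    pointing {A} c (e , p) = Euler.D.θUᴱ ℚLoc *ᴱ ∂ᴱ e +ᴱ conᴱ c *ᴱ e , λ n →
      ≡.trans (ℚₚ.*-distribʳ-+ (A n) (nat n) c) (≡.cong₂ ℚ._+_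
        (≡.trans (≡.cong (nat n ℚ.*_) (p n)) (≡.trans (Euler.D.chain ℚLoc U e n) (𝔽.*-congʳ {value (∂ᴱ e)} {Euler.θ ℚLoc U} {value (Euler.D.θUᴱ ℚLoc)} θU≈ n)))
        (≡.trans (≡.cong (c ℚ.*_) (p n)) (≡.sym (P.κ-✶ c (value e) n))))

    difference : ∀ {A B} → Representable A → Representable B → Representable (λ n → A n ℚ.- B n)
    difference {A} {B} (e , p) (f , q) = e +ᴱ negE f , λ n → ≡.cong₂ ℚ._+_ (p n)
      (≡.trans (≡.cong ℚ.-_ (q n)) (≡.trans (neg (value f n)) (≡.sym (P.κ-✶ (ℚ.- 1ℚ) (value f) n))))
      where
      neg : ∀ x → ℚ.- x ≡ (ℚ.- 1ℚ) ℚ.* x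
      neg x = ≡.trans (≡.cong ℚ.-_ (≡.sym (ℚₚ.*-identityˡ x))) (ℚₚ.neg-distribˡ-* 1ℚ x)

    rational : ∀ {A} → Representable A → IsRationalIn A U
    rational {A} (e , p) = N , D , (0 , λ z → 1≢0 (≡.trans (≡.sym unit) (≡.trans (≡.sym (evalP≈ D U 0)) z))) ,
      𝔽.trans (⊗-cong {B = A} (evalP≈ D U) p) (𝔽.trans {evalR D U 𝔽.* value e} {evalR N U} equation (𝔽.sym {evalP N U} (evalP≈ N U)))
      where
      open Fraction (fraction U e)
      1≢0 : 1ℚ ≢ 0ℚ
      1≢0 ()

    algebraicity : ∀ {A} → Representable A → IsAlgebraic A
    algebraicity {A} (e , p) = proj₁ dependence , proj₁ (proj₂ dependence) ,
      λ n → ≡.trans (evalY≈ (proj₁ dependence) A n) (≡.trans (proj₂ (proj₂ dependence) n) (≡.sym (const≈ 0ℚ n)))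
      where
      dependence : Σ Poly2 λ P → NonZeroPoly2 P × evalR₂ P tSer A 𝔽.≈ 𝔽.0#
      dependence = algebraic (fraction-cong {U} {value tᴱ} {tSer} t≈ (fraction U tᴱ)) (fraction-cong {U} {value e} {A} (λ n → ≡.sym (p n)) (fraction U e))

-- Orbits and chains of flags

module Counting where
  open import Data.Bool using (Bool; true; false; _∧_; if_then_else_)
  open import Data.Empty using (⊥-elim)
  open import Data.Fin as Fin using (Fin)
  open import Data.List as List using (List; []; _∷_; _++_; allFin; concatMap; map; length)
  import Data.List.Properties as Listₚ
  open import Data.List.Membership.Propositional using (_∈_)
  open import Data.List.Membership.Propositional.Properties using (∈-allFin)
  open import Data.List.Relation.Binary.Permutation.Propositional using (_↭_)
  open import Data.List.Relation.Binary.Permutation.Propositional.Properties using (map⁺)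
  open import Data.List.Relation.Unary.Any using (here; there)
  open import Data.List.Relation.Unary.All using (All; []; _∷_)
  import Data.List.Relation.Unary.All as All
  open import Data.List.Relation.Unary.AllPairs using ([]; _∷_)
  open import Data.List.Relation.Unary.Unique.Propositional using (Unique)
  open import Data.List.Relation.Unary.Unique.Propositional.Properties using (allFin⁺)
  open import Data.Nat using (ℕ; suc; _+_; _*_)
  open import Data.Nat.ListAction using (sum)
  open import Data.Nat.ListAction.Properties using (sum-++; sum-↭)
  import Data.Nat.Properties as ℕₚ
  open import Data.Product using (_×_; _,_)
  open import Data.Vec as Vec using (Vec; []; _∷_)
  open import Function using (_∘_)
  open import Relation.Binary.PropositionalEquality
  open import Relation.Nullary using (yes; no)
  open import Defs using (allVecs; _==_; Fun)

  private
    variable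
      A B : Set

  sumOver : List A → (A → ℕ) → ℕ
  sumOver xs f = sum (map f xs)

  indicator : Bool → ℕ
  indicator b = if b then 1 else 0

  sumOver-cong : ∀ (xs : List A) {f g : A → ℕ} → (∀ x → f x ≡ g x) → sumOver xs f ≡ sumOver xs g
  sumOver-cong xs p = cong sum (Listₚ.map-cong p xs)

  sumOver-∈ : ∀ (xs : List A) {f g : A → ℕ} → (∀ x → x ∈ xs → f x ≡ g x) → sumOver xs f ≡ sumOver xs g
  sumOver-∈ [] p = refl
  sumOver-∈ (x ∷ xs) p = cong₂ _+_ (p x (here refl)) (sumOver-∈ xs (λ y m → p y (there m)))

  sumOver-++ : ∀ (xs ys : List A) (f : A → ℕ) → sumOver (xs ++ ys) f ≡ sumOver xs f + sumOver ys f
  sumOver-++ xs ys f = trans (cong sum (Listₚ.map-++ f xs ys)) (sum-++ (map f xs) (map f ys))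

  sumOver-↭ : ∀ {xs ys : List A} (f : A → ℕ) → xs ↭ ys → sumOver xs f ≡ sumOver ys f
  sumOver-↭ f p = sum-↭ (map⁺ f p)

  sumOver-0 : ∀ (xs : List A) {f : A → ℕ} → (∀ x → x ∈ xs → f x ≡ 0) → sumOver xs f ≡ 0
  sumOver-0 [] p = refl
  sumOver-0 (x ∷ xs) p = cong₂ _+_ (p x (here refl)) (sumOver-0 xs (λ y m → p y (there m)))

  sumOver-const : ∀ (xs : List A) c → sumOver xs (λ _ → c) ≡ length xs * c
  sumOver-const [] c = refl
  sumOver-const (x ∷ xs) c = cong (c +_) (sumOver-const xs c)

  sumOver-+ : ∀ (xs : List A) (f g : A → ℕ) → sumOver xs (λ x → f x + g x) ≡ sumOver xs f + sumOver xs g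
  sumOver-+ [] f g = refl
  sumOver-+ (x ∷ xs) f g = trans (cong (f x + g x +_) (sumOver-+ xs f g))
    (trans (ℕₚ.+-assoc (f x) (g x) _) (trans (cong (f x +_) (trans (sym (ℕₚ.+-assoc (g x) _ _)) (trans (cong (_+ sumOver xs g) (ℕₚ.+-comm (g x) (sumOver xs f))) (ℕₚ.+-assoc (sumOver xs f) (g x) _)))) (sym (ℕₚ.+-assoc (f x) _ _))))

  sumOver-swap : ∀ (xs : List A) (ys : List B) (f : A → B → ℕ) →
    sumOver xs (λ x → sumOver ys (f x)) ≡ sumOver ys (λ y → sumOver xs (λ x → f x y))
  sumOver-swap [] ys f = sym (sumOver-0 ys (λ _ _ → refl))
  sumOver-swap (x ∷ xs) ys f = trans (cong (sumOver ys (f x) +_) (sumOver-swap xs ys f)) (sym (sumOver-+ ys (f x) _))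

  sumOver-concatMap : ∀ (h : A → List B) xs (f : B → ℕ) → sumOver (concatMap h xs) f ≡ sumOver xs (λ x → sumOver (h x) f)
  sumOver-concatMap h [] f = refl
  sumOver-concatMap h (x ∷ xs) f = trans (sumOver-++ (h x) (concatMap h xs) f) (cong (sumOver (h x) f +_) (sumOver-concatMap h xs f))

  sumOver-map : ∀ (h : A → B) xs (f : B → ℕ) → sumOver (map h xs) f ≡ sumOver xs (f ∘ h)
  sumOver-map h xs f = cong sum (sym (Listₚ.map-∘ xs))

  sumOver-single : ∀ {xs : List A} {a} (f : A → ℕ) → Unique xs → a ∈ xs → (∀ x → x ≢ a → f x ≡ 0) → sumOver xs f ≡ f a
  sumOver-single f (u ∷ us) (here refl) z = trans (cong (f _ +_) (sumOver-0 _ (λ x m → z x (λ e → All.lookup u m (sym e))))) (ℕₚ.+-identityʳ _)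
  sumOver-single f (u ∷ us) (there m) z = cong₂ _+_ (z _ (All.lookup u m)) (sumOver-single f us m z)

  sumOver-Fin : ∀ {m} (a : Fin m) (f : Fin m → ℕ) → (∀ x → x ≢ a → f x ≡ 0) → sumOver (allFin m) f ≡ f a
  sumOver-Fin {m} a f z = sumOver-single f (allFin⁺ m) (∈-allFin a) z

  sumOver-Vec : ∀ {m k} (w : Vec (Fin m) k) (f : Vec (Fin m) k → ℕ) → (∀ v → v ≢ w → f v ≡ 0) → sumOver (allVecs (allFin m) k) f ≡ f w
  sumOver-Vec {m} [] f z = ℕₚ.+-identityʳ (f [])
  sumOver-Vec {m} {suc k} (a ∷ w) f z = begin
    sumOver (concatMap (λ v → map (_∷ v) (allFin m)) (allVecs (allFin m) k)) f ≡⟨ sumOver-concatMap (λ v → map (_∷ v) (allFin m)) (allVecs (allFin m) k) f ⟩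
    sumOver (allVecs (allFin m) k) (λ v → sumOver (map (_∷ v) (allFin m)) f)
      ≡⟨ sumOver-cong (allVecs (allFin m) k) (λ v → trans (sumOver-map (_∷ v) (allFin m) f) (sumOver-Fin a (λ x → f (x ∷ v)) (λ x x≢a → z (x ∷ v) (λ { refl → x≢a refl })))) ⟩
    sumOver (allVecs (allFin m) k) (λ v → f (a ∷ v)) ≡⟨ sumOver-Vec w (λ v → f (a ∷ v)) (λ v v≢w → z (a ∷ v) (λ { refl → v≢w refl })) ⟩
    f (a ∷ w) ∎
    where
    open ≡-Reasoning

  ∧-true : ∀ {a b} → a ∧ b ≡ true → a ≡ true × b ≡ true
  ∧-true {true} {true} _ = refl , refl

  true-∧ : ∀ {a b} → a ≡ true → b ≡ true → a ∧ b ≡ true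
  true-∧ refl refl = refl

  not-true : ∀ {a} → a ≢ true → a ≡ false
  not-true {true} h = ⊥-elim (h refl)
  not-true {false} h = refl

  ==-true : ∀ {m} {x y : Fin m} → (x == y) ≡ true → x ≡ y
  ==-true {x = x} {y} h with x Fin.≟ y
  ... | yes p = p

  ==-refl : ∀ {m} (x : Fin m) → (x == x) ≡ true
  ==-refl x with x Fin.≟ x
  ... | yes _ = refl
  ... | no h = ⊥-elim (h refl)

  ==-false : ∀ {m} {x y : Fin m} → x ≢ y → (x == y) ≡ false
  ==-false h = not-true (λ e → h (==-true e))

  module Triples (m : ℕ) where
    Triple : Set
    Triple = Fun m × Fun m × Fun m

    private
      fs : List (Fun m)
      fs = allVecs (allFin m) m

    count : (Triple → Bool) → ℕ
    count Q = sumOver fs λ s₀ → sumOver fs λ s₁ → sumOver fs λ s₂ → indicator (Q (s₀ , s₁ , s₂))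

    count-cong : ∀ {Q R : Triple → Bool} → (∀ τ → Q τ ≡ R τ) → count Q ≡ count R
    count-cong p = sumOver-cong fs λ s₀ → sumOver-cong fs λ s₁ → sumOver-cong fs λ s₂ → cong indicator (p (s₀ , s₁ , s₂))

    count-0 : ∀ {Q} → (∀ τ → Q τ ≢ true) → count Q ≡ 0
    count-0 p = sumOver-0 fs λ s₀ _ → sumOver-0 fs λ s₁ _ → sumOver-0 fs λ s₂ _ → cong indicator (not-true (p (s₀ , s₁ , s₂)))

    count-1 : ∀ {Q} τ → Q τ ≡ true → (∀ σ → Q σ ≡ true → σ ≡ τ) → count Q ≡ 1
    count-1 {Q} (s₀ , s₁ , s₂) q u =
      trans (sumOver-Vec s₀ _ (λ r₀ h → sumOver-0 fs λ r₁ _ → sumOver-0 fs λ r₂ _ → zeroes (λ { refl → h refl })))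
      (trans (sumOver-Vec s₁ _ (λ r₁ h → sumOver-0 fs λ r₂ _ → zeroes (λ { refl → h refl })))
      (trans (sumOver-Vec s₂ _ (λ r₂ h → zeroes (λ { refl → h refl }))) (cong indicator q)))
      where
      zeroes : ∀ {σ} → σ ≢ (s₀ , s₁ , s₂) → indicator (Q σ) ≡ 0
      zeroes {σ} h = cong indicator (not-true (λ e → h (u σ e)))

    -- One step of the exploration: the triples are sorted by the image of a chosen flag.
    count-split : ∀ Q (f : Triple → Fin m) → count Q ≡ sumOver (allFin m) (λ y → count (λ τ → Q τ ∧ (f τ == y)))
    count-split Q f = sym (trans (sumOver-swap (allFin m) fs _) (sumOver-cong fs λ s₀ →
      trans (sumOver-swap (allFin m) fs _) (sumOver-cong fs λ s₁ →
      trans (sumOver-swap (allFin m) fs _) (sumOver-cong fs λ s₂ → point (s₀ , s₁ , s₂)))))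
      where
      point : ∀ τ → sumOver (allFin m) (λ y → indicator (Q τ ∧ (f τ == y))) ≡ indicator (Q τ)
      point τ with Q τ
      ... | false = sumOver-0 (allFin m) (λ _ _ → refl)
      ... | true = trans (sumOver-Fin (f τ) _ (λ y h → cong indicator (==-false (h ∘ sym)))) (cong indicator (==-refl (f τ)))

    count-complement : ∀ (P Q : Triple → Bool) → count P ≡ count (λ τ → P τ ∧ Q τ) + count (λ τ → P τ ∧ Data.Bool.not (Q τ))
    count-complement P Q = trans (sumOver-cong fs λ s₀ → trans (sumOver-cong fs λ s₁ →
      trans (sumOver-cong fs λ s₂ → point (s₀ , s₁ , s₂)) (sumOver-+ fs _ _)) (sumOver-+ fs _ _)) (sumOver-+ fs _ _)
      where
      point : ∀ τ → indicator (P τ) ≡ indicator (P τ ∧ Q τ) + indicator (P τ ∧ Data.Bool.not (Q τ))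
      point τ with P τ | Q τ
      ... | false | _ = refl
      ... | true | true = refl
      ... | true | false = refl

module Orbits where
  open import Data.Bool using (Bool; true; false; _∧_; _∨_; not)
  open import Data.Bool.ListAction as BL using ()
  open import Data.Empty using (⊥; ⊥-elim)
  open import Data.Fin as Fin using (Fin; toℕ)
  import Data.Fin.Properties as Finₚ
  open import Data.List as List using (List; []; _∷_; allFin; map; length)
  open import Data.List.Membership.Propositional using (_∈_; find)
  open import Data.List.Membership.Propositional.Properties using (∈-allFin)
  open import Data.List.Relation.Unary.Any as Any using (Any; here; there)
  open import Data.List.Relation.Unary.All as All using (All; []; _∷_)
  open import Data.List.Relation.Unary.AllPairs using (AllPairs; []; _∷_)
  open import Data.Nat as ℕ using (ℕ; zero; suc; _+_; _≤_; _<_; z≤n; s≤s; _≤ᵇ_)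
  import Data.Nat.Properties as ℕₚ
  open import Data.Nat.Induction using (<-wellFounded; Acc; acc)
  open import Data.Product using (_×_; _,_; Σ; ∃; proj₁; proj₂)
  open import Data.Sum using (_⊎_; inj₁; inj₂)
  open import Function using (_∘_)
  open import Relation.Binary.PropositionalEquality
  open import Relation.Nullary using (¬_; yes; no)
  open import Defs using (Fun; app; _==_; allF; step; iter; orbit; numOrbits; transitive)
  open Counting

  all-true : ∀ {A : Set} (p : A → Bool) xs → BL.all p xs ≡ true → ∀ {x} → x ∈ xs → p x ≡ true
  all-true p (x ∷ xs) h (here refl) = proj₁ (∧-true h)
  all-true p (x ∷ xs) h (there m) = all-true p xs (proj₂ (∧-true {p x} h)) m

  true-all : ∀ {A : Set} (p : A → Bool) xs → (∀ {x} → x ∈ xs → p x ≡ true) → BL.all p xs ≡ true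
  true-all p [] h = refl
  true-all p (x ∷ xs) h = true-∧ (h (here refl)) (true-all p xs (h ∘ there))

  ∨-true : ∀ {a b} → a ∨ b ≡ true → a ≡ true ⊎ b ≡ true
  ∨-true {true} _ = inj₁ refl
  ∨-true {false} h = inj₂ h

  true-∨ʳ : ∀ a {b} → b ≡ true → a ∨ b ≡ true
  true-∨ʳ true _ = refl
  true-∨ʳ false h = h

  true-∨ˡ : ∀ {a} b → a ≡ true → a ∨ b ≡ true
  true-∨ˡ b refl = refl

  any-true : ∀ {A : Set} (p : A → Bool) xs → BL.any p xs ≡ true → ∃ λ x → x ∈ xs × p x ≡ true
  any-true p (x ∷ xs) h with ∨-true {p x} h
  ... | inj₁ q = x , here refl , q
  ... | inj₂ q with any-true p xs q
  ... | y , m , r = y , there m , r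

  true-any : ∀ {A : Set} (p : A → Bool) xs {x} → x ∈ xs → p x ≡ true → BL.any p xs ≡ true
  true-any p (x ∷ xs) (here refl) q = true-∨ˡ _ q
  true-any p (x ∷ xs) (there m) q = true-∨ʳ (p x) (true-any p xs m q)

  allF-true : ∀ {m} (p : Fin m → Bool) → allF p ≡ true → ∀ x → p x ≡ true
  allF-true {m} p h x = all-true p (allFin m) h (∈-allFin x)

  true-allF : ∀ {m} (p : Fin m → Bool) → (∀ x → p x ≡ true) → allF p ≡ true
  true-allF {m} p h = true-all p (allFin m) (λ {x} _ → h x)

  module _ {m : ℕ} (gens : List (Fun m)) where

    data Reach : Fin m → Fin m → Set where
      stop : ∀ {x} → Reach x x
      go : ∀ {x z} g → g ∈ gens → Reach x z → Reach x (app g z)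

    private
      S : Fin m → ℕ → Fin m → Bool
      S x k = iter k (step gens) (_== x)

      sound : ∀ x k y → S x k y ≡ true → Reach x y
      sound x zero y h with refl ← ==-true h = stop
      sound x (suc k) y h with ∨-true {S x k y} h
      ... | inj₁ q = sound x k y q
      ... | inj₂ q with any-true _ (allFin m) q
      ... | z , _ , r with any-true _ gens (proj₂ (∧-true {S x k z} r))
      ... | g , mem , e with refl ← ==-true {x = app g z} e = go g mem (sound x k z (proj₁ (∧-true r)))

      Closed : (Fin m → Bool) → Set
      Closed P = ∀ g z → g ∈ gens → P z ≡ true → P (app g z) ≡ true

      advance : ∀ x k g z → g ∈ gens → S x k z ≡ true → S x (suc k) (app g z) ≡ true
      advance x k g z mem h = true-∨ʳ (S x k (app g z)) (true-any _ (allFin m) (∈-allFin z)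
        (true-∧ h (true-any _ gens mem (==-refl (app g z)))))

      closed-reach : ∀ x k → Closed (S x k) → ∀ {y} → S x k x ≡ true → Reach x y → S x k y ≡ true
      closed-reach x k c s stop = s
      closed-reach x k c s (go g mem r) = c g _ mem (closed-reach x k c s r)

      start : ∀ x k → S x k x ≡ true
      start x zero = ==-refl x
      start x (suc k) = true-∨ˡ _ (start x k)

      size : (Fin m → Bool) → ℕ
      size P = sumOver (allFin m) (λ y → indicator (P y))

      sum-mono : ∀ (xs : List (Fin m)) {f g : Fin m → ℕ} → (∀ y → f y ≤ g y) → sumOver xs f ≤ sumOver xs g
      sum-mono [] p = z≤n
      sum-mono (x ∷ xs) p = ℕₚ.+-mono-≤ (p x) (sum-mono xs p)

      sum-strict : ∀ (xs : List (Fin m)) {f g : Fin m → ℕ} → (∀ y → f y ≤ g y) → ∀ {y} → y ∈ xs → f y < g y → sumOver xs f < sumOver xs g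
      sum-strict (x ∷ xs) p (here refl) l = ℕₚ.+-mono-<-≤ l (sum-mono xs p)
      sum-strict (x ∷ xs) p (there mem) l = ℕₚ.+-mono-≤-< (p x) (sum-strict xs p mem l)

      size≤ : ∀ P → size P ≤ m
      size≤ P = ℕₚ.≤-trans (sum-mono (allFin m) (λ y → bit (P y))) (ℕₚ.≤-reflexive (trans (sumOver-const (allFin m) 1) (trans (ℕₚ.*-identityʳ _) (Listₚ.length-tabulate (λ x → x)))))
        where
        import Data.List.Properties as Listₚ
        bit : ∀ b → indicator b ≤ 1
        bit true = s≤s z≤n
        bit false = z≤n

      grow : ∀ x k y → indicator (S x k y) ≤ indicator (S x (suc k) y)
      grow x k y with S x k y
      ... | true = s≤s z≤n
      ... | false = z≤n

      -- A round that adds nothing shows the set to be closed. Otherwise the set grows each time,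
      -- and after `m` rounds it would have more than `m` elements.
      progress : ∀ x k → Closed (S x k) ⊎ suc k ≤ size (S x k)
      progress x zero = inj₂ (ℕₚ.≤-reflexive (sym (trans (sumOver-Fin x _ (λ y h → cong indicator (==-false h))) (cong indicator (==-refl x)))))
      progress x (suc k) with Finₚ.any? (λ y → (S x k y Data.Bool.≟ false) ×-dec (S x (suc k) y Data.Bool.≟ true))
        where
        open import Relation.Nullary.Decidable using (_×-dec_)
      ... | yes (y , f , t) with progress x k
      ... | inj₁ c = ⊥-elim (false≢true (trans (sym f) (closed-reach x k c (start x k) (sound x (suc k) y t))))
        where
        false≢true : false ≢ true
        false≢true ()
      ... | inj₂ l = inj₂ (ℕₚ.≤-trans (s≤s l) (sum-strict (allFin m) (grow x k) (∈-allFin y) (subst₂ (λ a b → indicator a < indicator b) (sym f) (sym t) (s≤s z≤n))))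
      progress x (suc k) | no h = inj₁ (λ g z mem p → true-∨ˡ _ (stable (app g z) (advance x k g z mem (stable z p))))
        where
        stable : ∀ y → S x (suc k) y ≡ true → S x k y ≡ true
        stable y t with S x k y Data.Bool.≟ true
        ... | yes p = p
        ... | no n = ⊥-elim (h (y , not-true n , t))

    orbit-sound : ∀ x y → orbit gens x y ≡ true → Reach x y
    orbit-sound x y = sound x m y

    orbit-complete : ∀ x y → Reach x y → orbit gens x y ≡ true
    orbit-complete x y r with progress x m
    ... | inj₁ c = closed-reach x m c (start x m) r
    ... | inj₂ l = ⊥-elim (ℕₚ.1+n≰n (ℕₚ.≤-trans l (size≤ (S x m))))

    transitive-reach : transitive gens ≡ true → ∀ x y → Reach x y
    transitive-reach h x y = orbit-sound x y (allF-true _ (allF-true _ h x) y)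

    reach-transitive : (∀ x y → Reach x y) → transitive gens ≡ true
    reach-transitive h = true-allF _ (λ x → true-allF _ (λ y → orbit-complete x y (h x y)))

    isLeast : Fin m → Bool
    isLeast x = allF λ y → not (orbit gens x y) ∨ (toℕ x ≤ᵇ toℕ y)

    isLeast-≤ : ∀ x → isLeast x ≡ true → ∀ y → Reach x y → toℕ x ≤ toℕ y
    isLeast-≤ x h y r with ∨-true {not (orbit gens x y)} (allF-true _ h y)
    ... | inj₁ q rewrite orbit-complete x y r with () ← q
    ... | inj₂ q = ℕₚ.≤ᵇ⇒≤ (toℕ x) (toℕ y) (subst Data.Bool.T (sym q) _)

    ≤-isLeast : ∀ x → (∀ y → Reach x y → toℕ x ≤ toℕ y) → isLeast x ≡ true
    ≤-isLeast x h = true-allF _ point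
      where
      point : ∀ y → not (orbit gens x y) ∨ (toℕ x ≤ᵇ toℕ y) ≡ true
      point y with orbit gens x y in eq
      ... | false = refl
      ... | true with toℕ x ≤ᵇ toℕ y | ℕₚ.≤⇒≤ᵇ (h y (orbit-sound x y eq))
      ... | true | _ = refl

    module _ (_~_ : Fin m → Fin m → Set) (~-sym : ∀ {x y} → x ~ y → y ~ x) (~-trans : ∀ {x y z} → x ~ y → y ~ z → x ~ z)
             (to : ∀ {x y} → x ~ y → Reach x y) (from : ∀ {x y} → Reach x y → x ~ y) where

      private
        least : ∀ y → Acc _<_ (toℕ y) → Σ (Fin m) λ z → y ~ z × isLeast z ≡ true
        least y (acc rec) with isLeast y in eq
        ... | true = y , from stop , eq
        ... | false with Finₚ.any? (λ z → (orbit gens y z Data.Bool.≟ true) ×-dec (toℕ z ℕ.<? toℕ y))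
          where
          open import Relation.Nullary.Decidable using (_×-dec_)
        ... | yes (z , o , l) with least z (rec l)
        ... | w , zw , q = w , ~-trans (from (orbit-sound y z o)) zw , q
        least y (acc rec) | false | no h with () ← trans (sym eq) (≤-isLeast y (λ z r → ℕₚ.≮⇒≥ (λ l → h (z , orbit-complete y z r , l))))

        sum-one : ∀ {A : Set} (q : A → Bool) {xs} → Any (λ r → q r ≡ true) xs → AllPairs (λ r s → ¬ (q r ≡ true × q s ≡ true)) xs →
          sumOver xs (λ r → indicator (q r)) ≡ 1
        sum-one q {x ∷ xs} (here h) (u ∷ us) rewrite h = cong suc (sumOver-0 xs (λ y mem → cong indicator (not-true (λ e → All.lookup u mem (refl , e)))))
        sum-one q {x ∷ xs} (there h) (u ∷ us) = cong₂ _+_ (cong indicator (not-true (λ e → absurd e))) (sum-one q h us)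
          where
          absurd : q x ≡ true → ⊥
          absurd e with find h
          ... | y , mem , e′ = All.lookup u mem (e , e′)

      -- Double counting of pairs of a least element and a representative of its class: every class
      -- contains exactly one of each.
      numOrbits-transversal : ∀ rs → AllPairs (λ r s → ¬ (r ~ s)) rs → (∀ x → Any (x ~_) rs) → numOrbits gens ≡ length rs
      numOrbits-transversal rs distinct cover = begin
        sumOver (allFin m) (λ x → indicator (isLeast x))
          ≡⟨ sumOver-cong (allFin m) by-class ⟩
        sumOver (allFin m) (λ x → sumOver rs (λ r → indicator (isLeast x ∧ orbit gens r x)))
          ≡⟨ sumOver-swap (allFin m) rs _ ⟩
        sumOver rs (λ r → sumOver (allFin m) (λ x → indicator (isLeast x ∧ orbit gens r x)))
          ≡⟨ sumOver-cong rs one-least ⟩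
        sumOver rs (λ _ → 1) ≡⟨ trans (sumOver-const rs 1) (ℕₚ.*-identityʳ _) ⟩
        length rs ∎
        where
        open ≡-Reasoning
        o~ : ∀ {r x} → orbit gens r x ≡ true → r ~ x
        o~ {r} {x} h = from (orbit-sound r x h)
        by-class : ∀ x → indicator (isLeast x) ≡ sumOver rs (λ r → indicator (isLeast x ∧ orbit gens r x))
        by-class x with isLeast x
        ... | false = sym (sumOver-0 rs (λ _ _ → refl))
        ... | true = sym (sum-one (λ r → orbit gens r x) (Any.map (λ {r} p → orbit-complete r x (to (~-sym p))) (cover x))
                       (AllPairs.map (λ n (a , b) → n (~-trans (o~ a) (~-sym (o~ b)))) distinct))
          where
          import Data.List.Relation.Unary.AllPairs as AllPairs
        one-least : ∀ r → sumOver (allFin m) (λ x → indicator (isLeast x ∧ orbit gens r x)) ≡ 1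
        one-least r with least r (<-wellFounded (toℕ r))
        ... | z , rz , lz = trans (sumOver-Fin z _ others) (cong indicator (true-∧ lz (orbit-complete r z (to rz))))
          where
          others : ∀ x → x ≢ z → indicator (isLeast x ∧ orbit gens r x) ≡ 0
          others x ne = cong indicator (not-true (λ e → let lx , ox = ∧-true {isLeast x} e in
            ne (Finₚ.toℕ-injective (ℕₚ.≤-antisym (isLeast-≤ x lx z (to (~-trans (~-sym (o~ ox)) rz))) (isLeast-≤ z lz x (to (~-trans (~-sym rz) (o~ ox))))))))

module Chains where
  open import Data.Bool using (Bool; true; false)
  open import Data.List as List using (List; []; _∷_; _++_; map; length)
  import Data.List.Properties as Listₚ
  open import Data.List.Membership.Propositional using (_∈_)
  open import Data.List.Relation.Binary.Permutation.Propositional as ↭ using (_↭_; ↭-refl; ↭-sym; ↭-trans; prep; swap)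
  open import Data.List.Relation.Binary.Permutation.Propositional.Properties using (map⁺; ++⁺ˡ; ++⁺ʳ; shift; ++-comm; All-resp-↭; Any-resp-↭)
  import Data.List.Relation.Binary.Permutation.Setoid.Properties as SetoidPerm
  open import Data.List.Relation.Unary.All as All using (All; []; _∷_)
  open import Data.List.Relation.Unary.AllPairs as AllPairs using (AllPairs; []; _∷_)
  open import Data.List.Relation.Unary.Any as Any using (Any; here; there)
  open import Data.Product using (_×_; _,_; proj₁; proj₂)
  open import Data.Sum using (_⊎_; inj₁; inj₂)
  open import Relation.Binary.PropositionalEquality as ≡ using (_≡_; refl; sym; trans; cong; subst; subst₂)
  open import Relation.Nullary using (¬_)

  module _ {F : Set} where

    Pair : Set
    Pair = F × F

    data Conn (P : List Pair) : F → F → Set where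
      done : ∀ {x} → Conn P x x
      fwd : ∀ {x y z} → (x , y) ∈ P → Conn P y z → Conn P x z
      bwd : ∀ {x y z} → (y , x) ∈ P → Conn P y z → Conn P x z

    module _ {P : List Pair} where
      conn-trans : ∀ {x y z} → Conn P x y → Conn P y z → Conn P x z
      conn-trans done q = q
      conn-trans (fwd e p) q = fwd e (conn-trans p q)
      conn-trans (bwd e p) q = bwd e (conn-trans p q)

      conn-sym : ∀ {x y} → Conn P x y → Conn P y x
      conn-sym done = done
      conn-sym (fwd e p) = conn-trans (conn-sym p) (bwd e done)
      conn-sym (bwd e p) = conn-trans (conn-sym p) (fwd e done)

    conn-map : ∀ {P Q} → (∀ {x y} → (x , y) ∈ P → Conn Q x y) → ∀ {x y} → Conn P x y → Conn Q x y
    conn-map f done = done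
    conn-map f (fwd e p) = conn-trans (f e) (conn-map f p)
    conn-map f (bwd e p) = conn-trans (conn-sym (f e)) (conn-map f p)

    conn-⊆ : ∀ {P Q} → (∀ {e} → e ∈ P → e ∈ Q) → ∀ {x y} → Conn P x y → Conn Q x y
    conn-⊆ f = conn-map (λ e → fwd (f e) done)

    -- Repeated passages through the added edge can be shortcut, so a path needs it at most once.
    conn-cut : ∀ {P x y u v} → Conn ((x , y) ∷ P) u v → Conn P u v ⊎ ((Conn P u x × Conn P y v) ⊎ (Conn P u y × Conn P x v))
    conn-cut done = inj₁ done
    conn-cut (fwd (here refl) p) with conn-cut p
    ... | inj₁ q = inj₂ (inj₁ (done , q))
    ... | inj₂ (inj₁ (_ , q)) = inj₂ (inj₁ (done , q))
    ... | inj₂ (inj₂ (_ , q)) = inj₁ q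
    conn-cut (bwd (here refl) p) with conn-cut p
    ... | inj₁ q = inj₂ (inj₂ (done , q))
    ... | inj₂ (inj₁ (_ , q)) = inj₁ q
    ... | inj₂ (inj₂ (_ , q)) = inj₂ (inj₂ (done , q))
    conn-cut (fwd (there e) p) with conn-cut p
    ... | inj₁ q = inj₁ (fwd e q)
    ... | inj₂ (inj₁ (q , r)) = inj₂ (inj₁ (fwd e q , r))
    ... | inj₂ (inj₂ (q , r)) = inj₂ (inj₂ (fwd e q , r))
    conn-cut (bwd (there e) p) with conn-cut p
    ... | inj₁ q = inj₁ (bwd e q)
    ... | inj₂ (inj₁ (q , r)) = inj₂ (inj₁ (bwd e q , r))
    ... | inj₂ (inj₂ (q , r)) = inj₂ (inj₂ (bwd e q , r))

    conn-absorb : ∀ {P x y} → Conn P x y → ∀ {u v} → Conn ((x , y) ∷ P) u v → Conn P u v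
    conn-absorb c = conn-map (λ { (here refl) → c ; (there e) → fwd e done })

    conn-weaken : ∀ {P e u v} → Conn P u v → Conn (e ∷ P) u v
    conn-weaken = conn-⊆ there

    record Transversal (P : List Pair) (rs : List F) : Set where
      field
        distinct : AllPairs (λ r s → ¬ Conn P r s) rs
        cover : ∀ u → Any (Conn P u) rs

    open Transversal public

    AllPairs-↭ : ∀ {R : F → F → Set} → (∀ {x y} → R x y → R y x) → ∀ {xs ys} → xs ↭ ys → AllPairs R xs → AllPairs R ys
    AllPairs-↭ {R} s p = SetoidPerm.AllPairs-resp-↭ (≡.setoid F) s ((λ { refl r → r }) , (λ { refl r → r })) (↭⇒↭ₛ p)
      where
      open import Data.List.Relation.Binary.Permutation.Propositional using () renaming (↭⇒↭ₛ to ↭⇒↭ₛ)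

    transversal-↭ : ∀ {P rs rs′} → rs ↭ rs′ → Transversal P rs → Transversal P rs′
    transversal-↭ p t = record { distinct = AllPairs-↭ (λ n c → n (conn-sym c)) p (distinct t) ; cover = λ u → Any-resp-↭ p (cover t u) }

    transversal-replace : ∀ {P x x′ rs} → Conn P x x′ → Transversal P (x ∷ rs) → Transversal P (x′ ∷ rs)
    transversal-replace c t with distinct t
    ... | n ∷ ns = record { distinct = All.map (λ h d → h (conn-trans c d)) n ∷ ns ; cover = λ u → replace (cover t u) }
      where
      replace : ∀ {u} → Any (Conn _ u) (_ ∷ _) → Any (Conn _ u) (_ ∷ _)
      replace (here d) = here (conn-trans d c)
      replace (there a) = there a

    transversal-trivial : ∀ {P x y rs} → Conn P x y → Transversal P rs → Transversal ((x , y) ∷ P) rs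
    transversal-trivial c t = record { distinct = AllPairs.map (λ h d → h (conn-absorb c d)) (distinct t) ; cover = λ u → Any.map conn-weaken (cover t u) }

    -- Only the classes of `x` and `y` unite; `conn-cut` keeps all others apart.
    transversal-merge : ∀ {P x y rs} → Transversal P (x ∷ y ∷ rs) → Transversal ((x , y) ∷ P) (x ∷ rs)
    transversal-merge {P} {x} {y} {rs} t with distinct t
    ... | (xy ∷ xn) ∷ (yn ∷ ns) = record { distinct = All.zipWith head-case (xn , yn) ∷ pairs rs yn xn ns ; cover = λ u → merge (cover t u) }
      where
      head-case : ∀ {r} → (¬ Conn P x r) × (¬ Conn P y r) → ¬ Conn ((x , y) ∷ P) x r
      head-case (nx , ny) c with conn-cut c
      ... | inj₁ d = nx d
      ... | inj₂ (inj₁ (_ , d)) = ny d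
      ... | inj₂ (inj₂ (_ , d)) = nx d
      pairs : ∀ rs → All (λ r → ¬ Conn P y r) rs → All (λ r → ¬ Conn P x r) rs → AllPairs (λ r s → ¬ Conn P r s) rs → AllPairs (λ r s → ¬ Conn ((x , y) ∷ P) r s) rs
      pairs [] _ _ _ = []
      pairs (r ∷ rs) (ny ∷ nys) (nx ∷ nxs) (n ∷ ns) = All.map (λ {s} h c → other h c) n ∷ pairs rs nys nxs ns
        where
        other : ∀ {s} → ¬ Conn P r s → ¬ Conn ((x , y) ∷ P) r s
        other h c with conn-cut c
        ... | inj₁ d = h d
        ... | inj₂ (inj₁ (d , _)) = nx (conn-sym d)
        ... | inj₂ (inj₂ (d , _)) = ny (conn-sym d)
      merge : ∀ {u} → Any (Conn P u) (x ∷ y ∷ rs) → Any (Conn ((x , y) ∷ P) u) (x ∷ rs)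
      merge (here c) = here (conn-weaken c)
      merge (there (here c)) = here (conn-trans (conn-weaken c) (bwd (here refl) done))
      merge (there (there a)) = there (Any.map conn-weaken a)

    infix 4 _≋_
    -- Neither the order of the open chains nor the direction of a chain matters.
    data _≋_ : List Pair → List Pair → Set where
      perm : ∀ {E E′} → E ↭ E′ → E ≋ E′
      flip : ∀ {x y E E′} → E ≋ E′ → (x , y) ∷ E ≋ (y , x) ∷ E′
      keep : ∀ {e E E′} → E ≋ E′ → e ∷ E ≋ e ∷ E′
      _⟫_ : ∀ {E E′ E″} → E ≋ E′ → E′ ≋ E″ → E ≋ E″

    infixr 3 _⟫_

    ≋-refl : ∀ {E} → E ≋ E
    ≋-refl = perm ↭-refl

    ≋-sym : ∀ {E E′} → E ≋ E′ → E′ ≋ E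
    ≋-sym (perm p) = perm (↭-sym p)
    ≋-sym (flip p) = flip (≋-sym p)
    ≋-sym (keep p) = keep (≋-sym p)
    ≋-sym (p ⟫ q) = ≋-sym q ⟫ ≋-sym p

    ≋-++ʳ : ∀ {E E′} G → E ≋ E′ → E ++ G ≋ E′ ++ G
    ≋-++ʳ G (perm p) = perm (++⁺ʳ G p)
    ≋-++ʳ G (flip p) = flip (≋-++ʳ G p)
    ≋-++ʳ G (keep p) = keep (≋-++ʳ G p)
    ≋-++ʳ G (p ⟫ q) = ≋-++ʳ G p ⟫ ≋-++ʳ G q

    ≋-++ˡ : ∀ G {E E′} → E ≋ E′ → G ++ E ≋ G ++ E′
    ≋-++ˡ [] p = p
    ≋-++ˡ (e ∷ G) p = keep (≋-++ˡ G p)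

    -- E lists the endpoints of the open chains of Conn P, and R one point in each remaining class.
    record ChainSystem (P E : List Pair) (R : List F) : Set where
      constructor chainSystem
      field
        joins : All (λ e → Conn P (proj₁ e) (proj₂ e)) E
        classes : Transversal P (map proj₁ E ++ R)

    open ChainSystem public

    chains-↭ : ∀ {P E R R′} → R ↭ R′ → ChainSystem P E R → ChainSystem P E R′
    chains-↭ {E = E} p (chainSystem j c) = chainSystem j (transversal-↭ (++⁺ˡ (map proj₁ E) p) c)

    private
      to-rest : ∀ {P x y E R} → ChainSystem P ((x , y) ∷ E) R → Conn P x y × ChainSystem P E (x ∷ R)
      to-rest {x = x} {E = E} {R} (chainSystem (c ∷ j) t) = c , chainSystem j (transversal-↭ (↭-sym (shift x (map proj₁ E) R)) t)

      from-rest : ∀ {P x y E R} → Conn P x y → ChainSystem P E (x ∷ R) → ChainSystem P ((x , y) ∷ E) R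
      from-rest {x = x} {E = E} {R} c (chainSystem j t) = chainSystem (c ∷ j) (transversal-↭ (shift x (map proj₁ E) R) t)

      replace-rest : ∀ {P x y E R} → Conn P x y → ChainSystem P E (x ∷ R) → ChainSystem P E (y ∷ R)
      replace-rest {x = x} {y} {E} {R} c (chainSystem j t) = chainSystem j
        (transversal-↭ (↭-sym (shift y (map proj₁ E) R)) (transversal-replace c (transversal-↭ (shift x (map proj₁ E) R) t)))

    chains-≋ : ∀ {P E E′ R} → E ≋ E′ → ChainSystem P E R → ChainSystem P E′ R
    chains-≋ {R = R} (perm p) (chainSystem j c) = chainSystem (All-resp-↭ p j) (transversal-↭ (++⁺ʳ R (map⁺ proj₁ p)) c)
    chains-≋ (flip p) s with to-rest s
    ... | c , s′ = from-rest (conn-sym c) (replace-rest c (chains-≋ p s′))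
    chains-≋ (keep p) s with to-rest s
    ... | c , s′ = from-rest c (chains-≋ p s′)
    chains-≋ (p ⟫ q) s = chains-≋ q (chains-≋ p s)

    private
      edge : ∀ {P x y E R} → Conn P x y → ChainSystem P E R → ChainSystem ((x , y) ∷ P) E R
      edge c (chainSystem j t) = chainSystem (All.map conn-weaken j) (transversal-trivial c t)

    chains-relabel : ∀ {P P′ E R} → (∀ {e} → e ∈ P → e ∈ P′) → (∀ {e} → e ∈ P′ → e ∈ P) → ChainSystem P E R → ChainSystem P′ E R
    chains-relabel f g (chainSystem j t) = chainSystem (All.map (conn-⊆ f) j) (record
      { distinct = AllPairs.map (λ n c → n (conn-⊆ g c)) (distinct t) ; cover = λ u → Any.map (conn-⊆ f) (cover t u) })

    -- Glueing x to y in the chains E leaves the chains E′; the flag tells whether a chain closes up.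
    data Glue (x y : F) (E E′ : List Pair) : Bool → Set where
      closing : E ≋ (x , y) ∷ E′ → Glue x y E E′ true
      joining : ∀ u v G → E ≋ (u , x) ∷ (y , v) ∷ G → (u , v) ∷ G ≋ E′ → Glue x y E E′ false

    closed : Bool → F → List F → List F
    closed true x R = x ∷ R
    closed false x R = R

    -- Glueing both ends of one chain completes an orbit, whose representative moves to the closed
    -- classes; glueing ends of two chains makes them one.
    glue-chains : ∀ {P E E′ R x y b} → Glue x y E E′ b → ChainSystem P E R → ChainSystem ((x , y) ∷ P) E′ (closed b x R)
    glue-chains (closing p) s with to-rest (chains-≋ p s)
    ... | c , s′ = edge c s′
    glue-chains {P} {R = R} {x} {y} (joining u v G p q) s with chains-≋ p s
    ... | chainSystem (ux ∷ yv ∷ j) t = chains-≋ q (chainSystem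
          (conn-trans (conn-weaken ux) (fwd (here refl) (conn-weaken yv)) ∷ All.map conn-weaken j)
          (transversal-replace (conn-weaken (conn-sym ux)) (transversal-merge (transversal-replace ux t))))

    open-chain : ∀ {P E R y z} → ChainSystem P E (y ∷ z ∷ R) → ChainSystem ((y , z) ∷ P) ((y , z) ∷ E) R
    open-chain {P} {E} {R} {y} {z} (chainSystem j t) = from-rest (fwd (here refl) done) (chainSystem (All.map conn-weaken j)
      (transversal-↭ (↭-sym (shift y (map proj₁ E) R)) (transversal-merge (transversal-↭ rearrange t))))
      where
      rearrange : map proj₁ E ++ y ∷ z ∷ R ↭ y ∷ z ∷ map proj₁ E ++ R
      rearrange = ↭-trans (shift y (map proj₁ E) (z ∷ R)) (prep y (shift z (map proj₁ E) R))

    glue-frame : ∀ {x y E E′ b} G → Glue x y E E′ b → Glue x y (E ++ G) (E′ ++ G) b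
    glue-frame G (closing p) = closing (≋-++ʳ G p)
    glue-frame G (joining u v H p q) = joining u v (H ++ G) (≋-++ʳ G p) (≋-++ʳ G q)

    glue-≋ : ∀ {x y E E′ D D′ b} → D ≋ E → E′ ≋ D′ → Glue x y E E′ b → Glue x y D D′ b
    glue-≋ p q (closing r) = closing (p ⟫ r ⟫ keep q)
    glue-≋ p q (joining u v G r s) = joining u v G (p ⟫ r) (s ⟫ q)

    -- A loop is a cyclic word of pairs; path q L x lists the pairs obtained by shifting q, L, x by one place.
    path : F → List Pair → F → List Pair
    path q [] x = (q , x) ∷ []
    path q ((p , p′) ∷ L) x = (q , p) ∷ path p′ L x

    -- The pairs of a loop are its open face chains. Shifted cyclically by one flag, they link the
    -- end of a face chain to the start of the next: these are the open vertex chains.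
    cycle : List Pair → List Pair
    cycle [] = []
    cycle ((p , q) ∷ L) = path q L p

    init : F → List Pair → List Pair
    init q [] = []
    init q ((p , p′) ∷ L) = (q , p) ∷ init p′ L

    last : F → List Pair → F
    last q [] = q
    last q ((p , p′) ∷ L) = last p′ L

    first : List Pair → F → F
    first [] x = x
    first ((p , p′) ∷ L) x = p

    tail : List Pair → F → List Pair
    tail [] x = []
    tail ((p , p′) ∷ L) x = path p′ L x

    path-last : ∀ q L x → path q L x ↭ (last q L , x) ∷ init q L
    path-last q [] x = ↭-refl
    path-last q ((p , p′) ∷ L) x = ↭-trans (prep (q , p) (path-last p′ L x)) (swap (q , p) _ ↭-refl)

    path-first : ∀ q L x → path q L x ≡ (q , first L x) ∷ tail L x
    path-first q [] x = refl
    path-first q ((p , p′) ∷ L) x = refl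

    path-++ : ∀ q A C x → path q (A ++ C) x ≡ init q A ++ path (last q A) C x
    path-++ q [] C x = refl
    path-++ q ((p , p′) ∷ A) C x = cong ((q , p) ∷_) (path-++ p′ A C x)

    path-mid : ∀ q A p p′ B x → path q (A ++ (p , p′) ∷ B) x ≡ path q A p ++ path p′ B x
    path-mid q [] p p′ B x = refl
    path-mid q ((a , a′) ∷ A) p p′ B x = cong ((q , a) ∷_) (path-mid a′ A p p′ B x)

    flipped : List Pair → List Pair
    flipped [] = []
    flipped ((p , q) ∷ L) = flipped L ++ (q , p) ∷ []

    flipped-≋ : ∀ L → flipped L ≋ L
    flipped-≋ [] = ≋-refl
    flipped-≋ ((p , q) ∷ L) = perm (++-comm (flipped L) ((q , p) ∷ [])) ⟫ flip (flipped-≋ L)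

    flipped-length : ∀ L → length (flipped L) ≡ length L
    flipped-length [] = refl
    flipped-length ((p , q) ∷ L) = trans (Listₚ.length-++ (flipped L)) (trans (Data.Nat.Properties.+-comm (length (flipped L)) 1) (cong Data.Nat.suc (flipped-length L)))
      where
      import Data.Nat
      import Data.Nat.Properties

    path-flipped : ∀ u C q → path u (flipped C) q ≋ (u , last q C) ∷ init q C
    path-flipped u [] q = ≋-refl
    path-flipped u ((b , b′) ∷ C) q = perm (≡.subst (λ E → E ↭ (b , q) ∷ path u (flipped C) b′) (sym (path-mid u (flipped C) b′ b [] q)) (++-comm (path u (flipped C) b′) ((b , q) ∷ [])))
      ⟫ flip (path-flipped u C b′) ⟫ perm (swap _ _ ↭-refl)

    isEmpty : List Pair → Bool
    isEmpty [] = true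
    isEmpty (_ ∷ _) = false

    -- The vertex side of closing a face: two neighbouring vertex chains join, or the only one
    -- closes if the loop had length one.
    glue-cycle : ∀ x q L → Glue x q (path q L x) (cycle L) (isEmpty L)
    glue-cycle x q [] = closing (flip ≋-refl)
    glue-cycle x q ((p , p′) ∷ L) = joining (last p′ L) p (init p′ L)
      (perm (↭-trans (prep (q , p) (path-last p′ L x)) (swap _ _ ↭-refl)))
      (perm (↭-sym (path-last p′ L p)))

    -- The partner is the second flag of a later pair. Direction is preserved and the loop falls
    -- into two, `B` being the second.
    glue-split : ∀ x q₁ A p q B → Glue x q ((x , q₁) ∷ A ++ (p , q) ∷ B) (((p , q₁) ∷ A) ++ B) false
    glue-split x q₁ A p q B = joining q₁ p (A ++ B) (flip (perm (shift (p , q) A B) ⟫ flip ≋-refl)) (flip ≋-refl)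

    glue-split-cycle : ∀ x q₁ A p q B → Glue x q (cycle ((x , q₁) ∷ A ++ (p , q) ∷ B)) (cycle ((p , q₁) ∷ A) ++ cycle B) (isEmpty B)
    glue-split-cycle x q₁ A p q B = ≡.subst (λ E → Glue x q E (path q₁ A p ++ cycle B) (isEmpty B)) (sym (path-mid q₁ A p q B x))
      (glue-≋ (perm (++-comm (path q₁ A p) (path q B x))) (perm (++-comm (cycle B) (path q₁ A p))) (glue-frame (path q₁ A p) (glue-cycle x q B)))

    -- The partner is the first flag of a later pair. The part `B` behind it is now traversed
    -- backwards, and one loop remains.
    glue-twist : ∀ x q₁ A p q B → Glue x p ((x , q₁) ∷ A ++ (p , q) ∷ B) ((q , q₁) ∷ A ++ flipped B) false
    glue-twist x q₁ A p q B = joining q₁ q (A ++ B) (flip (perm (shift (p , q) A B))) (flip (≋-++ˡ A (≋-sym (flipped-≋ B))))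

    private
      twist-paths : ∀ x q₁ A p q B → Glue x p (path q₁ A p ++ path q B x) (path q₁ (A ++ flipped B) q) false
      twist-paths x q₁ A p q B = joining (last q B) (last q₁ A) (init q₁ A ++ init q B)
        (≋-++ʳ _ (perm (path-last q₁ A p)) ⟫ ≋-++ˡ ((last q₁ A , p) ∷ init q₁ A) (perm (path-last q B x))
          ⟫ perm (shift (last q B , x) ((last q₁ A , p) ∷ init q₁ A) (init q B)) ⟫ keep (flip ≋-refl))
        (flip ≋-refl ⟫ perm (↭-sym (shift _ (init q₁ A) (init q B))) ⟫ ≋-++ˡ (init q₁ A) (≋-sym (path-flipped (last q₁ A) B q))
          ⟫ ≡.subst (_≋ path q₁ (A ++ flipped B) q) (path-++ q₁ A (flipped B) q) ≋-refl)

    glue-twist-cycle : ∀ x q₁ A p q B → Glue x p (cycle ((x , q₁) ∷ A ++ (p , q) ∷ B)) (cycle ((q , q₁) ∷ A ++ flipped B)) false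
    glue-twist-cycle x q₁ A p q B = ≡.subst (λ E → Glue x p E (path q₁ (A ++ flipped B) q) false) (sym (path-mid q₁ A p q B x)) (twist-paths x q₁ A p q B)

    cycle-rotation : ∀ A p q B → cycle (A ++ (p , q) ∷ B) ↭ path q (B ++ A) p
    cycle-rotation [] p q B = ≡.subst (λ C → path q B p ↭ path q C p) (sym (Listₚ.++-identityʳ B)) ↭-refl
    cycle-rotation ((a , a′) ∷ A) p q B = ≡.subst₂ _↭_ (sym (path-mid a′ A p q B a)) (sym (path-mid q B a a′ A p)) (++-comm (path a′ A p) (path q B a))

    -- The other loop is cut open at `(p , q)` and inserted. Being a cyclic word, it then reads
    -- `B ++ A`.
    glue-merge : ∀ x q₁ L A p q B → Glue x q (((x , q₁) ∷ L) ++ (A ++ (p , q) ∷ B)) ((p , q₁) ∷ L ++ (B ++ A)) false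
    glue-merge x q₁ L A p q B = glue-≋
      (keep (≋-++ˡ L (perm (↭-trans (shift (p , q) A B) (prep (p , q) (++-comm A B))))))
      ≋-refl (glue-split x q₁ L p q (B ++ A))

    glue-merge-cycle : ∀ x q₁ L A p q B → Glue x q (cycle ((x , q₁) ∷ L) ++ cycle (A ++ (p , q) ∷ B)) (cycle ((p , q₁) ∷ L ++ (B ++ A))) false
    glue-merge-cycle x q₁ L A p q B = glue-≋ (≋-++ˡ (path q₁ L x) (perm (cycle-rotation A p q B))) ≋-refl
      (joining (last q₁ L) (first C p) (init q₁ L ++ tail C p)
        (≋-++ʳ _ (perm (path-last q₁ L x)) ⟫ keep (≡.subst (λ E → init q₁ L ++ E ≋ (q , first C p) ∷ init q₁ L ++ tail C p) (sym (path-first q C p)) (perm (shift _ (init q₁ L) (tail C p)))))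
        (perm (↭-sym (shift _ (init q₁ L) (tail C p))) ⟫ ≡.subst₂ (λ E E′ → init q₁ L ++ E ≋ E′) (path-first (last q₁ L) C p) (sym (path-++ q₁ L C p)) ≋-refl))
      where C = B ++ A

    glue-cross : ∀ x q₁ L A p q B → Glue x p (((x , q₁) ∷ L) ++ (A ++ (p , q) ∷ B)) ((q , q₁) ∷ L ++ flipped (B ++ A)) false
    glue-cross x q₁ L A p q B = glue-≋
      (keep (≋-++ˡ L (perm (↭-trans (shift (p , q) A B) (prep (p , q) (++-comm A B))))))
      ≋-refl (glue-twist x q₁ L p q (B ++ A))

    glue-cross-cycle : ∀ x q₁ L A p q B → Glue x p (cycle ((x , q₁) ∷ L) ++ cycle (A ++ (p , q) ∷ B)) (cycle ((q , q₁) ∷ L ++ flipped (B ++ A))) false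
    glue-cross-cycle x q₁ L A p q B = glue-≋ (≋-++ˡ (path q₁ L x) (perm (cycle-rotation A p q B))) ≋-refl
      (joining (last q₁ L) (last q C) (init q₁ L ++ init q C)
        (≋-++ʳ _ (perm (path-last q₁ L x)) ⟫ keep (≋-++ˡ (init q₁ L) (perm (path-last q C p)) ⟫ perm (shift _ (init q₁ L) (init q C))  ⟫ flip ≋-refl))
        (perm (↭-sym (shift _ (init q₁ L) (init q C))) ⟫ ≋-++ˡ (init q₁ L) (≋-sym (path-flipped (last q₁ L) C q))
          ⟫ ≡.subst (_≋ path q₁ (L ++ flipped C) q) (path-++ q₁ L (flipped C) q) ≋-refl))
      where C = B ++ A

    flags : List Pair → List F
    flags [] = []
    flags ((p , q) ∷ L) = p ∷ q ∷ flags L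

    flags-++ : ∀ L M → flags (L ++ M) ≡ flags L ++ flags M
    flags-++ [] M = refl
    flags-++ ((p , q) ∷ L) M = cong (λ z → p ∷ q ∷ z) (flags-++ L M)

    flags-≋ : ∀ {E E′} → E ≋ E′ → flags E ↭ flags E′
    flags-≋ (perm p) = go p
      where
      go : ∀ {E E′} → E ↭ E′ → flags E ↭ flags E′
      go ↭.refl = ↭-refl
      go (prep (p , q) r) = prep p (prep q (go r))
      go (swap (p , q) (u , v) r) = ↭-trans (shifts p q u v) (prep u (prep v (prep p (prep q (go r)))))
        where
        shifts : ∀ p q u v {Z} → p ∷ q ∷ u ∷ v ∷ Z ↭ u ∷ v ∷ p ∷ q ∷ Z
        shifts p q u v {Z} = ++⁺ʳ Z (++-comm (p ∷ q ∷ []) (u ∷ v ∷ []))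
      go (↭.trans p q) = ↭-trans (go p) (go q)
    flags-≋ (flip p) = swap _ _ (flags-≋ p)
    flags-≋ (keep {p , q} r) = prep p (prep q (flags-≋ r))
    flags-≋ (p ⟫ q) = ↭-trans (flags-≋ p) (flags-≋ q)

    glue-flags : ∀ {x y E E′ b} → Glue x y E E′ b → flags E ↭ x ∷ y ∷ flags E′
    glue-flags (closing p) = flags-≋ p
    glue-flags {x} {y} (joining u v G p q) = ↭-trans (flags-≋ p) (↭-trans (swap u x ↭-refl) (prep x (↭-trans (swap u y ↭-refl) (prep y (flags-≋ q)))))

-- The recursion for completions of given loops

module Walk where
  open import Data.List using (List; []; _∷_)
  open import Data.Nat using (ℕ; zero; suc; _+_; _*_; pred)
  import Data.Nat.Properties as ℕₚ
  open import Function using (_∘_)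
  open import Relation.Binary.PropositionalEquality

  isOneℕ : ℕ → ℕ
  isOneℕ (suc zero) = 1
  isOneℕ _ = 0

  -- the sum of the h i j over i + 1 + j = k
  splits : (ℕ → ℕ → ℕ) → ℕ → ℕ
  splits h zero = 0
  splits h (suc k) = h 0 k + splits (h ∘ suc) k

  picks : (ℕ → List ℕ → ℕ) → List ℕ → ℕ
  picks f [] = 0
  picks f (k ∷ K) = f k K + picks (λ l L → f l (k ∷ L)) K

  -- maps b s i K r: the number of ways to complete loops of lengths K and r further edges to a connected map of
  -- deficiency i - 1; s = sum K + 2r is the number of steps left.
  maps : ℕ → ℕ → ℕ → List ℕ → ℕ → ℕ
  -- Index 1 means that the deficiency is spent exactly. The shift by one leaves index 0 for an
  -- overdrawn deficiency, which truncated subtraction would otherwise confuse with it.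
  maps b s i [] zero = isOneℕ i
  -- No loop is open although edges remain: they could not be connected any more.
  maps b s i [] (suc r) = 0
  maps b s i (zero ∷ K) r = maps b s i K r
  maps b zero i (suc k ∷ K) r = 0
  -- The first flag has `suc k` straight partners on its own loop, which split it, and `k` twisted
  -- ones. Another loop of length `l` offers `l` straight and `l` crossed partners. Twisted and
  -- crossed ones count only for `b = 1`.
  maps b (suc s) i (suc k ∷ K) zero =
    splits (λ p q → maps b s i (p ∷ q ∷ K) 0) (suc k)
    + (b * (k * maps b s (pred i) (k ∷ K) 0) + suc b * picks (λ l L → l * maps b s (pred (pred i)) (k + l ∷ L) 0) K)
  maps b (suc s) i (suc k ∷ K) (suc r) =
    (splits (λ p q → maps b s i (p ∷ q ∷ K) (suc r)) (suc k)
    + (b * (k * maps b s (pred i) (k ∷ K) (suc r)) + suc b * picks (λ l L → l * maps b s (pred (pred i)) (k + l ∷ L) (suc r)) K))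
    + maps b s i (suc (suc k) ∷ K) r

  splits-scale : ∀ c h k → splits (λ i j → c * h i j) k ≡ c * splits h k
  splits-scale c h zero = sym (ℕₚ.*-zeroʳ c)
  splits-scale c h (suc k) = trans (cong (c * h 0 k +_) (splits-scale c (h ∘ suc) k)) (sym (ℕₚ.*-distribˡ-+ c (h 0 k) _))

  splits-const : ∀ u k → splits (λ _ _ → u) k ≡ k * u
  splits-const u zero = refl
  splits-const u (suc k) = cong (u +_) (splits-const u k)

  picks-scale : ∀ c f K → picks (λ l L → c * f l L) K ≡ c * picks f K
  picks-scale c f [] = sym (ℕₚ.*-zeroʳ c)
  picks-scale c f (k ∷ K) = trans (cong (c * f k K +_) (picks-scale c (λ l L → f l (k ∷ L)) K)) (sym (ℕₚ.*-distribˡ-+ c (f k K) _))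

  picks-cong : ∀ {f g : ℕ → List ℕ → ℕ} → (∀ l L → f l L ≡ g l L) → ∀ K → picks f K ≡ picks g K
  picks-cong p [] = refl
  picks-cong p (k ∷ K) = cong₂ _+_ (p k K) (picks-cong (λ l L → p l (k ∷ L)) K)

-- Exploration of labelled maps

-- There are `m` flags and `n` edges, and `e` is `2 - χ`. If `o` is true orientability is demanded;
-- if it is false, nothing is demanded about it.
module State (m n : ℕ) (o : Bool) (e : ℕ) where
  open import Data.Bool using (Bool; true; false; _xor_)
  open import Data.Nat as ℕ using (ℕ; _+_)
  open import Data.Fin as Fin using (Fin)

  open import Data.Bool using (not; if_then_else_)
  open import Data.Bool.ListAction as BL using ()
  open import Data.List as List using (List; []; _∷_; _++_; map; concat; concatMap; allFin)
  open import Data.List.Membership.Propositional using (_∈_; _∉_)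
  open import Data.List.Membership.Propositional.Properties using (∈-++⁺ʳ)
  open import Data.List.Relation.Binary.Permutation.Propositional using (_↭_; ↭-refl; ↭-trans; prep; swap)
  open import Data.List.Relation.Unary.All as All using (All; []; _∷_)
  open import Data.List.Relation.Unary.Any as Any using (Any; here; there)
  open import Data.List.Relation.Unary.AllPairs using ([]; _∷_)
  open import Data.List.Relation.Unary.Unique.Propositional using (Unique)
  open import Data.Product using (_×_; _,_; Σ; proj₁; proj₂)
  open import Data.Sum using (_⊎_; inj₁; inj₂)
  open import Data.Vec as Vec using (Vec; lookup)
  open import Function using (_∘_)
  open import Relation.Binary.PropositionalEquality
  open import Defs using (Fun; app; numOrbits)
  open Counting
  open Orbits
  open Chains

  F : Set
  F = Fin m

  open Triples m public

  record Valid (τ : Triple) : Set where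
    private
      s₀ = app (proj₁ τ)
      s₁ = app (proj₁ (proj₂ τ))
      s₂ = app (proj₂ (proj₂ τ))
    field
      inv₀ : ∀ x → s₀ (s₀ x) ≡ x
      inv₁ : ∀ x → s₁ (s₁ x) ≡ x
      inv₂ : ∀ x → s₂ (s₂ x) ≡ x
      free₀ : ∀ x → s₀ x ≢ x
      free₁ : ∀ x → s₁ x ≢ x
      free₂ : ∀ x → s₂ x ≢ x
      commute : ∀ x → s₀ (s₂ x) ≡ s₂ (s₀ x)
      free₀₂ : ∀ x → s₀ (s₂ x) ≢ x
      connected : ∀ x y → Reach (proj₁ τ ∷ proj₁ (proj₂ τ) ∷ proj₂ (proj₂ τ) ∷ []) x y
      euler : numOrbits (proj₁ (proj₂ τ) ∷ proj₂ (proj₂ τ) ∷ []) + numOrbits (proj₁ τ ∷ proj₁ (proj₂ τ) ∷ []) + e ≡ n + 2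
      colouring : o ≡ true → Σ (F → Bool) λ c → ∀ x → c (s₀ x) ≡ not (c x) × c (s₁ x) ≡ not (c x) × c (s₂ x) ≡ not (c x)

  -- The block ⟨ a , b , c , d ⟩ is an edge with σ₀ = (a b)(c d) and σ₂ = (b c)(d a).
  data Block : Set where
    ⟨_,_,_,_⟩ : (a b c d : F) → Block

  corners even odd : List Block → List F
  corners [] = []
  corners (⟨ a , b , c , d ⟩ ∷ bl) = a ∷ b ∷ c ∷ d ∷ corners bl
  even [] = []
  even (⟨ a , b , c , d ⟩ ∷ bl) = a ∷ c ∷ even bl
  odd [] = []
  odd (⟨ a , b , c , d ⟩ ∷ bl) = b ∷ d ∷ odd bl

  p₀ p₂ : List Block → List (F × F)
  p₀ [] = []
  p₀ (⟨ a , b , c , d ⟩ ∷ bl) = (b , a) ∷ (c , d) ∷ p₀ bl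
  p₂ [] = []
  p₂ (⟨ a , b , c , d ⟩ ∷ bl) = (b , c) ∷ (d , a) ∷ p₂ bl

  Matches : Fun m → List (F × F) → Set
  Matches s P = ∀ {x y} → (x , y) ∈ P → app s x ≡ y

  -- Three values suffice: `σ₂ d = a` follows because `σ₀` and `σ₂` commute.
  BlockOK : Triple → Block → Set
  BlockOK (s₀ , s₁ , s₂) ⟨ a , b , c , d ⟩ = app s₀ b ≡ a × app s₂ b ≡ c × app s₀ c ≡ d

  record Sat (p₁ : List (F × F)) (bl : List Block) (τ : Triple) : Set where
    constructor sat
    field
      pairs : All (λ e → app (proj₁ (proj₂ τ)) (proj₁ e) ≡ proj₂ e) p₁
      blocks : All (BlockOK τ) bl

  open Sat public

  Spec : (Triple → Bool) → List (F × F) → List Block → Set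
  Spec Q p₁ bl = (∀ τ → Q τ ≡ true → Valid τ × Sat p₁ bl τ) × (∀ τ → Valid τ → Sat p₁ bl τ → Q τ ≡ true)

  -- `un` holds the flags of edges not yet found. Every flag is matched by `σ₁`, lies on a loop, or
  -- is in `un`. `RV` and `RF` represent the vertices and faces already completed, and each flag of
  -- `un` is still a class by itself.
  record Core (p₁ : List (F × F)) (bl : List Block) (loops : List (List (F × F))) (un RV RF : List F) : Set where
    field
      flags-all : flags p₁ ++ (flags (concat loops) ++ un) ↭ allFin m
      corners-all : corners bl ++ un ↭ allFin m
      vertices : ChainSystem (p₁ ++ p₂ bl) (concatMap cycle loops) (RV ++ un)
      faces : ChainSystem (p₁ ++ p₀ bl) (concat loops) (RF ++ un)

  Cross : List Block → F × F → Set
  Cross bl (x , y) = (x ∈ even bl × y ∈ odd bl) ⊎ (x ∈ odd bl × y ∈ even bl)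

  -- Where orientability is demanded, even and odd corners must become a proper colouring. Loop
  -- pairs run from even to odd, so twisted and crossed partners have the same colour and straight
  -- ones the opposite.
  Oriented : List (F × F) → List Block → List (List (F × F)) → Set
  Oriented p₁ bl loops = o ≡ true → All (Cross bl) p₁ × All (λ e → proj₁ e ∈ even bl × proj₂ e ∈ odd bl) (concat loops)

  Reached : F → List (F × F) → List Block → Set
  Reached ρ p₁ bl = ∀ {u} → u ∈ corners bl → Conn (p₁ ++ (p₀ bl ++ p₂ bl)) ρ u

  even⊆ : ∀ bl {u} → u ∈ even bl → u ∈ corners bl
  even⊆ (⟨ a , b , c , d ⟩ ∷ bl) (here refl) = here refl
  even⊆ (⟨ a , b , c , d ⟩ ∷ bl) (there (here refl)) = there (there (here refl))
  even⊆ (⟨ a , b , c , d ⟩ ∷ bl) (there (there h)) = there (there (there (there (even⊆ bl h))))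

  odd⊆ : ∀ bl {u} → u ∈ odd bl → u ∈ corners bl
  odd⊆ (⟨ a , b , c , d ⟩ ∷ bl) (here refl) = there (here refl)
  odd⊆ (⟨ a , b , c , d ⟩ ∷ bl) (there (here refl)) = there (there (there (here refl)))
  odd⊆ (⟨ a , b , c , d ⟩ ∷ bl) (there (there h)) = there (there (there (there (odd⊆ bl h))))

  even-odd : ∀ bl → Unique (corners bl) → ∀ {u} → u ∈ even bl → u ∉ odd bl
  even-odd (⟨ a , b , c , d ⟩ ∷ bl) (na ∷ nb ∷ nc ∷ nd ∷ us) = λ
    { (here refl) (here refl) → All.lookup na (here refl) refl
    ; (here refl) (there (here refl)) → All.lookup na (there (there (here refl))) refl
    ; (here refl) (there (there q)) → All.lookup na (there (there (there (odd⊆ bl q)))) refl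
    ; (there (here refl)) (here refl) → All.lookup nb (here refl) refl
    ; (there (here refl)) (there (here refl)) → All.lookup nc (here refl) refl
    ; (there (here refl)) (there (there q)) → All.lookup nc (there (odd⊆ bl q)) refl
    ; (there (there p)) (here refl) → All.lookup nb (there (there (even⊆ bl p))) refl
    ; (there (there p)) (there (here refl)) → All.lookup nd (even⊆ bl p) refl
    ; (there (there p)) (there (there q)) → even-odd bl us p q }

  p₀-cross : ∀ bl → All (Cross bl) (p₀ bl)
  p₀-cross [] = []
  p₀-cross (⟨ a , b , c , d ⟩ ∷ bl) = inj₂ (here refl , here refl) ∷ inj₁ (there (here refl) , there (here refl)) ∷ All.map deeper (p₀-cross bl)
    where
    deeper : ∀ {e} → Cross bl e → Cross (⟨ a , b , c , d ⟩ ∷ bl) e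
    deeper (inj₁ (p , q)) = inj₁ (there (there p) , there (there q))
    deeper (inj₂ (p , q)) = inj₂ (there (there p) , there (there q))

  p₂-cross : ∀ bl → All (Cross bl) (p₂ bl)
  p₂-cross [] = []
  p₂-cross (⟨ a , b , c , d ⟩ ∷ bl) = inj₂ (here refl , there (here refl)) ∷ inj₂ (there (here refl) , here refl) ∷ All.map deeper (p₂-cross bl)
    where
    deeper : ∀ {e} → Cross bl e → Cross (⟨ a , b , c , d ⟩ ∷ bl) e
    deeper (inj₁ (p , q)) = inj₁ (there (there p) , there (there q))
    deeper (inj₂ (p , q)) = inj₂ (there (there p) , there (there q))

  unique-↭ : ∀ {xs ys : List F} → xs ↭ ys → Unique xs → Unique ys
  unique-↭ = AllPairs-↭ (λ n q → n (sym q))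

  unique-++ˡ : ∀ (xs : List F) {ys} → Unique (xs ++ ys) → Unique xs
  unique-++ˡ [] u = []
  unique-++ˡ (x ∷ xs) (n ∷ u) = Allₚ.++⁻ˡ xs n ∷ unique-++ˡ xs u
    where
    import Data.List.Relation.Unary.All.Properties as Allₚ

  unique-disjoint : ∀ (xs : List F) {ys u} → Unique (xs ++ ys) → u ∈ xs → u ∉ ys
  unique-disjoint (x ∷ xs) (n ∷ us) (here refl) q = All.lookup n (∈-++⁺ʳ xs q) refl
  unique-disjoint (x ∷ xs) (n ∷ us) (there p) q = unique-disjoint xs us p q

  side : List Block → F → Bool
  side bl u = BL.any (λ v → u Defs.== v) (odd bl)


  side-odd : ∀ bl {u} → u ∈ odd bl → side bl u ≡ true
  side-odd bl {u} p = true-any _ (odd bl) p (==-refl u)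

  side-even : ∀ bl → Unique (corners bl) → ∀ {u} → u ∈ even bl → side bl u ≡ false
  side-even bl us {u} p = not-true λ h → let v , q , r = any-true _ (odd bl) h in
    even-odd bl us p (subst (_∈ odd bl) (sym (==-true {x = u} r)) q)

  side-cross : ∀ bl → Unique (corners bl) → ∀ {x y} → Cross bl (x , y) → side bl y ≡ not (side bl x)
  side-cross bl us (inj₁ (p , q)) rewrite side-even bl us p | side-odd bl q = refl
  side-cross bl us (inj₂ (p , q)) rewrite side-even bl us q | side-odd bl p = refl

  -- Two proper colourings of a connected graph agree up to a global exchange of the colours.
  colour-side : ∀ {P : List (F × F)} {c d : F → Bool} → (∀ {x y} → (x , y) ∈ P → c y ≡ not (c x) × d y ≡ not (d x)) →
    ∀ {u v} → Conn P u v → c u xor d u ≡ c v xor d v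
  colour-side h done = refl
  colour-side {c = c} {d} h (fwd {x} {y} p q) = trans (opposite (c x) (d x) (proj₁ (h p)) (proj₂ (h p))) (colour-side h q)
    where
    opposite : ∀ a b {a′ b′} → a′ ≡ not a → b′ ≡ not b → a xor b ≡ a′ xor b′
    opposite true true refl refl = refl
    opposite true false refl refl = refl
    opposite false true refl refl = refl
    opposite false false refl refl = refl
  colour-side {c = c} {d} h (bwd {x} {y} p q) = trans (opposite (c y) (d y) (proj₁ (h p)) (proj₂ (h p))) (colour-side h q)
    where
    opposite : ∀ a b {a′ b′} → a′ ≡ not a → b′ ≡ not b → a′ xor b′ ≡ a xor b
    opposite true true refl refl = refl
    opposite true false refl refl = refl
    opposite false true refl refl = refl
    opposite false false refl refl = refl

  module Consequences {p₁ bl} {τ : Triple} (v : Valid τ) (s : Sat p₁ bl τ) where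
    open Valid v
    private
      s₀ = app (proj₁ τ)
      s₁ = app (proj₁ (proj₂ τ))
      s₂ = app (proj₂ (proj₂ τ))

    match₁ : Matches (proj₁ (proj₂ τ)) p₁
    match₁ = All.lookup (pairs s)

    private
      go₀ : ∀ bl → All (BlockOK τ) bl → ∀ {x y} → (x , y) ∈ p₀ bl → s₀ x ≡ y
      go₀ (⟨ a , b , c , d ⟩ ∷ bl) ((x , y , z) ∷ q) (here refl) = x
      go₀ (⟨ a , b , c , d ⟩ ∷ bl) ((x , y , z) ∷ q) (there (here refl)) = z
      go₀ (⟨ a , b , c , d ⟩ ∷ bl) (_ ∷ q) (there (there p)) = go₀ bl q p

      go₂ : ∀ bl → All (BlockOK τ) bl → ∀ {x y} → (x , y) ∈ p₂ bl → s₂ x ≡ y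
      go₂ (⟨ a , b , c , d ⟩ ∷ bl) ((x , y , z) ∷ q) (here refl) = y
      go₂ (⟨ a , b , c , d ⟩ ∷ bl) ((x , y , z) ∷ q) (there (here refl)) = begin
        s₂ d ≡⟨ cong s₂ z ⟨
        s₂ (s₀ c) ≡⟨ commute c ⟨
        s₀ (s₂ c) ≡⟨ cong (s₀ ∘ s₂) y ⟨
        s₀ (s₂ (s₂ b)) ≡⟨ cong s₀ (inv₂ b) ⟩
        s₀ b ≡⟨ x ⟩
        a ∎
        where
        open ≡-Reasoning
      go₂ (⟨ a , b , c , d ⟩ ∷ bl) (_ ∷ q) (there (there p)) = go₂ bl q p

    match₀ : Matches (proj₁ τ) (p₀ bl)
    match₀ = go₀ bl (blocks s)

    match₂ : Matches (proj₂ (proj₂ τ)) (p₂ bl)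
    match₂ = go₂ bl (blocks s)

  flags-∈ : ∀ {x y : F} {P} → (x , y) ∈ P → x ∈ flags P × y ∈ flags P
  flags-∈ (here refl) = here refl , there (here refl)
  flags-∈ {P = (p , q) ∷ P} (there h) with flags-∈ h
  ... | x , y = there (there x) , there (there y)

  ∈-flags : ∀ {u : F} P → u ∈ flags P → Σ F λ v → (u , v) ∈ P ⊎ (v , u) ∈ P
  ∈-flags ((p , q) ∷ P) (here refl) = q , inj₁ (here refl)
  ∈-flags ((p , q) ∷ P) (there (here refl)) = p , inj₂ (here refl)
  ∈-flags ((p , q) ∷ P) (there (there h)) with ∈-flags P h
  ... | v , inj₁ k = v , inj₁ (there k)
  ... | v , inj₂ k = v , inj₂ (there k)

  flags-p₀ : ∀ bl → flags (p₀ bl) ↭ corners bl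
  flags-p₀ [] = ↭-refl
  flags-p₀ (⟨ a , b , c , d ⟩ ∷ bl) = swap b a (prep c (prep d (flags-p₀ bl)))

  flags-p₂ : ∀ bl → flags (p₂ bl) ↭ corners bl
  flags-p₂ [] = ↭-refl
  flags-p₂ (⟨ a , b , c , d ⟩ ∷ bl) = ↭-trans (prep b (prep c (swap d a (flags-p₂ bl)))) (↭-trans (prep b (swap c a ↭-refl)) (swap b a ↭-refl))

  flags-closed : ∀ {s P} → (∀ x → app s (app s x) ≡ x) → Matches s P → ∀ {u : F} → u ∈ flags P → app s u ∈ flags P
  flags-closed {s} {P} inv match {u} h with ∈-flags P h
  ... | v , inj₁ k = subst (_∈ flags P) (sym (match k)) (proj₂ (flags-∈ k))
  ... | v , inj₂ k = subst (_∈ flags P) (trans (sym (inv v)) (cong (app s) (match k))) (proj₁ (flags-∈ k))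

  partner : List (F × F) → F → F
  partner [] u = u
  partner ((x , y) ∷ P) u = if (u Defs.== x) then y else (if (u Defs.== y) then x else partner P u)

  module Partner {P : List (F × F)} (us : Unique (flags P)) where
    partner-fwd : ∀ {P} → Unique (flags P) → ∀ {x y} → (x , y) ∈ P → partner P x ≡ y
    partner-fwd {(x , y) ∷ P} us (here refl) rewrite ==-refl x = refl
    partner-fwd {(x , y) ∷ P} (nx ∷ ny ∷ us) {u} (there h)
      rewrite ==-false {x = u} {x} (λ q → All.lookup nx (there (proj₁ (flags-∈ h))) (sym q)) | ==-false {x = u} {y} (λ q → All.lookup ny (proj₁ (flags-∈ h)) (sym q)) = partner-fwd us h

    partner-bwd : ∀ {P} → Unique (flags P) → ∀ {x y} → (x , y) ∈ P → partner P y ≡ x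
    partner-bwd {(x , y) ∷ P} (nx ∷ ny ∷ us) (here refl) rewrite ==-false {x = y} {x} (λ q → All.lookup nx (here refl) (sym q)) | ==-refl y = refl
    partner-bwd {(x , y) ∷ P} (nx ∷ ny ∷ us) {_} {u} (there h)
      rewrite ==-false {x = u} {x} (λ q → All.lookup nx (there (proj₂ (flags-∈ h))) (sym q)) | ==-false {x = u} {y} (λ q → All.lookup ny (proj₂ (flags-∈ h)) (sym q)) = partner-bwd us h

    fwd′ : ∀ {x y} → (x , y) ∈ P → partner P x ≡ y
    fwd′ = partner-fwd us

    bwd′ : ∀ {x y} → (x , y) ∈ P → partner P y ≡ x
    bwd′ = partner-bwd us

    pair-distinct : ∀ {P} → Unique (flags P) → ∀ {x y : F} → (x , y) ∈ P → x ≢ y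
    pair-distinct (nx ∷ _) (here refl) = All.lookup nx (here refl)
    pair-distinct (_ ∷ _ ∷ us) (there h) = pair-distinct us h

    involution : (∀ u → u ∈ flags P) → ∀ u → partner P (partner P u) ≡ u × partner P u ≢ u
    involution all u with ∈-flags P (all u)
    ... | v , inj₁ k rewrite fwd′ k = bwd′ k , λ q → pair-distinct us k (sym q)
    ... | v , inj₂ k rewrite bwd′ k = fwd′ k , pair-distinct us k

module Leaf (m n : ℕ) (o : Bool) (e : ℕ) where
  open import Data.Bool using (Bool; true; not)
  open import Data.Nat as ℕ using (ℕ; zero; suc; _+_; _∸_)

  import Data.Bool.Properties as Boolₚ
  open import Data.Empty using (⊥; ⊥-elim)
  open import Data.Fin as Fin using (Fin)
  open import Data.List as List using (List; []; _∷_; _++_; length; allFin)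
  import Data.List.Properties as Listₚ
  open import Data.List.Membership.Propositional using (_∈_)
  open import Data.List.Membership.Propositional.Properties using (∈-allFin; ∈-++⁺ˡ; ∈-++⁺ʳ; ∈-++⁻)
  open import Data.List.Relation.Binary.Permutation.Propositional using (_↭_; ↭-sym; ↭-trans)
  open import Data.List.Relation.Binary.Permutation.Propositional.Properties using (∈-resp-↭)
  open import Data.List.Relation.Unary.All as All using (All; []; _∷_)
  open import Data.List.Relation.Unary.Any as Any using (Any; here; there)
  open import Data.List.Relation.Unary.AllPairs using ([]; _∷_)
  open import Data.List.Relation.Unary.Unique.Propositional using (Unique)
  open import Data.List.Relation.Unary.Unique.Propositional.Properties using (allFin⁺)
  import Data.Nat.Properties as ℕₚ
  open import Data.Product using (_×_; _,_; Σ; proj₁; proj₂)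
  open import Data.Sum using (_⊎_; inj₁; inj₂)
  open import Data.Vec as Vec using (lookup; tabulate)
  import Data.Vec.Properties as Vecₚ
  open import Function using (_∘_)
  open import Relation.Binary.PropositionalEquality
  open import Relation.Nullary using (Dec; yes; no)
  open import Defs using (Fun; app; numOrbits)
  open Counting
  open Orbits
  open Chains
  open Walk using (isOneℕ)
  open State m n o e

  reach-trans : ∀ {gens : List (Fun m)} {x y z} → Reach gens x y → Reach gens y z → Reach gens x z
  reach-trans r stop = r
  reach-trans r (go g k s) = go g k (reach-trans r s)

  reach-sym : ∀ {gens : List (Fun m)} → (∀ {g} → g ∈ gens → ∀ x → app g (app g x) ≡ x) → ∀ {x y} → Reach gens x y → Reach gens y x
  reach-sym inv stop = stop
  reach-sym {gens} inv (go {z = z} g k s) = reach-trans (subst (Reach gens (app g z)) (inv k z) (go g k stop)) (reach-sym inv s)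

  conn-reach : ∀ {gens : List (Fun m)} {P} → (∀ {x y} → (x , y) ∈ P → Reach gens x y × Reach gens y x) → ∀ {x y} → Conn P x y → Reach gens x y
  conn-reach h done = stop
  conn-reach h (fwd p c) = reach-trans (proj₁ (h p)) (conn-reach h c)
  conn-reach h (bwd p c) = reach-trans (proj₂ (h p)) (conn-reach h c)

  match-conn : ∀ {s P} → (∀ x → app s (app s x) ≡ x) → Matches s P → ∀ u → u ∈ flags P → Conn P u (app s u)
  match-conn {s} {P} inv match u h with ∈-flags P h
  ... | v , inj₁ k = subst (Conn P u) (sym (match k)) (fwd k done)
  ... | v , inj₂ k = subst (Conn P u) (trans (sym (inv v)) (cong (app s) (match k))) (bwd k done)

  match-reach : ∀ {gens s P} → s ∈ gens → (∀ x → app s (app s x) ≡ x) → Matches s P → ∀ {x y} → (x , y) ∈ P → Reach gens x y × Reach gens y x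
  match-reach {gens} {s} k inv match {x} {y} p = subst (Reach gens x) (match p) (go s k stop) ,
    subst (Reach gens y) (trans (cong (app s) (sym (match p))) (inv x)) (go s k stop)

  module _ {s s′ : Fun m} {P P′ PP : List (F × F)} (inv : ∀ x → app s (app s x) ≡ x) (inv′ : ∀ x → app s′ (app s′ x) ≡ x)
    (match : Matches s P) (match′ : Matches s′ P′) (all : ∀ u → u ∈ flags P) (all′ : ∀ u → u ∈ flags P′)
    (incl : ∀ {e} → e ∈ P → e ∈ PP) (incl′ : ∀ {e} → e ∈ P′ → e ∈ PP) (split : ∀ {e} → e ∈ PP → e ∈ P ⊎ e ∈ P′) where

    private
      gens : List (Fun m)
      gens = s ∷ s′ ∷ []

      edge : ∀ {x y} → (x , y) ∈ PP → Reach gens x y × Reach gens y x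
      edge p with split p
      ... | inj₁ k = match-reach {s = s} {P} (here refl) inv match k
      ... | inj₂ k = match-reach {s = s′} {P′} (there (here refl)) inv′ match′ k

      from : ∀ {x y} → Reach gens x y → Conn PP x y
      from stop = done
      from (go g (here refl) r) = conn-trans (from r) (conn-⊆ incl (match-conn {s} {P} inv match _ (all _)))
      from (go g (there (here refl)) r) = conn-trans (from r) (conn-⊆ incl′ (match-conn {s′} {P′} inv′ match′ _ (all′ _)))

    orbit-count : ∀ {rs} → Transversal PP rs → numOrbits gens ≡ length rs
    orbit-count t = numOrbits-transversal gens (Conn PP) conn-sym conn-trans (conn-reach edge) from _ (distinct t) (cover t)

  data InBlock (bl : List Block) (u : F) : Set where
    inBlock : ∀ {a b c d} → (b , a) ∈ p₀ bl → (c , d) ∈ p₀ bl → (b , c) ∈ p₂ bl → (d , a) ∈ p₂ bl → a ≢ c → b ≢ d →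
      (u ≡ a ⊎ u ≡ b) ⊎ (u ≡ c ⊎ u ≡ d) → InBlock bl u

  in-block : ∀ bl → Unique (corners bl) → ∀ {u} → u ∈ corners bl → InBlock bl u
  in-block (⟨ a , b , c , d ⟩ ∷ bl) (na ∷ nb ∷ nc ∷ nd ∷ us) = λ
    { (here p) → at (inj₁ (inj₁ p)) ; (there (here p)) → at (inj₁ (inj₂ p)) ; (there (there (here p))) → at (inj₂ (inj₁ p))
    ; (there (there (there (here p)))) → at (inj₂ (inj₂ p)) ; (there (there (there (there p)))) → deeper (in-block bl us p) }
    where
    at : ∀ {u} → (u ≡ a ⊎ u ≡ b) ⊎ (u ≡ c ⊎ u ≡ d) → InBlock (⟨ a , b , c , d ⟩ ∷ bl) u
    at = inBlock (here refl) (there (here refl)) (here refl) (there (here refl)) (All.lookup na (there (here refl))) (All.lookup nb (there (here refl)))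
    deeper : ∀ {u} → InBlock bl u → InBlock (⟨ a , b , c , d ⟩ ∷ bl) u
    deeper (inBlock p q r s x y z) = inBlock (there (there p)) (there (there q)) (there (there r)) (there (there s)) x y z

  block-pairs : ∀ {bl a b c d} → ⟨ a , b , c , d ⟩ ∈ bl → (b , a) ∈ p₀ bl × (b , c) ∈ p₂ bl × (c , d) ∈ p₀ bl
  block-pairs (here refl) = here refl , here refl , there (here refl)
  block-pairs {bl = ⟨ _ , _ , _ , _ ⟩ ∷ bl} (there h) with block-pairs h
  ... | p , q , r = there (there p) , there (there q) , there (there r)

  isOne-gap : ∀ {d} → e ≢ d → isOneℕ (suc e ∸ d) ≡ 0
  isOne-gap {d} ne = gap e d ne
    where
    gap : ∀ e d → e ≢ d → isOneℕ (suc e ∸ d) ≡ 0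
    gap zero zero ne = ⊥-elim (ne refl)
    gap (suc e) zero ne = refl
    gap zero (suc zero) ne = refl
    gap zero (suc (suc d)) ne = refl
    gap (suc e) (suc d) ne = gap e d (ne ∘ cong suc)

  module _ {ρ : F} {p₁ bl un RV RF} (core : Core p₁ bl [] un RV RF) (Q : Triple → Bool) (spec : Spec Q p₁ bl) where
    open Core core

    private
      unique-flags : Unique (flags p₁ ++ un)
      unique-flags = unique-↭ (↭-sym flags-all) (allFin⁺ m)

      unique-corners : Unique (corners bl ++ un)
      unique-corners = unique-↭ (↭-sym corners-all) (allFin⁺ m)

    dead-end : ∀ {u} → u ∈ un → ρ ∈ corners bl → count Q ≡ 0
    dead-end {u} u∈ ρ∈ = count-0 λ τ q → impossible τ (proj₁ (proj₁ spec τ q)) (proj₂ (proj₁ spec τ q))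
      where
      impossible : ∀ τ → Valid τ → Sat p₁ bl τ → ⊥
      impossible (s₀ , s₁ , s₂) v s = unique-disjoint (corners bl) unique-corners (stays (connected ρ u)) u∈
        where
        open Valid v
        open Consequences v s
        stays : ∀ {y} → Reach (s₀ ∷ s₁ ∷ s₂ ∷ []) ρ y → y ∈ corners bl
        stays stop = ρ∈
        stays (go g (here refl) r) = ∈-resp-↭ (flags-p₀ bl) (flags-closed {s₀} {p₀ bl} inv₀ match₀ (∈-resp-↭ (↭-sym (flags-p₀ bl)) (stays r)))
        stays (go g (there (there (here refl))) r) = ∈-resp-↭ (flags-p₂ bl) (flags-closed {s₂} {p₂ bl} inv₂ match₂ (∈-resp-↭ (↭-sym (flags-p₂ bl)) (stays r)))
        stays (go {z = z} g (there (here refl)) r) with ∈-++⁻ (flags p₁) (∈-resp-↭ (↭-sym flags-all) (∈-allFin z))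
        ... | inj₂ k = ⊥-elim (unique-disjoint (corners bl) unique-corners (stays r) k)
        ... | inj₁ k with ∈-++⁻ (corners bl) (∈-resp-↭ (↭-sym corners-all) (∈-allFin (app s₁ z)))
        ... | inj₁ l = l
        ... | inj₂ l = ⊥-elim (unique-disjoint (flags p₁) unique-flags (flags-closed {s₁} {p₁} inv₁ match₁ k) l)

    module _ (un≡ : un ≡ []) (reached : Reached ρ p₁ bl) (oriented : Oriented p₁ bl []) where
      private
        full₁ : flags p₁ ↭ allFin m
        full₁ = subst (_↭ allFin m) (trans (cong (flags p₁ ++_) un≡) (Listₚ.++-identityʳ (flags p₁))) flags-all
        full : corners bl ↭ allFin m
        full = subst (_↭ allFin m) (trans (cong (corners bl ++_) un≡) (Listₚ.++-identityʳ (corners bl))) corners-all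
        all₁ : ∀ u → u ∈ flags p₁
        all₁ u = ∈-resp-↭ (↭-sym full₁) (∈-allFin u)
        all₀ : ∀ u → u ∈ flags (p₀ bl)
        all₀ u = ∈-resp-↭ (↭-sym (↭-trans (flags-p₀ bl) full)) (∈-allFin u)
        all₂ : ∀ u → u ∈ flags (p₂ bl)
        all₂ u = ∈-resp-↭ (↭-sym (↭-trans (flags-p₂ bl) full)) (∈-allFin u)
        u-corners : Unique (corners bl)
        u-corners = unique-↭ (↭-sym full) (allFin⁺ m)
        u₁ : Unique (flags p₁)
        u₁ = unique-↭ (↭-sym full₁) (allFin⁺ m)
        u₀ : Unique (flags (p₀ bl))
        u₀ = unique-↭ (↭-sym (flags-p₀ bl)) u-corners
        u₂ : Unique (flags (p₂ bl))
        u₂ = unique-↭ (↭-sym (flags-p₂ bl)) u-corners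
        tidy : ∀ R → length (R ++ un) ≡ length R
        tidy R = cong length (trans (cong (R ++_) un≡) (Listₚ.++-identityʳ R))

      module _ {s₀ s₁ s₂} (inv₀ : ∀ x → app s₀ (app s₀ x) ≡ x) (inv₁ : ∀ x → app s₁ (app s₁ x) ≡ x) (inv₂ : ∀ x → app s₂ (app s₂ x) ≡ x)
        (match₀ : Matches s₀ (p₀ bl)) (match₁ : Matches s₁ p₁) (match₂ : Matches s₂ (p₂ bl)) where

        vertex-count : numOrbits (s₁ ∷ s₂ ∷ []) ≡ length RV
        vertex-count = trans (orbit-count {s₁} {s₂} {p₁} {p₂ bl} {p₁ ++ p₂ bl} inv₁ inv₂ match₁ match₂ all₁ all₂ ∈-++⁺ˡ (∈-++⁺ʳ p₁) (∈-++⁻ p₁) (classes vertices)) (tidy RV)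

        face-count : numOrbits (s₀ ∷ s₁ ∷ []) ≡ length RF
        face-count = trans (orbit-count {s₀} {s₁} {p₀ bl} {p₁} {p₁ ++ p₀ bl} inv₀ inv₁ match₀ match₁ all₀ all₁ (∈-++⁺ʳ p₁) ∈-++⁺ˡ (swap⊎ ∘ ∈-++⁻ p₁) (classes faces)) (tidy RF)
          where
          swap⊎ : ∀ {A B : Set} → A ⊎ B → B ⊎ A
          swap⊎ (inj₁ a) = inj₂ a
          swap⊎ (inj₂ b) = inj₁ b

      module _ {d} (balance : length RV + length RF + d ≡ n + 2) where
        private
          mismatch : e ≢ d → ∀ τ → Q τ ≢ true
          mismatch ne (s₀ , s₁ , s₂) q = ne (ℕₚ.+-cancelˡ-≡ (length RV + length RF) e d (trans (trans (cong (_+ e) (sym (cong₂ _+_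
              (vertex-count {s₀} {s₁} {s₂} inv₀ inv₁ inv₂ match₀ match₁ match₂) (face-count {s₀} {s₁} {s₂} inv₀ inv₁ inv₂ match₀ match₁ match₂)))) euler) (sym balance)))
            where
            open Valid (proj₁ (proj₁ spec _ q))
            open Consequences (proj₁ (proj₁ spec _ q)) (proj₂ (proj₁ spec _ q))

          π₀ = partner (p₀ bl)
          π₁ = partner p₁
          π₂ = partner (p₂ bl)
          module M₀ = Partner {p₀ bl} u₀
          module M₁ = Partner {p₁} u₁
          module M₂ = Partner {p₂ bl} u₂
          t₀ t₁ t₂ : Fun m
          t₀ = tabulate π₀
          t₁ = tabulate π₁
          t₂ = tabulate π₂
          at : ∀ (f : F → F) x → lookup (tabulate f) x ≡ f x
          at f x = Vecₚ.lookup∘tabulate f x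
          twice : ∀ (f g : F → F) x → lookup (tabulate f) (lookup (tabulate g) x) ≡ f (g x)
          twice f g x = trans (at f _) (cong f (at g x))

          corner-laws : ∀ x → π₀ (π₂ x) ≡ π₂ (π₀ x) × π₀ (π₂ x) ≢ x
          corner-laws x = cases (in-block bl u-corners {x} (∈-resp-↭ (↭-sym full) (∈-allFin x)))
            where
            law : ∀ {y z w} → π₂ x ≡ y → π₀ y ≡ z → π₀ x ≡ w → π₂ w ≡ z → z ≢ x → π₀ (π₂ x) ≡ π₂ (π₀ x) × π₀ (π₂ x) ≢ x
            law p q r s ne = trans (trans (cong π₀ p) q) (sym (trans (cong π₂ r) s)) , λ h → ne (trans (sym (trans (cong π₀ p) q)) h)
            cases : InBlock bl x → π₀ (π₂ x) ≡ π₂ (π₀ x) × π₀ (π₂ x) ≢ x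
            cases (inBlock ba cd bc da a≢c b≢d (inj₁ (inj₁ refl))) = law (M₂.bwd′ da) (M₀.bwd′ cd) (M₀.bwd′ ba) (M₂.fwd′ bc) (a≢c ∘ sym)
            cases (inBlock ba cd bc da a≢c b≢d (inj₁ (inj₂ refl))) = law (M₂.fwd′ bc) (M₀.fwd′ cd) (M₀.fwd′ ba) (M₂.bwd′ da) (b≢d ∘ sym)
            cases (inBlock ba cd bc da a≢c b≢d (inj₂ (inj₁ refl))) = law (M₂.bwd′ bc) (M₀.fwd′ ba) (M₀.fwd′ cd) (M₂.fwd′ da) a≢c
            cases (inBlock ba cd bc da a≢c b≢d (inj₂ (inj₂ refl))) = law (M₂.fwd′ da) (M₀.bwd′ ba) (M₀.bwd′ cd) (M₂.bwd′ bc) b≢d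

          opposite : ∀ {P} → All (Cross bl) P → (us : Unique (flags P)) → (∀ u → u ∈ flags P) → ∀ x → side bl (partner P x) ≡ not (side bl x)
          opposite {P} cross us all x = cases (∈-flags P (all x))
            where
            cases : Σ F (λ v → (x , v) ∈ P ⊎ (v , x) ∈ P) → side bl (partner P x) ≡ not (side bl x)
            cases (v , inj₁ k) = trans (cong (side bl) (Partner.fwd′ {P} us k)) (side-cross bl u-corners (All.lookup cross k))
            cases (v , inj₂ k) = trans (cong (side bl) (Partner.bwd′ {P} us k)) (trans (sym (Boolₚ.not-involutive _)) (cong not (sym (side-cross bl u-corners (All.lookup cross k)))))

          τ : Triple
          τ = t₀ , t₁ , t₂
          m₀ : Matches t₀ (p₀ bl)
          m₀ {x} {y} k = trans (at π₀ x) (M₀.fwd′ k)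
          m₁ : Matches t₁ p₁
          m₁ {x} {y} k = trans (at π₁ x) (M₁.fwd′ k)
          m₂ : Matches t₂ (p₂ bl)
          m₂ {x} {y} k = trans (at π₂ x) (M₂.fwd′ k)
          i₀ : ∀ x → lookup t₀ (lookup t₀ x) ≡ x
          i₀ = λ x → trans (twice π₀ π₀ x) (proj₁ (M₀.involution all₀ x))
          i₁ : ∀ x → lookup t₁ (lookup t₁ x) ≡ x
          i₁ = λ x → trans (twice π₁ π₁ x) (proj₁ (M₁.involution all₁ x))
          i₂ : ∀ x → lookup t₂ (lookup t₂ x) ≡ x
          i₂ = λ x → trans (twice π₂ π₂ x) (proj₁ (M₂.involution all₂ x))
          gens : List (Fun m)
          gens = t₀ ∷ t₁ ∷ t₂ ∷ []

          connect : ∀ x → Reach gens ρ x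
          connect x = conn-reach edge (reached (∈-resp-↭ (↭-sym full) (∈-allFin x)))
            where
            edge : ∀ {x y} → (x , y) ∈ p₁ ++ (p₀ bl ++ p₂ bl) → Reach gens x y × Reach gens y x
            edge k with ∈-++⁻ p₁ k
            ... | inj₁ l = match-reach {s = t₁} {p₁} (there (here refl)) i₁ m₁ l
            ... | inj₂ l with ∈-++⁻ (p₀ bl) l
            ... | inj₁ l′ = match-reach {s = t₀} {p₀ bl} (here refl) i₀ m₀ l′
            ... | inj₂ l′ = match-reach {s = t₂} {p₂ bl} (there (there (here refl))) i₂ m₂ l′

          valid : e ≡ d → Valid τ
          valid e≡d = record
            { inv₀ = i₀ ; inv₁ = i₁ ; inv₂ = i₂
            ; free₀ = λ x q → proj₂ (M₀.involution all₀ x) (trans (sym (at π₀ x)) q)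
            ; free₁ = λ x q → proj₂ (M₁.involution all₁ x) (trans (sym (at π₁ x)) q)
            ; free₂ = λ x q → proj₂ (M₂.involution all₂ x) (trans (sym (at π₂ x)) q)
            ; commute = λ x → trans (twice π₀ π₂ x) (trans (proj₁ (corner-laws x)) (sym (twice π₂ π₀ x)))
            ; free₀₂ = λ x q → proj₂ (corner-laws x) (trans (sym (twice π₀ π₂ x)) q)
            ; connected = λ x y → reach-trans (reach-sym (λ { (here refl) → i₀ ; (there (here refl)) → i₁ ; (there (there (here refl))) → i₂ }) (connect x)) (connect y)
            ; euler = trans (cong₂ _+_ (cong₂ _+_ (vertex-count {t₀} {t₁} {t₂} i₀ i₁ i₂ m₀ m₁ m₂) (face-count {t₀} {t₁} {t₂} i₀ i₁ i₂ m₀ m₁ m₂)) e≡d) balance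
            ; colouring = λ or → side bl , λ x →
                trans (cong (side bl) (at π₀ x)) (opposite {p₀ bl} (p₀-cross bl) u₀ all₀ x) ,
                trans (cong (side bl) (at π₁ x)) (opposite {p₁} (proj₁ (oriented or)) u₁ all₁ x) ,
                trans (cong (side bl) (at π₂ x)) (opposite {p₂ bl} (p₂-cross bl) u₂ all₂ x) }

          satisfies : Sat p₁ bl τ
          satisfies = sat (All.tabulate m₁) (All.tabulate (λ { {⟨ a , b , c , d ⟩} k → let p , q , r = block-pairs k in m₀ p , m₂ q , m₀ r }))

          determined : ∀ {s P} → (∀ x → app s (app s x) ≡ x) → Matches s P → (us : Unique (flags P)) → (∀ u → u ∈ flags P) → s ≡ tabulate (partner P)
          determined {s} {P} inv match us all = trans (sym (Vecₚ.tabulate∘lookup s)) (Vecₚ.tabulate-cong point)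
            where
            point : ∀ x → app s x ≡ partner P x
            point x = cases (∈-flags P (all x))
              where
              cases : Σ F (λ v → (x , v) ∈ P ⊎ (v , x) ∈ P) → app s x ≡ partner P x
              cases (v , inj₁ k) = trans (match k) (sym (Partner.fwd′ {P} us k))
              cases (v , inj₂ k) = trans (trans (cong (app s) (sym (match k))) (inv v)) (sym (Partner.bwd′ {P} us k))

        -- All three involutions are determined, so there is a single candidate. It satisfies every
        -- condition as soon as the Euler characteristic is right, that is, if the deficiency spent
        -- equals `e`.
        leaf : count Q ≡ isOneℕ (suc e ∸ d)
        leaf = cases (e ℕ.≟ d)
          where
          only : ∀ σ → Q σ ≡ true → σ ≡ τ
          only (s₀ , s₁ , s₂) q = cong₂ _,_ (determined {s₀} {p₀ bl} inv₀ match₀ u₀ all₀) (cong₂ _,_ (determined {s₁} {p₁} inv₁ match₁ u₁ all₁) (determined {s₂} {p₂ bl} inv₂ match₂ u₂ all₂))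
            where
            open Valid (proj₁ (proj₁ spec _ q))
            open Consequences (proj₁ (proj₁ spec _ q)) (proj₂ (proj₁ spec _ q))

          cases : Dec (e ≡ d) → count Q ≡ isOneℕ (suc e ∸ d)
          cases (no ne) = trans (count-0 (mismatch ne)) (sym (isOne-gap ne))
          cases (yes q) = trans (count-1 τ (proj₂ spec τ (valid q) satisfies) only) (sym (cong isOneℕ (trans (cong (suc e ∸_) (sym q)) (ℕₚ.m+n∸n≡m 1 e))))

module Moves (m n : ℕ) (o : Bool) (e : ℕ) where
  open import Data.Bool using (Bool; true; false; _∧_)
  open import Data.Nat as ℕ using (ℕ; suc; _+_; _*_)

  open import Data.Empty using (⊥)
  open import Data.Fin as Fin using (Fin)
  open import Data.List as List using (List; []; _∷_; _++_; length; allFin; map; concat; concatMap)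
  import Data.List.Properties as Listₚ
  open import Data.List.Membership.Propositional using (_∈_; _∉_)
  open import Data.List.Membership.Propositional.Properties using (∈-++⁻; ∈-∃++)
  open import Data.List.Relation.Binary.Permutation.Propositional using (_↭_; ↭-refl; ↭-sym; ↭-trans; ↭-reflexive; prep; swap)
  open import Data.List.Relation.Binary.Permutation.Propositional.Properties using (∈-resp-↭; ++⁺ˡ; ++⁺ʳ; shift; ++-comm; shifts; ↭-length)
  open import Data.List.Relation.Unary.All as All using (All; []; _∷_)
  open import Data.List.Relation.Unary.Any as Any using (Any; here; there)
  open import Data.List.Relation.Unary.AllPairs using ([]; _∷_)
  open import Data.List.Relation.Unary.Unique.Propositional using (Unique)
  open import Data.List.Relation.Unary.Unique.Propositional.Properties using (allFin⁺)
  import Data.Nat.Properties as ℕₚ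
  open import Data.Product using (_×_; _,_; Σ; proj₁; proj₂)
  open import Data.Sum using (_⊎_; inj₁; inj₂)
  open import Function using (_∘_)
  open import Relation.Binary.PropositionalEquality
  open import Defs using (app; _==_)
  open Counting
  open Chains
  open Walk
  open State m n o e
  open Leaf m n o e

  concat-mid : ∀ {A : Set} (X : List (List A)) M Y → concat (X ++ M ∷ Y) ↭ M ++ concat (X ++ Y)
  concat-mid [] M Y = ↭-refl
  concat-mid (L ∷ X) M Y = ↭-trans (++⁺ˡ L (concat-mid X M Y)) (shifts L M)

  cycles-mid : ∀ (X : List (List (F × F))) M Y → concatMap cycle (X ++ M ∷ Y) ↭ cycle M ++ concatMap cycle (X ++ Y)
  cycles-mid [] M Y = ↭-refl
  cycles-mid (L ∷ X) M Y = ↭-trans (++⁺ˡ (cycle L) (cycles-mid X M Y)) (shifts (cycle L) (cycle M))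

  closed-++ : ∀ b (x : F) R {un} → closed b x (R ++ un) ≡ closed b x R ++ un
  closed-++ true x R = refl
  closed-++ false x R = refl

  childCore : ∀ {p₁ bl loops loops′ un RV RF x y bF bV} → Core p₁ bl loops un RV RF →
    Glue x y (concat loops) (concat loops′) bF → Glue x y (concatMap cycle loops) (concatMap cycle loops′) bV →
    Core ((x , y) ∷ p₁) bl loops′ un (closed bV x RV) (closed bF x RF)
  childCore {p₁} {bl} {loops} {loops′} {un} {RV} {RF} {x} {y} {bF} {bV} core gF gV = record
    { flags-all = ↭-trans (↭-sym (↭-trans (++⁺ˡ (flags p₁) (++⁺ʳ un (glue-flags gF))) (shifts (flags p₁) (x ∷ y ∷ [])))) flags-all
    ; corners-all = corners-all
    ; vertices = subst (ChainSystem ((x , y) ∷ (p₁ ++ p₂ bl)) (concatMap cycle loops′)) (closed-++ bV x RV) (glue-chains gV vertices)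
    ; faces = subst (ChainSystem ((x , y) ∷ (p₁ ++ p₀ bl)) (concat loops′)) (closed-++ bF x RF) (glue-chains gF faces) }
    where
    open Core core

  swapCore : ∀ {p₁ bl M N LS un RV RF} → Core p₁ bl (M ∷ N ∷ LS) un RV RF → Core p₁ bl (N ∷ M ∷ LS) un RV RF
  swapCore {p₁} {M = M} {N} {LS} {un} core = record
    { flags-all = ↭-trans (++⁺ˡ (flags p₁) (++⁺ʳ un (flags-≋ (perm (shifts N M))))) flags-all
    ; corners-all = corners-all
    ; vertices = chains-≋ (perm (shifts (cycle M) (cycle N))) vertices
    ; faces = chains-≋ (perm (shifts M N)) faces }
    where
    open Core core

  insert-pairs : ∀ {P Q : List (F × F)} {a b} → ∀ {e} → e ∈ a ∷ b ∷ (P ++ Q) → e ∈ P ++ (a ∷ b ∷ Q)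
  insert-pairs {P} {Q} {a} {b} = ∈-resp-↭ (↭-sym (shifts P (a ∷ b ∷ [])))

  extract-pairs : ∀ {P Q : List (F × F)} {a b} → ∀ {e} → e ∈ P ++ (a ∷ b ∷ Q) → e ∈ a ∷ b ∷ (P ++ Q)
  extract-pairs {P} {Q} {a} {b} = ∈-resp-↭ (shifts P (a ∷ b ∷ []))

  -- The boundary of a single edge, a loop of length two. Finding an edge amounts to adding this
  -- loop and merging it with the first one.
  newLoop : F → F → F → F → List (F × F)
  newLoop a y c d = (a , y) ∷ (c , d) ∷ []

  newCore : ∀ {p₁ bl loops un rest RV RF y a c d} → Core p₁ bl loops un RV RF → un ↭ y ∷ a ∷ c ∷ d ∷ rest →
    Core p₁ (⟨ a , y , c , d ⟩ ∷ bl) (newLoop a y c d ∷ loops) rest RV RF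
  newCore {p₁} {bl} {loops} {un} {rest} {RV} {RF} {y} {a} {c} {d} core p = record
    { flags-all = ↭-trans (++⁺ˡ (flags p₁) (↭-trans (swap a y ↭-refl) (move (flags (concat loops))))) flags-all
    ; corners-all = ↭-trans (↭-trans (swap a y ↭-refl) (move (corners bl))) corners-all
    ; vertices = chains-relabel (insert-pairs {p₁}) (extract-pairs {p₁}) (open-chain (open-chain (chains-↭ orderV vertices)))
    ; faces = chains-relabel (insert-pairs {p₁}) (extract-pairs {p₁}) (chains-≋ (flip ≋-refl) (open-chain (open-chain (chains-↭ orderF faces)))) }
    where
    open Core core
    move : ∀ Z → (y ∷ a ∷ c ∷ d ∷ []) ++ Z ++ rest ↭ Z ++ un
    move Z = ↭-trans (shifts (y ∷ a ∷ c ∷ d ∷ []) Z) (++⁺ˡ Z (↭-sym p))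
    orderV : RV ++ un ↭ d ∷ a ∷ y ∷ c ∷ RV ++ rest
    orderV = ↭-trans (++⁺ˡ RV (↭-trans p (↭-trans (++⁺ʳ rest (↭-trans (prep y (prep a (swap c d ↭-refl))) (↭-trans (prep y (swap a d ↭-refl)) (swap y d (swap a c ↭-refl))))) (prep d (↭-trans (prep y (swap c a ↭-refl)) (swap y a ↭-refl))))))
      (shifts RV (d ∷ a ∷ y ∷ c ∷ []))
    orderF : RF ++ un ↭ c ∷ d ∷ y ∷ a ∷ RF ++ rest
    orderF = ↭-trans (++⁺ˡ RF (↭-trans p (++⁺ʳ rest (++-comm (y ∷ a ∷ []) (c ∷ d ∷ [])))))
      (shifts RF (c ∷ d ∷ y ∷ a ∷ []))

  -- The first flag of each pair is a twisted partner, with a value independent of its place; the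
  -- second is a straight partner, whose value depends on how it divides the loop.
  sumFlags : ∀ L (f : F → ℕ) t h → (∀ A p q B → L ≡ A ++ (p , q) ∷ B → f p ≡ t × f q ≡ h (length A) (length B)) →
    sumOver (flags L) f ≡ length L * t + splits h (length L)
  sumFlags [] f t h hyp = refl
  sumFlags ((p , q) ∷ L) f t h hyp = begin
    f p + (f q + sumOver (flags L) f)
      ≡⟨ cong₂ _+_ (proj₁ (hyp [] p q L refl)) (cong₂ _+_ (proj₂ (hyp [] p q L refl)) (sumFlags L f t (h ∘ suc) (λ A p′ q′ B eq → hyp ((p , q) ∷ A) p′ q′ B (cong ((p , q) ∷_) eq)))) ⟩
    t + (h 0 (length L) + (length L * t + splits (h ∘ suc) (length L)))
      ≡⟨ solve 4 (λ t h l s → t :+ (h :+ (l :+ s)) := (t :+ l) :+ (h :+ s)) refl t (h 0 (length L)) (length L * t) (splits (h ∘ suc) (length L)) ⟩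
    (t + length L * t) + (h 0 (length L) + splits (h ∘ suc) (length L)) ∎
    where
    open ≡-Reasoning
    open import Data.Nat.Solver using (module +-*-Solver)
    open +-*-Solver

  sumLoops : ∀ LS (f : F → ℕ) g → (∀ X M Y → LS ≡ X ++ M ∷ Y → sumOver (flags M) f ≡ g (length M) (map length (X ++ Y))) →
    sumOver (flags (concat LS)) f ≡ picks g (map length LS)
  sumLoops [] f g hyp = refl
  sumLoops (M ∷ LS) f g hyp = trans (cong (λ z → sumOver z f) (flags-++ M (concat LS))) (trans (sumOver-++ (flags M) (flags (concat LS)) f)
    (cong₂ _+_ (hyp [] M LS refl) (sumLoops LS f (λ l L → g l (length M ∷ L)) (λ X N Y eq → hyp (M ∷ X) N Y (cong (M ∷_) eq)))))

  extract : ∀ {A : Set} {x : A} {xs} → x ∈ xs → Σ (List A) λ ys → xs ↭ x ∷ ys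
  extract {x = x} h with ∈-∃++ h
  ... | ys , zs , refl = ys ++ zs , shift x ys zs

  sum-restrict : ∀ {seen rest : List F} (f : F → ℕ) → seen ++ rest ↭ allFin m → (∀ x → x ∈ seen → f x ≡ 0) → sumOver (allFin m) f ≡ sumOver rest f
  sum-restrict {seen} {rest} f p z = trans (sumOver-↭ f (↭-sym p)) (trans (sumOver-++ seen rest f) (cong (_+ sumOver rest f) (sumOver-0 seen z)))

  sum-equal : ∀ {A : Set} (xs : List A) (f : A → ℕ) v k → (∀ x → x ∈ xs → f x ≡ v) → length xs ≡ k → sumOver xs f ≡ k * v
  sum-equal xs f v k h l = trans (sumOver-∈ xs h) (trans (sumOver-const xs v) (cong (_* v) l))

  σ₀ σ₁ σ₂ : Triple → F → F
  σ₀ τ = app (proj₁ τ)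
  σ₁ τ = app (proj₁ (proj₂ τ))
  σ₂ τ = app (proj₂ (proj₂ τ))

  count-none : ∀ {Q : Triple → Bool} {f : Triple → F} {y} → (∀ τ → Q τ ≡ true → f τ ≢ y) → count (λ τ → Q τ ∧ (f τ == y)) ≡ 0
  count-none {Q} {f} h = count-0 λ τ q → let a , b = ∧-true {Q τ} q in h τ a (==-true {x = f τ} b)

  module Discover {bl : List Block} {y : F} {u₁ : List F} (all : corners bl ++ y ∷ u₁ ↭ allFin m)
    (Q : Triple → Bool) (hyp : ∀ τ → Q τ ≡ true → Valid τ × All (BlockOK τ) bl) where

    found : F → F → F → Triple → Bool
    found a c d τ = ((Q τ ∧ (σ₀ τ y == a)) ∧ (σ₂ τ y == c)) ∧ (σ₀ τ c == d)

    private
      unique : Unique (corners bl ++ y ∷ u₁)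
      unique = unique-↭ (↭-sym all) (allFin⁺ m)

      outside : ∀ {v} → v ∈ y ∷ u₁ → v ∉ corners bl
      outside h k = unique-disjoint (corners bl) unique k h

      stable₀ : ∀ τ → Q τ ≡ true → ∀ {v} → σ₀ τ v ∈ corners bl → v ∈ corners bl
      stable₀ τ q {v} h = subst (_∈ corners bl) (Valid.inv₀ val v)
        (∈-resp-↭ (flags-p₀ bl) (flags-closed {proj₁ τ} {p₀ bl} (Valid.inv₀ val) (Consequences.match₀ {[]} val (sat [] ok)) (∈-resp-↭ (↭-sym (flags-p₀ bl)) h)))
        where
        val = proj₁ (hyp τ q)
        ok = proj₂ (hyp τ q)

      stable₂ : ∀ τ → Q τ ≡ true → ∀ {v} → σ₂ τ v ∈ corners bl → v ∈ corners bl
      stable₂ τ q {v} h = subst (_∈ corners bl) (Valid.inv₂ val v)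
        (∈-resp-↭ (flags-p₂ bl) (flags-closed {proj₂ (proj₂ τ)} {p₂ bl} (Valid.inv₂ val) (Consequences.match₂ {[]} val (sat [] ok)) (∈-resp-↭ (↭-sym (flags-p₂ bl)) h)))
        where
        val = proj₁ (hyp τ q)
        ok = proj₂ (hyp τ q)

    discover : ∀ V N → length u₁ ≡ 3 + N → (∀ a c d rest → u₁ ↭ a ∷ c ∷ d ∷ rest → count (found a c d) ≡ V) →
      count Q ≡ (3 + N) * ((2 + N) * ((1 + N) * V))
    discover V N len final = trans (count-split Q (λ τ → σ₀ τ y)) (trans
      (sum-restrict {corners bl ++ y ∷ []} {u₁} _ (↭-trans (↭-reflexive (Listₚ.++-assoc (corners bl) (y ∷ []) u₁)) all) (λ a h → count-none λ τ q eq → none₁ τ q eq (∈-++⁻ (corners bl) h)))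
      (sum-equal u₁ _ _ (3 + N) step₁ len))
      where
      none₁ : ∀ τ → Q τ ≡ true → ∀ {a} → σ₀ τ y ≡ a → a ∈ corners bl ⊎ a ∈ y ∷ [] → ⊥
      none₁ τ q eq (inj₁ h) = outside (here refl) (stable₀ τ q (subst (_∈ corners bl) (sym eq) h))
      none₁ τ q eq (inj₂ (here refl)) = Valid.free₀ (proj₁ (hyp τ q)) y eq
      step₁ : ∀ a → a ∈ u₁ → count (λ τ → Q τ ∧ (σ₀ τ y == a)) ≡ (2 + N) * ((1 + N) * V)
      step₁ a a∈ with extract a∈
      ... | u₂ , p₂ = trans (count-split Q₁ (λ τ → σ₂ τ y)) (trans
          (sum-restrict {corners bl ++ y ∷ a ∷ []} {u₂} _ (↭-trans (↭-reflexive (Listₚ.++-assoc (corners bl) (y ∷ a ∷ []) u₂)) (↭-trans (++⁺ˡ (corners bl) (prep y (↭-sym p₂))) all))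
            (λ c h → count-none λ τ q eq → none₂ τ (∧-true {Q τ} q) eq (∈-++⁻ (corners bl) h)))
          (sum-equal u₂ _ _ (2 + N) step₂ (ℕₚ.suc-injective (trans (sym (↭-length p₂)) len))))
        where
        Q₁ = λ τ → Q τ ∧ (σ₀ τ y == a)
        none₂ : ∀ τ → Q τ ≡ true × (σ₀ τ y == a) ≡ true → ∀ {c} → σ₂ τ y ≡ c → c ∈ corners bl ⊎ c ∈ y ∷ a ∷ [] → ⊥
        none₂ τ (q , qa) eq (inj₁ h) = outside (here refl) (stable₂ τ q (subst (_∈ corners bl) (sym eq) h))
        none₂ τ (q , qa) eq (inj₂ (here refl)) = Valid.free₂ (proj₁ (hyp τ q)) y eq
        none₂ τ (q , qa) eq (inj₂ (there (here refl))) = free₀₂ y (trans (cong (σ₀ τ) (trans eq (sym (==-true {x = σ₀ τ y} qa)))) (inv₀ y))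
          where
          open Valid (proj₁ (hyp τ q))
        step₂ : ∀ c → c ∈ u₂ → count (λ τ → Q₁ τ ∧ (σ₂ τ y == c)) ≡ (1 + N) * V
        step₂ c c∈ with extract c∈
        ... | u₃ , p₃ = trans (count-split Q₂ (λ τ → σ₀ τ c)) (trans
            (sum-restrict {corners bl ++ y ∷ a ∷ c ∷ []} {u₃} _ (↭-trans (↭-reflexive (Listₚ.++-assoc (corners bl) (y ∷ a ∷ c ∷ []) u₃)) (↭-trans (++⁺ˡ (corners bl) (prep y (↭-trans (prep a (↭-sym p₃)) (↭-sym p₂)))) all))
              (λ d h → count-none λ τ q eq → let q₁ , qc = ∧-true {Q₁ τ} q ; q₀ , qa = ∧-true {Q τ} q₁ in none₃ τ q₀ (==-true {x = σ₀ τ y} qa) eq (∈-++⁻ (corners bl) h)))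
            (sum-equal u₃ _ _ (1 + N) step₃ (ℕₚ.suc-injective (ℕₚ.suc-injective (trans (sym (cong suc (↭-length p₃))) (trans (sym (↭-length p₂)) len))))))
          where
          Q₂ = λ τ → Q₁ τ ∧ (σ₂ τ y == c)
          order : u₁ ↭ a ∷ c ∷ u₃
          order = ↭-trans p₂ (prep a p₃)
          distinct₃ : Unique (corners bl ++ y ∷ a ∷ c ∷ u₃)
          distinct₃ = unique-↭ (++⁺ˡ (corners bl) (prep y order)) unique
          tails : ∀ (Z : List F) {W} → Unique (Z ++ W) → Unique W
          tails [] u = u
          tails (z ∷ Z) (_ ∷ u) = tails Z u
          none₃ : ∀ τ → Q τ ≡ true → σ₀ τ y ≡ a → ∀ {d} → σ₀ τ c ≡ d → d ∈ corners bl ⊎ d ∈ y ∷ a ∷ c ∷ [] → ⊥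
          none₃ τ q ya eq (inj₁ h) = outside (there (∈-resp-↭ (↭-sym order) (there (here refl)))) (stable₀ τ q (subst (_∈ corners bl) (sym eq) h))
          none₃ τ q ya eq (inj₂ (here refl)) with tails (corners bl) distinct₃
          ... | _ ∷ na ∷ _ = All.lookup na (here refl) (trans (sym ya) (trans (cong (σ₀ τ) (sym eq)) (Valid.inv₀ (proj₁ (hyp τ q)) c)))
          none₃ τ q ya eq (inj₂ (there (here refl))) with tails (corners bl) distinct₃
          ... | ny ∷ _ = All.lookup ny (there (here refl)) (trans (sym (inv₀ y)) (trans (cong (σ₀ τ) (trans ya (sym eq))) (inv₀ c)))
            where
            open Valid (proj₁ (hyp τ q))
          none₃ τ q ya eq (inj₂ (there (there (here refl)))) = Valid.free₀ (proj₁ (hyp τ q)) c eq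
          step₃ : ∀ d → d ∈ u₃ → count (λ τ → Q₂ τ ∧ (σ₀ τ c == d)) ≡ V
          step₃ d d∈ with extract d∈
          ... | u₄ , p₄ = final a c d u₄ (↭-trans order (prep a (prep c p₄)))

    found-spec : ∀ {p₁} a c d → (∀ τ → Q τ ≡ true → Sat p₁ bl τ) → (∀ τ → Valid τ → Sat p₁ bl τ → Q τ ≡ true) → Spec (found a c d) p₁ (⟨ a , y , c , d ⟩ ∷ bl)
    found-spec {p₁} a c d h₁ h₂ = to , from
      where
      to : ∀ τ → found a c d τ ≡ true → Valid τ × Sat p₁ (⟨ a , y , c , d ⟩ ∷ bl) τ
      to τ q = let q₂ , qd = ∧-true {(Q τ ∧ (σ₀ τ y == a)) ∧ (σ₂ τ y == c)} q ; q₁ , qc = ∧-true {Q τ ∧ (σ₀ τ y == a)} q₂ ; q₀ , qa = ∧-true {Q τ} q₁ in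
        proj₁ (hyp τ q₀) , sat (pairs (h₁ τ q₀)) ((==-true {x = σ₀ τ y} qa , ==-true {x = σ₂ τ y} qc , ==-true {x = σ₀ τ c} qd) ∷ blocks (h₁ τ q₀))
      from : ∀ τ → Valid τ → Sat p₁ (⟨ a , y , c , d ⟩ ∷ bl) τ → found a c d τ ≡ true
      from τ v (sat ps ((ya , yc , cd) ∷ bs)) = true-∧ (true-∧ (true-∧ (h₂ τ v (sat ps bs)) (test ya)) (test yc)) (test cd)
        where
        test : ∀ {u v : F} → u ≡ v → (u == v) ≡ true
        test {u} refl = ==-refl u

module Explore (m n : ℕ) (o : Bool) (e : ℕ) (ρ : Fin m) where
  open import Data.Bool using (Bool; true; false; not; _xor_; _∧_)
  open import Data.Nat as ℕ using (ℕ; zero; suc; _+_; _*_; _∸_; _!; pred)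
  open import Data.Fin as Fin using (Fin)

  import Data.Bool.Properties as Boolₚ
  open import Data.Empty using (⊥; ⊥-elim)
  open import Data.List as List using (List; []; _∷_; _++_; length; allFin; map; concat; concatMap)
  import Data.List.Properties as Listₚ
  open import Data.List.Membership.Propositional using (_∈_)
  open import Data.List.Membership.Propositional.Properties using (∈-allFin; ∈-++⁺ˡ; ∈-++⁺ʳ; ∈-++⁻)
  open import Data.List.Relation.Binary.Permutation.Propositional using (_↭_; ↭-sym; ↭-trans; ↭-reflexive; prep)
  open import Data.List.Relation.Binary.Permutation.Propositional.Properties using (∈-resp-↭; ++⁺ˡ; All-resp-↭; ↭-length)
  open import Data.List.Relation.Unary.All as All using (All; []; _∷_)
  import Data.List.Relation.Unary.All.Properties as Allₚ
  open import Data.List.Relation.Unary.AllPairs using ([]; _∷_)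
  open import Data.List.Relation.Unary.Any as Any using (Any; here; there)
  open import Data.List.Relation.Unary.Unique.Propositional using (Unique)
  open import Data.List.Relation.Unary.Unique.Propositional.Properties using (allFin⁺)
  open import Data.Nat.ListAction using (sum)
  import Data.Nat.Properties as ℕₚ
  open import Data.Nat.Solver using (module +-*-Solver)
  open import Data.Product using (_×_; _,_; proj₁; proj₂)
  open import Data.Sum using (inj₁; inj₂)
  open import Function using (_∘_)
  open import Relation.Binary.PropositionalEquality
  open import Defs using (_==_)
  open Counting
  open Chains
  open Walk
  open State m n o e
  open Leaf m n o e
  open Moves m n o e

  -- 0 for orientable maps only, 1 for all maps
  bit : Bool → ℕ
  bit true = 0
  bit false = 1

  b : ℕ
  b = bit o

  -- An emptied loop may stay in the list. Its last vertex is already counted as closed, so it must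
  -- not count as an open loop.
  nonempty : List ℕ → ℕ
  nonempty [] = 0
  nonempty (zero ∷ K) = nonempty K
  nonempty (suc k ∷ K) = suc (nonempty K)

  lengths : List (List (F × F)) → List ℕ
  lengths = map length

  -- A potential that turns into the number of vertices plus faces at the end. Closing a face,
  -- splitting a loop and finding an edge preserve it; a twist lowers it by one and a junction by
  -- two. The total loss `d` is therefore `2 - χ`.
  weight : List F → List F → List ℕ → ℕ → ℕ
  weight RV RF K r = length RV + length RF + (sum K + r + nonempty K)

  record Situation (p₁ : List (F × F)) (bl : List Block) (loops : List (List (F × F))) (un RV RF : List F) (r d : ℕ) : Set where
    field
      core : Core p₁ bl loops un RV RF
      size : length un ≡ 4 * r
      balance : weight RV RF (lengths loops) r + d ≡ n + 2
      reached : Reached ρ p₁ bl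
      oriented : Oriented p₁ bl loops
      root : ρ ∈ corners bl

  bump : Bool → ℕ
  bump true = 1
  bump false = 0

  closed-length : ∀ c (x : F) R → length (closed c x R) ≡ bump c + length R
  closed-length true x R = refl
  closed-length false x R = refl

  empty-or-not : ∀ (L : List (F × F)) K → bump (isEmpty L) + nonempty (length L ∷ K) ≡ suc (nonempty K)
  empty-or-not [] K = refl
  empty-or-not (_ ∷ L) K = refl

  sum-mid : ∀ K k L → sum (K ++ k ∷ L) ≡ k + sum (K ++ L)
  sum-mid [] k L = refl
  sum-mid (j ∷ K) k L = trans (cong (j +_) (sum-mid K k L)) (solve 3 (λ j k s → j :+ (k :+ s) := k :+ (j :+ s)) refl j k (sum (K ++ L)))
    where
    open +-*-Solver

  nonempty-mid : ∀ K k L → nonempty (K ++ suc k ∷ L) ≡ suc (nonempty (K ++ L))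
  nonempty-mid [] k L = refl
  nonempty-mid (zero ∷ K) k L = nonempty-mid K k L
  nonempty-mid (suc j ∷ K) k L = cong suc (nonempty-mid K k L)

  stepSpec : ∀ {Q p₁ bl} x y → Spec Q p₁ bl → Spec (λ τ → Q τ ∧ (σ₁ τ x == y)) ((x , y) ∷ p₁) bl
  stepSpec {Q} {p₁} {bl} x y (to , from) =
    (λ τ h → let q , xy = ∧-true {Q τ} h in proj₁ (to τ q) , sat (==-true {x = σ₁ τ x} xy ∷ pairs (proj₂ (to τ q))) (blocks (proj₂ (to τ q)))) ,
    (λ { τ v (sat (xy ∷ ps) bs) → true-∧ (from τ v (sat ps bs)) (test xy) })
    where
    test : ∀ {u v : F} → u ≡ v → (u == v) ≡ true
    test {u} refl = ==-refl u

  -- The explored part is connected, so a proper colouring of the map agrees there with `side` up to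
  -- a constant. `σ₁` cannot match two flags on the same side.
  same-colour : ∀ {Q p₁ bl loops un RV RF r d} → Situation p₁ bl loops un RV RF r d → Spec Q p₁ bl → o ≡ true →
    ∀ {x p} → x ∈ even bl → p ∈ even bl → count (λ τ → Q τ ∧ (σ₁ τ x == p)) ≡ 0
  same-colour {Q} {p₁} {bl} {un = un} sit (to , _) or {x} {p} x∈ p∈ = count-none λ τ q eq → contradiction τ (proj₁ (to τ q)) (proj₂ (to τ q)) eq
    where
    open Situation sit
    open Core core
    unique : Unique (corners bl)
    unique = unique-++ˡ (corners bl) (unique-↭ (↭-sym corners-all) (allFin⁺ m))
    contradiction : ∀ τ → Valid τ → Sat p₁ bl τ → σ₁ τ x ≢ p
    contradiction τ v s eq with Valid.colouring v or
    ... | c , alt = Boolₚ.not-¬ {c x} refl (trans agree (trans (cong c (sym eq)) (proj₁ (proj₂ (alt x)))))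
      where
      open Consequences v s
      opposite : ∀ {u w} → (u , w) ∈ p₁ ++ (p₀ bl ++ p₂ bl) → c w ≡ not (c u) × side bl w ≡ not (side bl u)
      opposite {u} h with ∈-++⁻ p₁ h
      ... | inj₁ k = trans (cong c (sym (match₁ k))) (proj₁ (proj₂ (alt u))) , side-cross bl unique (All.lookup (proj₁ (oriented or)) k)
      ... | inj₂ k with ∈-++⁻ (p₀ bl) k
      ... | inj₁ k₀ = trans (cong c (sym (match₀ k₀))) (proj₁ (alt u)) , side-cross bl unique (All.lookup (p₀-cross bl) k₀)
      ... | inj₂ k₂ = trans (cong c (sym (match₂ k₂))) (proj₂ (proj₂ (alt u))) , side-cross bl unique (All.lookup (p₂-cross bl) k₂)
      relation : c x xor side bl x ≡ c p xor side bl p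
      relation = colour-side {c = c} {side bl} opposite (conn-trans (conn-sym (reached (even⊆ bl x∈))) (reached (even⊆ bl p∈)))
      agree : c x ≡ c p
      agree = trans (sym (Boolₚ.xor-identityʳ (c x))) (trans (cong (c x xor_) (sym (side-even bl unique x∈)))
        (trans relation (trans (cong (c p xor_) (side-even bl unique p∈)) (Boolₚ.xor-identityʳ (c p)))))

  fresh : ℕ → ℕ → ℕ → List ℕ → ℕ → ℕ
  fresh s i k K zero = 0
  fresh s i k K (suc r) = maps b s i (suc (suc k) ∷ K) r

  maps-unfold : ∀ s i k K r → maps b (suc s) i (suc k ∷ K) r ≡
    (maps b s i (k ∷ K) r + splits (λ p q → maps b s i (suc p ∷ q ∷ K) r) k
    + (b * (k * maps b s (pred i) (k ∷ K) r) + suc b * picks (λ l L → l * maps b s (pred (pred i)) (k + l ∷ L) r) K))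
    + fresh s i k K r
  maps-unfold s i k K zero = sym (ℕₚ.+-identityʳ _)
  maps-unfold s i k K (suc r) = refl

  -- The factorial is the number of ways to name the flags of the `r` edges still to be found.
  Result : (Triple → Bool) → List ℕ → ℕ → ℕ → ℕ → Set
  Result Q K r s i = count Q ≡ (4 * r) ! * maps b s i K r

  -- The triples are sorted by the `σ₁`-partner of the first flag of the first loop. Matched flags
  -- and the flag itself contribute nothing; the other partners correspond to the terms of `maps`.
  explore : ∀ s loops {p₁ bl un RV RF r d} Q → Situation p₁ bl loops un RV RF r d → Spec Q p₁ bl → s ≡ sum (lengths loops) + (r + r) →
    Result Q (lengths loops) r s (suc e ∸ d)
  explore s [] {p₁} {bl} {[]} {RV} {RF} {zero} {d} Q sit spec eq =
    trans (leaf {ρ} core Q spec refl reached oriented (trans (cong (_+ d) (sym (ℕₚ.+-identityʳ (length RV + length RF)))) balance)) (sym (ℕₚ.*-identityˡ _))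
    where
    open Situation sit
  explore s [] {un = u ∷ un} {r = zero} Q sit spec eq with () ← Situation.size sit
  explore s [] {un = []} {r = suc r} Q sit spec eq with () ← Situation.size sit
  explore s [] {un = u ∷ un} {r = suc r} Q sit spec eq = trans (dead-end {ρ} core Q spec (here refl) root) (sym (ℕₚ.*-zeroʳ ((4 * suc r) !)))
    where
    open Situation sit
  explore s ([] ∷ loops) Q sit spec eq = explore s loops Q (record
    { core = record { flags-all = flags-all ; corners-all = corners-all ; vertices = vertices ; faces = faces }
    ; size = size ; balance = balance ; reached = reached ; oriented = oriented ; root = root }) spec eq
    where
    open Situation sit
    open Core core
  explore (suc s) (((x , q₁) ∷ L) ∷ LS) {p₁} {bl} {un} {RV} {RF} {r} {d} Q sit spec eq = begin
    count Q ≡⟨ count-split Q (λ τ → σ₁ τ x) ⟩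
    sumOver (allFin m) f ≡⟨ sumOver-↭ f (↭-sym flags-all) ⟩
    sumOver (flags p₁ ++ (flags (concat loops) ++ un)) f
      ≡⟨ trans (sumOver-++ (flags p₁) _ f) (cong₂ _+_ used (sumOver-++ (flags (concat loops)) un f)) ⟩
    f x + (f q₁ + sumOver (flags (L ++ concat LS)) f) + sumOver un f
      ≡⟨ cong₂ _+_ (cong₂ _+_ self (cong₂ _+_ case-i (trans (cong (λ z → sumOver z f) (flags-++ L (concat LS))) (trans (sumOver-++ (flags L) (flags (concat LS)) f) (cong₂ _+_ (sumFlags L f t h case-loop) (sumLoops LS f g case-other)))))) case-new ⟩
    (c * w₀ + (k * t + splits h k + picks g K)) + c * fresh s i k K r
      ≡⟨ cong (_+ c * fresh s i k K r) (cong (c * w₀ +_) (cong₂ _+_ (cong (k * t +_) (splits-scale c _ k)) (trans (picks-cong (λ l M → factor l (maps b s (pred (pred i)) (k + l ∷ M) r)) K) (picks-scale (c * suc b) _ K)))) ⟩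
    (c * w₀ + (k * t + c * S + c * suc b * P)) + c * fresh s i k K r
      ≡⟨ solve 8 (λ c w k b w₁ S P z → (c :* w :+ (k :* (c :* (b :* w₁)) :+ c :* S :+ c :* (con 1 :+ b) :* P)) :+ c :* z
           := c :* (((w :+ S) :+ (b :* (k :* w₁) :+ (con 1 :+ b) :* P)) :+ z)) refl c w₀ k b w₁ S P (fresh s i k K r) ⟩
    c * ((w₀ + S + (b * (k * w₁) + suc b * P)) + fresh s i k K r) ≡⟨ cong (c *_) (sym (maps-unfold s i k K r)) ⟩
    c * maps b (suc s) i (suc k ∷ K) r ∎
    where
    open ≡-Reasoning
    open +-*-Solver
    open Situation sit
    open Core core
    loops = ((x , q₁) ∷ L) ∷ LS
    k = length L
    K = lengths LS
    i = suc e ∸ d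
    c = (4 * r) !
    f : F → ℕ
    f y = count (λ τ → Q τ ∧ (σ₁ τ x == y))
    w₀ = maps b s i (k ∷ K) r
    w₁ = maps b s (pred i) (k ∷ K) r
    h : ℕ → ℕ → ℕ
    h p q = c * maps b s i (suc p ∷ q ∷ K) r
    t = c * (b * w₁)
    g : ℕ → List ℕ → ℕ
    g l M = let w = maps b s (pred (pred i)) (k + l ∷ M) r in l * (c * (b * w)) + l * (c * w)
    S = splits (λ p q → maps b s i (suc p ∷ q ∷ K) r) k
    P = picks (λ l M → l * maps b s (pred (pred i)) (k + l ∷ M) r) K

    factor : ∀ l w → l * (c * (b * w)) + l * (c * w) ≡ c * suc b * (l * w)
    factor l w = solve 4 (λ l c b w → l :* (c :* (b :* w)) :+ l :* (c :* w) := c :* (con 1 :+ b) :* (l :* w)) refl l c b w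

    fuel : s ≡ (k + sum K) + (r + r)
    fuel = ℕₚ.suc-injective eq

    unique-flags : Unique (flags p₁ ++ (flags (concat loops) ++ un))
    unique-flags = unique-↭ (↭-sym flags-all) (allFin⁺ m)

    used : sumOver (flags p₁) f ≡ 0
    used = sumOver-0 (flags p₁) λ y y∈ → count-none λ τ q xy → unique-disjoint (flags p₁) unique-flags
      (subst (_∈ flags p₁) (trans (cong (σ₁ τ) (sym xy)) (Valid.inv₁ (proj₁ (proj₁ spec τ q)) x))
        (flags-closed {proj₁ (proj₂ τ)} {p₁} (Valid.inv₁ (proj₁ (proj₁ spec τ q))) (Consequences.match₁ (proj₁ (proj₁ spec τ q)) (proj₂ (proj₁ spec τ q))) y∈))
      (here refl)

    self : f x ≡ 0
    self = count-none λ τ q xx → Valid.free₁ (proj₁ (proj₁ spec τ q)) x xx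

    x∈corners : x ∈ corners bl
    x∈corners with ∈-++⁻ (corners bl) (∈-resp-↭ (↭-sym corners-all) (∈-allFin x))
    ... | inj₁ h = h
    ... | inj₂ h = ⊥-elim (unique-disjoint (flags (concat loops)) (rest (flags p₁) unique-flags) (here refl) h)
      where
      rest : ∀ (Z : List F) {W} → Unique (Z ++ W) → Unique W
      rest [] u = u
      rest (z ∷ Z) (_ ∷ u) = rest Z u

    child : ∀ {y loops′ bF bV d′ K′ w} → Glue x y (concat loops) (concat loops′) bF → Glue x y (concatMap cycle loops) (concatMap cycle loops′) bV →
      lengths loops′ ≡ K′ → weight (closed bV x RV) (closed bF x RF) K′ r + d′ ≡ n + 2 → s ≡ sum K′ + (r + r) →
      (o ≡ true → Cross bl (x , y) × All (λ z → proj₁ z ∈ even bl × proj₂ z ∈ odd bl) (concat loops′)) →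
      w ≡ maps b s (suc e ∸ d′) K′ r → f y ≡ c * w
    child {y} {loops′} gF gV refl bal fuel′ ori w≡ = trans (explore s loops′ _ (record
      { core = childCore {bl = bl} {loops = loops} {loops′} core gF gV ; size = size ; balance = bal ; reached = λ h → conn-weaken (reached h)
      ; oriented = λ or → (proj₁ (ori or) ∷ proj₁ (oriented or)) , proj₂ (ori or) ; root = root }) (stepSpec x y spec) fuel′) (cong (c *_) (sym w≡))

    dropped : pred i ≡ suc e ∸ suc d
    dropped = ℕₚ.pred[m∸n]≡m∸[1+n] (suc e) d

    dropped₂ : pred (pred i) ≡ suc e ∸ suc (suc d)
    dropped₂ = trans (cong pred dropped) (ℕₚ.pred[m∸n]≡m∸[1+n] (suc e) (suc d))

    -- A partner of the same colour is impossible if orientability is demanded and counts in full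
    -- otherwise, which is the factor `b`.
    orientable-case : ∀ {y w} → (o ≡ true → x ∈ even bl × y ∈ even bl) → ((o ≡ true → ⊥) → f y ≡ c * w) → f y ≡ c * (b * w)
    orientable-case {y} {w} both value = go o refl
      where
      go : ∀ o′ → o ≡ o′ → f y ≡ c * (bit o′ * w)
      go true or = trans (same-colour sit spec or (proj₁ (both or)) (proj₂ (both or))) (sym (ℕₚ.*-zeroʳ c))
      go false no = trans (value (λ or → absurd (trans (sym or) no))) (cong (c *_) (sym (ℕₚ.+-identityʳ w)))
        where
        absurd : true ≢ false
        absurd ()

    sides : (or : o ≡ true) → All (λ z → proj₁ z ∈ even bl × proj₂ z ∈ odd bl) (concat loops)
    sides or = proj₂ (oriented or)

    case-i : f q₁ ≡ c * w₀
    case-i = child {loops′ = L ∷ LS} {d′ = d} (closing ≋-refl) (glue-frame (concatMap cycle LS) (glue-cycle x q₁ L)) refl bal fuel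
      (λ or → let (x∈ , q∈) = All.lookup (sides or) (here refl) in inj₁ (x∈ , q∈) , All.tail (sides or)) refl
      where
      bal : weight (closed (isEmpty L) x RV) (x ∷ RF) (k ∷ K) r + d ≡ n + 2
      bal = trans (cong (λ v → v + suc (length RF) + (k + sum K + r + nonempty (k ∷ K)) + d) (closed-length (isEmpty L) x RV)) (trans
        (solve 8 (λ β v f k S r N d → β :+ v :+ (con 1 :+ f) :+ (k :+ S :+ r :+ N) :+ d := v :+ f :+ ((con 1 :+ k) :+ S :+ r :+ (β :+ N)) :+ d) refl
          (bump (isEmpty L)) (length RV) (length RF) k (sum K) r (nonempty (k ∷ K)) d)
        (trans (cong (λ N → length RV + length RF + (suc k + sum K + r + N) + d) (empty-or-not L K)) balance))

    case-loop : ∀ A p q B → L ≡ A ++ (p , q) ∷ B → f p ≡ t × f q ≡ h (length A) (length B)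
    case-loop A p q B L≡ = orientable-case both twisted , straight
      where
      a = length A
      β = length B
      k≡ : k ≡ a + suc β
      k≡ = trans (cong length L≡) (Listₚ.length-++ A)
      both : o ≡ true → x ∈ even bl × p ∈ even bl
      both or = proj₁ (All.lookup (sides or) (here refl)) , proj₁ (All.lookup (sides or) (there (∈-++⁺ˡ (subst ((p , q) ∈_) (sym L≡) (∈-++⁺ʳ A (here refl))))))
      frameF : ∀ {y E′ c} → Glue x y ((x , q₁) ∷ A ++ (p , q) ∷ B) E′ c → Glue x y (concat loops) (E′ ++ concat LS) c
      frameF {y} {E′} {c} gl = subst (λ M → Glue x y (((x , q₁) ∷ M) ++ concat LS) (E′ ++ concat LS) c) (sym L≡) (glue-frame (concat LS) gl)
      frameV : ∀ {y E′ c} → Glue x y (cycle ((x , q₁) ∷ A ++ (p , q) ∷ B)) E′ c → Glue x y (concatMap cycle loops) (E′ ++ concatMap cycle LS) c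
      frameV {y} {E′} {c} gl = subst (λ M → Glue x y (cycle ((x , q₁) ∷ M) ++ concatMap cycle LS) (E′ ++ concatMap cycle LS) c) (sym L≡) (glue-frame (concatMap cycle LS) gl)
      twisted : (o ≡ true → ⊥) → f p ≡ c * w₁
      twisted no = child {loops′ = ((q , q₁) ∷ A ++ flipped B) ∷ LS} {d′ = suc d} (frameF (glue-twist x q₁ A p q B)) (frameV (glue-twist-cycle x q₁ A p q B))
        (cong (_∷ K) len) bal fuel (λ or → ⊥-elim (no or)) (cong (λ j → maps b s j (k ∷ K) r) dropped)
        where
        len : suc (length (A ++ flipped B)) ≡ k
        len = trans (cong suc (trans (Listₚ.length-++ A) (cong (a +_) (flipped-length B)))) (trans (sym (ℕₚ.+-suc a β)) (sym k≡))
        bal : weight RV RF (k ∷ K) r + suc d ≡ n + 2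
        bal = trans (ℕₚ.+-suc (weight RV RF (k ∷ K) r) d) (trans (cong (λ N → suc (length RV + length RF + (k + sum K + r + N)) + d) (nonzero k≡))
          (trans (solve 7 (λ v f k S r N d → con 1 :+ (v :+ f :+ (k :+ S :+ r :+ N)) :+ d := v :+ f :+ (con 1 :+ k :+ S :+ r :+ N) :+ d) refl (length RV) (length RF) k (sum K) r (suc (nonempty K)) d) balance))
          where
          nonzero : ∀ {k} → k ≡ a + suc β → nonempty (k ∷ K) ≡ suc (nonempty K)
          nonzero eq rewrite trans eq (ℕₚ.+-suc a β) = refl
      straight : f q ≡ h a β
      straight = child {loops′ = ((p , q₁) ∷ A) ∷ B ∷ LS} {d′ = d}
        (glue-≋ ≋-refl (perm (↭-reflexive (Listₚ.++-assoc ((p , q₁) ∷ A) B (concat LS)))) (frameF (glue-split x q₁ A p q B)))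
        (glue-≋ ≋-refl (perm (↭-reflexive (Listₚ.++-assoc (cycle ((p , q₁) ∷ A)) (cycle B) (concatMap cycle LS)))) (frameV (glue-split-cycle x q₁ A p q B)))
        refl bal (trans fuel (trans (cong (λ k → k + sum K + (r + r)) k≡) (solve 4 (λ a β S R → a :+ (con 1 :+ β) :+ S :+ R := con 1 :+ a :+ (β :+ S) :+ R) refl a β (sum K) (r + r))))
        ori refl
        where
        ori : o ≡ true → Cross bl (x , q) × All (λ z → proj₁ z ∈ even bl × proj₂ z ∈ odd bl) ((p , q₁) ∷ A ++ (B ++ concat LS))
        ori or with sides or
        ... | (x∈ , q₁∈) ∷ rest with Allₚ.++⁻ L rest
        ... | onL , others with Allₚ.++⁻ A (subst (All _) L≡ onL)
        ... | onA , (p∈ , q∈) ∷ onB = inj₁ (x∈ , q∈) , ((p∈ , q₁∈) ∷ Allₚ.++⁺ onA (Allₚ.++⁺ onB others))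
        bal : weight (closed (isEmpty B) x RV) RF (suc a ∷ β ∷ K) r + d ≡ n + 2
        bal = trans (cong (λ v → v + length RF + (suc a + (β + sum K) + r + suc (nonempty (β ∷ K))) + d) (closed-length (isEmpty B) x RV)) (trans
          (solve 9 (λ e v f a β S r N d → e :+ v :+ f :+ (con 1 :+ a :+ (β :+ S) :+ r :+ (con 1 :+ N)) :+ d := v :+ f :+ ((con 1 :+ (a :+ (con 1 :+ β))) :+ S :+ r :+ (e :+ N)) :+ d) refl
            (bump (isEmpty B)) (length RV) (length RF) a β (sum K) r (nonempty (β ∷ K)) d)
          (trans (cong₂ (λ k N → length RV + length RF + (suc k + sum K + r + N) + d) (sym k≡) (empty-or-not B K)) balance))

    case-other : ∀ X M Y → LS ≡ X ++ M ∷ Y → sumOver (flags M) f ≡ g (length M) (lengths (X ++ Y))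
    case-other X M Y LS≡ = trans (sumFlags M f (c * (b * w)) (λ _ _ → c * w) both-ends) (cong (length M * (c * (b * w)) +_) (splits-const (c * w) (length M)))
      where
      w = maps b s (pred (pred i)) (k + length M ∷ lengths (X ++ Y)) r
      both-ends : ∀ A p q B → M ≡ A ++ (p , q) ∷ B → f p ≡ c * (b * w) × f q ≡ c * w
      both-ends A p q B M≡ = orientable-case both crossed , merged
        where
        N = B ++ A
        μ≡ : length M ≡ suc (length N)
        μ≡ = trans (cong length M≡) (trans (Listₚ.length-++ A) (trans (ℕₚ.+-comm (length A) _) (cong suc (sym (Listₚ.length-++ B)))))
        KK : K ≡ lengths X ++ suc (length N) ∷ lengths Y
        KK = trans (cong lengths LS≡) (trans (Listₚ.map-++ length X (M ∷ Y)) (cong (λ μ → lengths X ++ μ ∷ lengths Y) μ≡))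
        KXY : lengths (X ++ Y) ≡ lengths X ++ lengths Y
        KXY = Listₚ.map-++ length X Y
        sumK : sum K ≡ suc (length N) + sum (lengths (X ++ Y))
        sumK = trans (cong sum KK) (trans (sum-mid (lengths X) _ (lengths Y)) (cong (λ Z → suc (length N) + sum Z) (sym KXY)))
        neK : nonempty K ≡ suc (nonempty (lengths (X ++ Y)))
        neK = trans (cong nonempty KK) (trans (nonempty-mid (lengths X) _ (lengths Y)) (cong (suc ∘ nonempty) (sym KXY)))
        frameF : ∀ {y E′} → Glue x y (((x , q₁) ∷ L) ++ (A ++ (p , q) ∷ B)) E′ false → Glue x y (concat loops) (E′ ++ concat (X ++ Y)) false
        frameF {y} {E′} gl = glue-≋ (perm (subst₂ (λ Z W → ((x , q₁) ∷ L) ++ concat Z ↭ (((x , q₁) ∷ L) ++ W) ++ concat (X ++ Y)) (sym LS≡) M≡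
          (↭-trans (++⁺ˡ ((x , q₁) ∷ L) (concat-mid X M Y)) (↭-reflexive (sym (Listₚ.++-assoc ((x , q₁) ∷ L) M (concat (X ++ Y)))))))) ≋-refl (glue-frame (concat (X ++ Y)) gl)
        frameV : ∀ {y E′} → Glue x y (cycle ((x , q₁) ∷ L) ++ cycle (A ++ (p , q) ∷ B)) E′ false → Glue x y (concatMap cycle loops) (E′ ++ concatMap cycle (X ++ Y)) false
        frameV {y} {E′} gl = glue-≋ (perm (subst₂ (λ Z W → cycle ((x , q₁) ∷ L) ++ concatMap cycle Z ↭ (cycle ((x , q₁) ∷ L) ++ cycle W) ++ concatMap cycle (X ++ Y)) (sym LS≡) M≡
          (↭-trans (++⁺ˡ (cycle ((x , q₁) ∷ L)) (cycles-mid X M Y)) (↭-reflexive (sym (Listₚ.++-assoc (cycle ((x , q₁) ∷ L)) (cycle M) (concatMap cycle (X ++ Y)))))))) ≋-refl (glue-frame (concatMap cycle (X ++ Y)) gl)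
        bal : weight RV RF (k + length M ∷ lengths (X ++ Y)) r + suc (suc d) ≡ n + 2
        bal = trans (cong (λ N → length RV + length RF + (k + length M + sum (lengths (X ++ Y)) + r + N) + suc (suc d)) (positive μ≡)) (trans
          (cong (λ μ → length RV + length RF + (k + μ + sum (lengths (X ++ Y)) + r + suc (nonempty (lengths (X ++ Y)))) + suc (suc d)) μ≡) (trans
          (solve 8 (λ v f k ν S r N d → v :+ f :+ (k :+ (con 1 :+ ν) :+ S :+ r :+ (con 1 :+ N)) :+ (con 2 :+ d) := v :+ f :+ ((con 1 :+ k) :+ ((con 1 :+ ν) :+ S) :+ r :+ (con 1 :+ (con 1 :+ N))) :+ d) refl
            (length RV) (length RF) k (length N) (sum (lengths (X ++ Y))) r (nonempty (lengths (X ++ Y))) d)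
          (trans (cong₂ (λ S N → length RV + length RF + (suc k + S + r + suc N) + d) (sym sumK) (sym neK)) balance)))
          where
          positive : ∀ {μ ν} → μ ≡ suc ν → nonempty (k + μ ∷ lengths (X ++ Y)) ≡ suc (nonempty (lengths (X ++ Y)))
          positive {ν = ν} eq rewrite trans (cong (k +_) eq) (ℕₚ.+-suc k ν) = refl
        fuel′ : s ≡ (k + length M + sum (lengths (X ++ Y))) + (r + r)
        fuel′ = trans fuel (cong (_+ (r + r)) (trans (cong (k +_) (trans sumK (cong (_+ sum (lengths (X ++ Y))) (sym μ≡)))) (sym (ℕₚ.+-assoc k (length M) _))))
        inLS : ∀ {P : F × F → Set} → All P (concat LS) → All P (M ++ concat (X ++ Y))
        inLS ps = All-resp-↭ (concat-mid X M Y) (subst (λ Z → All _ (concat Z)) LS≡ ps)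
        both : o ≡ true → x ∈ even bl × p ∈ even bl
        both or with sides or
        ... | (x∈ , _) ∷ rest = x∈ , proj₁ (All.lookup (Allₚ.++⁻ˡ M (inLS (Allₚ.++⁻ʳ L rest))) (subst ((p , q) ∈_) (sym M≡) (∈-++⁺ʳ A (here refl))))
        crossed : (o ≡ true → ⊥) → f p ≡ c * w
        crossed no = child {loops′ = ((q , q₁) ∷ L ++ flipped N) ∷ (X ++ Y)} {d′ = suc (suc d)} (frameF (glue-cross x q₁ L A p q B)) (frameV (glue-cross-cycle x q₁ L A p q B))
          (cong (_∷ lengths (X ++ Y)) len) bal fuel′ (λ or → ⊥-elim (no or)) (cong (λ j → maps b s j (k + length M ∷ lengths (X ++ Y)) r) dropped₂)
          where
          len : suc (length (L ++ flipped N)) ≡ k + length M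
          len = trans (cong suc (trans (Listₚ.length-++ L) (cong (k +_) (flipped-length N)))) (trans (sym (ℕₚ.+-suc k (length N))) (cong (k +_) (sym μ≡)))
        merged : f q ≡ c * w
        merged = child {loops′ = ((p , q₁) ∷ L ++ N) ∷ (X ++ Y)} {d′ = suc (suc d)} (frameF (glue-merge x q₁ L A p q B)) (frameV (glue-merge-cycle x q₁ L A p q B))
          (cong (_∷ lengths (X ++ Y)) len) bal fuel′ ori (cong (λ j → maps b s j (k + length M ∷ lengths (X ++ Y)) r) dropped₂)
          where
          len : suc (length (L ++ N)) ≡ k + length M
          len = trans (cong suc (Listₚ.length-++ L)) (trans (sym (ℕₚ.+-suc k (length N))) (cong (k +_) (sym μ≡)))
          ori : o ≡ true → Cross bl (x , q) × All (λ z → proj₁ z ∈ even bl × proj₂ z ∈ odd bl) ((p , q₁) ∷ (L ++ N) ++ concat (X ++ Y))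
          ori or with sides or
          ... | (x∈ , q₁∈) ∷ rest with Allₚ.++⁻ L rest
          ... | onL , others with Allₚ.++⁻ M (inLS others)
          ... | onM , onXY with Allₚ.++⁻ A (subst (All _) M≡ onM)
          ... | onA , (p∈ , q∈) ∷ onB = inj₁ (x∈ , q∈) , ((p∈ , q₁∈) ∷ Allₚ.++⁺ (Allₚ.++⁺ onL (Allₚ.++⁺ onB onA)) onXY)

    case-new : sumOver un f ≡ c * fresh s i k K r
    case-new = by-rank r refl
      where
      by-rank : ∀ r′ → r ≡ r′ → sumOver un f ≡ c * fresh s i k K r
      by-rank zero r≡ = trans (cong (λ u → sumOver u f) (none {un} (trans size (cong (4 *_) r≡)))) (sym (trans (cong (λ r → c * fresh s i k K r) r≡) (ℕₚ.*-zeroʳ c)))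
        where
        none : ∀ {u : List F} → length u ≡ 0 → u ≡ []
        none {[]} _ = refl
      by-rank (suc r₁) r≡ = begin
        sumOver un f ≡⟨ sum-equal un f ((3 + N) * ((2 + N) * ((1 + N) * V))) (4 + N) block (trans size rank) ⟩
        (4 + N) * ((3 + N) * ((2 + N) * ((1 + N) * (N ! * w))))
          ≡⟨ solve 6 (λ p q r s n w → p :* (q :* (r :* (s :* (n :* w)))) := (p :* (q :* (r :* (s :* n)))) :* w) refl (4 + N) (3 + N) (2 + N) (1 + N) (N !) w ⟩
        (4 + N) ! * w ≡⟨ cong₂ (λ M r → M ! * fresh s i k K r) (sym rank) (sym r≡) ⟩
        c * fresh s i k K r ∎
        where
        N = 4 * r₁
        w = maps b s i (suc (suc k) ∷ K) r₁
        V = N ! * w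
        rank : 4 * r ≡ 4 + N
        rank = trans (cong (4 *_) r≡) (ℕₚ.*-suc 4 r₁)
        block : ∀ y → y ∈ un → f y ≡ (3 + N) * ((2 + N) * ((1 + N) * V))
        block y y∈ with extract y∈
        ... | u₁ , order = discover V N (ℕₚ.suc-injective (trans (sym (↭-length order)) (trans size rank))) final
          where
          spec′ : Spec (λ τ → Q τ ∧ (σ₁ τ x == y)) ((x , y) ∷ p₁) bl
          spec′ = stepSpec x y spec
          open Discover {bl} {y} {u₁} (↭-trans (++⁺ˡ (corners bl) (↭-sym order)) corners-all) (λ τ → Q τ ∧ (σ₁ τ x == y)) (λ τ q → proj₁ (proj₁ spec′ τ q) , blocks (proj₂ (proj₁ spec′ τ q)))
          final : ∀ a c d rest → u₁ ↭ a ∷ c ∷ d ∷ rest → count (found a c d) ≡ V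
          final a c′ d′ rest order′ = trans (explore s loops′ (found a c′ d′) situation (found-spec a c′ d′ (λ τ q → proj₂ (proj₁ spec′ τ q)) (proj₂ spec′)) fuel′)
            (cong (λ l → N ! * maps b s i (l ∷ K) r₁) len)
            where
            bl′ = ⟨ a , y , c′ , d′ ⟩ ∷ bl
            B = (c′ , d′) ∷ []
            loops′ = ((a , q₁) ∷ L ++ B) ∷ LS
            un↭ : un ↭ y ∷ a ∷ c′ ∷ d′ ∷ rest
            un↭ = ↭-trans order (prep y order′)
            len : length ((a , q₁) ∷ L ++ B) ≡ suc (suc k)
            len = cong suc (trans (Listₚ.length-++ L) (ℕₚ.+-comm k 1))
            rest-size : length rest ≡ N
            rest-size = ℕₚ.+-cancelˡ-≡ 4 _ _ (trans (sym (↭-length un↭)) (trans size rank))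
            gF : Glue x y (concat (((x , q₁) ∷ L) ∷ newLoop a y c′ d′ ∷ LS)) (concat loops′) false
            gF = glue-≋ (perm (↭-reflexive (sym (Listₚ.++-assoc ((x , q₁) ∷ L) (newLoop a y c′ d′) (concat LS))))) ≋-refl (glue-frame (concat LS) (glue-merge x q₁ L [] a y B))
            gV : Glue x y (concatMap cycle (((x , q₁) ∷ L) ∷ newLoop a y c′ d′ ∷ LS)) (concatMap cycle loops′) false
            gV = glue-≋ (perm (↭-reflexive (sym (Listₚ.++-assoc (cycle ((x , q₁) ∷ L)) (cycle (newLoop a y c′ d′)) (concatMap cycle LS))))) ≋-refl (glue-frame (concatMap cycle LS) (glue-merge-cycle x q₁ L [] a y B))
            fuel′ : s ≡ sum (lengths loops′) + (r₁ + r₁)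
            fuel′ = trans fuel (trans (cong (λ r → k + sum K + (r + r)) r≡) (trans (solve 3 (λ k S r → k :+ S :+ ((con 1 :+ r) :+ (con 1 :+ r)) := (con 2 :+ k) :+ S :+ (r :+ r)) refl k (sum K) r₁)
              (cong (λ l → l + sum K + (r₁ + r₁)) (sym len))))
            P′ = (x , y) ∷ (p₁ ++ (p₀ bl′ ++ p₂ bl′))
            bigger : ∀ {z} → z ∈ p₁ ++ (p₀ bl ++ p₂ bl) → z ∈ P′
            bigger h with ∈-++⁻ p₁ h
            ... | inj₁ h₁ = there (∈-++⁺ˡ h₁)
            ... | inj₂ h₂ with ∈-++⁻ (p₀ bl) h₂
            ... | inj₁ h₀ = there (∈-++⁺ʳ p₁ (there (there (∈-++⁺ˡ h₀))))
            ... | inj₂ h₃ = there (∈-++⁺ʳ p₁ (there (there (∈-++⁺ʳ (p₀ bl) (there (there h₃))))))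
            to-y : Conn P′ ρ y
            to-y = conn-trans (conn-⊆ bigger (reached x∈corners)) (fwd (here refl) done)
            ya : Conn P′ y a
            ya = fwd (there (∈-++⁺ʳ p₁ (here refl))) done
            yc : Conn P′ y c′
            yc = fwd (there (∈-++⁺ʳ p₁ (there (there (∈-++⁺ʳ (p₀ bl) (here refl)))))) done
            cd : Conn P′ c′ d′
            cd = fwd (there (∈-++⁺ʳ p₁ (there (here refl)))) done
            reached′ : Reached ρ ((x , y) ∷ p₁) bl′
            reached′ (here refl) = conn-trans to-y ya
            reached′ (there (here refl)) = to-y
            reached′ (there (there (here refl))) = conn-trans to-y yc
            reached′ (there (there (there (here refl)))) = conn-trans to-y (conn-trans yc cd)
            reached′ (there (there (there (there h)))) = conn-⊆ bigger (reached h)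
            deeper : ∀ {z : F × F} → proj₁ z ∈ even bl × proj₂ z ∈ odd bl → proj₁ z ∈ even bl′ × proj₂ z ∈ odd bl′
            deeper (p , q) = there (there p) , there (there q)
            deeper-cross : ∀ {z} → Cross bl z → Cross bl′ z
            deeper-cross (inj₁ (p , q)) = inj₁ (there (there p) , there (there q))
            deeper-cross (inj₂ (p , q)) = inj₂ (there (there p) , there (there q))
            oriented′ : Oriented ((x , y) ∷ p₁) bl′ loops′
            oriented′ or with sides or
            ... | (x∈ , q₁∈) ∷ others with Allₚ.++⁻ L others
            ... | onL , onLS = (inj₁ (there (there x∈) , here refl) ∷ All.map deeper-cross (proj₁ (oriented or))) ,
              ((here refl , there (there q₁∈)) ∷ Allₚ.++⁺ (Allₚ.++⁺ (All.map deeper onL) ((there (here refl) , there (here refl)) ∷ [])) (All.map deeper onLS))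
            balance′ : weight RV RF (lengths loops′) r₁ + d ≡ n + 2
            balance′ = trans (cong (λ l → weight RV RF (l ∷ K) r₁ + d) len) (trans
              (solve 7 (λ v f k S r N d → v :+ f :+ ((con 2 :+ k) :+ S :+ r :+ (con 1 :+ N)) :+ d := v :+ f :+ ((con 1 :+ k) :+ S :+ (con 1 :+ r) :+ (con 1 :+ N)) :+ d) refl (length RV) (length RF) k (sum K) r₁ (nonempty K) d)
              (trans (cong (λ r → weight RV RF (suc k ∷ K) r + d) (sym r≡)) balance))
            situation : Situation ((x , y) ∷ p₁) bl′ loops′ rest RV RF r₁ d
            situation = record
              { core = childCore {bl = bl′} {loops = ((x , q₁) ∷ L) ∷ newLoop a y c′ d′ ∷ LS} {loops′} (swapCore {bl = bl′} {newLoop a y c′ d′} {(x , q₁) ∷ L} {LS} (newCore core un↭)) gF gV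
              ; size = rest-size ; balance = balance′ ; reached = reached′ ; oriented = oriented′ ; root = there (there (there (there root))) }

-- From labelled to rooted maps

module Labelled where
  open import Data.Bool using (Bool; true; false; not; _∧_; _xor_)
  import Data.Bool.Properties as Boolₚ
  open import Data.Bool.ListAction as BL using ()
  open import Data.Fin as Fin using (Fin)
  open import Data.List as List using (List; []; _∷_; allFin; map)
  import Data.List.Properties as Listₚ
  open import Data.List.Membership.Propositional using (_∈_)
  open import Data.List.Membership.Propositional.Properties using (∈-allFin; ∈-map⁺; ∈-concatMap⁺)
  open import Data.List.Relation.Binary.Permutation.Propositional using (_↭_; ↭-refl; prep)
  open import Data.List.Relation.Unary.All as All using (All; []; _∷_)
  open import Data.List.Relation.Unary.AllPairs as AllPairs using ([]; _∷_)
  open import Data.List.Relation.Unary.Any as Any using (Any; here; there)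
  open import Data.List.Relation.Unary.Unique.Propositional.Properties using (allFin⁺)
  open import Data.Nat as ℕ using (ℕ; zero; suc; _+_; _*_; _∸_; _!)
  open import Data.Nat.DivMod as DM using ()
  import Data.Nat.Properties as ℕₚ
  open import Data.Nat.Solver using (module +-*-Solver)
  open import Data.Product using (_×_; _,_; Σ; proj₁; proj₂)
  open import Data.Vec as Vec using (Vec; []; _∷_; lookup; tabulate)
  import Data.Vec.Properties as Vecₚ
  open import Relation.Binary.PropositionalEquality
  open import Defs hiding (_≈_; const)
  open Counting
  open Orbits
  open Chains
  open Walk

  ∈-allVecs : ∀ {A : Set} (as : List A) → (∀ a → a ∈ as) → ∀ {k} (v : Vec A k) → v ∈ allVecs as k
  ∈-allVecs as h [] = here refl
  ∈-allVecs as h (a ∷ v) = ∈-concatMap⁺ _ (Any.map (λ { refl → ∈-map⁺ (Vec._∷ v) (h a) }) (∈-allVecs as h v))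

  not-== : ∀ {m} {x y : Fin m} → not (x == y) ≡ true → x ≢ y
  not-== {x = x} h refl rewrite ==-refl x with () ← h

  ==-not : ∀ {m} {x y : Fin m} → x ≢ y → not (x == y) ≡ true
  ==-not h = cong not (==-false h)

  ==-≡ : ∀ {m} {x y : Fin m} → x ≡ y → (x == y) ≡ true
  ==-≡ {x = x} refl = ==-refl x

  xor-not : ∀ a b → a xor b ≡ true → a ≡ not b
  xor-not true false _ = refl
  xor-not false true _ = refl

  not-xor : ∀ a b → a ≡ not b → a xor b ≡ true
  not-xor true false _ = refl
  not-xor false true _ = refl

  module _ (n : ℕ) where
    private
      m = 4 * n

    open Triples m using (Triple)

    generators : Triple → List (Fun m)
    generators (s₀ , s₁ , s₂) = s₀ ∷ s₁ ∷ s₂ ∷ []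

    map? : (Triple → Bool) → Triple → Bool
    map? extra τ@(s₀ , s₁ , s₂) = fpfInvolution s₀ ∧ fpfInvolution s₁ ∧ fpfInvolution s₂ ∧ commuteFpf s₀ s₂ ∧ transitive (generators τ) ∧ extra τ

    euler? : ℕ → Triple → Bool
    euler? e (s₀ , s₁ , s₂) = (numOrbits (s₁ ∷ s₂ ∷ []) + numOrbits (s₀ ∷ s₁ ∷ []) + e) ℕ.≡ᵇ (n + 2)

    oriented? : Bool → Triple → Bool
    oriented? true τ = orientable (generators τ)
    oriented? false τ = true

    surface? : Bool → ℕ → Triple → Bool
    surface? o e = map? (λ τ → oriented? o τ ∧ euler? e τ)

  module _ (k : ℕ) (o : Bool) (e : ℕ) where
    private
      n = suc k
      m = 4 * n
      ρ : Fin m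
      ρ = Fin.zero

    open State m n o e
    open Moves m n o e
    open Explore m n o e ρ

    private
      fpf-sound : ∀ {s : Fun m} → fpfInvolution s ≡ true → (∀ x → app s (app s x) ≡ x) × (∀ x → app s x ≢ x)
      fpf-sound {s} h = (λ x → ==-true {x = app s (app s x)} (proj₁ (∧-true {app s (app s x) == x} (allF-true _ h x)))) ,
        (λ x → not-== (proj₂ (∧-true {app s (app s x) == x} (allF-true _ h x))))

      fpf-complete : ∀ {s : Fun m} → (∀ x → app s (app s x) ≡ x) → (∀ x → app s x ≢ x) → fpfInvolution s ≡ true
      fpf-complete h h′ = true-allF _ (λ x → true-∧ (==-≡ (h x)) (==-not (h′ x)))

      oriented-sound : ∀ o τ → oriented? n o τ ≡ true → o ≡ true → Σ (Fin m → Bool) λ c → ∀ x → c (σ₀ τ x) ≡ not (c x) × c (σ₁ τ x) ≡ not (c x) × c (σ₂ τ x) ≡ not (c x)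
      oriented-sound true τ h _ with any-true _ (allColourings m) h
      ... | v , _ , q = lookup v , λ x → let good = all-true (λ g → lookup v (app g x) xor lookup v x) (generators n τ) (allF-true _ q x) in
        xor-not (lookup v (σ₀ τ x)) _ (good (here refl)) , xor-not (lookup v (σ₁ τ x)) _ (good (there (here refl))) , xor-not (lookup v (σ₂ τ x)) _ (good (there (there (here refl))))

      oriented-complete : ∀ o τ → (o ≡ true → Σ (Fin m → Bool) λ c → ∀ x → c (σ₀ τ x) ≡ not (c x) × c (σ₁ τ x) ≡ not (c x) × c (σ₂ τ x) ≡ not (c x)) → oriented? n o τ ≡ true
      oriented-complete false τ h = refl
      oriented-complete true τ h with h refl
      ... | c , alt = true-any _ (allColourings m) (∈-allVecs _ (λ { true → here refl ; false → there (here refl) }) (tabulate c))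
        (true-allF _ (λ x → true-all (λ g → lookup (tabulate c) (app g x) xor lookup (tabulate c) x) (generators n τ) (λ { (here refl) → proper x _ (proj₁ (alt x)) ; (there (here refl)) → proper x _ (proj₁ (proj₂ (alt x))) ; (there (there (here refl))) → proper x _ (proj₂ (proj₂ (alt x))) })))
        where
        proper : ∀ x y → c y ≡ not (c x) → lookup (tabulate c) y xor lookup (tabulate c) x ≡ true
        proper x y q = not-xor _ _ (trans (Vecₚ.lookup∘tabulate c y) (trans q (cong not (sym (Vecₚ.lookup∘tabulate c x)))))

      to : ∀ τ → surface? n o e τ ≡ true → Valid τ
      to τ@(s₀ , s₁ , s₂) h = record
        { inv₀ = proj₁ f₀ ; inv₁ = proj₁ f₁ ; inv₂ = proj₁ f₂ ; free₀ = proj₂ f₀ ; free₁ = proj₂ f₁ ; free₂ = proj₂ f₂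
        ; commute = λ x → ==-true {x = app s₀ (app s₂ x)} (proj₁ (∧-true {app s₀ (app s₂ x) == app s₂ (app s₀ x)} (allF-true _ (proj₁ h₃) x)))
        ; free₀₂ = λ x → not-== (proj₂ (∧-true {app s₀ (app s₂ x) == app s₂ (app s₀ x)} (allF-true _ (proj₁ h₃) x)))
        ; connected = transitive-reach (generators n τ) (proj₁ h₄)
        ; euler = ℕₚ.≡ᵇ⇒≡ _ (n + 2) (subst Data.Bool.T (sym (proj₂ h₅)) _)
        ; colouring = oriented-sound o τ (proj₁ h₅) }
        where
        h₀ = ∧-true {fpfInvolution s₀} h
        h₁ = ∧-true {fpfInvolution s₁} (proj₂ h₀)
        h₂ = ∧-true {fpfInvolution s₂} (proj₂ h₁)
        h₃ = ∧-true {commuteFpf s₀ s₂} (proj₂ h₂)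
        h₄ = ∧-true {transitive (generators n τ)} (proj₂ h₃)
        h₅ = ∧-true {oriented? n o τ} (proj₂ h₄)
        f₀ = fpf-sound {s₀} (proj₁ h₀)
        f₁ = fpf-sound {s₁} (proj₁ h₁)
        f₂ = fpf-sound {s₂} (proj₁ h₂)

      from : ∀ τ → Valid τ → surface? n o e τ ≡ true
      from τ@(s₀ , s₁ , s₂) v = true-∧ (fpf-complete {s₀} inv₀ free₀) (true-∧ (fpf-complete {s₁} inv₁ free₁) (true-∧ (fpf-complete {s₂} inv₂ free₂)
        (true-∧ (true-allF _ (λ x → true-∧ (==-≡ (commute x)) (==-not (free₀₂ x)))) (true-∧ (reach-transitive (generators n τ) connected)
          (true-∧ (oriented-complete o τ colouring) (T-true (ℕₚ.≡⇒≡ᵇ (numOrbits (s₁ ∷ s₂ ∷ []) + numOrbits (s₀ ∷ s₁ ∷ []) + e) (n + 2) euler)))))))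
        where
        open Valid v
        T-true : ∀ {a} → Data.Bool.T a → a ≡ true
        T-true {true} _ = refl

      start : Core [] [] [] (allFin m) [] []
      start = record
        { flags-all = ↭-refl ; corners-all = ↭-refl
        ; vertices = chainSystem [] trivial ; faces = chainSystem [] trivial }
        where
        trivial : Transversal [] (allFin m)
        trivial = record { distinct = AllPairs.map (λ { ne done → ne refl }) (allFin⁺ m) ; cover = λ u → Any.map (λ { refl → done }) (∈-allFin u) }

      others : List (Fin m)
      others = List.tabulate Fin.suc

      N = 4 * k

      m≡ : m ≡ 4 + N
      m≡ = ℕₚ.*-suc 4 k

      fuel : ℕ
      fuel = 2 + (k + k)

      value : ℕ
      value = maps b fuel (suc e) (2 ∷ []) k

      open Discover {[]} {ρ} {others} ↭-refl (surface? n o e) (λ τ q → to τ q , [])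

      begun : ∀ a c d rest → others ↭ a ∷ c ∷ d ∷ rest → count (found a c d) ≡ N ! * value
      begun a c d rest order = explore fuel (newLoop a ρ c d ∷ []) {[]} {⟨ a , ρ , c , d ⟩ ∷ []} {rest} {[]} {[]} {k} {0} (found a c d) (record
          { core = newCore start (prep ρ order)
          ; size = ℕₚ.+-cancelˡ-≡ 4 _ _ (trans (sym (trans (sym (Listₚ.length-tabulate (λ x → x))) (↭-length (prep ρ order)))) m≡)
          ; balance = solve 1 (λ k → con 2 :+ con 0 :+ k :+ con 1 :+ con 0 := con 1 :+ k :+ con 2) refl k
          ; reached = λ { (here refl) → fwd (here refl) done ; (there (here refl)) → done ; (there (there (here refl))) → fwd (there (there (here refl))) done
                        ; (there (there (there (here refl)))) → fwd (there (there (here refl))) (fwd (there (here refl)) done) }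
          ; oriented = λ _ → [] , ((here refl , here refl) ∷ (there (here refl) , there (here refl)) ∷ [])
          ; root = there (here refl) })
        (found-spec {[]} a c d (λ τ q → sat [] []) (λ τ v _ → from τ v)) refl
        where
        open +-*-Solver
        open import Data.List.Relation.Binary.Permutation.Propositional.Properties using (↭-length)

    -- The exploration starts at flag zero. Naming the rest of its edge gives `(4n-1)(4n-2)(4n-3)`,
    -- and the remaining edges give `(4n-4)!`. The product is the number of labellings of one rooted
    -- map, and the first loop is the boundary of the root edge.
    surface-count : Triples.count m (surface? n o e) ≡ (4 * suc k ∸ 1) ! * maps b (2 + (k + k)) (suc e) (2 ∷ []) k
    surface-count = trans (discover (N ! * value) N (ℕₚ.suc-injective (trans (cong suc (Listₚ.length-tabulate {n = _} Fin.suc)) m≡)) begun)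
      (trans (solve 5 (λ p q r s w → p :* (q :* (r :* (s :* w))) := p :* (q :* (r :* s)) :* w) refl (3 + N) (2 + N) (1 + N) (N !) value)
        (cong (λ M → (M ∸ 1) ! * value) (sym m≡)))
      where
      open +-*-Solver

  quotient-exact : ∀ {L q} f .{{_ : ℕ.NonZero f}} → L ≡ f * q → L DM./ f ≡ q
  quotient-exact f refl = trans (cong (DM._/ f) (ℕₚ.*-comm f _)) (DM.m*n/n≡m _ f)

  -- rooted maps on orientable surfaces (β = 0) or on all surfaces (β = 1), of Euler characteristic 2 - e
  rooted : ℕ → ℕ → ℕ → ℕ
  rooted β e k = maps β (2 + (k + k)) (suc e) (2 ∷ []) k

  rooted-𝒮 : ∀ g k → rootedMaps (𝒮 g) (suc k) ≡ rooted 0 (2 * g) k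
  rooted-𝒮 zero k = quotient-exact _ {{(4 * suc k ∸ 1) ℕₚ.!≢0}} (surface-count k true 0)
  rooted-𝒮 (suc g) k = quotient-exact _ {{(4 * suc k ∸ 1) ℕₚ.!≢0}} (surface-count k true (2 * suc g))

  -- The labelled maps of a given Euler characteristic are divided by orientability; the equation
  -- with the common factor `f` is then divided by `f`.
  rooted-𝒩 : ∀ h k → rootedMaps (𝒩 h) (suc k) + rooted 0 (suc h) k ≡ rooted 1 (suc h) k
  rooted-𝒩 h k = trans (cong (_+ rooted 0 (suc h) k) (quotient-exact {q = rooted 1 (suc h) k ∸ rooted 0 (suc h) k} f labelled))
      (ℕₚ.m∸n+n≡m smaller)
    where
    n = suc k
    open Triples (4 * n)
    f = (4 * n ∸ 1) !
    instance
      f≢0 : ℕ.NonZero f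
      f≢0 = (4 * n ∸ 1) ℕₚ.!≢0
    A = rooted 1 (suc h) k
    O = rooted 0 (suc h) k
    L = labelledMaps (𝒩 h) n
    total : f * A ≡ f * O + L
    total = trans (sym (surface-count k false (suc h))) (trans (count-complement (surface? n false (suc h)) (oriented? n true))
      (cong₂ _+_ (trans (count-cong (λ τ → move τ (oriented? n true τ))) (surface-count k true (suc h))) (count-cong (λ τ → move τ (not (oriented? n true τ))))))
      where
      shuffle : ∀ a b c d t x y → (a ∧ b ∧ c ∧ d ∧ t ∧ (true ∧ x)) ∧ y ≡ a ∧ b ∧ c ∧ d ∧ t ∧ (y ∧ x)
      shuffle true true true true true x y = Boolₚ.∧-comm x y
      shuffle true true true true false x y = refl
      shuffle true true true false t x y = refl
      shuffle true true false d t x y = refl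
      shuffle true false c d t x y = refl
      shuffle false b c d t x y = refl
      move : ∀ τ y → surface? n false (suc h) τ ∧ y ≡ map? n (λ τ → y ∧ euler? n (suc h) τ) τ
      move τ@(s₀ , s₁ , s₂) y = shuffle (fpfInvolution s₀) (fpfInvolution s₁) (fpfInvolution s₂) (commuteFpf s₀ s₂) (transitive (generators n τ)) (euler? n (suc h) τ) y
    labelled : L ≡ f * (A ∸ O)
    labelled = sym (trans (ℕₚ.*-distribˡ-∸ f A O) (trans (cong (_∸ f * O) total) (ℕₚ.m+n∸m≡n (f * O) L)))
    smaller : O ℕ.≤ A
    smaller = ℕₚ.*-cancelˡ-≤ f (ℕₚ.≤-trans (ℕₚ.m≤m+n (f * O) L) (ℕₚ.≤-reflexive (sym total)))

-- Generating functions of rooted maps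

module Main where
  open import Data.Integer as ℤ using (ℤ; +_)
  import Data.Integer.Properties as ℤₚ
  open import Data.List as List using (List; []; _∷_)
  open import Data.Nat as ℕ using (ℕ; zero; suc; pred)
  open import Data.Nat.ListAction using (sum)
  import Data.Nat.Properties as ℕₚ
  open import Data.Nat.Solver using (module +-*-Solver)
  open import Data.Product using (Σ; _×_; _,_; proj₁; proj₂)
  open import Data.Rational as ℚ using (ℚ; 0ℚ; 1ℚ; _/_)
  import Data.Rational.Properties as ℚₚ
  import Data.Rational.Unnormalised as ℚᵘ
  import Data.Rational.Unnormalised.Properties as ℚᵘₚ
  open import Function using (_∘_)
  open import Relation.Binary.PropositionalEquality as ≡ using (_≡_)
  open import Defs
  open Local
  open Expr
  open Tower using (nat)
  open Coeff using (module Diagonal)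
  open Walk
  open Algebraic using (module Evaluation)
  open Rational
  open Labelled using (rooted; rooted-𝒮; rooted-𝒩)

  nat-+ : ∀ a b → nat (a ℕ.+ b) ≡ nat a ℚ.+ nat b
  nat-+ zero b = ≡.sym (ℚₚ.+-identityˡ (nat b))
  nat-+ (suc a) b = ≡.trans (≡.cong (1ℚ ℚ.+_) (nat-+ a b)) (≡.sym (ℚₚ.+-assoc 1ℚ (nat a) (nat b)))

  nat-* : ∀ a b → nat (a ℕ.* b) ≡ nat a ℚ.* nat b
  nat-* zero b = ≡.sym (ℚₚ.*-zeroˡ (nat b))
  nat-* (suc a) b = ≡.trans (nat-+ b (a ℕ.* b)) (≡.trans (≡.cong₂ ℚ._+_ (≡.sym (ℚₚ.*-identityˡ (nat b))) (nat-* a b)) (≡.sym (ℚₚ.*-distribʳ-+ (nat b) 1ℚ (nat a))))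

  private
    toᵘ : ∀ i → ℚ.toℚᵘ (i / 1) ℚᵘ.≃ ℚᵘ.mkℚᵘ i 0
    toᵘ i = ℚₚ.toℚᵘ-fromℚᵘ (ℚᵘ.mkℚᵘ i 0)

  /1-+ : ∀ i j → (i ℤ.+ j) / 1 ≡ (i / 1) ℚ.+ (j / 1)
  /1-+ i j = ℚₚ.toℚᵘ-injective (ℚᵘₚ.≃-trans (toᵘ (i ℤ.+ j)) (ℚᵘₚ.≃-trans
    (ℚᵘ.*≡* (≡.cong (ℤ._* (+ 1)) (≡.cong₂ ℤ._+_ (≡.sym (ℤₚ.*-identityʳ i)) (≡.sym (ℤₚ.*-identityʳ j)))))
    (ℚᵘₚ.≃-sym (ℚᵘₚ.≃-trans (ℚₚ.toℚᵘ-homo-+ (i / 1) (j / 1)) (ℚᵘₚ.+-cong (toᵘ i) (toᵘ j))))))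

  /1-* : ∀ i j → (i ℤ.* j) / 1 ≡ (i / 1) ℚ.* (j / 1)
  /1-* i j = ℚₚ.toℚᵘ-injective (ℚᵘₚ.≃-trans (toᵘ (i ℤ.* j))
    (ℚᵘₚ.≃-sym (ℚᵘₚ.≃-trans (ℚₚ.toℚᵘ-homo-* (i / 1) (j / 1)) (ℚᵘₚ.*-cong (toᵘ i) (toᵘ j)))))

  nat-/1 : ∀ n → nat n ≡ + n / 1
  nat-/1 zero = ≡.refl
  nat-/1 (suc n) = ≡.trans (≡.cong (1ℚ ℚ.+_) (nat-/1 n)) (≡.sym (/1-+ (+ 1) (+ n)))

  -- An overdrawn deficiency never recovers, since `pred 0` is 0.
  maps-zero : ∀ β s K r → maps β s 0 K r ≡ 0
  maps-zero β s [] zero = ≡.refl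
  maps-zero β s [] (suc r) = ≡.refl
  maps-zero β s (zero ∷ K) r = maps-zero β s K r
  maps-zero β zero (suc k ∷ K) r = ≡.refl
  maps-zero β (suc s) (suc k ∷ K) r = by-rank r
    where
    splits-0 : ∀ {h} → (∀ p q → h p q ≡ 0) → ∀ k → splits h k ≡ 0
    splits-0 z zero = ≡.refl
    splits-0 z (suc k) = ≡.cong₂ ℕ._+_ (z 0 k) (splits-0 (λ p → z (suc p)) k)
    picks-0 : ∀ {f} → (∀ l L → f l L ≡ 0) → ∀ K → picks f K ≡ 0
    picks-0 z [] = ≡.refl
    picks-0 z (k ∷ K) = ≡.cong₂ ℕ._+_ (z k K) (picks-0 (λ l L → z l (k ∷ L)) K)
    *-0 : ∀ a {x} → x ≡ 0 → a ℕ.* x ≡ 0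
    *-0 a z = ≡.trans (≡.cong (a ℕ.*_) z) (ℕₚ.*-zeroʳ a)
    old : ∀ r → splits (λ p q → maps β s 0 (p ∷ q ∷ K) r) (suc k)
      ℕ.+ (β ℕ.* (k ℕ.* maps β s 0 (k ∷ K) r) ℕ.+ suc β ℕ.* picks (λ l L → l ℕ.* maps β s 0 (k ℕ.+ l ∷ L) r) K) ≡ 0
    old r = ≡.cong₂ ℕ._+_ (splits-0 (λ p q → maps-zero β s (p ∷ q ∷ K) r) (suc k))
      (≡.cong₂ ℕ._+_ (*-0 β (*-0 k (maps-zero β s (k ∷ K) r))) (*-0 (suc β) (picks-0 (λ l L → *-0 l (maps-zero β s (k ℕ.+ l ∷ L) r)) K)))
    by-rank : ∀ r → maps β (suc s) 0 (suc k ∷ K) r ≡ 0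
    by-rank zero = old 0
    by-rank (suc r) = ≡.cong₂ ℕ._+_ (old (suc r)) (maps-zero β s (suc (suc k) ∷ K) r)

  module _ (T U : FPS)
    (hT : T ≈ const 1ℚ ⊕ const (+ 3 / 1) ⊗ tSer ⊗ T ⊗ T)
    (hU : U ≈ tSer ⊗ T ⊗ T ⊗ (const 1ℚ ⊕ U ⊕ U ⊗ U)) where

    open Parametrization T U hT hU

    private
      module F = Loc 𝔽
      module P = PS ℚLoc

    module _ (β : ℕ) where
      private
        module M = Moments 𝔽 U U₀ (nat β)
        module R = Recursion 𝔽 U U₀ (nat β)

      -- Starts from a loop of length one instead of the root edge. If there are edges, the first
      -- step has to find one and leaves a loop of length two; if there are none, the loop closes to
      -- the vertex map. So the constant term is right too.
      series : ℕ → FPS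
      series e = M.moment (suc e) (1 ∷ [])

      series-representable : ∀ e → Representable (series e)
      series-representable e = M.mapSeries (suc e) , F.trans {series e} (M.mapSeries-law (suc e))
        (Eval.eval-cong 𝔽 {Subst.Substitution.env 𝔽 U U₀ 0} {only U} same (M.mapSeries (suc e)))
        where
        open Evaluation 𝔽 using (only)
        same : ∀ v → Subst.Substitution.env 𝔽 U U₀ 0 v F.≈ only U v
        same zero n = ≡.refl
        same (suc v) n = ≡.refl

      private
        dsum-value : ∀ (f : ℕ → ℕ → FPS) h r k → (∀ p q → p ℕ.+ q ≡ k → f p q r ≡ nat (h p q)) → Diagonal.dsum 𝔽 𝔽 f k r ≡ nat (splits h (suc k))
        dsum-value f h r zero p = ≡.trans (p 0 0 ≡.refl) (≡.cong nat (≡.sym (ℕₚ.+-identityʳ (h 0 0))))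
        dsum-value f h r (suc k) p = ≡.trans (≡.cong₂ ℚ._+_ (p 0 (suc k) ≡.refl) (dsum-value (f ∘ suc) (h ∘ suc) r k (λ a b e → p (suc a) b (≡.cong suc e))))
          (≡.sym (nat-+ (h 0 (suc k)) _))

        pick-value : ∀ (f : ℕ → List ℕ → FPS) g r K → (∀ l L → l ℕ.+ sum L ≡ sum K → f l L r ≡ nat (g l L)) → R.pick f K r ≡ nat (picks g K)
        pick-value f g r [] p = P-zero r
          where
          P-zero : ∀ r → P.κ 0ℚ r ≡ 0ℚ
          P-zero zero = ≡.refl
          P-zero (suc r) = ≡.refl
        pick-value f g r (k ∷ K) p = ≡.trans (≡.cong₂ ℚ._+_ (p k K ≡.refl) (pick-value (λ l L → f l (k ∷ L)) (λ l L → g l (k ∷ L)) r K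
            (λ l L e → p l (k ∷ L) (≡.trans (rearrange l k (sum L)) (≡.cong (k ℕ.+_) e)))))
          (≡.sym (nat-+ (g k K) _))
          where
          open +-*-Solver
          rearrange : ∀ a b c → a ℕ.+ (b ℕ.+ c) ≡ b ℕ.+ (a ℕ.+ c)
          rearrange = solve 3 (λ a b c → a :+ (b :+ c) := b :+ (a :+ c)) ≡.refl

        scaled : ∀ c (f : FPS) r {x} → f r ≡ nat x → (P.κ (nat c) F.* f) r ≡ nat (c ℕ.* x)
        scaled c f r {x} p = ≡.trans (P.κ-✶ (nat c) f r) (≡.trans (≡.cong (nat c ℚ.*_) p) (≡.sym (nat-* c x)))

        τ≈ : R.τ F.≈ P.X
        τ≈ = F.trans {R.τ} {tSer} {P.X} t≈ tSer≈

      -- Both sides obey the same recursion. Multiplication by `τ`, which is `t`, lowers the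
      -- coefficient index by one, just as finding an edge does, and `s` decreases at every step.
      moment-value : ∀ s i K r → s ≡ sum K ℕ.+ (r ℕ.+ r) → M.moment i K r ≡ nat (maps β s i K r)
      moment-value s zero K r e = ≡.trans (M.moment-zero K r) (≡.trans (zero-series r) (≡.cong nat (≡.sym (maps-zero β s K r))))
        where
        zero-series : ∀ r → P.κ 0ℚ r ≡ 0ℚ
        zero-series zero = ≡.refl
        zero-series (suc r) = ≡.refl
      moment-value s (suc zero) [] zero e = M.moment-nil 0 0
      moment-value s (suc (suc i)) [] zero e = M.moment-nil (suc i) 0
      moment-value s (suc i) [] (suc r) e = M.moment-nil i (suc r)
      moment-value s (suc i) (zero ∷ K) r e = ≡.trans (M.moment-empty-loop (suc i) K r) (moment-value s (suc i) K r e)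
      moment-value (suc s) (suc i) (suc k ∷ K) r e = by-rank r e
        where
        left : ∀ r → suc s ≡ suc k ℕ.+ sum K ℕ.+ (r ℕ.+ r) →
          (Diagonal.dsum 𝔽 𝔽 (λ m n → M.moment (suc i) (m ∷ n ∷ K)) k F.+
            (P.κ (nat β) F.* (P.κ (nat k) F.* M.moment i (k ∷ K)) F.+ P.κ (nat (suc β)) F.* R.pick (λ l L → P.κ (nat l) F.* M.moment (pred i) (k ℕ.+ l ∷ L)) K)) r
          ≡ nat (splits (λ p q → maps β s (suc i) (p ∷ q ∷ K) r) (suc k)
              ℕ.+ (β ℕ.* (k ℕ.* maps β s i (k ∷ K) r) ℕ.+ suc β ℕ.* picks (λ l L → l ℕ.* maps β s (pred i) (k ℕ.+ l ∷ L) r) K))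
        left r e = ≡.trans (≡.cong₂ ℚ._+_
            (dsum-value (λ m n → M.moment (suc i) (m ∷ n ∷ K)) h r k λ p q pq → moment-value s (suc i) (p ∷ q ∷ K) r (≡.trans fuel (≡.cong (ℕ._+ (r ℕ.+ r)) (≡.trans (≡.cong (ℕ._+ sum K) (≡.sym pq)) (ℕₚ.+-assoc p q (sum K))))))
            (≡.cong₂ ℚ._+_
              (scaled β (P.κ (nat k) F.* M.moment i (k ∷ K)) r {k ℕ.* v} (scaled k (M.moment i (k ∷ K)) r {v} (moment-value s i (k ∷ K) r fuel)))
              (scaled (suc β) (R.pick f K) r {picks g K}
                (pick-value f g r K λ l L lL → scaled l (M.moment (pred i) (k ℕ.+ l ∷ L)) r {maps β s (pred i) (k ℕ.+ l ∷ L) r}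
                  (moment-value s (pred i) (k ℕ.+ l ∷ L) r (≡.trans fuel (≡.cong (ℕ._+ (r ℕ.+ r)) (≡.trans (≡.cong (k ℕ.+_) (≡.sym lL)) (≡.sym (ℕₚ.+-assoc k l (sum L)))))))))))
          (≡.trans (≡.cong (nat A ℚ.+_) (≡.sym (nat-+ B C))) (≡.sym (nat-+ A (B ℕ.+ C))))
          where
          fuel : s ≡ k ℕ.+ sum K ℕ.+ (r ℕ.+ r)
          fuel = ℕₚ.suc-injective e
          f : ℕ → List ℕ → FPS
          f l L = P.κ (nat l) F.* M.moment (pred i) (k ℕ.+ l ∷ L)
          g : ℕ → List ℕ → ℕ
          g l L = l ℕ.* maps β s (pred i) (k ℕ.+ l ∷ L) r
          h : ℕ → ℕ → ℕ
          h p q = maps β s (suc i) (p ∷ q ∷ K) r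
          v = maps β s i (k ∷ K) r
          A = splits h (suc k)
          B = β ℕ.* (k ℕ.* v)
          C = suc β ℕ.* picks g K
        new : FPS
        new = M.moment (suc i) (suc (suc k) ∷ K)
        by-rank : ∀ r → suc s ≡ suc k ℕ.+ sum K ℕ.+ (r ℕ.+ r) → M.moment (suc i) (suc k ∷ K) r ≡ nat (maps β (suc s) (suc i) (suc k ∷ K) r)
        by-rank zero e = ≡.trans (M.moment-recursion i k K zero) (≡.trans (≡.cong₂ ℚ._+_ (left zero e) (≡.trans (F.*-congʳ {new} {R.τ} {P.X} τ≈ 0) (P.X-✶-zero new))) (ℚₚ.+-identityʳ _))
        by-rank (suc r) e = ≡.trans (M.moment-recursion i k K (suc r)) (≡.trans (≡.cong₂ ℚ._+_ (left (suc r) e)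
            (≡.trans (F.*-congʳ {new} {R.τ} {P.X} τ≈ (suc r)) (≡.trans (P.X-✶-suc new r) (moment-value s (suc i) (suc (suc k) ∷ K) r
              (≡.trans (ℕₚ.suc-injective e) (solve 3 (λ k S r → k :+ S :+ ((con 1 :+ r) :+ (con 1 :+ r)) := (con 2 :+ k) :+ S :+ (r :+ r)) ≡.refl k (sum K) r))))))
          (≡.sym (nat-+ (splits (λ p q → maps β s (suc i) (p ∷ q ∷ K) (suc r)) (suc k)
              ℕ.+ (β ℕ.* (k ℕ.* maps β s i (k ∷ K) (suc r)) ℕ.+ suc β ℕ.* picks (λ l L → l ℕ.* maps β s (pred i) (k ℕ.+ l ∷ L) (suc r)) K))
            (maps β s (suc i) (suc (suc k) ∷ K) r))))
          where
          open +-*-Solver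

      series-zero : ∀ e → series e 0 ≡ nat (isOneℕ (suc e))
      series-zero e = ≡.trans (moment-value 1 (suc e) (1 ∷ []) 0 ≡.refl) (≡.cong nat (solve 3 (λ x b c → x :+ con 0 :+ (b :* con 0 :+ (con 1 :+ b) :* con 0) := x) ≡.refl (isOneℕ (suc e)) β 0))
        where
        open +-*-Solver

      series-suc : ∀ e k → series e (suc k) ≡ nat (rooted β e k)
      series-suc e k = ≡.trans (moment-value (suc (suc (suc (k ℕ.+ k)))) (suc e) (1 ∷ []) (suc k) (≡.cong (λ x → suc (suc x)) (≡.sym (ℕₚ.+-suc k k))))
        (≡.cong nat (solve 2 (λ x b → con 0 :+ con 0 :+ (b :* con 0 :+ (con 1 :+ b) :* con 0) :+ x := x) ≡.refl (rooted β e k) β))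
        where
        open +-*-Solver

    count-series : (S : Surface) → Σ FPS λ A → Representable A × (∀ n → nat (rootedMaps S n) ≡ A n)
    count-series (𝒮 g) = series 0 (2 ℕ.* g) , series-representable 0 (2 ℕ.* g) , value-at g
      where
      value-at : ∀ g n → nat (rootedMaps (𝒮 g) n) ≡ series 0 (2 ℕ.* g) n
      value-at zero zero = ≡.sym (series-zero 0 0)
      value-at (suc g) zero = ≡.sym (series-zero 0 (2 ℕ.* suc g))
      value-at g (suc k) = ≡.trans (≡.cong nat (rooted-𝒮 g k)) (≡.sym (series-suc 0 (2 ℕ.* g) k))
    count-series (𝒩 h) = (λ n → A n ℚ.- O n) , difference (series-representable 1 (suc h)) (series-representable 0 (suc h)) , value-at
      where
      A O : FPS
      A = series 1 (suc h)
      O = series 0 (suc h)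
      value-at : ∀ n → nat (rootedMaps (𝒩 h) n) ≡ A n ℚ.- O n
      value-at zero = ≡.sym (≡.cong₂ ℚ._-_ (series-zero 1 (suc h)) (series-zero 0 (suc h)))
      value-at (suc k) = ≡.trans (subtract _ _ _ (≡.trans (≡.sym (nat-+ (rootedMaps (𝒩 h) (suc k)) (rooted 0 (suc h) k))) (≡.cong nat (rooted-𝒩 h k))))
        (≡.sym (≡.cong₂ ℚ._-_ (series-suc 1 (suc h) k) (series-suc 0 (suc h) k)))
        where
        subtract : ∀ x y z → x ℚ.+ y ≡ z → x ≡ z ℚ.- y
        subtract x y z ≡.refl = ≡.sym (≡.trans (ℚₚ.+-assoc x y (ℚ.- y)) (≡.trans (≡.cong (x ℚ.+_) (ℚₚ.+-inverseʳ y)) (ℚₚ.+-identityʳ x)))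

    QSer-representable : ∀ S → Representable (QSer S)
    QSer-representable S with count-series S
    ... | A , rep , at = proj₁ pointed , λ n → ≡.trans (coefficient n) (proj₂ pointed n)
      where
      c : ℚ
      c = (+ 2 ℤ.- + twoh S) / 1
      pointed = pointing {A} c rep
      coefficient : ∀ n → QSer S n ≡ (nat n ℚ.+ c) ℚ.* A n
      coefficient n = ≡.trans (/1-* (+ (n ℕ.+ 2) ℤ.- + twoh S) (+ rootedMaps S n))
        (≡.cong₂ ℚ._*_ (≡.trans (≡.cong (_/ 1) (ℤₚ.+-assoc (+ n) (+ 2) (ℤ.- + twoh S))) (≡.trans (/1-+ (+ n) (+ 2 ℤ.- + twoh S)) (≡.cong (ℚ._+ c) (≡.sym (nat-/1 n)))))
          (≡.trans (≡.sym (nat-/1 (rootedMaps S n))) (at n)))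

open import Defs
open import Data.Product using (_×_; _,_)
open import Data.Rational using (1ℚ; _/_)
open import Data.Integer using (+_)
open Main using (QSer-representable)
open Rational using (module Parametrization)

theorem4p1 : (S : Surface) (T U : FPS)
    → T ≈ const 1ℚ ⊕ const (+ 3 / 1) ⊗ tSer ⊗ T ⊗ T
    → U ≈ tSer ⊗ T ⊗ T ⊗ (const 1ℚ ⊕ U ⊕ U ⊗ U)
    → IsAlgebraic (QSer S) × IsRationalIn (QSer S) U
theorem4p1 S T U hT hU = algebraicity rep , rational rep
  where
  open Parametrization T U hT hU
  rep : Representable (QSer S)
  rep = QSer-representable T U hT hU S
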